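{- For all integers $k\ge1$ and $n\ge0$, $$e_4(13^{2k}n+\delta_{13,2k})\equiv0\pmod{13^{2k}}.$$
   Context: $q=e^{2\pi i\tau}$, $(q;q)_\infty=\prod_{n\ge1}(1-q^n)$, $E_4(\tau)=1+240\sum_{n\ge1}\sigma_3(n)q^n$ with $\sigma_3(n)=\sum_{d\mid n}d^3$. The numbers $e_4(n)$ are defined by $\sum_{n\ge0}e_4(n)q^n=E_4(\tau)/(q;q)_\infty$. For a prime $\ell\ge5$ and $k\ge1$, $\delta_{\ell,k}$ is the integer with $0<\delta_{\ell,k}<\ell^k$ and $24\delta_{\ell,k}\equiv1\pmod{\ell^k}$. -}

module Defs where

open import Data.Nat using (ℕ; zero; suc; _+_; _*_; _∸_; _^_; _/_)
open import Data.Nat.Divisibility using (_∣?_)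
open import Data.List using (List; map; filter; upTo; applyUpTo)
open import Data.Nat.ListAction using (sum)

-- σ₃(n) = Σ_{d ∣ n, 1 ≤ d ≤ n} d³   (σ₃ 0 = 0; only used for n ≥ 1)
σ₃ : ℕ → ℕ
σ₃ n = sum (map (λ d → d ^ 3) (filter (_∣? n) (applyUpTo suc n)))

E₄coeff : ℕ → ℕ
E₄coeff zero    = 1
E₄coeff (suc n) = 240 * σ₃ (suc n)

-- invProdCoeff m n = coefficient of qⁿ in ∏_{i=1}^{m} 1/(1 - qⁱ)
-- (multiply by the geometric series Σ_j q^{j·i} one factor at a time)
invProdCoeff : ℕ → ℕ → ℕ
invProdCoeff zero zero    = 1
invProdCoeff zero (suc n) = 0
invProdCoeff (suc m) n =
  sum (map (λ j → invProdCoeff m (n ∸ j * suc m)) (upTo (suc (n / suc m))))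

-- coefficient of qⁿ in 1/(q;q)_∞ ; factors with i > n do not affect qⁿ
pinv : ℕ → ℕ
pinv n = invProdCoeff n n

e₄ : ℕ → ℕ
e₄ n = sum (map (λ j → E₄coeff j * pinv (n ∸ j)) (upTo (suc n)))

private
  open import Relation.Binary.PropositionalEquality using (_≡_; refl)
  t1 : map pinv (upTo 8) ≡ 1 Data.List.∷ 1 Data.List.∷ 2 Data.List.∷ 3 Data.List.∷ 5 Data.List.∷ 7 Data.List.∷ 11 Data.List.∷ 15 Data.List.∷ Data.List.[]
  t1 = refl
  t2 : map e₄ (upTo 3) ≡ 1 Data.List.∷ 241 Data.List.∷ (2 + 240 + 240 * 9) Data.List.∷ Data.List.[]
  t2 = refl

{-# OPTIONS --safe #-}
-- Let g_l = E₄ jˡ / E and h_i = E·E₄E₆ jⁱ / Δ with E = (q;q)_∞.  The span of the g_l is the orthogonal complement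
-- of the h_i for the constant term pairing, and g_0 = E₄ / (q;q)_∞.  Call X in this span good if its coefficients
-- at exponents n ≤ 0 vanish unless 1 − 24 n = 169ᵐ, and are then divisible by 169ᵐ.  The Hecke operator T of index
-- 13² preserves the span and sends a good X to 169 X′ with X′ good; the recursion
-- U₁₆₉^{k+2} X = 169 U₁₆₉^{k+1} X′ − 13⁵ U₁₆₉^k X then gives the congruence.
-- For the stability of the span under T, the vectors of residue class components of g and h are paired with those
-- of the Serre derivatives N_0, …, N_6 of E.  All pairings are traces of forms on X₀(13), which has genus 0 with
-- Hauptmodul x = q (E(13τ)/E(τ))², so they are computed with polynomials in x and the Fricke involution.
-- The Gram matrix of the N_n has level one and is inverted explicitly up to Δ², which turns ⟨T g, h⟩ into the
-- constant term of a level one form of weight two, that is, of a derivative.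
module Submission where

open import Data.Nat.Base as N using (ℕ; zero; suc)
import Data.Nat.Properties as N
open import Data.Integer.Base as Z using (ℤ; +_; -[1+_])
import Data.Integer.Properties as Z
open import Data.Integer.Tactic.RingSolver using () renaming (solve-∀ to arith)
open import Data.List.Base using (List; []; _∷_)
open import Data.Product using (_,_; _×_; ∃; proj₁; proj₂)
open import Relation.Binary.PropositionalEquality as I using (_≡_; _≢_; cong; cong₂; subst) renaming (trans to tr; sym to sy)
open import Data.Sum.Base using (_⊎_; inj₁; inj₂)
open import Data.Empty using (⊥; ⊥-elim)
open import Relation.Nullary using (yes; no)
import Defs

-- At level 13 a form of weight 2n is `ε`ⁿ, with `ε` = θx/x, times a rational function of x. These
-- formulas for E₄, E₆ and their images under q ↦ q¹³ hold because both sides satisfy the same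
-- differential equations, and residues on a curve of genus 0 become coefficients of polynomials. At
-- level one, weight k means that all products with monomials of weight 2 - k in E₄, E₆, Δ, 1/Δ have
-- constant term 0. The difficulty is that residue class components are not modular one by one. The
-- vectors have length seven because seven classes modulo 13 contain pentagonal numbers; seven
-- pairings with the N_n determine a vector because the leading coefficients of their components
-- form a matrix of Vandermonde type. The N_n are formed with 13 E₂(13τ) instead of E₂, since
-- multiplication by a series in q¹³ preserves residue classes. Class 7 is exceptional: 24 · 7 + 1 =
-- 13², and there (q;q)_∞ reproduces itself as q⁷ times its image under q ↦ q¹⁶⁹. This supplies the
-- Fricke term that completes U to a trace.

pattern mone = -[1+ 0 ]

-- The ring of formal power series over the integers.

module PS where
 open import Relation.Binary.PropositionalEquality
 open import Algebra.Bundles using (CommutativeRing)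
 open import Level using (0ℓ)

 PS : Set
 PS = ℕ -> ℤ

 infix 4 _≐_
 _≐_ : PS -> PS -> Set
 f ≐ g = ∀ n -> f n ≡ g n

 tail : PS -> PS
 tail f n = f (suc n)

 infixl 7 _**_
 infixl 6 _⊕_
 _⊕_ _**_ : PS -> PS -> PS
 (f ⊕ g) n = f n Z.+ g n
 (f ** g) zero    = f 0 Z.* g 0
 (f ** g) (suc n) = f 0 Z.* g (suc n) Z.+ (tail f ** g) n

 ⊖_ : PS -> PS
 (⊖ f) n = Z.- f n

 shift : ℕ -> PS -> PS
 shift zero    f         = f
 shift (suc k) f zero    = Z.0ℤ
 shift (suc k) f (suc n) = shift k f n

 con : ℤ -> PS
 con c zero    = c
 con c (suc n) = Z.0ℤ

 +ˡ : ∀ a {b c} -> b ≡ c -> a Z.+ b ≡ a Z.+ c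
 +ˡ a = cong (\z -> a Z.+ z)

 *ˡ : ∀ a {b c} -> b ≡ c -> a Z.* b ≡ a Z.* c
 *ˡ a = cong (\z -> a Z.* z)

 -- Only the pairs of indices with sum n enter the coefficient of degree n. This form is needed for
 -- truncations that agree with a series only up to degree n.
 **-cong-at : ∀ n {f fʹ g gʹ : PS} -> (∀ i j -> i N.+ j ≡ n -> f i Z.* g j ≡ fʹ i Z.* gʹ j) ->
       (f ** g) n ≡ (fʹ ** gʹ) n
 **-cong-at zero    h = h 0 0 refl
 **-cong-at (suc n) h = cong₂ Z._+_ (h 0 (suc n) refl) (**-cong-at n \i j e -> h (suc i) j (cong suc e))

 **-cong : ∀ {f fʹ g gʹ} -> f ≐ fʹ -> g ≐ gʹ -> f ** g ≐ fʹ ** gʹ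
 **-cong p r n = **-cong-at n \i j _ -> cong₂ Z._*_ (p i) (r j)

 **-zeroˡ : ∀ g n -> (con Z.0ℤ ** g) n ≡ Z.0ℤ
 **-zeroˡ g zero    = refl
 **-zeroˡ g (suc n) = trans (Z.+-identityˡ _) (trans (**-cong-at n \ { zero _ _ -> refl ; (suc _) _ _ -> refl }) (**-zeroˡ g n))

 **-vanish : ∀ n {f g : PS} -> (∀ i j -> i N.+ j ≡ n -> f i Z.* g j ≡ Z.0ℤ) -> (f ** g) n ≡ Z.0ℤ
 **-vanish n {g = g} h = trans (**-cong-at n \ { zero j e -> h 0 j e ; (suc i) j e -> h (suc i) j e }) (**-zeroˡ g n)

 **-con : ∀ c g n -> (con c ** g) n ≡ c Z.* g n
 **-con c g zero    = refl
 **-con c g (suc n) = trans (+ˡ (c Z.* g (suc n)) (**-vanish n \_ _ _ -> refl)) (Z.+-identityʳ _)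

 -- The defining recursion peels off the left factor; this mirror image, peeling off the right one,
 -- makes commutativity an induction.
 **-sucʳ : ∀ f g n -> (f ** g) (suc n) ≡ f (suc n) Z.* g 0 Z.+ (f ** tail g) n
 **-sucʳ f g zero    = Z.+-comm (f 0 Z.* g 1) _
 **-sucʳ f g (suc n) = trans (+ˡ (f 0 Z.* g (suc (suc n))) (**-sucʳ (tail f) g n)) (swap (f 0 Z.* g (suc (suc n))) (f (suc (suc n)) Z.* g 0) ((tail f ** tail g) n))
  where
  swap : ∀ a b c -> a Z.+ (b Z.+ c) ≡ b Z.+ (a Z.+ c)
  swap = arith

 **-comm : ∀ f g -> f ** g ≐ g ** f
 **-comm f g zero    = Z.*-comm (f 0) (g 0)
 **-comm f g (suc n) = trans (cong₂ Z._+_ (Z.*-comm (f 0) _) (**-comm (tail f) g n)) (sym (**-sucʳ g f n))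

 **-distribʳ : ∀ h f g -> (f ⊕ g) ** h ≐ (f ** h) ⊕ (g ** h)
 **-distribʳ h f g zero    = Z.*-distribʳ-+ (h 0) (f 0) (g 0)
 **-distribʳ h f g (suc n) =
  trans (+ˡ ((f 0 Z.+ g 0) Z.* h (suc n)) (**-distribʳ h (tail f) (tail g) n)) (lem (f 0) (g 0) _ _ _)
  where
  lem : ∀ a b c d e -> (a Z.+ b) Z.* c Z.+ (d Z.+ e) ≡ (a Z.* c Z.+ d) Z.+ (b Z.* c Z.+ e)
  lem = arith

 **-scale : ∀ c f g n -> ((\i -> c Z.* f i) ** g) n ≡ c Z.* (f ** g) n
 **-scale c f g zero    = Z.*-assoc c (f 0) (g 0)
 **-scale c f g (suc n) = trans (+ˡ (c Z.* f 0 Z.* g (suc n)) (**-scale c (tail f) g n)) (lem c (f 0) _ _)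
  where
  lem : ∀ a b d e -> a Z.* b Z.* d Z.+ a Z.* e ≡ a Z.* (b Z.* d Z.+ e)
  lem = arith

 **-assoc : ∀ f g h -> (f ** g) ** h ≐ f ** (g ** h)
 **-assoc f g h zero    = Z.*-assoc (f 0) (g 0) (h 0)
 **-assoc f g h (suc n) = begin
  f 0 Z.* g 0 Z.* h (suc n) Z.+ (((\i -> f 0 Z.* g (suc i)) ⊕ (tail f ** g)) ** h) n
   ≡⟨ +ˡ (f 0 Z.* g 0 Z.* h (suc n)) (**-distribʳ h _ _ n) ⟩
  f 0 Z.* g 0 Z.* h (suc n) Z.+ (((\i -> f 0 Z.* g (suc i)) ** h) n Z.+ ((tail f ** g) ** h) n)
   ≡⟨ +ˡ (f 0 Z.* g 0 Z.* h (suc n)) (cong₂ Z._+_ (**-scale (f 0) (tail g) h n) (**-assoc (tail f) g h n)) ⟩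
  f 0 Z.* g 0 Z.* h (suc n) Z.+ (f 0 Z.* (tail g ** h) n Z.+ (tail f ** (g ** h)) n)
   ≡⟨ lem (f 0) (g 0) _ _ _ ⟩
  f 0 Z.* (g 0 Z.* h (suc n) Z.+ (tail g ** h) n) Z.+ (tail f ** (g ** h)) n ∎
  where
  open ≡-Reasoning
  lem : ∀ a b c d e -> a Z.* b Z.* c Z.+ (a Z.* d Z.+ e) ≡ a Z.* (b Z.* c Z.+ d) Z.+ e
  lem = arith

 psRing : CommutativeRing 0ℓ 0ℓ
 psRing = record
  { Carrier = PS ; _≈_ = _≐_ ; _+_ = _⊕_ ; _*_ = _**_ ; -_ = ⊖_ ; 0# = con Z.0ℤ ; 1# = con Z.1ℤ
  ; isCommutativeRing = record
   { isRing = record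
    { +-isAbelianGroup = record
     { isGroup = record
      { isMonoid = record
       { isSemigroup = record
        { isMagma = record
         { isEquivalence = record { refl = \_ -> refl ; sym = \p n -> sym (p n) ; trans = \p r n -> trans (p n) (r n) }
         ; ∙-cong = \p r n -> cong₂ Z._+_ (p n) (r n) }
        ; assoc = \f g h n -> Z.+-assoc (f n) (g n) (h n) }
       ; identity = (\ { f zero -> Z.+-identityˡ (f 0) ; f (suc n) -> Z.+-identityˡ (f (suc n)) })
            , (\ { f zero -> Z.+-identityʳ (f 0) ; f (suc n) -> Z.+-identityʳ (f (suc n)) }) }
      ; inverse = (\ { f zero -> Z.+-inverseˡ (f 0) ; f (suc n) -> Z.+-inverseˡ (f (suc n)) })
           , (\ { f zero -> Z.+-inverseʳ (f 0) ; f (suc n) -> Z.+-inverseʳ (f (suc n)) })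
      ; ⁻¹-cong = \p n -> cong Z.-_ (p n) }
     ; comm = \f g n -> Z.+-comm (f n) (g n) }
    ; *-cong = **-cong
    ; *-assoc = **-assoc
    ; *-identity = (\f n -> trans (**-con Z.1ℤ f n) (Z.*-identityˡ (f n)))
          , (\f n -> trans (**-comm f _ n) (trans (**-con Z.1ℤ f n) (Z.*-identityˡ (f n))))
    ; distrib = (\h f g n -> trans (**-comm h (f ⊕ g) n) (trans (**-distribʳ h f g n) (cong₂ Z._+_ (**-comm f h n) (**-comm g h n))))
         , **-distribʳ }
   ; *-comm = **-comm } }

 shift-+ : ∀ k f n -> shift k f (k N.+ n) ≡ f n
 shift-+ zero    f n = refl
 shift-+ (suc k) f n = shift-+ k f n

 shift-cong : ∀ k {f g} -> f ≐ g -> shift k f ≐ shift k g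
 shift-cong zero    p n       = p n
 shift-cong (suc k) p zero    = refl
 shift-cong (suc k) p (suc n) = shift-cong k p n

 shift-shift : ∀ k l f -> shift k (shift l f) ≐ shift (k N.+ l) f
 shift-shift zero    l f n       = refl
 shift-shift (suc k) l f zero    = refl
 shift-shift (suc k) l f (suc n) = shift-shift k l f n

 shift-** : ∀ k f g -> shift k f ** g ≐ shift k (f ** g)
 shift-** zero    f g n       = refl
 shift-** (suc k) f g zero    = refl
 shift-** (suc k) f g (suc n) = trans (Z.+-identityˡ _) (shift-** k f g n)

 shift-low : ∀ k f n -> n N.< k -> shift k f n ≡ Z.0ℤ
 shift-low (suc k) f zero    _           = refl
 shift-low (suc k) f (suc n) (N.s≤s n<k) = shift-low k f n n<k

 mono : ℕ -> PS
 mono k = shift k (con Z.1ℤ)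

 mono-** : ∀ k f -> mono k ** f ≐ shift k f
 mono-** k f n = trans (shift-** k _ f n) (shift-cong k (\m -> trans (**-con Z.1ℤ f m) (Z.*-identityˡ _)) n)

 mono-+ : ∀ k l -> mono (k N.+ l) ≐ mono k ** mono l
 mono-+ k l n = sym (trans (mono-** k (mono l) n) (shift-shift k l _ n))

 shift-inj : ∀ k {f g} -> shift k f ≐ shift k g -> f ≐ g
 shift-inj k {f} {g} p n = trans (sym (shift-+ k f n)) (trans (p (k N.+ n)) (shift-+ k g n))

 θ : PS -> PS
 θ f n = + n Z.* f n

 -- The tail of `θ f` is `tail f ⊕ θ (tail f)`, which absorbs the extra summand produced by the
 -- factor `suc n` = 1 + n.
 θ-** : ∀ f g -> θ (f ** g) ≐ (θ f ** g) ⊕ (f ** θ g)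
 θ-** f g zero    = lem (f 0) (g 0)
  where
  lem : ∀ a b -> + 0 Z.* (a Z.* b) ≡ + 0 Z.* a Z.* b Z.+ a Z.* (+ 0 Z.* b)
  lem = arith
 θ-** f g (suc n) = begin
  + suc n Z.* (f 0 Z.* g (suc n) Z.+ m)
   ≡⟨ lem1 (+ n) (f 0) (g (suc n)) m ⟩
  f 0 Z.* (+ suc n Z.* g (suc n)) Z.+ (m Z.+ + n Z.* m)
   ≡⟨ cong (\z -> f 0 Z.* (+ suc n Z.* g (suc n)) Z.+ (m Z.+ z)) (θ-** (tail f) g n) ⟩
  f 0 Z.* (+ suc n Z.* g (suc n)) Z.+ (m Z.+ ((θ (tail f) ** g) n Z.+ (tail f ** θ g) n))
   ≡⟨ lem2 (f 0) (g (suc n)) (f 0 Z.* (+ suc n Z.* g (suc n))) m _ _ ⟩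
  (+ 0 Z.* f 0 Z.* g (suc n) Z.+ (m Z.+ (θ (tail f) ** g) n)) Z.+ (f 0 Z.* (+ suc n Z.* g (suc n)) Z.+ (tail f ** θ g) n)
   ≡⟨ cong (\z -> (+ 0 Z.* f 0 Z.* g (suc n) Z.+ z) Z.+ (f 0 Z.* (+ suc n Z.* g (suc n)) Z.+ (tail f ** θ g) n))
     (sym (trans (**-cong {g = g} (\i -> lem3 (+ i) (f (suc i))) (\_ -> refl) n) (**-distribʳ g (tail f) (θ (tail f)) n))) ⟩
  (+ 0 Z.* f 0 Z.* g (suc n) Z.+ (tail (θ f) ** g) n) Z.+ (f 0 Z.* (+ suc n Z.* g (suc n)) Z.+ (tail f ** θ g) n) ∎
  where
  open ≡-Reasoning
  m = (tail f ** g) n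
  lem1 : ∀ n a b m -> (+ 1 Z.+ n) Z.* (a Z.* b Z.+ m) ≡ a Z.* ((+ 1 Z.+ n) Z.* b) Z.+ (m Z.+ n Z.* m)
  lem1 = arith
  lem2 : ∀ a b c m d e -> c Z.+ (m Z.+ (d Z.+ e)) ≡ (+ 0 Z.* a Z.* b Z.+ (m Z.+ d)) Z.+ (c Z.+ e)
  lem2 = arith
  lem3 : ∀ i a -> (+ 1 Z.+ i) Z.* a ≡ a Z.+ i Z.* a
  lem3 = arith

 -- A product is determined by its lowest terms.
 **-lead : ∀ k l f g -> (∀ i -> i N.< k -> f i ≡ Z.0ℤ) -> (∀ i -> i N.< l -> g i ≡ Z.0ℤ) ->
     (f ** g) (k N.+ l) ≡ f k Z.* g l
 **-lead zero    zero    f g p r = refl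
 **-lead zero    (suc l) f g p r =
  trans (+ˡ (f 0 Z.* g (suc l)) (**-vanish l \i j e ->
      trans (*ˡ (f (suc i)) (r j (N.s≤s (subst (j N.≤_) e (N.m≤n+m j i))))) (Z.*-zeroʳ (f (suc i)))))
     (Z.+-identityʳ _)
 **-lead (suc k) l f g p r =
  trans (cong₂ Z._+_ (trans (cong (Z._* g (suc (k N.+ l))) (p 0 (N.s≤s N.z≤n))) refl)
           (**-lead k l (tail f) g (\i i<k -> p (suc i) (N.s≤s i<k)) r))
     (Z.+-identityˡ _)

 **-low : ∀ k l f g -> (∀ i -> i N.< k -> f i ≡ Z.0ℤ) -> (∀ i -> i N.< l -> g i ≡ Z.0ℤ) ->
     ∀ n -> n N.< k N.+ l -> (f ** g) n ≡ Z.0ℤ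
 **-low zero    l f g p r n n<l = **-vanish n \i j e ->
  trans (*ˡ (f i) (r j (N.≤-<-trans (subst (j N.≤_) e (N.m≤n+m j i)) n<l))) (Z.*-zeroʳ (f i))
 **-low (suc k) l f g p r zero    _ = trans (cong (Z._* g 0) (p 0 (N.s≤s N.z≤n))) refl
 **-low (suc k) l f g p r (suc n) (N.s≤s n<) =
  trans (cong₂ Z._+_ (trans (cong (Z._* g (suc n)) (p 0 (N.s≤s N.z≤n))) refl)
           (**-low k l (tail f) g (\i i<k -> p (suc i) (N.s≤s i<k)) r n n<)) refl

-- Commutative rings with integer constants.

module ZSolver where
 open import Algebra.Bundles using (CommutativeRing)
 open import Algebra.Solver.Ring.AlmostCommutativeRing using (fromCommutativeRing; _-Raw-AlmostCommutative⟶_)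
 import Algebra.Solver.Ring
 open import Data.Maybe.Base using (Maybe; just; nothing)
 open import Level using (0ℓ)

 -- The map from ℤ is part of the structure, so that ring identities are normalised with integers as
 -- coefficients, both for power series and for Laurent series.
 record ZRing : Set1 where
  field
   commRing : CommutativeRing 0ℓ 0ℓ
  open CommutativeRing commRing public
  field
   ι   : ℤ -> Carrier
   ι-+ : ∀ a b -> ι (a Z.+ b) ≈ ι a + ι b
   ι-* : ∀ a b -> ι (a Z.* b) ≈ ι a * ι b
   ι-- : ∀ a -> ι (Z.- a) ≈ - ι a
   ι-0 : ι Z.0ℤ ≈ 0#
   ι-1 : ι Z.1ℤ ≈ 1#

  ι-≡ : ∀ {a b} -> a ≡ b -> ι a ≈ ι b
  ι-≡ I.refl = refl

  morphism : Z.+-*-rawRing -Raw-AlmostCommutative⟶ fromCommutativeRing commRing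
  morphism = record { ⟦_⟧ = ι ; +-homo = ι-+ ; *-homo = ι-* ; -‿homo = ι-- ; 0-homo = ι-0 ; 1-homo = ι-1 }

  dec : ∀ a b -> Maybe (ι a ≈ ι b)
  dec a b with a Z.≟ b
  ... | yes p = just (ι-≡ p)
  ... | no  _ = nothing

  open Algebra.Solver.Ring Z.+-*-rawRing (fromCommutativeRing commRing) morphism dec public
   using (Polynomial; solve; _:=_; _:+_; _:*_; :-_; _:-_; con; _:^_)

  :0 :1 : ∀ {n} -> Polynomial n
  :0 = con (+ 0)
  :1 = con (+ 1)

  open import Relation.Binary.Reasoning.Setoid setoid public

 module _ (Z : ZRing) where
  open ZRing Z

  -- The product rule for two fractions with powers of q as denominators: `c` and `k` are minus the
  -- exponents of these powers, and `M` is the denominator of the product.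
  leibniz-numerator : ∀ f g fʹ gʹ c k M ->
   ((fʹ * g + f * gʹ) + (c + k) * (f * g)) * (M * M) ≈ ((fʹ + c * f) * g * M + f * (gʹ + k * g) * M) * M
  leibniz-numerator = solve 7 (\f g fʹ gʹ c k M -> (((fʹ :* g) :+ (f :* gʹ)) :+ ((c :+ k) :* (f :* g))) :* (M :* M) :=
   ((((fʹ :+ (c :* f)) :* g) :* M) :+ ((f :* (gʹ :+ (k :* g))) :* M)) :* M) refl

-- Localisation at a multiplicative family of cancellable elements.

module Loc where
 open import Algebra.Bundles using (CommutativeRing)
 open import Level using (0ℓ)
 open ZSolver

 -- The denominators are indexed by ℕ, `f / d` standing for f over `m d`. The cancellation law is
 -- what makes equality by cross multiplication transitive.
 module Localise (Z : ZRing) (m : ℕ -> ZRing.Carrier Z) (m0 : ZRing._≈_ Z (m 0) (ZRing.1# Z))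
  (m+ : ∀ d e -> ZRing._≈_ Z (m (d N.+ e)) (ZRing._*_ Z (m d) (m e)))
  (cancel : ∀ d {f g} -> ZRing._≈_ Z (ZRing._*_ Z f (m d)) (ZRing._*_ Z g (m d)) -> ZRing._≈_ Z f g) where
  open ZRing Z

  record Frac : Set where
   constructor _/_
   field
    num : Carrier
    den : ℕ
  open Frac public

  infix 4 _≃_
  _≃_ : Frac -> Frac -> Set
  X ≃ Y = num X * m (den Y) ≈ num Y * m (den X)

  _⊞_ _⊠_ : Frac -> Frac -> Frac
  (f / d) ⊞ (g / e) = (f * m e + g * m d) / (d N.+ e)
  (f / d) ⊠ (g / e) = (f * g) / (d N.+ e)

  ⊟_ : Frac -> Frac
  ⊟ (f / d) = (- f) / d

  private

   ≃-trans : ∀ {X Y Z} -> X ≃ Y -> Y ≃ Z -> X ≃ Z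
   ≃-trans {f / a} {g / b} {h / c} p q = cancel b (begin
    (f * m c) * m b ≈⟨ l1 f (m c) (m b) ⟩
    (f * m b) * m c ≈⟨ *-congʳ p ⟩
    (g * m a) * m c ≈⟨ l1 g (m a) (m c) ⟩
    (g * m c) * m a ≈⟨ *-congʳ q ⟩
    (h * m b) * m a ≈⟨ l1 h (m b) (m a) ⟩
    (h * m a) * m b ∎)
    where
    l1 : ∀ x y z -> (x * y) * z ≈ (x * z) * y
    l1 = solve 3 (\x y z -> (x :* y) :* z := (x :* z) :* y) refl

   ⊞-cong : ∀ {X Xʹ Y Yʹ} -> X ≃ Xʹ -> Y ≃ Yʹ -> (X ⊞ Y) ≃ (Xʹ ⊞ Yʹ)
   ⊞-cong {f / a} {fʹ / aʹ} {g / b} {gʹ / bʹ} p q = begin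
    (f * m b + g * m a) * m (aʹ N.+ bʹ)     ≈⟨ *-congˡ (m+ aʹ bʹ) ⟩
    (f * m b + g * m a) * (m aʹ * m bʹ)     ≈⟨ l1 f (m b) g (m a) (m aʹ) (m bʹ) ⟩
    (f * m aʹ) * (m b * m bʹ) + (g * m bʹ) * (m a * m aʹ) ≈⟨ +-cong (*-congʳ p) (*-congʳ q) ⟩
    (fʹ * m a) * (m b * m bʹ) + (gʹ * m b) * (m a * m aʹ) ≈⟨ l2 fʹ (m b) gʹ (m a) (m aʹ) (m bʹ) ⟩
    (fʹ * m bʹ + gʹ * m aʹ) * (m a * m b)   ≈⟨ *-congˡ (sym (m+ a b)) ⟩
    (fʹ * m bʹ + gʹ * m aʹ) * m (a N.+ b) ∎
    where
    l1 : ∀ f mb g ma maʹ mbʹ -> (f * mb + g * ma) * (maʹ * mbʹ) ≈ (f * maʹ) * (mb * mbʹ) + (g * mbʹ) * (ma * maʹ)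
    l1 = solve 6 (\f mb g ma maʹ mbʹ -> (f :* mb :+ g :* ma) :* (maʹ :* mbʹ) := (f :* maʹ) :* (mb :* mbʹ) :+ (g :* mbʹ) :* (ma :* maʹ)) refl
    l2 : ∀ f mb g ma maʹ mbʹ -> (f * ma) * (mb * mbʹ) + (g * mb) * (ma * maʹ) ≈ (f * mbʹ + g * maʹ) * (ma * mb)
    l2 = solve 6 (\f mb g ma maʹ mbʹ -> (f :* ma) :* (mb :* mbʹ) :+ (g :* mb) :* (ma :* maʹ) := (f :* mbʹ :+ g :* maʹ) :* (ma :* mb)) refl

   ⊠-cong : ∀ {X Xʹ Y Yʹ} -> X ≃ Xʹ -> Y ≃ Yʹ -> (X ⊠ Y) ≃ (Xʹ ⊠ Yʹ)
   ⊠-cong {f / a} {fʹ / aʹ} {g / b} {gʹ / bʹ} p q = begin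
    (f * g) * m (aʹ N.+ bʹ)       ≈⟨ *-congˡ (m+ aʹ bʹ) ⟩
    (f * g) * (m aʹ * m bʹ)       ≈⟨ l f g (m aʹ) (m bʹ) ⟩
    (f * m aʹ) * (g * m bʹ)       ≈⟨ *-cong p q ⟩
    (fʹ * m a) * (gʹ * m b)       ≈⟨ sym (l fʹ gʹ (m a) (m b)) ⟩
    (fʹ * gʹ) * (m a * m b)       ≈⟨ *-congˡ (sym (m+ a b)) ⟩
    (fʹ * gʹ) * m (a N.+ b) ∎
    where
    l : ∀ f g a b -> (f * g) * (a * b) ≈ (f * a) * (g * b)
    l = solve 4 (\f g a b -> (f :* g) :* (a :* b) := (f :* a) :* (g :* b)) refl

   -- Two fractions with denominators a + b and b + a (in some bracketing) agree once the numerators and the denominators do.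
   same : ∀ {f g d e} -> f ≈ g -> m d ≈ m e -> (f / d) ≃ (g / e)
   same p q = *-cong p (sym q)

   m-assoc : ∀ a b c -> m ((a N.+ b) N.+ c) ≈ m (a N.+ (b N.+ c))
   m-assoc a b c = begin
    m ((a N.+ b) N.+ c)   ≈⟨ trans (m+ (a N.+ b) c) (*-congʳ (m+ a b)) ⟩
    (m a * m b) * m c     ≈⟨ *-assoc _ _ _ ⟩
    m a * (m b * m c)     ≈⟨ sym (trans (m+ a (b N.+ c)) (*-congˡ (m+ b c))) ⟩
    m (a N.+ (b N.+ c)) ∎

   m-comm : ∀ a b -> m (a N.+ b) ≈ m (b N.+ a)
   m-comm a b = trans (m+ a b) (trans (*-comm _ _) (sym (m+ b a)))

   ⊞-assoc : ∀ X Y Z -> ((X ⊞ Y) ⊞ Z) ≃ (X ⊞ (Y ⊞ Z))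
   ⊞-assoc (f / a) (g / b) (h / c) = same
    (begin
     (f * m b + g * m a) * m c + h * m (a N.+ b)   ≈⟨ +-congˡ (*-congˡ (m+ a b)) ⟩
     (f * m b + g * m a) * m c + h * (m a * m b)   ≈⟨ l f g h (m a) (m b) (m c) ⟩
     f * (m b * m c) + (g * m c + h * m b) * m a   ≈⟨ +-congʳ (*-congˡ (sym (m+ b c))) ⟩
     f * m (b N.+ c) + (g * m c + h * m b) * m a ∎)
    (m-assoc a b c)
    where
    l : ∀ f g h a b c -> (f * b + g * a) * c + h * (a * b) ≈ f * (b * c) + (g * c + h * b) * a
    l = solve 6 (\f g h a b c -> (f :* b :+ g :* a) :* c :+ h :* (a :* b) := f :* (b :* c) :+ (g :* c :+ h :* b) :* a) refl

   ⊞-comm : ∀ X Y -> (X ⊞ Y) ≃ (Y ⊞ X)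
   ⊞-comm (f / a) (g / b) = same (+-comm _ _) (m-comm a b)

   ⊞-identityˡ : ∀ X -> ((0# / 0) ⊞ X) ≃ X
   ⊞-identityˡ (f / a) = *-congʳ (begin
    0# * m a + f * m 0 ≈⟨ +-cong (zeroˡ _) (trans (*-congˡ m0) (*-identityʳ f)) ⟩
    0# + f             ≈⟨ +-identityˡ f ⟩
    f ∎)

   ⊞-inverseˡ : ∀ X -> ((⊟ X) ⊞ X) ≃ (0# / 0)
   ⊞-inverseˡ (f / a) = begin
    (- f * m a + f * m a) * m 0 ≈⟨ *-congʳ (sym (distribʳ _ _ _)) ⟩
    ((- f + f) * m a) * m 0     ≈⟨ *-congʳ (*-congʳ (-‿inverseˡ f)) ⟩
    (0# * m a) * m 0            ≈⟨ trans (*-congʳ (zeroˡ _)) (zeroˡ _) ⟩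
    0#                          ≈⟨ sym (zeroˡ _) ⟩
    0# * m (a N.+ a) ∎

   ⊟-cong : ∀ {X Y} -> X ≃ Y -> (⊟ X) ≃ (⊟ Y)
   ⊟-cong {f / a} {g / b} p = begin
    - f * m b   ≈⟨ l f (m b) ⟩
    - (f * m b) ≈⟨ -‿cong p ⟩
    - (g * m a) ≈⟨ sym (l g (m a)) ⟩
    - g * m a ∎
    where
    l : ∀ x y -> - x * y ≈ - (x * y)
    l = solve 2 (\x y -> :- x :* y := :- (x :* y)) refl

   ⊠-identityˡ : ∀ X -> ((1# / 0) ⊠ X) ≃ X
   ⊠-identityˡ (f / a) = *-congʳ (*-identityˡ f)

   ⊠-comm : ∀ X Y -> (X ⊠ Y) ≃ (Y ⊠ X)
   ⊠-comm (f / a) (g / b) = same (*-comm f g) (m-comm a b)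

   ⊠-distribʳ : ∀ Z X Y -> ((X ⊞ Y) ⊠ Z) ≃ ((X ⊠ Z) ⊞ (Y ⊠ Z))
   ⊠-distribʳ (h / c) (f / a) (g / b) = begin
    ((f * m b + g * m a) * h) * m ((a N.+ c) N.+ (b N.+ c))       ≈⟨ *-congˡ (trans (m+ _ _) (*-cong (m+ a c) (m+ b c))) ⟩
    ((f * m b + g * m a) * h) * ((m a * m c) * (m b * m c))       ≈⟨ l f g h (m a) (m b) (m c) ⟩
    ((f * h) * (m b * m c) + (g * h) * (m a * m c)) * ((m a * m b) * m c)
     ≈⟨ *-cong (+-cong (*-congˡ (sym (m+ b c))) (*-congˡ (sym (m+ a c)))) (sym (trans (m+ _ _) (*-congʳ (m+ a b)))) ⟩
    ((f * h) * m (b N.+ c) + (g * h) * m (a N.+ c)) * m ((a N.+ b) N.+ c) ∎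
    where
    l : ∀ f g h a b c -> ((f * b + g * a) * h) * ((a * c) * (b * c)) ≈ ((f * h) * (b * c) + (g * h) * (a * c)) * ((a * b) * c)
    l = solve 6 (\f g h a b c -> ((f :* b :+ g :* a) :* h) :* ((a :* c) :* (b :* c)) := ((f :* h) :* (b :* c) :+ (g :* h) :* (a :* c)) :* ((a :* b) :* c)) refl

  fracRing : CommutativeRing 0ℓ 0ℓ
  fracRing = record
   { Carrier = Frac ; _≈_ = _≃_ ; _+_ = _⊞_ ; _*_ = _⊠_ ; -_ = ⊟_ ; 0# = 0# / 0 ; 1# = 1# / 0
   ; isCommutativeRing = record
    { isRing = record
     { +-isAbelianGroup = record
      { isGroup = record
       { isMonoid = record
        { isSemigroup = record
         { isMagma = record
          { isEquivalence = record { refl = refl ; sym = sym ; trans = \ {X} {Y} {Z} -> ≃-trans {X} {Y} {Z} }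
          ; ∙-cong = \ {X} {Xʹ} {Y} {Yʹ} -> ⊞-cong {X} {Xʹ} {Y} {Yʹ} }
         ; assoc = ⊞-assoc }
        ; identity = ⊞-identityˡ , \X -> ≃-trans {X ⊞ (0# / 0)} {(0# / 0) ⊞ X} {X} (⊞-comm X (0# / 0)) (⊞-identityˡ X) }
       ; inverse = ⊞-inverseˡ , \X -> ≃-trans {X ⊞ (⊟ X)} {(⊟ X) ⊞ X} {0# / 0} (⊞-comm X (⊟ X)) (⊞-inverseˡ X)
       ; ⁻¹-cong = \ {X} {Y} -> ⊟-cong {X} {Y} }
      ; comm = ⊞-comm }
     ; *-cong = \ {X} {Xʹ} {Y} {Yʹ} -> ⊠-cong {X} {Xʹ} {Y} {Yʹ}
     ; *-assoc = \ { (f / a) (g / b) (h / c) -> same (*-assoc f g h) (m-assoc a b c) }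
     ; *-identity = ⊠-identityˡ , \X -> ≃-trans {X ⊠ (1# / 0)} {(1# / 0) ⊠ X} {X} (⊠-comm X (1# / 0)) (⊠-identityˡ X)
     ; distrib = (\X Y Z -> ≃-trans {X ⊠ (Y ⊞ Z)} {(Y ⊞ Z) ⊠ X} {(X ⊠ Y) ⊞ (X ⊠ Z)} (⊠-comm X (Y ⊞ Z))
            (≃-trans {(Y ⊞ Z) ⊠ X} {(Y ⊠ X) ⊞ (Z ⊠ X)} {(X ⊠ Y) ⊞ (X ⊠ Z)} (⊠-distribʳ X Y Z)
             (⊞-cong {Y ⊠ X} {X ⊠ Y} {Z ⊠ X} {X ⊠ Z} (⊠-comm Y X) (⊠-comm Z X))))
          , ⊠-distribʳ }
    ; *-comm = ⊠-comm } }

-- The substitution q ↦ q¹³ and sections along residue classes.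

module Series where
 open import Data.Nat.Base as N using (ℕ; zero; suc; _%_; _/_)
 open import Data.Nat.DivMod using (m≡m%n+[m/n]*n; m%n<n)
 open import Relation.Binary.PropositionalEquality
 open PS
 open ZSolver
 open Loc

 con-⊕ : ∀ a b -> con (a Z.+ b) ≐ con a ⊕ con b
 con-⊕ a b zero    = refl
 con-⊕ a b (suc n) = refl

 con-⊖ : ∀ a -> con (Z.- a) ≐ ⊖ con a
 con-⊖ a zero    = refl
 con-⊖ a (suc n) = refl

 con-** : ∀ a b -> con (a Z.* b) ≐ con a ** con b
 con-** a b zero    = refl
 con-** a b (suc n) = sym (trans (**-con a (con b) (suc n)) (Z.*-zeroʳ a))

 psZ : ZRing
 psZ = record { commRing = psRing ; ι = con ; ι-+ = con-⊕ ; ι-* = con-** ; ι-- = con-⊖ ; ι-0 = \_ -> refl ; ι-1 = \_ -> refl }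

 -- `spread k f` is q^k f(q¹³); the counter says how many zeros precede the next coefficient of f.
 spread : ℕ -> PS -> PS
 spread zero    f zero    = f 0
 spread zero    f (suc n) = spread 12 (tail f) n
 spread (suc k) f zero    = Z.0ℤ
 spread (suc k) f (suc n) = spread k f n

 Vp : PS -> PS
 Vp = spread 0

 sect : ℕ -> PS -> PS
 sect ρ f m = f (ρ N.+ m N.* 13)

 spread-shift : ∀ k f -> spread k f ≐ shift k (Vp f)
 spread-shift zero    f n       = refl
 spread-shift (suc k) f zero    = refl
 spread-shift (suc k) f (suc n) = spread-shift k f n

 sect-ext : ∀ {f g} -> (∀ ρ -> ρ N.< 13 -> sect ρ f ≐ sect ρ g) -> f ≐ g
 sect-ext {f} {g} h n = subst (\m -> f m ≡ g m) (sym (m≡m%n+[m/n]*n n 13)) (h (n % 13) (m%n<n n 13) (n / 13))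

 +13 : ∀ ρ m -> ρ N.+ (13 N.+ m) ≡ 13 N.+ (ρ N.+ m)
 +13 ρ m = trans (sym (N.+-assoc ρ 13 m)) (trans (cong (N._+ m) (N.+-comm ρ 13)) (N.+-assoc 13 ρ m))

 sect-shift : ∀ {ρ} -> ρ N.< 13 -> ∀ h -> sect ρ (shift 13 h) ≐ shift 1 (sect ρ h)
 sect-shift {ρ} ρ< h zero    = shift-low 13 h (ρ N.+ 0) (subst (N._< 13) (sym (N.+-identityʳ ρ)) ρ<)
 sect-shift {ρ} ρ< h (suc m) = cong (shift 13 h) (+13 ρ (m N.* 13))

 sect-V0 : ∀ f -> sect 0 (Vp f) ≐ f
 sect-V0 f zero    = refl
 sect-V0 f (suc m) = sect-V0 (tail f) m

 sect-V : ∀ ρ -> suc ρ N.< 13 -> ∀ f m -> sect (suc ρ) (Vp f) m ≡ Z.0ℤ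
 sect-V ρ (N.s≤s ρ<) f zero =
  trans (spread-shift 12 (tail f) (ρ N.+ 0)) (shift-low 12 _ (ρ N.+ 0) (subst (N._< 12) (sym (N.+-identityʳ ρ)) ρ<))
 sect-V ρ ρ< f (suc m) = trans (cong (Vp f) (+13 (suc ρ) (m N.* 13))) (sect-V ρ ρ< (tail f) m)

 split : ∀ f -> f ≐ con (f 0) ⊕ shift 1 (tail f)
 split f zero    = sym (Z.+-identityʳ (f 0))
 split f (suc n) = sym (Z.+-identityˡ (f (suc n)))

 V-split : ∀ f -> Vp f ≐ con (f 0) ⊕ shift 13 (Vp (tail f))
 V-split f zero    = sym (Z.+-identityʳ (f 0))
 V-split f (suc n) = trans (spread-shift 12 (tail f) n) (sym (Z.+-identityˡ _))

 **-split : ∀ c k f h -> f ** (con c ⊕ shift k h) ≐ (\n -> c Z.* f n) ⊕ shift k (f ** h)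
 **-split c k f h n = trans (**-comm f _ n) (trans (**-distribʳ f (con c) (shift k h) n)
  (cong₂ Z._+_ (**-con c f n) (trans (shift-** k h f n) (shift-cong k (**-comm h f) n))))

 -- Induction in which the constant term of g is split off: V of the rest is q¹³ times a V-image,
 -- and a shift by 13 becomes a shift by 1 in the section.
 sect-**V : ∀ {ρ} -> ρ N.< 13 -> ∀ f g -> sect ρ (f ** Vp g) ≐ sect ρ f ** g
 sect-**V {ρ} ρ< f g m = begin
  (f ** Vp g) (ρ N.+ m N.* 13) ≡⟨ **-cong {f = f} (\_ -> refl) (V-split g) (ρ N.+ m N.* 13) ⟩
  (f ** (con (g 0) ⊕ shift 13 (Vp (tail g)))) (ρ N.+ m N.* 13) ≡⟨ **-split (g 0) 13 f (Vp (tail g)) (ρ N.+ m N.* 13) ⟩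
  g 0 Z.* sect ρ f m Z.+ sect ρ (shift 13 (f ** Vp (tail g))) m ≡⟨ +ˡ (g 0 Z.* sect ρ f m) (trans (sect-shift ρ< _ m) (ih m)) ⟩
  g 0 Z.* sect ρ f m Z.+ shift 1 (sect ρ f ** tail g) m ≡⟨ sym (**-split (g 0) 1 (sect ρ f) (tail g) m) ⟩
  (sect ρ f ** (con (g 0) ⊕ shift 1 (tail g))) m ≡⟨ sym (**-cong {f = sect ρ f} (\_ -> refl) (split g) m) ⟩
  (sect ρ f ** g) m ∎
  where
  open ≡-Reasoning
  ih : ∀ m -> shift 1 (sect ρ (f ** Vp (tail g))) m ≡ shift 1 (sect ρ f ** tail g) m
  ih zero    = refl
  ih (suc m) = sect-**V ρ< f (tail g) m

 0<13 : 0 N.< 13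
 0<13 = N.s≤s N.z≤n

 V-** : ∀ f g -> Vp (f ** g) ≐ Vp f ** Vp g
 V-** f g = sect-ext \
  { zero    ρ< m -> trans (sect-V0 (f ** g) m) (sym (trans (sect-**V ρ< (Vp f) g m) (**-cong {g = g} (sect-V0 f) (\_ -> refl) m)))
  ; (suc ρ) ρ< m -> trans (sect-V ρ ρ< (f ** g) m) (sym (trans (sect-**V ρ< (Vp f) g m)
           (**-vanish m \i j _ -> cong (Z._* g j) (sect-V ρ ρ< f i)))) }

 V-cong : ∀ {f g} -> f ≐ g -> Vp f ≐ Vp g
 V-cong {f} {g} p = sect-ext \
  { zero    ρ< m -> trans (sect-V0 f m) (trans (p m) (sym (sect-V0 g m)))
  ; (suc ρ) ρ< m -> trans (sect-V ρ ρ< f m) (sym (sect-V ρ ρ< g m)) }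

 V-⊕ : ∀ f g -> Vp (f ⊕ g) ≐ Vp f ⊕ Vp g
 V-⊕ f g = sect-ext \
  { zero    ρ< m -> trans (sect-V0 _ m) (sym (cong₂ Z._+_ (sect-V0 f m) (sect-V0 g m)))
  ; (suc ρ) ρ< m -> trans (sect-V ρ ρ< (f ⊕ g) m) (sym (cong₂ Z._+_ (sect-V ρ ρ< f m) (sect-V ρ ρ< g m))) }

 V-con : ∀ c -> Vp (con c) ≐ con c
 V-con c zero    = refl
 V-con c (suc n) = trans (spread-shift 12 _ n) (trans (shift-cong 12 (\m -> zeroV m) n) (zeros 12 n))
  where
  zeroV : ∀ m -> Vp (\_ -> Z.0ℤ) m ≡ Z.0ℤ
  zeroV = sect-ext {g = \_ -> Z.0ℤ} \ { zero _ m -> sect-V0 (\_ -> Z.0ℤ) m ; (suc ρ) ρ< m -> sect-V ρ ρ< (\_ -> Z.0ℤ) m }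
  zeros : ∀ k n -> shift k (\_ -> Z.0ℤ) n ≡ Z.0ℤ
  zeros zero    n       = refl
  zeros (suc k) zero    = refl
  zeros (suc k) (suc n) = zeros k n

 V-mono : ∀ k -> Vp (mono k) ≐ mono (k N.* 13)
 V-mono zero    = V-con Z.1ℤ
 V-mono (suc k) zero    = refl
 V-mono (suc k) (suc n) = trans (spread-shift 12 (mono k) n)
  (trans (shift-cong 12 (V-mono k) n) (shift-shift 12 (k N.* 13) (con Z.1ℤ) n))

 at : PS -> ℤ -> ℤ
 at f (+ n)    = f n
 at f -[1+ n ] = Z.0ℤ

 at-suc : ∀ h hʹ -> hʹ 0 ≡ Z.0ℤ -> (∀ n -> hʹ (suc n) ≡ h n) -> ∀ z -> at hʹ (Z.suc z) ≡ at h z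
 at-suc h hʹ p r (+ n)        = r n
 at-suc h hʹ p r -[1+ zero ]  = p
 at-suc h hʹ p r -[1+ suc n ] = refl

 at-shift : ∀ k f z -> at (shift k f) (z Z.+ + k) ≡ at f z
 at-shift zero    f z = cong (at f) (Z.+-identityʳ z)
 at-shift (suc k) f z = trans (cong (at (shift (suc k) f)) (lem z (+ k)))
  (trans (at-suc (shift k f) (shift (suc k) f) refl (\_ -> refl) (z Z.+ + k)) (at-shift k f z))
  where
  lem : ∀ z k -> z Z.+ (+ 1 Z.+ k) ≡ + 1 Z.+ (z Z.+ k)
  lem = arith

 at-cong : ∀ {f g} -> f ≐ g -> ∀ z -> at f z ≡ at g z
 at-cong p (+ n)    = p n
 at-cong p -[1+ n ] = refl

 at-low : ∀ a b f g -> (∀ z -> z Z.< a -> at f z ≡ Z.0ℤ) -> (∀ z -> z Z.< b -> at g z ≡ Z.0ℤ) ->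
     ∀ z -> z Z.< a Z.+ b -> at (f ** g) z ≡ Z.0ℤ
 at-low a b f g p r -[1+ k ] _ = refl
 at-low (+ m) (+ n) f g p r (+ k) k< =
  **-low m n f g (\i i< -> p (+ i) (Z.+<+ i<)) (\i i< -> r (+ i) (Z.+<+ i<)) k (Z.drop‿+<+ k<)
 at-low -[1+ m ] (+ n) f g p r (+ k) k< =
  **-low 0 n f g (\_ ()) (\i i< -> r (+ i) (Z.+<+ i<)) k
   (Z.drop‿+<+ (Z.<-trans k< (subst (Z._< + n) (Z.+-comm (+ n) -[1+ m ]) (Z.m⊖1+n<m n (suc m)))))
 at-low (+ m) -[1+ n ] f g p r (+ k) k< = trans (**-comm f g k)
  (**-low 0 m g f (\_ ()) (\i i< -> p (+ i) (Z.+<+ i<)) k (Z.drop‿+<+ (Z.<-trans k< (Z.m⊖1+n<m m (suc n)))))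

 at-lead : ∀ a b f g -> (∀ z -> z Z.< a -> at f z ≡ Z.0ℤ) -> (∀ z -> z Z.< b -> at g z ≡ Z.0ℤ) ->
      at (f ** g) (a Z.+ b) ≡ at f a Z.* at g b
 at-lead (+ m) (+ n) f g p r = **-lead m n f g (\i i< -> p (+ i) (Z.+<+ i<)) (\i i< -> r (+ i) (Z.+<+ i<))
 at-lead -[1+ m ] b f g p r =
  at-low (+ 0) b f g (\ { (+ n) (Z.+<+ ()) ; -[1+ n ] _ -> refl }) r (-[1+ m ] Z.+ b) (Z.+-monoˡ-< b Z.-<+)
 at-lead (+ m) -[1+ n ] f g p r = trans (at-low (+ m) (+ 0) f g p (\ { (+ n) (Z.+<+ ()) ; -[1+ n ] _ -> refl }) (+ m Z.+ -[1+ n ]) (Z.+-monoʳ-< (+ m) Z.-<+))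
  (sym (Z.*-zeroʳ (f m)))

-- Decomposition of series by exponents modulo 13.

module Classes where
 open import Data.Nat.Base as N using (ℕ; zero; suc; _%_; _≡ᵇ_)
 open import Data.Nat.DivMod using (m≡m%n+[m/n]*n; m%n<n; [m+kn]%n≡m%n; m<n⇒m%n≡m; %-distribˡ-+; m%n%n≡m%n)
 open import Data.Bool.Base using (true; false; if_then_else_; T)
 open import Relation.Nullary using (yes; no)
 open import Relation.Binary.PropositionalEquality
 open PS
 open ZSolver
 open Loc
 open Series

 pick : ℕ -> PS -> PS
 pick r f n = if n % 13 ≡ᵇ r then f n else Z.0ℤ

 ≡ᵇ-yes : ∀ {m n} {A : Set} {x y : A} -> m ≡ n -> (if m ≡ᵇ n then x else y) ≡ x
 ≡ᵇ-yes {zero}  refl = refl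
 ≡ᵇ-yes {suc m} refl = ≡ᵇ-yes {m} refl

 ≡ᵇ-no : ∀ {m n} {A : Set} {x y : A} -> m ≢ n -> (if m ≡ᵇ n then x else y) ≡ y
 ≡ᵇ-no {m} {n} ne with m ≡ᵇ n in e
 ... | false = refl
 ... | true  = ⊥-elim (ne (N.≡ᵇ⇒≡ m n (subst T (sym e) _)))

 pick-yes : ∀ {r} f {n} -> n % 13 ≡ r -> pick r f n ≡ f n
 pick-yes f e = ≡ᵇ-yes e

 pick-no : ∀ {r} f {n} -> n % 13 ≢ r -> pick r f n ≡ Z.0ℤ
 pick-no f e = ≡ᵇ-no e

 sect-res : ∀ {ρ} -> ρ N.< 13 -> ∀ m -> (ρ N.+ m N.* 13) % 13 ≡ ρ
 sect-res {ρ} ρ< m = trans ([m+kn]%n≡m%n ρ m 13) (m<n⇒m%n≡m ρ<)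

 pick-**V : ∀ r f g -> pick r (f ** Vp g) ≐ pick r f ** Vp g
 pick-**V r f g = sect-ext \ρ ρ< m -> trans (go ρ ρ< m) (sym (sect-**V ρ< (pick r f) g m))
  where
  go : ∀ ρ -> ρ N.< 13 -> ∀ m -> sect ρ (pick r (f ** Vp g)) m ≡ (sect ρ (pick r f) ** g) m
  go ρ ρ< m with ρ N.≟ r
  ... | yes refl = trans (pick-yes (f ** Vp g) {ρ N.+ m N.* 13} (sect-res ρ< m)) (trans (sect-**V ρ< f g m)
     (**-cong {g = g} (\i -> sym (pick-yes f {ρ N.+ i N.* 13} (sect-res ρ< i))) (\_ -> refl) m))
  ... | no ne = trans (pick-no (f ** Vp g) {ρ N.+ m N.* 13} (\e -> ne (trans (sym (sect-res ρ< m)) e)))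
     (sym (**-vanish m \i j _ -> cong (Z._* g j) (pick-no f {ρ N.+ i N.* 13} (\e -> ne (trans (sym (sect-res ρ< i)) e)))))

 pick-V : ∀ f -> pick 0 f ≐ Vp (sect 0 f)
 pick-V f = sect-ext \
  { zero    ρ< m -> trans (pick-yes f {m N.* 13} (sect-res ρ< m)) (sym (sect-V0 (sect 0 f) m))
  ; (suc ρ) ρ< m -> trans (pick-no f {suc ρ N.+ m N.* 13} (\e -> N.1+n≢0 (trans (sym (sect-res ρ< m)) e))) (sym (sect-V ρ ρ< (sect 0 f) m)) }

 sum< : ℕ -> (ℕ -> PS) -> PS
 sum< zero    F = con Z.0ℤ
 sum< (suc k) F = sum< k F ⊕ F k

 -- This is s - ρ modulo 13, the class that has to meet class ρ in a product to contribute to class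
 -- s.
 co-class : ℕ -> ℕ -> ℕ
 co-class s ρ = (s N.+ (13 N.∸ ρ)) % 13

 residues : ∀ s i j -> (i N.+ j) % 13 ≡ s % 13 -> i % 13 ≡ co-class s (j % 13)
 residues s i j e = begin
  i % 13                                   ≡⟨ sym ([m+kn]%n≡m%n i (suc (j N./ 13)) 13) ⟩
  (i N.+ suc (j N./ 13) N.* 13) % 13       ≡⟨ cong (_% 13) lem ⟩
  (i N.+ j N.+ (13 N.∸ j % 13)) % 13       ≡⟨ %-distribˡ-+ (i N.+ j) (13 N.∸ j % 13) 13 ⟩
  ((i N.+ j) % 13 N.+ (13 N.∸ j % 13) % 13) % 13 ≡⟨ cong (\z -> (z N.+ (13 N.∸ j % 13) % 13) % 13) e ⟩
  (s % 13 N.+ (13 N.∸ j % 13) % 13) % 13   ≡⟨ sym (%-distribˡ-+ s (13 N.∸ j % 13) 13) ⟩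
  (s N.+ (13 N.∸ j % 13)) % 13 ∎
  where
  open ≡-Reasoning
  r = j % 13
  r+ : r N.+ (13 N.∸ r) ≡ 13
  r+ = N.m+[n∸m]≡n (N.<⇒≤ (m%n<n j 13))
  lem : i N.+ suc (j N./ 13) N.* 13 ≡ i N.+ j N.+ (13 N.∸ r)
  lem = trans (cong (i N.+_) (trans (cong (N._+ j N./ 13 N.* 13) (sym r+))
      (trans (N.+-assoc r (13 N.∸ r) _) (trans (cong (r N.+_) (N.+-comm (13 N.∸ r) _))
      (trans (sym (N.+-assoc r (j N./ 13 N.* 13) (13 N.∸ r))) (cong (N._+ (13 N.∸ r)) (sym (m≡m%n+[m/n]*n j 13))))))))
     (sym (N.+-assoc i j _))

 residues⁻ : ∀ s i j -> i % 13 ≡ co-class s (j % 13) -> (i N.+ j) % 13 ≡ s % 13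
 residues⁻ s i j e = begin
  (i N.+ j) % 13 ≡⟨ %-distribˡ-+ i j 13 ⟩
  (i % 13 N.+ r) % 13 ≡⟨ cong (\z -> (z N.+ r) % 13) e ⟩
  ((s N.+ (13 N.∸ r)) % 13 N.+ r) % 13 ≡⟨ cong (\z -> ((s N.+ (13 N.∸ r)) % 13 N.+ z) % 13) (sym (m%n%n≡m%n j 13)) ⟩
  ((s N.+ (13 N.∸ r)) % 13 N.+ r % 13) % 13 ≡⟨ sym (%-distribˡ-+ (s N.+ (13 N.∸ r)) r 13) ⟩
  (s N.+ (13 N.∸ r) N.+ r) % 13 ≡⟨ cong (_% 13) (trans (N.+-assoc s _ r) (cong (s N.+_) (N.m∸n+n≡m (N.<⇒≤ (m%n<n j 13))))) ⟩
  (s N.+ 13) % 13 ≡⟨ [m+kn]%n≡m%n s 1 13 ⟩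
  s % 13 ∎
  where
  open ≡-Reasoning
  r = j % 13

 sum<-** : ∀ k f F n -> sum< k (\ρ -> f ** F ρ) n ≡ (f ** sum< k F) n
 sum<-** zero    f F n = sym (trans (**-comm f _ n) (trans (**-zeroˡ f n) (sym (zero0 n))))
  where
  zero0 : ∀ n -> con Z.0ℤ n ≡ Z.0ℤ
  zero0 zero    = refl
  zero0 (suc _) = refl
 sum<-** (suc k) f F n = trans (cong (\z -> z Z.+ (f ** F k) n) (sum<-** k f F n))
  (sym (trans (**-comm f _ n) (trans (**-distribʳ f (sum< k F) (F k) n) (cong₂ Z._+_ (**-comm (sum< k F) f n) (**-comm (F k) f n)))))

 sum<-pick : ∀ k f n -> n % 13 N.< k -> sum< k (\ρ -> pick ρ f) n ≡ f n
 sum<-pick (suc k) f n n< with n % 13 N.≟ k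
 ... | yes e = trans (cong₂ Z._+_ (below k (N.≤-reflexive (sym e))) (pick-yes f {n} e)) (Z.+-identityˡ _)
  where
  zero0 : ∀ n -> con Z.0ℤ n ≡ Z.0ℤ
  zero0 zero    = refl
  zero0 (suc _) = refl
  below : ∀ l -> l N.≤ n % 13 -> sum< l (\ρ -> pick ρ f) n ≡ Z.0ℤ
  below zero    _  = zero0 n
  below (suc l) l< = cong₂ Z._+_ (below l (N.<⇒≤ l<)) (pick-no f {n} (\e -> N.<-irrefl (sym e) l<))
 ... | no ne = trans (cong₂ Z._+_ (sum<-pick k f n (N.≤∧≢⇒< (N.≤-pred n<) ne)) (pick-no f {n} ne)) (Z.+-identityʳ _)

 sum<-cong-at : ∀ k (F G : ℕ -> PS) n -> (∀ ρ -> ρ N.< k -> F ρ n ≡ G ρ n) -> sum< k F n ≡ sum< k G n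
 sum<-cong-at zero    F G n h = refl
 sum<-cong-at (suc k) F G n h = cong₂ Z._+_ (sum<-cong-at k F G n \ρ ρ< -> h ρ (N.m≤n⇒m≤1+n ρ<)) (h k N.≤-refl)

 pick-** : ∀ s -> s N.< 13 -> ∀ f g -> pick s (f ** g) ≐ sum< 13 (\ρ -> pick (co-class s ρ) f ** pick ρ g)
 pick-** s s< f g n with n % 13 N.≟ s
 ... | yes e = trans (pick-yes (f ** g) {n} e) (sym (begin
  sum< 13 (\ρ -> pick (co-class s ρ) f ** pick ρ g) n ≡⟨ sum<-cong-at 13 (\ρ -> pick (co-class s ρ) f ** pick ρ g) (\ρ -> f ** pick ρ g) n (\ρ ρ< -> **-cong-at n {pick (co-class s ρ) f} {f} {pick ρ g} {pick ρ g} (\i j i+j -> cell ρ ρ< i j i+j)) ⟩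
  sum< 13 (\ρ -> f ** pick ρ g) n ≡⟨ sum<-** 13 f (\ρ -> pick ρ g) n ⟩
  (f ** sum< 13 (\ρ -> pick ρ g)) n ≡⟨ **-cong {f = f} (\_ -> refl) (\m -> sum<-pick 13 g m (m%n<n m 13)) n ⟩
  (f ** g) n ∎))
  where
  open ≡-Reasoning
  cell : ∀ ρ -> ρ N.< 13 -> ∀ i j -> i N.+ j ≡ n -> pick (co-class s ρ) f i Z.* pick ρ g j ≡ f i Z.* pick ρ g j
  cell ρ ρ< i j i+j with j % 13 N.≟ ρ
  ... | yes refl = cong (Z._* pick (j % 13) g j) (pick-yes f {i} (residues s i j
           (trans (cong (_% 13) i+j) (trans e (sym (m<n⇒m%n≡m s<))))))
  ... | no ne = trans (*ˡ (pick (co-class s ρ) f i) (pick-no g {j} ne))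
          (trans (Z.*-zeroʳ (pick (co-class s ρ) f i)) (sym (trans (*ˡ (f i) (pick-no g {j} ne)) (Z.*-zeroʳ (f i)))))
 ... | no ne = trans (pick-no (f ** g) {n} ne) (sym (trans (sum<-cong-at 13 (\ρ -> pick (co-class s ρ) f ** pick ρ g) (\_ _ -> Z.0ℤ) n \ρ ρ< -> **-vanish n {pick (co-class s ρ) f} {pick ρ g} (cell ρ ρ<)) (zeros 13)))
  where
  zero0 : ∀ n -> con Z.0ℤ n ≡ Z.0ℤ
  zero0 zero    = refl
  zero0 (suc _) = refl
  zeros : ∀ k -> sum< k (\_ _ -> Z.0ℤ) n ≡ Z.0ℤ
  zeros zero    = zero0 n
  zeros (suc k) = cong (Z._+ Z.0ℤ) (zeros k)
  cell : ∀ ρ -> ρ N.< 13 -> ∀ i j -> i N.+ j ≡ n -> pick (co-class s ρ) f i Z.* pick ρ g j ≡ Z.0ℤ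
  cell ρ ρ< i j i+j with j % 13 N.≟ ρ
  ... | no neʹ = trans (*ˡ (pick (co-class s ρ) f i) (pick-no g {j} neʹ)) (Z.*-zeroʳ (pick (co-class s ρ) f i))
  ... | yes refl = cong (Z._* pick (j % 13) g j) (pick-no f {i} (\e -> ne
      (trans (cong (_% 13) (sym i+j)) (trans (residues⁻ s i j e) (m<n⇒m%n≡m s<)))))

-- The interface of the Laurent series ring.

module LInt where
 open import Data.Nat.Base as N using (ℕ; zero; suc; _≡ᵇ_)
 open import Data.Integer.DivMod using (_%ℕ_)
 open import Data.Integer.Divisibility.Signed using (_∣_)
 open import Data.Bool.Base using (if_then_else_)
 open PS using (PS; _⊕_; _**_; ⊖_; _≐_) renaming (con to conp; θ to θp)
 open ZSolver
 open Series using (at; Vp)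
 open Classes using (co-class)

 sumR : (Z : ZRing) -> ℕ -> (ℕ -> ZRing.Carrier Z) -> ZRing.Carrier Z
 sumR Z zero    F = ZRing.0# Z
 sumR Z (suc k) F = ZRing._+_ Z (sumR Z k F) (F k)

 -- A series is known through its coefficients `co`, which determine it by `co-ext`. Here θ is q
 -- d/dq, V substitutes q¹³ for q, U keeps the exponents divisible by 13 and divides them by 13,
 -- `Π r` keeps the exponents congruent to r, and `emb` imports power series.
 record Laurent : Set1 where
  field
   zr : ZRing
  open ZRing zr public
  field
   co      : Carrier -> ℤ -> ℤ
   co-cong : ∀ {X Y} -> X ≈ Y -> ∀ z -> co X z ≡ co Y z
   co-ext  : ∀ {X Y} -> (∀ z -> co X z ≡ co Y z) -> X ≈ Y
   co-+    : ∀ X Y z -> co (X + Y) z ≡ co X z Z.+ co Y z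
   co-ι    : ∀ c X z -> co (ι c * X) z ≡ c Z.* co X z

  Low : Carrier -> ℤ -> Set
  Low X a = ∀ z -> z Z.< a -> co X z ≡ Z.0ℤ

  field
   co-low  : ∀ {X Y a b} -> Low X a -> Low Y b -> Low (X * Y) (a Z.+ b)
   co-lead : ∀ {X Y a b} -> Low X a -> Low Y b -> co (X * Y) (a Z.+ b) ≡ co X a Z.* co Y b
   below   : ∀ X -> ∃ \d -> Low X (Z.- (+ d))
   divide  : ∀ c X -> (∀ z -> c ∣ co X z) -> ∃ \Y -> X ≈ ι c * Y

   q       : ℤ -> Carrier
   co-q    : ∀ k X z -> co (q k * X) z ≡ co X (z Z.- k)

   θ V U   : Carrier -> Carrier
   Π       : ℕ -> Carrier -> Carrier
   co-θ    : ∀ X z -> co (θ X) z ≡ z Z.* co X z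
   co-V    : ∀ X z -> co (V X) (z Z.* + 13) ≡ co X z
   co-V0   : ∀ X z -> (∀ w -> z ≢ w Z.* + 13) -> co (V X) z ≡ Z.0ℤ
   co-U    : ∀ X z -> co (U X) z ≡ co X (z Z.* + 13)
   co-Π    : ∀ r X z -> co (Π r X) z ≡ (if z %ℕ 13 ≡ᵇ r then co X z else Z.0ℤ)
   θ-*     : ∀ X Y -> θ (X * Y) ≈ θ X * Y + X * θ Y
   V-cong  : ∀ {X Y} -> X ≈ Y -> V X ≈ V Y
   V-+     : ∀ X Y -> V (X + Y) ≈ V X + V Y
   V-*     : ∀ X Y -> V (X * Y) ≈ V X * V Y
   UV      : ∀ X Y -> U (X * V Y) ≈ U X * Y
   ΠV      : ∀ r X Y -> Π r (X * V Y) ≈ Π r X * V Y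
   Π0      : ∀ X -> Π 0 X ≈ V (U X)
   Π-*     : ∀ s -> s N.< 13 -> ∀ X Y -> Π s (X * Y) ≈ sumR zr 13 (\ρ -> Π (co-class s ρ) X * Π ρ Y)

   emb     : PS -> Carrier
   co-emb  : ∀ f z -> co (emb f) z ≡ at f z
   emb-**   : ∀ f g -> emb (f ** g) ≈ emb f * emb g
   emb-con : ∀ c -> emb (conp c) ≈ ι c
   emb-V   : ∀ f -> emb (Vp f) ≈ V (emb f)

-- Laurent series as fractions with powers of q¹³ as denominators.

module LInst where
 open import Data.Nat.Base as N using (ℕ; zero; suc; _%_; _≡ᵇ_)
 open import Data.Nat.DivMod using (m≡m%n+[m/n]*n; m%n<n)
 open import Data.Integer.DivMod using (_%ℕ_; _/ℕ_; a≡a%ℕn+[a/ℕn]*n; n%ℕd<d)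
 open import Data.Integer.Divisibility.Signed using (_∣_)
 open import Data.Bool.Base using (if_then_else_)
 open import Relation.Binary.PropositionalEquality hiding ([_])
 open PS
 open ZSolver
 open Loc
 open Series
 open Classes
 open LInt using (sumR; Laurent)

 m : ℕ -> PS
 m d = mono (d N.* 13)

 module P = ZRing psZ

 m+ : ∀ d e -> m (d N.+ e) ≐ m d ** m e
 m+ d e n = trans (cong (\k -> mono k n) (N.*-distribʳ-+ 13 d e)) (mono-+ (d N.* 13) (e N.* 13) n)

 m-shift : ∀ d f -> f ** m d ≐ shift (d N.* 13) f
 m-shift d f n = trans (**-comm f (m d) n) (mono-** (d N.* 13) f n)

 m-cancel : ∀ d {f g} -> f ** m d ≐ g ** m d -> f ≐ g
 m-cancel d {f} {g} p = shift-inj (d N.* 13) \n -> trans (sym (m-shift d f n)) (trans (p n) (m-shift d g n))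

 open Localise psZ m (\_ -> refl) m+ (\d {f} {g} -> m-cancel d {f} {g})

 val : ℕ -> ℤ
 val d = + (d N.* 13)

 cf : Frac -> ℤ -> ℤ
 cf (f / d) z = at f (z Z.+ val d)

 at-m : ∀ d f z -> at (f ** m d) (z Z.+ val d) ≡ at f z
 at-m d f z = trans (at-cong (m-shift d f) (z Z.+ val d)) (at-shift (d N.* 13) f z)

 at-m⁻ : ∀ d f z -> at (f ** m d) z ≡ at f (z Z.- val d)
 at-m⁻ d f z = trans (cong (at (f ** m d)) (lem z (val d))) (at-m d f (z Z.- val d))
  where
  lem : ∀ z v -> z ≡ z Z.- v Z.+ v
  lem = arith

 cf-cong : ∀ {X Y} -> X ≃ Y -> ∀ z -> cf X z ≡ cf Y z
 cf-cong {f / d} {g / e} p z =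
  trans (sym (at-m e f (z Z.+ val d))) (trans (at-cong p (z Z.+ val d Z.+ val e)) (trans (cong (at (g ** m d)) (lem z (val d) (val e))) (at-m d g (z Z.+ val e))))
  where
  lem : ∀ z d e -> z Z.+ d Z.+ e ≡ z Z.+ e Z.+ d
  lem = arith

 cf-ext : ∀ {X Y} -> (∀ z -> cf X z ≡ cf Y z) -> X ≃ Y
 cf-ext {f / d} {g / e} h n =
  trans (at-m⁻ e f (+ n)) (trans (cong (at f) (lem (+ n) (val e) (val d)))
   (trans (h (+ n Z.- val e Z.- val d)) (trans (cong (at g) (lem2 (+ n) (val e) (val d))) (sym (at-m⁻ d g (+ n))))))
  where
  lem : ∀ n e d -> n Z.- e ≡ n Z.- e Z.- d Z.+ d
  lem = arith
  lem2 : ∀ n e d -> n Z.- e Z.- d Z.+ e ≡ n Z.- d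
  lem2 = arith

 at-⊕ : ∀ f g z -> at (f ⊕ g) z ≡ at f z Z.+ at g z
 at-⊕ f g (+ n)    = refl
 at-⊕ f g -[1+ n ] = refl

 val-+ : ∀ d e -> val (d N.+ e) ≡ val d Z.+ val e
 val-+ d e = cong +_ (N.*-distribʳ-+ 13 d e)

 cf-⊞ : ∀ X Y z -> cf (X ⊞ Y) z ≡ cf X z Z.+ cf Y z
 cf-⊞ (f / d) (g / e) z = trans (at-⊕ (f ** m e) (g ** m d) (z Z.+ val (d N.+ e))) (cong₂ Z._+_
  (trans (cong (at (f ** m e)) (trans (cong (\v -> z Z.+ v) (val-+ d e)) (l1 z (val d) (val e)))) (at-m e f (z Z.+ val d)))
  (trans (cong (at (g ** m d)) (trans (cong (\v -> z Z.+ v) (val-+ d e)) (l2 z (val d) (val e)))) (at-m d g (z Z.+ val e))))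
  where
  l1 : ∀ z d e -> z Z.+ (d Z.+ e) ≡ z Z.+ d Z.+ e
  l1 = arith
  l2 : ∀ z d e -> z Z.+ (d Z.+ e) ≡ z Z.+ e Z.+ d
  l2 = arith

 at-con : ∀ c f z -> at (con c ** f) z ≡ c Z.* at f z
 at-con c f (+ n)    = **-con c f n
 at-con c f -[1+ n ] = sym (Z.*-zeroʳ c)

 ιL : ℤ -> Frac
 ιL c = con c / 0

 cf-ι : ∀ c X z -> cf (ιL c ⊠ X) z ≡ c Z.* cf X z
 cf-ι c (f / d) z = at-con c f (z Z.+ val d)

 lowShift : ∀ X a -> (∀ z -> z Z.< a -> cf X z ≡ Z.0ℤ) -> ∀ z -> z Z.< a Z.+ val (den X) -> at (num X) z ≡ Z.0ℤ
 lowShift (f / d) a h z z< = trans (cong (at f) (l1 z (val d))) (h (z Z.- val d)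
  (subst (z Z.- val d Z.<_) (l2 a (val d)) (Z.+-monoˡ-< (Z.- val d) z<)))
  where
  l1 : ∀ z v -> z ≡ z Z.- v Z.+ v
  l1 = arith
  l2 : ∀ z v -> z Z.+ v Z.- v ≡ z
  l2 = arith

 val-mid : ∀ a b d e -> a Z.+ b Z.+ val (d N.+ e) ≡ (a Z.+ val d) Z.+ (b Z.+ val e)
 val-mid a b d e = trans (cong (\v -> a Z.+ b Z.+ v) (val-+ d e)) (lem a b (val d) (val e))
  where
  lem : ∀ a b d e -> a Z.+ b Z.+ (d Z.+ e) ≡ (a Z.+ d) Z.+ (b Z.+ e)
  lem = arith

 cf-low : ∀ {X Y a b} -> (∀ z -> z Z.< a -> cf X z ≡ Z.0ℤ) -> (∀ z -> z Z.< b -> cf Y z ≡ Z.0ℤ) -> ∀ z -> z Z.< a Z.+ b -> cf (X ⊠ Y) z ≡ Z.0ℤ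
 cf-low {X@(f / d)} {Y@(g / e)} {a} {b} p r z z< =
  at-low (a Z.+ val d) (b Z.+ val e) f g (lowShift X a p) (lowShift Y b r) (z Z.+ val (d N.+ e))
   (subst (z Z.+ val (d N.+ e) Z.<_) (val-mid a b d e) (Z.+-monoˡ-< (val (d N.+ e)) z<))

 cf-lead : ∀ {X Y a b} -> (∀ z -> z Z.< a -> cf X z ≡ Z.0ℤ) -> (∀ z -> z Z.< b -> cf Y z ≡ Z.0ℤ) -> cf (X ⊠ Y) (a Z.+ b) ≡ cf X a Z.* cf Y b
 cf-lead {X@(f / d)} {Y@(g / e)} {a} {b} p r =
  trans (cong (at (f ** g)) (val-mid a b d e)) (at-lead (a Z.+ val d) (b Z.+ val e) f g (lowShift X a p) (lowShift Y b r))

 neg-at : ∀ f z -> z Z.< + 0 -> at f z ≡ Z.0ℤ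
 neg-at f (+ n) (Z.+<+ ())
 neg-at f -[1+ n ] _ = refl

 cf-below : ∀ X -> ∃ \d -> ∀ z -> z Z.< Z.- (+ d) -> cf X z ≡ Z.0ℤ
 cf-below (f / d) = d N.* 13 , \z z< -> neg-at f (z Z.+ val d) (subst (z Z.+ val d Z.<_) (Z.+-inverseˡ (val d)) (Z.+-monoˡ-< (val d) z<))

 cf-divide : ∀ c X -> (∀ z -> c ∣ cf X z) -> ∃ \Y -> X ≃ ιL c ⊠ Y
 cf-divide c (f / d) h = (g / d) , cf-ext {f / d} {ιL c ⊠ (g / d)} \z -> trans (at-cong {f} {con c ** g} (\n -> trans (eq n) (sym (**-con c g n))) (z Z.+ val d)) refl
  where
  k : ∀ n -> c ∣ f n
  k n = subst (c ∣_) (cong (at f) (lem (+ n) (val d))) (h (+ n Z.- val d))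
   where
   lem : ∀ z v -> z Z.- v Z.+ v ≡ z
   lem = arith
  g : PS
  g n = _∣_.quotient (k n)
  eq : ∀ n -> f n ≡ c Z.* g n
  eq n = trans (_∣_.equality (k n)) (Z.*-comm (g n) c)

 qL : ℤ -> Frac
 qL (+ n)    = mono n / 0
 -- The denominator must be a power of q¹³, so q^(-k) is expanded by q^(12k).
 qL -[1+ n ] = mono (suc n N.* 12) / suc n

 cf-mono : ∀ k f z -> at (mono k ** f) z ≡ at f (z Z.- + k)
 cf-mono k f z = trans (at-cong (mono-** k f) z) (trans (cong (at (shift k f)) (lem z (+ k))) (at-shift k f (z Z.- + k)))
  where
  lem : ∀ z v -> z ≡ z Z.- v Z.+ v
  lem = arith

 cf-q : ∀ k X z -> cf (qL k ⊠ X) z ≡ cf X (z Z.- k)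
 cf-q (+ n) (f / d) z = trans (cf-mono n f (z Z.+ val d)) (cong (at f) (lem z (val d) (+ n)))
  where
  lem : ∀ z v n -> z Z.+ v Z.- n ≡ z Z.- n Z.+ v
  lem = arith
 cf-q -[1+ n ] (f / d) z = trans (cf-mono (suc n N.* 12) f (z Z.+ val (suc n N.+ d))) (cong (at f)
  (trans (cong (\v -> z Z.+ v Z.- + (suc n N.* 12)) (val-+ (suc n) d))
  (trans (cong₂ (\u v -> z Z.+ (u Z.+ val d) Z.- v) (Z.pos-* (suc n) 13) (Z.pos-* (suc n) 12)) (lem z (val d) (+ suc n)))))
  where
  lem : ∀ z v n -> z Z.+ (n Z.* + 13 Z.+ v) Z.- n Z.* + 12 ≡ z Z.+ n Z.+ v
  lem = arith

 θL VL UL : Frac -> Frac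
 θL (f / d) = (θ f ⊕ (con (Z.- val d) ** f)) / d
 VL (f / d) = Vp f / (d N.* 13)
 -- Under U the denominator q^(13d) becomes q^d, which is expanded by q^(12d) to an admissible one.
 UL (f / d) = shift (d N.* 12) (sect 0 f) / d

 ΠL : ℕ -> Frac -> Frac
 ΠL r (f / d) = pick r f / d

 at-θ : ∀ f z -> at (θ f) z ≡ z Z.* at f z
 at-θ f (+ n)    = refl
 at-θ f -[1+ n ] = sym (Z.*-zeroʳ -[1+ n ])

 cf-θ : ∀ X z -> cf (θL X) z ≡ z Z.* cf X z
 cf-θ (f / d) z = trans (at-⊕ (θ f) (con (Z.- val d) ** f) (z Z.+ val d)) (trans (cong₂ Z._+_ (at-θ f (z Z.+ val d)) (at-con (Z.- val d) f (z Z.+ val d))) (lem z (val d) (at f (z Z.+ val d))))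
  where
  lem : ∀ z v a -> (z Z.+ v) Z.* a Z.+ (Z.- v) Z.* a ≡ z Z.* a
  lem = arith

 at-V : ∀ f z -> at (Vp f) (z Z.* + 13) ≡ at f z
 at-V f (+ n)    = trans (cong (at (Vp f)) (sym (Z.pos-* n 13))) (sect-V0 f n)
 at-V f -[1+ n ] = refl

 at-V0 : ∀ f z -> (∀ w -> z ≢ w Z.* + 13) -> at (Vp f) z ≡ Z.0ℤ
 at-V0 f -[1+ n ] h = refl
 at-V0 f (+ n) h with n % 13 in e
 ... | zero = ⊥-elim (h (+ (n N./ 13)) (trans (cong +_ (trans (m≡m%n+[m/n]*n n 13) (cong (N._+ n N./ 13 N.* 13) e))) (Z.pos-* (n N./ 13) 13)))
 ... | suc ρ = trans (cong (Vp f) (trans (m≡m%n+[m/n]*n n 13) (cong (N._+ n N./ 13 N.* 13) e))) (sect-V ρ (subst (N._< 13) e (m%n<n n 13)) f (n N./ 13))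

 cf-V : ∀ X z -> cf (VL X) (z Z.* + 13) ≡ cf X z
 cf-V (f / d) z = trans (cong (at (Vp f)) (trans (cong (\v -> z Z.* + 13 Z.+ v) (Z.pos-* (d N.* 13) 13)) (sym (Z.*-distribʳ-+ (+ 13) z (val d))))) (at-V f (z Z.+ val d))

 cf-V0 : ∀ X z -> (∀ w -> z ≢ w Z.* + 13) -> cf (VL X) z ≡ Z.0ℤ
 cf-V0 (f / d) z h = at-V0 f (z Z.+ val (d N.* 13)) \w e -> h (w Z.- val d) (trans (lem z (val (d N.* 13))) (trans (cong₂ Z._-_ e (Z.pos-* (d N.* 13) 13)) (lem2 w (val d))))
  where
  lem : ∀ z v -> z ≡ z Z.+ v Z.- v
  lem = arith
  lem2 : ∀ w v -> w Z.* + 13 Z.- v Z.* + 13 ≡ (w Z.- v) Z.* + 13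
  lem2 = arith

 at-sect : ∀ f z -> at (sect 0 f) z ≡ at f (z Z.* + 13)
 at-sect f (+ n)    = cong (at f) (Z.pos-* n 13)
 at-sect f -[1+ n ] = refl

 cf-U : ∀ X z -> cf (UL X) z ≡ cf X (z Z.* + 13)
 cf-U (f / d) z = trans (cong (at (shift (d N.* 12) (sect 0 f))) (trans (cong (\v -> z Z.+ v) (Z.pos-* d 13)) (trans (lem z (+ d)) (cong (\v -> z Z.+ + d Z.+ v) (sym (Z.pos-* d 12))))))
  (trans (at-shift (d N.* 12) (sect 0 f) (z Z.+ + d)) (trans (at-sect f (z Z.+ + d)) (cong (at f) (trans (Z.*-distribʳ-+ (+ 13) z (+ d)) (cong (\v -> z Z.* + 13 Z.+ v) (sym (Z.pos-* d 13)))))))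
  where
  lem : ∀ z d -> z Z.+ d Z.* + 13 ≡ z Z.+ d Z.+ d Z.* + 12
  lem = arith

 residue : ∀ z d n -> z Z.+ val d ≡ + n -> n % 13 ≡ z %ℕ 13
 residue z d n e = go (z /ℕ 13 Z.+ + d) refl
  where
  r = z %ℕ 13
  eq : ∀ w -> w ≡ z /ℕ 13 Z.+ + d -> + n ≡ + r Z.+ w Z.* + 13
  eq w p = trans (sym e) (trans (cong₂ Z._+_ (a≡a%ℕn+[a/ℕn]*n z 13) (Z.pos-* d 13)) (trans (lem (+ r) (z /ℕ 13) (+ d)) (cong (\w -> + r Z.+ w Z.* + 13) (sym p))))
   where
   lem : ∀ r w d -> r Z.+ w Z.* + 13 Z.+ d Z.* + 13 ≡ r Z.+ (w Z.+ d) Z.* + 13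
   lem = arith
  go : ∀ w -> w ≡ z /ℕ 13 Z.+ + d -> n % 13 ≡ r
  go (+ w) p = trans (cong (_% 13) (Z.+-injective (trans (eq (+ w) p) (cong (\v -> + r Z.+ v) (sym (Z.pos-* w 13)))))) (sect-res (n%ℕd<d z 13) w)
  go -[1+ w ] p = ⊥-elim (Z.<⇒≢ (Z.<-≤-trans lt (Z.+≤+ N.z≤n)) (sym (eq -[1+ w ] p)))
   where
   lt : + r Z.+ -[1+ w ] Z.* + 13 Z.< + 0
   lt = Z.<-≤-trans (Z.+-monoˡ-< (-[1+ w ] Z.* + 13) (Z.+<+ (n%ℕd<d z 13)))
      (subst (Z._≤ + 0) (lem (-[1+ w ])) (Z.*-monoʳ-≤-nonNeg (+ 13) {Z.suc -[1+ w ]} {+ 0} (suc≤ w)))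
    where
    lem : ∀ w -> (+ 1 Z.+ w) Z.* + 13 ≡ + 13 Z.+ w Z.* + 13
    lem = arith
    suc≤ : ∀ w -> Z.suc -[1+ w ] Z.≤ + 0
    suc≤ zero    = Z.+≤+ N.z≤n
    suc≤ (suc w) = Z.-≤+

 cf-Π : ∀ r X z -> cf (ΠL r X) z ≡ (if z %ℕ 13 ≡ᵇ r then cf X z else Z.0ℤ)
 cf-Π r (f / d) z with z Z.+ val d in e
 ... | + n = cong (\ρ -> if ρ ≡ᵇ r then f n else Z.0ℤ) (residue z d n e)
 ... | -[1+ n ] with z %ℕ 13 ≡ᵇ r
 ...   | Data.Bool.Base.true  = refl
 ...   | Data.Bool.Base.false = refl

 V-m : ∀ e -> Vp (m e) ≐ m (e N.* 13)
 V-m e = V-mono (e N.* 13)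

 VL-cong : ∀ {X Y} -> X ≃ Y -> VL X ≃ VL Y
 VL-cong {f / d} {g / e} p = P.trans (P.*-congˡ {x = Vp f} (P.sym (V-m e))) (P.trans (P.sym (V-** f (m e)))
  (P.trans (V-cong p) (P.trans (V-** g (m d)) (P.*-congˡ {x = Vp g} (V-m d)))))

 VL-+ : ∀ X Y -> VL (X ⊞ Y) ≃ (VL X ⊞ VL Y)
 VL-+ (f / d) (g / e) = P.*-cong
  (P.trans (V-⊕ (f ** m e) (g ** m d)) (P.+-cong (P.trans (V-** f (m e)) (P.*-congˡ {x = Vp f} (V-m e))) (P.trans (V-** g (m d)) (P.*-congˡ {x = Vp g} (V-m d)))))
  (\n -> cong (\k -> m k n) (sym (N.*-distribʳ-+ 13 d e)))

 VL-* : ∀ X Y -> VL (X ⊠ Y) ≃ (VL X ⊠ VL Y)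
 VL-* (f / d) (g / e) = P.*-cong (V-** f g) (\n -> cong (\k -> m k n) (sym (N.*-distribʳ-+ 13 d e)))

 θL-* : ∀ X Y -> θL (X ⊠ Y) ≃ ((θL X ⊠ Y) ⊞ (X ⊠ θL Y))
 θL-* (f / d) (g / e) = begin
  (θ (f ** g) ⊕ (con (Z.- val (d N.+ e)) ** (f ** g))) ** m ((d N.+ e) N.+ (d N.+ e))
   ≈⟨ *-cong {θ (f ** g) ⊕ (con (Z.- val (d N.+ e)) ** (f ** g))} (+-cong (θ-** f g) (*-congʳ {f ** g} cc)) (m+ (d N.+ e) (d N.+ e)) ⟩
  (((θ f ** g) ⊕ (f ** θ g)) ⊕ ((con (Z.- val d) ⊕ con (Z.- val e)) ** (f ** g))) ** (m (d N.+ e) ** m (d N.+ e))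
   ≈⟨ leibniz-numerator psZ f g (θ f) (θ g) (con (Z.- val d)) (con (Z.- val e)) (m (d N.+ e)) ⟩
  ((((θ f ⊕ (con (Z.- val d) ** f)) ** g) ** m (d N.+ e)) ⊕ ((f ** (θ g ⊕ (con (Z.- val e) ** g))) ** m (d N.+ e))) ** m (d N.+ e) ∎
  where
  open P using (_≈_; begin_; step-≈-⟩; _∎; *-cong; *-congʳ; +-cong)
  cc : con (Z.- val (d N.+ e)) ≐ con (Z.- val d) ⊕ con (Z.- val e)
  cc n = trans (cong (\v -> con v n) (trans (cong Z.-_ (val-+ d e)) (Z.neg-distrib-+ (val d) (val e)))) (con-⊕ (Z.- val d) (Z.- val e) n)

 shift-mono : ∀ k f -> shift k f ≐ f ** mono k
 shift-mono k f n = sym (trans (**-comm f (mono k) n) (mono-** k f n))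

 ULV : ∀ X Y -> UL (X ⊠ VL Y) ≃ (UL X ⊠ Y)
 ULV X Y = cf-ext {UL (X ⊠ VL Y)} {UL X ⊠ Y} \z -> trans (cf-U (X ⊠ VL Y) z) (go X Y z)
  where
  go : ∀ X Y z -> cf (X ⊠ VL Y) (z Z.* + 13) ≡ cf (UL X ⊠ Y) z
  go (f / d) (g / e) z = begin
   at (f ** Vp g) (z Z.* + 13 Z.+ val (d N.+ e N.* 13))
    ≡⟨ cong (at (f ** Vp g)) (trans (cong (\v -> z Z.* + 13 Z.+ v) (Z.pos-* (d N.+ e N.* 13) 13)) (sym (Z.*-distribʳ-+ (+ 13) z (+ (d N.+ e N.* 13))))) ⟩
   at (f ** Vp g) ((z Z.+ + (d N.+ e N.* 13)) Z.* + 13) ≡⟨ sym (at-sect (f ** Vp g) (z Z.+ + (d N.+ e N.* 13))) ⟩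
   at (sect 0 (f ** Vp g)) (z Z.+ + (d N.+ e N.* 13)) ≡⟨ at-cong (sect-**V 0<13 f g) (z Z.+ + (d N.+ e N.* 13)) ⟩
   at (sect 0 f ** g) (z Z.+ + (d N.+ e N.* 13)) ≡⟨ sym (at-shift (d N.* 12) (sect 0 f ** g) (z Z.+ + (d N.+ e N.* 13))) ⟩
   at (shift (d N.* 12) (sect 0 f ** g)) (z Z.+ + (d N.+ e N.* 13) Z.+ + (d N.* 12))
    ≡⟨ at-cong (\n -> sym (shift-** (d N.* 12) (sect 0 f) g n)) (z Z.+ + (d N.+ e N.* 13) Z.+ + (d N.* 12)) ⟩
   at (shift (d N.* 12) (sect 0 f) ** g) (z Z.+ + (d N.+ e N.* 13) Z.+ + (d N.* 12))
    ≡⟨ cong (at (shift (d N.* 12) (sect 0 f) ** g)) (trans (trans (cong₂ (\u v -> z Z.+ (+ d Z.+ u) Z.+ v) (Z.pos-* e 13) (Z.pos-* d 12)) (lem z (+ d) (+ e)))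
      (cong (\v -> z Z.+ v) (sym (trans (Z.pos-* (d N.+ e) 13) refl)))) ⟩
   at (shift (d N.* 12) (sect 0 f) ** g) (z Z.+ val (d N.+ e)) ∎
   where
   open ≡-Reasoning
   lem : ∀ z d e -> z Z.+ (d Z.+ e Z.* + 13) Z.+ d Z.* + 12 ≡ z Z.+ (d Z.+ e) Z.* + 13
   lem = arith

 ΠLV : ∀ r X Y -> ΠL r (X ⊠ VL Y) ≃ (ΠL r X ⊠ VL Y)
 ΠLV r (f / d) (g / e) = P.*-congʳ {x = m (d N.+ e N.* 13)} (pick-**V r f g)

 ΠL0 : ∀ X -> ΠL 0 X ≃ VL (UL X)
 ΠL0 X@(f / d) = P.trans (P.*-congʳ {x = m (d N.* 13)} (pick-V f)) (P.trans (P.*-congˡ {x = Vp (sect 0 f)} (mm d))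
  (P.trans (P.sym (P.*-assoc (Vp (sect 0 f)) (Vp (mono (d N.* 12))) (m d)))
  (P.*-congʳ {x = m d} (P.trans (P.sym (V-** (sect 0 f) (mono (d N.* 12)))) (V-cong (P.sym (shift-mono (d N.* 12) (sect 0 f))))))))
  where
  mm : ∀ d -> m (d N.* 13) ≐ Vp (mono (d N.* 12)) ** m d
  mm d n = trans (trans (cong (\k -> mono k n) (trans (cong (N._* 13) (trans (N.*-suc d 12) (N.+-comm d (d N.* 12)))) (N.*-distribʳ-+ 13 (d N.* 12) d))) (mono-+ (d N.* 12 N.* 13) (d N.* 13) n))
       (P.*-congʳ {x = m d} (P.sym (V-mono (d N.* 12))) n)

 lZ : ZRing
 lZ = record
  { commRing = fracRing ; ι = ιL
  ; ι-+ = \a b n -> trans (**-cong {g = m 0} (con-⊕ a b) (\_ -> refl) n) (**-cong {g = m 0} {m 0} (\k -> cong₂ Z._+_ (sym (one (con a) k)) (sym (one (con b) k))) (\_ -> refl) n)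
  ; ι-* = \a b -> P.*-congʳ {x = m 0} (con-** a b)
  ; ι-- = \a -> P.*-congʳ {x = m 0} (con-⊖ a)
  ; ι-0 = \_ -> refl ; ι-1 = \_ -> refl }
  where
  one : ∀ f -> f ** m 0 ≐ f
  one f = P.*-identityʳ f

 sumR-num : ∀ k (F : ℕ -> PS) d -> sumR lZ k (\ρ -> F ρ / d) ≃ (sum< k F / d)
 sumR-num zero    F d n = trans (**-zeroˡ (m d) n) (sym (**-zeroˡ (m 0) n))
 sumR-num (suc k) F d = cf-ext {sumR lZ (suc k) (\ρ -> F ρ / d)} {sum< (suc k) F / d} \z ->
  trans (cf-⊞ (sumR lZ k (\ρ -> F ρ / d)) (F k / d) z)
  (trans (cong (\v -> v Z.+ at (F k) (z Z.+ val d)) (cf-cong {sumR lZ k (\ρ -> F ρ / d)} {sum< k F / d} (sumR-num k F d) z))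
     (sym (at-⊕ (sum< k F) (F k) (z Z.+ val d))))

 ΠL-* : ∀ s -> s N.< 13 -> ∀ X Y -> ΠL s (X ⊠ Y) ≃ sumR lZ 13 (\ρ -> ΠL (co-class s ρ) X ⊠ ΠL ρ Y)
 ΠL-* s s< (f / d) (g / e) = ZRing.trans lZ {ΠL s ((f / d) ⊠ (g / e))} {sum< 13 (\ρ -> pick (co-class s ρ) f ** pick ρ g) / (d N.+ e)}
  {sumR lZ 13 (\ρ -> ΠL (co-class s ρ) (f / d) ⊠ ΠL ρ (g / e))}
  (P.*-congʳ {x = m (d N.+ e)} (pick-** s s< f g))
  (ZRing.sym lZ {sumR lZ 13 (\ρ -> (pick (co-class s ρ) f ** pick ρ g) / (d N.+ e))} {sum< 13 (\ρ -> pick (co-class s ρ) f ** pick ρ g) / (d N.+ e)}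
   (sumR-num 13 (\ρ -> pick (co-class s ρ) f ** pick ρ g) (d N.+ e)))

 laurent : Laurent
 laurent = record
  { zr = lZ ; co = cf
  ; co-cong = \ {X} {Y} -> cf-cong {X} {Y} ; co-ext = \ {X} {Y} -> cf-ext {X} {Y}
  ; co-+ = cf-⊞ ; co-ι = cf-ι
  ; co-low = \ {X} {Y} -> cf-low {X} {Y} ; co-lead = \ {X} {Y} -> cf-lead {X} {Y}
  ; below = cf-below ; divide = cf-divide ; q = qL ; co-q = cf-q
  ; θ = θL ; V = VL ; U = UL ; Π = ΠL
  ; co-θ = cf-θ ; co-V = cf-V ; co-V0 = cf-V0 ; co-U = cf-U ; co-Π = cf-Π
  ; θ-* = θL-* ; V-cong = \ {X} {Y} -> VL-cong {X} {Y} ; V-+ = VL-+ ; V-* = VL-*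
  ; UV = ULV ; ΠV = ΠLV ; Π0 = ΠL0 ; Π-* = ΠL-*
  ; emb = \f -> f / 0
  ; co-emb = \f z -> cong (at f) (Z.+-identityʳ z)
  ; emb-** = \f g _ -> refl ; emb-con = \c _ -> refl ; emb-V = \f _ -> refl }

-- Calculus of Laurent series: operators, orders, cancellation.

module LL where
 open LInt using (Laurent)
 open LInst using (laurent)

 abstract
  L : Laurent
  L = laurent

module Base where
 open import Data.Nat.Base as N using (ℕ; zero; suc; _≡ᵇ_)
 open import Data.Integer.DivMod using (_%ℕ_; _/ℕ_; a≡a%ℕn+[a/ℕn]*n)
 open import Data.Bool.Base using (true; false; if_then_else_)
 open PS using (PS; _⊕_; _**_; _≐_; +ˡ; *ˡ) renaming (con to conp; θ to θp)
 open Series using (at; V-con; at-cong)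
 open ZSolver
 open LInt
 open LL

 infixr 2 _≡⟪_⟫_
 infix  3 _■

 _≡⟪_⟫_ : ∀ {A : Set} (x : A) {y z : A} -> x ≡ y -> y ≡ z -> x ≡ z
 x ≡⟪ p ⟫ q = tr p q

 _■ : ∀ {A : Set} (x : A) -> x ≡ x
 x ■ = I.refl

 module BaseL where
  open Laurent L public

  pattern ≡refl = I.refl

  sumr : ℕ -> (ℕ -> Carrier) -> Carrier
  sumr = sumR zr

  emb-cong : ∀ {f g} -> f ≐ g -> emb f ≈ emb g
  emb-cong {f} {g} p = co-ext \z -> tr (co-emb f z) (tr (at-cong p z) (sy (co-emb g z)))

  at-⊕ : ∀ f g z -> at (f ⊕ g) z ≡ at f z Z.+ at g z
  at-⊕ f g (+ n)    = ≡refl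
  at-⊕ f g -[1+ n ] = ≡refl

  emb-⊕ : ∀ f g -> emb (f ⊕ g) ≈ emb f + emb g
  emb-⊕ f g = co-ext \z -> tr (co-emb (f ⊕ g) z) (tr (at-⊕ f g z)
   (tr (cong₂ Z._+_ (sy (co-emb f z)) (sy (co-emb g z))) (sy (co-+ (emb f) (emb g) z))))

  emb-θ : ∀ f -> emb (θp f) ≈ θ (emb f)
  emb-θ f = co-ext \z -> tr (co-emb (θp f) z) (tr (lem z) (tr (*ˡ z (sy (co-emb f z))) (sy (co-θ (emb f) z))))
   where
   lem : ∀ z -> at (θp f) z ≡ z Z.* at f z
   lem (+ n)    = ≡refl
   lem -[1+ n ] = sy (Z.*-zeroʳ -[1+ n ])

  V-ι : ∀ c -> V (ι c) ≈ ι c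
  V-ι c = trans (V-cong (sym (emb-con c))) (trans (sym (emb-V (conp c))) (trans (emb-cong (V-con c)) (emb-con c)))

  co-ιz : ∀ c z -> co (ι c) z ≡ at (conp c) z
  co-ιz c z = tr (co-cong (sym (emb-con c)) z) (co-emb (conp c) z)

  co-0 : ∀ z -> co 0# z ≡ + 0
  co-0 z = tr (co-cong (sym ι-0) z) (tr (co-ιz (+ 0) z) (lem z))
   where
   lem : ∀ z -> at (conp (+ 0)) z ≡ + 0
   lem (+ zero)  = ≡refl
   lem (+ suc n) = ≡refl
   lem -[1+ n ]  = ≡refl

  co-neg : ∀ X z -> co (- X) z ≡ Z.- co X z
  co-neg X z = tr (co-cong (solve 1 (\x -> :- x := con (Z.- (+ 1)) :* x) refl X) z) (tr (co-ι (Z.- (+ 1)) X z) (lem (co X z)))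
   where
   lem : ∀ a -> (Z.- (+ 1)) Z.* a ≡ Z.- a
   lem = arith

  co-sub : ∀ X Y z -> co (X - Y) z ≡ co X z Z.- co Y z
  co-sub X Y z = tr (co-+ X (- Y) z) (+ˡ (co X z) (co-neg Y z))

  θ-cong : ∀ {X Y} -> X ≈ Y -> θ X ≈ θ Y
  θ-cong {X} {Y} p = co-ext \z -> tr (co-θ X z) (tr (*ˡ z (co-cong p z)) (sy (co-θ Y z)))

  θ-+ : ∀ X Y -> θ (X + Y) ≈ θ X + θ Y
  θ-+ X Y = co-ext \z -> tr (co-θ (X + Y) z) (tr (*ˡ z (co-+ X Y z)) (tr (Z.*-distribˡ-+ z (co X z) (co Y z))
   (tr (cong₂ Z._+_ (sy (co-θ X z)) (sy (co-θ Y z))) (sy (co-+ (θ X) (θ Y) z)))))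

  θ-ι : ∀ c -> θ (ι c) ≈ ι (+ 0)
  θ-ι c = co-ext \z -> tr (co-θ (ι c) z) (tr (*ˡ z (co-ιz c z)) (tr (lem z) (sy (tr (co-cong ι-0 z) (co-0 z)))))
   where
   lem : ∀ z -> z Z.* at (conp c) z ≡ + 0
   lem (+ zero)  = ≡refl
   lem (+ suc n) = Z.*-zeroʳ (+ suc n)
   lem -[1+ n ]  = Z.*-zeroʳ -[1+ n ]

  θ-ι* : ∀ c X -> θ (ι c * X) ≈ ι c * θ X
  θ-ι* c X = trans (θ-* (ι c) X) (trans (+-congʳ (*-congʳ (θ-ι c))) (solve 3 (\c x t -> :0 :* x :+ c :* t := c :* t) refl (ι c) X (θ X)))

  θ-neg : ∀ X -> θ (- X) ≈ - θ X
  θ-neg X = trans (θ-cong (solve 1 (\x -> :- x := con (Z.- (+ 1)) :* x) refl X)) (trans (θ-ι* (Z.- (+ 1)) X) (solve 1 (\x -> con (Z.- (+ 1)) :* x := :- x) refl (θ X)))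

  U-cong : ∀ {X Y} -> X ≈ Y -> U X ≈ U Y
  U-cong {X} {Y} p = co-ext \z -> tr (co-U X z) (tr (co-cong p _) (sy (co-U Y z)))

  U-+ : ∀ X Y -> U (X + Y) ≈ U X + U Y
  U-+ X Y = co-ext \z -> tr (co-U (X + Y) z) (tr (co-+ X Y _) (tr (cong₂ Z._+_ (sy (co-U X z)) (sy (co-U Y z))) (sy (co-+ (U X) (U Y) z))))

  U-ι : ∀ c X -> U (ι c * X) ≈ ι c * U X
  U-ι c X = co-ext \z -> tr (co-U (ι c * X) z) (tr (co-ι c X _) (tr (*ˡ c (sy (co-U X z))) (sy (co-ι c (U X) z))))

  Π-cong : ∀ r {X Y} -> X ≈ Y -> Π r X ≈ Π r Y
  Π-cong r {X} {Y} p = co-ext \z -> tr (co-Π r X z) (tr (cong (\w -> if z %ℕ 13 ≡ᵇ r then w else Z.0ℤ) (co-cong p z)) (sy (co-Π r Y z)))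

  Π-+ : ∀ r X Y -> Π r (X + Y) ≈ Π r X + Π r Y
  Π-+ r X Y = co-ext \z -> tr (co-Π r (X + Y) z) (tr (lem z (z %ℕ 13 ≡ᵇ r) (co-+ X Y z))
   (tr (cong₂ Z._+_ (sy (co-Π r X z)) (sy (co-Π r Y z))) (sy (co-+ (Π r X) (Π r Y) z))))
   where
   lem : ∀ z b {a c d} -> a ≡ c Z.+ d -> (if b then a else Z.0ℤ) ≡ (if b then c else Z.0ℤ) Z.+ (if b then d else Z.0ℤ)
   lem z true  p = p
   lem z false p = ≡refl

  Π-ι : ∀ r c X -> Π r (ι c * X) ≈ ι c * Π r X
  Π-ι r c X = co-ext \z -> tr (co-Π r (ι c * X) z) (tr (lem (z %ℕ 13 ≡ᵇ r) (co-ι c X z))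
   (tr (*ˡ c (sy (co-Π r X z))) (sy (co-ι c (Π r X) z))))
   where
   lem : ∀ b {a d} -> a ≡ c Z.* d -> (if b then a else Z.0ℤ) ≡ c Z.* (if b then d else Z.0ℤ)
   lem true  p = p
   lem false p = sy (Z.*-zeroʳ c)

  Π-θ : ∀ r X -> Π r (θ X) ≈ θ (Π r X)
  Π-θ r X = co-ext \z -> tr (co-Π r (θ X) z) (tr (lem z (z %ℕ 13 ≡ᵇ r) (co-θ X z))
   (tr (*ˡ z (sy (co-Π r X z))) (sy (co-θ (Π r X) z))))
   where
   lem : ∀ z b {a d} -> a ≡ z Z.* d -> (if b then a else Z.0ℤ) ≡ z Z.* (if b then d else Z.0ℤ)
   lem z true  p = p
   lem z false p = sy (Z.*-zeroʳ z)

  V-ι* : ∀ c X -> V (ι c * X) ≈ ι c * V X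
  V-ι* c X = trans (V-* (ι c) X) (*-congʳ (V-ι c))

  V-neg : ∀ X -> V (- X) ≈ - V X
  V-neg X = trans (V-cong (solve 1 (\x -> :- x := con (Z.- (+ 1)) :* x) refl X)) (trans (V-ι* (Z.- (+ 1)) X) (solve 1 (\x -> con (Z.- (+ 1)) :* x := :- x) refl (V X)))

  multiple? : ∀ z -> (∃ \w -> z ≡ w Z.* + 13) ⊎ (∀ w -> z ≢ w Z.* + 13)
  multiple? z with z %ℕ 13 N.≟ 0
  ... | yes e = inj₁ (z /ℕ 13 , tr (a≡a%ℕn+[a/ℕn]*n z 13) (tr (cong (\r -> + r Z.+ z /ℕ 13 Z.* + 13) e) (Z.+-identityˡ _)))
  ... | no ne = inj₂ \ { w ≡refl -> ne (div w) }
   where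
   open import Data.Integer.DivMod using (n%ℕd<d)
   open import Data.Nat.DivMod using (m*n%n≡0)
   div : ∀ w -> (w Z.* + 13) %ℕ 13 ≡ 0
   div w with (w Z.* + 13) %ℕ 13 in e | a≡a%ℕn+[a/ℕn]*n (w Z.* + 13) 13 | n%ℕd<d (w Z.* + 13) 13
   ... | zero  | _ | _ = ≡refl
   ... | suc r | p | r< = ⊥-elim (small r r< ((w Z.- (w Z.* + 13) /ℕ 13)) (tr (lem (+ suc r) w ((w Z.* + 13) /ℕ 13)) (tr (cong (\v -> v Z.+ (Z.- ((w Z.* + 13) /ℕ 13) Z.* + 13)) (sy p)) (lem2 w ((w Z.* + 13) /ℕ 13)))))
    where
    lem : ∀ r w k -> r ≡ r Z.+ k Z.* + 13 Z.+ (Z.- k Z.* + 13)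
    lem = arith
    lem2 : ∀ w k -> w Z.* + 13 Z.+ (Z.- k Z.* + 13) ≡ (w Z.- k) Z.* + 13
    lem2 = arith
    small : ∀ r -> suc r N.< 13 -> ∀ k -> + suc r ≢ k Z.* + 13
    small r r< (+ zero) ()
    small r r< (+ suc k) e = N.<-irrefl (Z.+-injective (tr e (sy (Z.pos-* (suc k) 13)))) (N.<-≤-trans r< (N.m≤m+n 13 (k N.* 13)))
    small r r< -[1+ k ] ()

  V-ext : ∀ X Y -> (∀ w -> co Y (w Z.* + 13) ≡ co X w) -> (∀ z -> (∀ w -> z ≢ w Z.* + 13) -> co Y z ≡ + 0) -> V X ≈ Y
  V-ext X Y p r = co-ext go
   where
   go : ∀ z -> co (V X) z ≡ co Y z
   go z with multiple? z
   ... | inj₁ (w , ≡refl) = tr (co-V X w) (sy (p w))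
   ... | inj₂ h           = tr (co-V0 X z h) (sy (r z h))

  -- The chain rule for q ↦ q¹³. This factor is one source of the powers of 13 in `R7`.
  θV : ∀ X -> θ (V X) ≈ ι (+ 13) * V (θ X)
  θV X = sym (trans (sym (V-ι* (+ 13) (θ X))) (V-ext (ι (+ 13) * θ X) (θ (V X))
   (\w -> tr (co-θ (V X) _) (tr (*ˡ (w Z.* + 13) (co-V X w)) (tr (lem w (co X w)) (tr (*ˡ (+ 13) (sy (co-θ X w))) (sy (co-ι (+ 13) (θ X) w))))))
   (\z h -> tr (co-θ (V X) z) (tr (*ˡ z (co-V0 X z h)) (Z.*-zeroʳ z)))))
   where
   lem : ∀ w a -> w Z.* + 13 Z.* a ≡ + 13 Z.* (w Z.* a)
   lem = arith

  ct : Carrier -> ℤ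
  ct X = co X (+ 0)

  ct-θ : ∀ X -> ct (θ X) ≡ + 0
  ct-θ X = co-θ X (+ 0)

  ct-U : ∀ X -> ct (U X) ≡ ct X
  ct-U X = co-U X (+ 0)

  ct-V : ∀ X -> ct (V X) ≡ ct X
  ct-V X = co-V X (+ 0)

  q-co : ∀ k z -> co (q k) z ≡ at (conp (+ 1)) (z Z.- k)
  q-co k z = tr (co-cong (trans (sym (*-identityʳ (q k))) (*-congˡ (sym ι-1))) z) (tr (co-q k (ι (+ 1)) z) (co-ιz (+ 1) (z Z.- k)))

  q-0 : q (+ 0) ≈ ι (+ 1)
  q-0 = co-ext \z -> tr (q-co (+ 0) z) (tr (cong (at (conp (+ 1))) (Z.+-identityʳ z)) (sy (co-ιz (+ 1) z)))

  q-+ : ∀ a b -> q (a Z.+ b) ≈ q a * q b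
  q-+ a b = co-ext \z -> tr (q-co (a Z.+ b) z) (sy (tr (co-q a (q b) z) (tr (q-co b (z Z.- a)) (cong (at (conp (+ 1))) (lem z a b)))))
   where
   lem : ∀ z a b -> z Z.- a Z.- b ≡ z Z.- (a Z.+ b)
   lem = arith

  q-inv : ∀ k -> q k * q (Z.- k) ≈ ι (+ 1)
  q-inv k = trans (sym (q-+ k (Z.- k))) (trans (reflexive (cong q (Z.+-inverseʳ k))) q-0)

  θ-q : ∀ k -> θ (q k) ≈ ι k * q k
  θ-q k = co-ext \z -> tr (co-θ (q k) z) (tr (*ˡ z (q-co k z)) (tr (lem z (z Z.- k) (l1 z k)) (tr (*ˡ k (sy (q-co k z))) (sy (co-ι k (q k) z)))))
   where
   l1 : ∀ z k -> z ≡ (z Z.- k) Z.+ k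
   l1 = arith
   lem : ∀ z w -> z ≡ w Z.+ k -> z Z.* at (conp (+ 1)) w ≡ k Z.* at (conp (+ 1)) w
   lem z (+ zero)  e = cong (Z._* + 1) (tr e (Z.+-identityˡ k))
   lem z (+ suc n) e = tr (Z.*-zeroʳ z) (sy (Z.*-zeroʳ k))
   lem z -[1+ n ]  e = tr (Z.*-zeroʳ z) (sy (Z.*-zeroʳ k))

  V-q : ∀ k -> V (q k) ≈ q (k Z.* + 13)
  V-q k = V-ext (q k) (q (k Z.* + 13))
   (\w -> tr (q-co (k Z.* + 13) _) (tr (cong (at (conp (+ 1))) (lem w k)) (tr (mul (w Z.- k)) (sy (q-co k w)))))
   (\z h -> tr (q-co (k Z.* + 13) z) (off (z Z.- k Z.* + 13) (\e -> h k (tr (l1 z (k Z.* + 13)) (tr (cong (Z._+ k Z.* + 13) e) (Z.+-identityˡ _))))))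
   where
   l1 : ∀ z k -> z ≡ (z Z.- k) Z.+ k
   l1 = arith
   lem : ∀ w k -> w Z.* + 13 Z.- k Z.* + 13 ≡ (w Z.- k) Z.* + 13
   lem = arith
   mul : ∀ w -> at (conp (+ 1)) (w Z.* + 13) ≡ at (conp (+ 1)) w
   mul (+ zero)  = ≡refl
   mul (+ suc n) = ≡refl
   mul -[1+ n ]  = ≡refl
   off : ∀ w -> w ≢ + 0 -> at (conp (+ 1)) w ≡ + 0
   off (+ zero)  ne = ⊥-elim (ne ≡refl)
   off (+ suc n) ne = ≡refl
   off -[1+ n ]  ne = ≡refl

  Low-cong : ∀ {X Y a} -> X ≈ Y -> Low X a -> Low Y a
  Low-cong p l z z< = tr (sy (co-cong p z)) (l z z<)

  Low-weaken : ∀ {X a b} -> b Z.≤ a -> Low X a -> Low X b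
  Low-weaken b≤ l z z< = l z (Z.<-≤-trans z< b≤)

  Low-+ : ∀ {X Y a} -> Low X a -> Low Y a -> Low (X + Y) a
  Low-+ {X} {Y} l m z z< = tr (co-+ X Y z) (cong₂ Z._+_ (l z z<) (m z z<))

  Low-ι : ∀ c {X a} -> Low X a -> Low (ι c * X) a
  Low-ι c {X} l z z< = tr (co-ι c X z) (tr (*ˡ c (l z z<)) (Z.*-zeroʳ c))

  Low-neg : ∀ {X a} -> Low X a -> Low (- X) a
  Low-neg {X} l z z< = tr (co-neg X z) (cong Z.-_ (l z z<))

  Low-θ : ∀ {X a} -> Low X a -> Low (θ X) a
  Low-θ {X} l z z< = tr (co-θ X z) (tr (*ˡ z (l z z<)) (Z.*-zeroʳ z))

  -- The common step of all arguments by order below: once the coefficient at the current bound is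
  -- shown to vanish, the bound moves up by one.
  Low-step : ∀ {X a} -> Low X a -> co X a ≡ + 0 -> Low X (Z.suc a)
  Low-step {X} {a} l e z z< with z Z.≟ a
  ... | yes ≡refl = e
  ... | no ne = l z (Z.≤∧≢⇒< (subst (Z._≤ a) (Z.pred-suc z) (subst (Z.pred (Z.suc z) Z.≤_) (Z.pred-suc a) (Z.pred-mono (Z.i<j⇒suc[i]≤j z<)))) ne)

  Low-emb : ∀ f -> Low (emb f) (+ 0)
  Low-emb f (+ n) (Z.+<+ ())
  Low-emb f -[1+ n ] _ = co-emb f -[1+ n ]

  Low-all : ∀ X -> (∀ n -> Low X (+ n)) -> X ≈ ι (+ 0)
  Low-all X h = co-ext \z -> tr (go z) (sy (tr (co-cong ι-0 z) (co-0 z)))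
   where
   go : ∀ z -> co X z ≡ + 0
   go (+ n)    = h (suc n) (+ n) (Z.+<+ (N.n<1+n n))
   go -[1+ n ] = h 0 -[1+ n ] Z.-<+

  -- Every series is bounded below, and from that bound the order can be raised without end.
  order-ind : ∀ X -> (∀ a -> Low X a -> co X a ≡ + 0) -> X ≈ ι (+ 0)
  order-ind X h = Low-all X \n -> Low-weaken (le n) (go (proj₁ (below X) N.+ n))
   where
   d = proj₁ (below X)
   go : ∀ n -> Low X (+ n Z.- + d)
   go zero    = subst (Low X) (sy (Z.+-identityˡ (Z.- + d))) (proj₂ (below X))
   go (suc n) = subst (Low X) (sy (Z.+-assoc (+ 1) (+ n) (Z.- + d))) (Low-step (go n) (h _ (go n)))
   le : ∀ n -> + n Z.≤ + (d N.+ n) Z.- + d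
   le n = Z.≤-reflexive (lem (+ d) (+ n))
    where
    lem : ∀ d n -> n ≡ d Z.+ n Z.- d
    lem = arith

  -- A nonzero lowest coefficient. Since ℤ has no zero divisors, multiplication by such a series is
  -- injective even when the series is not invertible over ℤ.
  Unitlike : Carrier -> Set
  Unitlike X = ∃ \a -> Low X a × co X a ≢ + 0

  cancel0 : ∀ {X Y} -> Unitlike X -> X * Y ≈ ι (+ 0) -> Y ≈ ι (+ 0)
  cancel0 {X} {Y} (a , l , ne) e = order-ind Y \b m -> zero-factor (co X a) (co Y b) ne
   (tr (sy (co-lead l m)) (tr (co-cong e (a Z.+ b)) (tr (co-cong ι-0 (a Z.+ b)) (co-0 _))))
   where
   zero-factor : ∀ x y -> x ≢ + 0 -> x Z.* y ≡ + 0 -> y ≡ + 0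
   zero-factor x y ne e with Z.i*j≡0⇒i≡0∨j≡0 x e
   ... | inj₁ x0 = ⊥-elim (ne x0)
   ... | inj₂ y0 = y0

  sub-0 : ∀ {X Y} -> X - Y ≈ ι (+ 0) -> X ≈ Y
  sub-0 {X} {Y} e = begin
   X           ≈⟨ solve 2 (\x y -> x := (x :- y) :+ y) refl X Y ⟩
   (X - Y) + Y ≈⟨ +-congʳ e ⟩
   ι (+ 0) + Y ≈⟨ solve 1 (\y -> :0 :+ y := y) refl Y ⟩
   Y ∎

  0-sub : ∀ {X Y} -> X ≈ Y -> X - Y ≈ ι (+ 0)
  0-sub {X} {Y} e = trans (+-congʳ e) (solve 1 (\y -> y :- y := :0) refl Y)

  cancel : ∀ {X Y Z} -> Unitlike X -> X * Y ≈ X * Z -> Y ≈ Z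
  cancel {X} {Y} {Z} u e = sub-0 (cancel0 u (trans (solve 3 (\x y z -> x :* (y :- z) := x :* y :- x :* z) refl X Y Z) (0-sub e)))

  ι-Unitlike : ∀ c -> c ≢ + 0 -> Unitlike (ι c)
  ι-Unitlike c ne = + 0 , (\ { (+ n) (Z.+<+ ()) ; -[1+ n ] _ -> co-ιz c -[1+ n ] }) , \e -> ne (tr (sy (co-ιz c (+ 0))) e)

  Unitlike-* : ∀ {X Y} -> Unitlike X -> Unitlike Y -> Unitlike (X * Y)
  Unitlike-* {X} {Y} (a , l , ne) (b , m , neʹ) = a Z.+ b , co-low l m , \e -> [ ne , neʹ ] (Z.i*j≡0⇒i≡0∨j≡0 (co X a) (tr (sy (co-lead l m)) e))
   where
   [_,_] : ∀ {A B C : Set} -> (A -> C) -> (B -> C) -> A ⊎ B -> C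
   [ f , g ] (inj₁ a) = f a
   [ f , g ] (inj₂ b) = g b

  infixr 8 _^_
  _^_ : Carrier -> ℕ -> Carrier
  X ^ zero  = ι (+ 1)
  X ^ suc n = X * X ^ n

  ^-cong : ∀ n {X Y} -> X ≈ Y -> X ^ n ≈ Y ^ n
  ^-cong zero    e = refl
  ^-cong (suc n) e = *-cong e (^-cong n e)

  ^-+ : ∀ X m n -> X ^ (m N.+ n) ≈ X ^ m * X ^ n
  ^-+ X zero    n = solve 1 (\x -> x := :1 :* x) refl (X ^ n)
  ^-+ X (suc m) n = trans (*-congˡ (^-+ X m n)) (sym (*-assoc X (X ^ m) (X ^ n)))

  V-^ : ∀ X n -> V (X ^ n) ≈ V X ^ n
  V-^ X zero    = V-ι (+ 1)
  V-^ X (suc n) = trans (V-* X (X ^ n)) (*-congˡ (V-^ X n))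

  Unitlike-^ : ∀ {X} n -> Unitlike X -> Unitlike (X ^ n)
  Unitlike-^ zero    u = ι-Unitlike (+ 1) (\())
  Unitlike-^ (suc n) u = Unitlike-* u (Unitlike-^ n u)

  θ-^ : ∀ X n -> θ (X ^ suc n) ≈ ι (+ suc n) * (X ^ n * θ X)
  θ-^ X zero = trans (θ-* X (ι (+ 1))) (trans (+-congˡ (*-congˡ (θ-ι (+ 1)))) (solve 2 (\x t -> t :* :1 :+ x :* :0 := :1 :* (:1 :* t)) refl X (θ X)))
  θ-^ X (suc n) = begin
   θ (X * X ^ suc n)                                       ≈⟨ θ-* X (X ^ suc n) ⟩
   θ X * X ^ suc n + X * θ (X ^ suc n)                     ≈⟨ +-congˡ (*-congˡ (θ-^ X n)) ⟩
   θ X * X ^ suc n + X * (ι (+ suc n) * (X ^ n * θ X))     ≈⟨ solve 4 (\x t y n -> t :* (x :* y) :+ x :* (n :* (y :* t)) := (:1 :+ n) :* (x :* y :* t)) refl X (θ X) (X ^ n) (ι (+ suc n)) ⟩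
   (ι (+ 1) + ι (+ suc n)) * (X ^ suc n * θ X)             ≈⟨ *-congʳ (sym (ι-+ (+ 1) (+ suc n))) ⟩
   ι (+ suc (suc n)) * (X ^ suc n * θ X) ∎

-- Finite sums and Liouville's elementary method.

module Sums where
 open import Data.Nat.Base as N using (ℕ; zero; suc; _∸_)
 open import Relation.Binary.PropositionalEquality
 open import Function.Base using (_∘_)
 open PS using (+ˡ; *ˡ)

 Σ< : ℕ -> (ℕ -> ℤ) -> ℤ
 Σ< zero    F = Z.0ℤ
 Σ< (suc N) F = Σ< N F Z.+ F N

 Σ-cong : ∀ N {F G} -> (∀ i -> i N.< N -> F i ≡ G i) -> Σ< N F ≡ Σ< N G
 Σ-cong zero    h = refl
 Σ-cong (suc N) h = cong₂ Z._+_ (Σ-cong N \i i< -> h i (N.m≤n⇒m≤1+n i<)) (h N N.≤-refl)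

 Σ-+ : ∀ N F G -> Σ< N (\i -> F i Z.+ G i) ≡ Σ< N F Z.+ Σ< N G
 Σ-+ zero    F G = refl
 Σ-+ (suc N) F G = trans (cong (\z -> z Z.+ (F N Z.+ G N)) (Σ-+ N F G)) (lem (Σ< N F) (Σ< N G) (F N) (G N))
  where
  lem : ∀ a b c d -> a Z.+ b Z.+ (c Z.+ d) ≡ a Z.+ c Z.+ (b Z.+ d)
  lem = arith

 Σ-* : ∀ N c F -> Σ< N (\i -> c Z.* F i) ≡ c Z.* Σ< N F
 Σ-* zero    c F = sym (Z.*-zeroʳ c)
 Σ-* (suc N) c F = trans (cong (\z -> z Z.+ c Z.* F N) (Σ-* N c F)) (sym (Z.*-distribˡ-+ c (Σ< N F) (F N)))

 Σ-trunc : ∀ M N F -> M N.≤ N -> (∀ i -> M N.≤ i -> i N.< N -> F i ≡ Z.0ℤ) -> Σ< M F ≡ Σ< N F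
 Σ-trunc M zero F M≤N h with N.n≤0⇒n≡0 M≤N
 ... | refl = refl
 Σ-trunc M (suc N) F M≤N h with N.m≤n⇒m<n∨m≡n M≤N
 ... | inj₂ refl = refl
 ... | inj₁ (N.s≤s M≤) = trans (Σ-trunc M N F M≤ \i M≤i i< -> h i M≤i (N.m≤n⇒m≤1+n i<))
  (sym (trans (+ˡ (Σ< N F) (h N M≤ N.≤-refl)) (Z.+-identityʳ _)))

 Σ-first : ∀ N F -> Σ< (suc N) F ≡ F 0 Z.+ Σ< N (F ∘ suc)
 Σ-first zero    F = Z.+-comm Z.0ℤ (F 0)
 Σ-first (suc N) F = trans (cong (Z._+ F (suc N)) (Σ-first N F)) (Z.+-assoc (F 0) (Σ< N (F ∘ suc)) (F (suc N)))

 Σ-reverse : ∀ N F -> Σ< N F ≡ Σ< N (\k -> F (N ∸ suc k))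
 Σ-reverse zero    F = refl
 Σ-reverse (suc N) F = trans (Z.+-comm (Σ< N F) (F N)) (trans (+ˡ (F N) (Σ-reverse N F))
  (sym (Σ-first N (\k -> F (N ∸ k)))))

 Σ-square : ∀ N (H : ℕ -> ℕ -> ℤ) -> Σ< N (\i -> Σ< N (\j -> H i j)) ≡
      Σ< N (\i -> Σ< i (\k -> H k i Z.+ H i k) Z.+ H i i)
 Σ-square zero    H = refl
 Σ-square (suc N) H = begin
  Σ< N (\i -> Σ< N (H i) Z.+ H i N) Z.+ (Σ< N (H N) Z.+ H N N)
   ≡⟨ cong (Z._+ (Σ< N (H N) Z.+ H N N)) (trans (Σ-+ N (\i -> Σ< N (H i)) (\i -> H i N)) (cong (Z._+ Σ< N (\i -> H i N)) (Σ-square N H))) ⟩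
  s Z.+ Σ< N (\i -> H i N) Z.+ (Σ< N (H N) Z.+ H N N)
   ≡⟨ lem s (Σ< N (\i -> H i N)) (Σ< N (H N)) (H N N) ⟩
  s Z.+ (Σ< N (\i -> H i N) Z.+ Σ< N (H N) Z.+ H N N)
   ≡⟨ +ˡ s (cong (Z._+ H N N) (sym (Σ-+ N (\i -> H i N) (H N)))) ⟩
  s Z.+ (Σ< N (\k -> H k N Z.+ H N k) Z.+ H N N) ∎
  where
  open ≡-Reasoning
  s = Σ< N (\i -> Σ< i (\k -> H k i Z.+ H i k) Z.+ H i i)
  lem : ∀ s a b c -> s Z.+ a Z.+ (b Z.+ c) ≡ s Z.+ (a Z.+ b Z.+ c)
  lem = arith

 Σ-triangle : ∀ N (H : ℕ -> ℕ -> ℤ) -> Σ< N (\i -> Σ< i (\k -> H (suc k) (i ∸ k))) ≡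
       Σ< N (\k -> Σ< (N ∸ suc k) (\j -> H (suc k) (suc j)))
 Σ-triangle zero    H = refl
 Σ-triangle (suc N) H = begin
  Σ< N (\i -> Σ< i (\k -> H (suc k) (i ∸ k))) Z.+ Σ< N (\k -> H (suc k) (N ∸ k))
   ≡⟨ cong (Z._+ Σ< N (\k -> H (suc k) (N ∸ k))) (Σ-triangle N H) ⟩
  Σ< N (\k -> Σ< (N ∸ suc k) (\j -> H (suc k) (suc j))) Z.+ Σ< N (\k -> H (suc k) (N ∸ k))
   ≡⟨ sym (Σ-+ N (\k -> Σ< (N ∸ suc k) (\j -> H (suc k) (suc j))) (\k -> H (suc k) (N ∸ k))) ⟩
  Σ< N (\k -> Σ< (N ∸ suc k) (\j -> H (suc k) (suc j)) Z.+ H (suc k) (N ∸ k))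
   ≡⟨ Σ-cong N (\k k< -> trans (+ˡ (Σ< (N ∸ suc k) (\j -> H (suc k) (suc j))) (cong (H (suc k)) (sym (step k<)))) (cong (\M -> Σ< M (\j -> H (suc k) (suc j))) (step k<))) ⟩
  Σ< N (\k -> Σ< (N ∸ k) (\j -> H (suc k) (suc j)))
   ≡⟨ sym (trans (cong (\M -> Σ< N (\k -> Σ< (N ∸ k) (\j -> H (suc k) (suc j))) Z.+ Σ< M (\j -> H (suc N) (suc j))) (N.n∸n≡0 N)) (Z.+-identityʳ _)) ⟩
  Σ< N (\k -> Σ< (N ∸ k) (\j -> H (suc k) (suc j))) Z.+ Σ< (N ∸ N) (\j -> H (suc N) (suc j)) ∎
  where
  open ≡-Reasoning
  step : ∀ {k} -> k N.< N -> suc (N ∸ suc k) ≡ N ∸ k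
  step {k} k< = sym (N.+-∸-assoc 1 k<)

 -- The vanishing for a + b > N cuts the square down to a triangle, which is then summed along the
 -- antidiagonals a + b = i + 1.
 Σ-square-triangle : ∀ N (H : ℕ -> ℕ -> ℤ) -> (∀ a b -> N N.< a N.+ b -> H a b ≡ Z.0ℤ) ->
  Σ< N (\i -> Σ< N (\j -> H (suc i) (suc j))) ≡ Σ< N (\i -> Σ< i (\k -> H (suc k) (i ∸ k)))
 Σ-square-triangle N H h = sym (trans (Σ-triangle N H) (Σ-cong N \k k< ->
  Σ-trunc (N ∸ suc k) N (\j -> H (suc k) (suc j)) (N.m∸n≤m N (suc k)) \j M≤j _ -> h (suc k) (suc j)
   (subst (N._< suc k N.+ suc j) (N.m+[n∸m]≡n k<) (N.+-monoʳ-< (suc k) (N.s≤s M≤j)))))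

 -- Liouville's method: G plays the role of the coefficients of u_a u_b with u_a = q^a/(1 - q^a).
 module Liouville (n : ℕ) (G : ℕ -> ℕ -> ℤ) (u : ℕ -> ℤ)
  (G-sym : ∀ a b -> G a b ≡ G b a) (G-low : ∀ a b -> n N.< a N.+ b -> G a b ≡ Z.0ℤ)
  (G-rel : ∀ a b -> G (suc a) (suc b) ≡ G (suc a) (suc a N.+ suc b) Z.+ G (suc b) (suc a N.+ suc b) Z.+ u (suc a N.+ suc b))
  (f g : ℤ -> ℤ -> ℤ) (fg : ∀ x y -> g x (x Z.+ y) Z.+ g (x Z.+ y) x ≡ f x y Z.+ f y x) where

  sq : (ℤ -> ℤ -> ℤ) -> ℤ
  sq h = Σ< n (\i -> Σ< n (\j -> h (+ suc i) (+ suc j) Z.* G (suc i) (suc j)))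

  φ : ℕ -> ℤ
  φ i = Σ< i (\k -> f (+ suc k) (+ suc i Z.- + suc k))

  sq-g : sq g ≡ Σ< n (\i -> Σ< i (\k -> (g (+ suc k) (+ suc i) Z.+ g (+ suc i) (+ suc k)) Z.* G (suc k) (suc i)) Z.+ g (+ suc i) (+ suc i) Z.* G (suc i) (suc i))
  sq-g = trans (Σ-square n (\i j -> g (+ suc i) (+ suc j) Z.* G (suc i) (suc j))) (Σ-cong n \i _ -> cong (Z._+ g (+ suc i) (+ suc i) Z.* G (suc i) (suc i))
   (Σ-cong i \k _ -> trans (+ˡ (g (+ suc k) (+ suc i) Z.* G (suc k) (suc i)) (*ˡ (g (+ suc i) (+ suc k)) (G-sym (suc i) (suc k))))
    (sym (Z.*-distribʳ-+ (G (suc k) (suc i)) (g (+ suc k) (+ suc i)) (g (+ suc i) (+ suc k))))))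

  diff : ∀ {i k} -> k N.< i -> + (i ∸ k) ≡ + suc i Z.- + suc k
  diff {i} {k} k< = trans (sym (Z.⊖-≥ (N.<⇒≤ k<))) (trans (sym (Z.[1+m]⊖[1+n]≡m⊖n i k)) refl)

  -- `G-rel` is the partial fraction identity u_a u_b = (u_a + u_b + 1) u_c with c = a + b; it
  -- replaces G(a, b) by terms that involve c. Reversing the summation in the term with b and
  -- applying `fg` turns values of f into values of g.
  sq-f : sq f ≡ Σ< n (\i -> Σ< i (\k -> (g (+ suc k) (+ suc i) Z.+ g (+ suc i) (+ suc k)) Z.* G (suc k) (suc i)) Z.+ φ i Z.* u (suc i))
  sq-f = trans (Σ-square-triangle n (\a b -> f (+ a) (+ b) Z.* G a b) (\a b lt -> trans (*ˡ (f (+ a) (+ b)) (G-low a b lt)) (Z.*-zeroʳ (f (+ a) (+ b)))))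
   (Σ-cong n \i _ -> row i)
   where
   open ≡-Reasoning
   row : ∀ i -> Σ< i (\k -> f (+ suc k) (+ (i ∸ k)) Z.* G (suc k) (i ∸ k)) ≡
         Σ< i (\k -> (g (+ suc k) (+ suc i) Z.+ g (+ suc i) (+ suc k)) Z.* G (suc k) (suc i)) Z.+ φ i Z.* u (suc i)
   row i = begin
    Σ< i (\k -> f (+ suc k) (+ (i ∸ k)) Z.* G (suc k) (i ∸ k))
     ≡⟨ Σ-cong i (\k k< -> trans (*ˡ (f (+ suc k) (+ (i ∸ k))) (rel k<)) (lem (f (+ suc k) (+ (i ∸ k))) (G (suc k) (suc i)) (G (i ∸ k) (suc i)) (u (suc i)))) ⟩
    Σ< i (\k -> A k Z.+ B k Z.+ u (suc i) Z.* f (+ suc k) (+ (i ∸ k)))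
     ≡⟨ trans (Σ-+ i (\k -> A k Z.+ B k) (\k -> u (suc i) Z.* f (+ suc k) (+ (i ∸ k)))) (cong₂ Z._+_ (Σ-+ i A B)
       (trans (Σ-* i (u (suc i)) (\k -> f (+ suc k) (+ (i ∸ k)))) (trans (*ˡ (u (suc i)) (Σ-cong i \k k< -> cong (f (+ suc k)) (diff k<))) (Z.*-comm (u (suc i)) (φ i))))) ⟩
    Σ< i A Z.+ Σ< i B Z.+ φ i Z.* u (suc i)
     ≡⟨ cong (Z._+ φ i Z.* u (suc i)) (trans (+ˡ (Σ< i A) (trans (Σ-reverse i B) (Σ-cong i \k k< -> flip k<))) (sym (Σ-+ i A (\k -> f (+ (i ∸ k)) (+ suc k) Z.* G (suc k) (suc i))))) ⟩
    Σ< i (\k -> A k Z.+ f (+ (i ∸ k)) (+ suc k) Z.* G (suc k) (suc i)) Z.+ φ i Z.* u (suc i)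
     ≡⟨ cong (Z._+ φ i Z.* u (suc i)) (Σ-cong i \k k< -> trans (sym (Z.*-distribʳ-+ (G (suc k) (suc i)) (f (+ suc k) (+ (i ∸ k))) (f (+ (i ∸ k)) (+ suc k)))) (cong (Z._* G (suc k) (suc i)) (use k<))) ⟩
    Σ< i (\k -> (g (+ suc k) (+ suc i) Z.+ g (+ suc i) (+ suc k)) Z.* G (suc k) (suc i)) Z.+ φ i Z.* u (suc i) ∎
    where
    A B : ℕ -> ℤ
    A k = f (+ suc k) (+ (i ∸ k)) Z.* G (suc k) (suc i)
    B k = f (+ suc k) (+ (i ∸ k)) Z.* G (i ∸ k) (suc i)
    lem : ∀ f a b c -> f Z.* (a Z.+ b Z.+ c) ≡ f Z.* a Z.+ f Z.* b Z.+ c Z.* f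
    lem = arith
    step : ∀ {k} -> k N.< i -> i ∸ k ≡ suc (i ∸ suc k)
    step {k} k< = N.+-∸-assoc 1 k<
    tot : ∀ {k} -> k N.< i -> suc k N.+ (i ∸ k) ≡ suc i
    tot k< = cong suc (N.m+[n∸m]≡n (N.<⇒≤ k<))
    rel : ∀ {k} -> k N.< i -> G (suc k) (i ∸ k) ≡ G (suc k) (suc i) Z.+ G (i ∸ k) (suc i) Z.+ u (suc i)
    rel {k} k< = subst (\b -> G (suc k) b ≡ G (suc k) (suc i) Z.+ G b (suc i) Z.+ u (suc i)) (sym (step k<))
     (subst (\c -> G (suc k) (suc (i ∸ suc k)) ≡ G (suc k) c Z.+ G (suc (i ∸ suc k)) c Z.+ u c)
      (trans (cong (suc k N.+_) (sym (step k<))) (tot k<)) (G-rel k (i ∸ suc k)))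
    flip : ∀ {k} -> k N.< i -> B (i ∸ suc k) ≡ f (+ (i ∸ k)) (+ suc k) Z.* G (suc k) (suc i)
    flip {k} k< = cong₂ (\a b -> f (+ a) (+ b) Z.* G b (suc i)) (sym (step k<)) (N.m∸[m∸n]≡n k<)
    use : ∀ {k} -> k N.< i -> f (+ suc k) (+ (i ∸ k)) Z.+ f (+ (i ∸ k)) (+ suc k) ≡ g (+ suc k) (+ suc i) Z.+ g (+ suc i) (+ suc k)
    use {k} k< = trans (sym (fg (+ suc k) (+ (i ∸ k)))) (cong (\c -> g (+ suc k) c Z.+ g c (+ suc k)) (cong +_ (tot k<)))

  -- By `sq-g` and `sq-f` both double sums have the same part off the diagonal; what remains is the
  -- diagonal of g and the one-fold sums φ.
  liouville : sq g Z.+ Σ< n (\i -> φ i Z.* u (suc i)) ≡ sq f Z.+ Σ< n (\i -> g (+ suc i) (+ suc i) Z.* G (suc i) (suc i))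
  liouville = trans (cong (Z._+ Σ< n (\i -> φ i Z.* u (suc i))) (trans sq-g (Σ-+ n C D)))
   (trans (lem (Σ< n C) (Σ< n D) (Σ< n (\i -> φ i Z.* u (suc i))))
    (cong (Z._+ Σ< n D) (sym (trans sq-f (Σ-+ n C (\i -> φ i Z.* u (suc i)))))))
   where
   C D : ℕ -> ℤ
   C i = Σ< i (\k -> (g (+ suc k) (+ suc i) Z.+ g (+ suc i) (+ suc k)) Z.* G (suc k) (suc i))
   D i = g (+ suc i) (+ suc i) Z.* G (suc i) (suc i)
   lem : ∀ a b c -> a Z.+ b Z.+ c ≡ a Z.+ c Z.+ b
   lem = arith

-- Algebra of geometric series and of Shanks's telescoping sum.

module Geom where
 open ZSolver

 module Geometric (Z : ZRing) where
  open ZRing Z renaming (trans to ≈-trans; refl to ≈-refl; sym to ≈-sym)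

  -- The hypothesis expresses u = x/(1 - x) without a division.
  inv : ∀ {x u} -> u ≈ x * (ι (+ 1) + u) -> (ι (+ 1) - x) * (ι (+ 1) + u) ≈ ι (+ 1)
  inv {x} {u} p = begin
   (ι (+ 1) - x) * (ι (+ 1) + u)        ≈⟨ solve 2 (\x u -> (con (+ 1) :- x) :* (con (+ 1) :+ u) := (con (+ 1) :+ u) :- x :* (con (+ 1) :+ u)) ≈-refl x u ⟩
   (ι (+ 1) + u) - x * (ι (+ 1) + u)    ≈⟨ +-congˡ (-‿cong (≈-sym p)) ⟩
   (ι (+ 1) + u) - u                    ≈⟨ solve 1 (\u -> (con (+ 1) :+ u) :- u := con (+ 1)) ≈-refl u ⟩
   ι (+ 1) ∎

  low : ∀ {x u} -> u ≈ x * (ι (+ 1) + u) -> (ι (+ 1) - x) * u ≈ x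
  low {x} {u} p = begin
   (ι (+ 1) - x) * u            ≈⟨ solve 2 (\x u -> (con (+ 1) :- x) :* u := (u :- x :* (con (+ 1) :+ u)) :+ x) ≈-refl x u ⟩
   (u - x * (ι (+ 1) + u)) + x  ≈⟨ +-congʳ (+-congˡ (-‿cong (≈-sym p))) ⟩
   (u - u) + x                  ≈⟨ solve 2 (\x u -> (u :- u) :+ x := x) ≈-refl x u ⟩
   x ∎

  cancel : ∀ {x u D} -> u ≈ x * (ι (+ 1) + u) -> (ι (+ 1) - x) * D ≈ ι (+ 0) -> D ≈ ι (+ 0)
  cancel {x} {u} {D} p z = begin
   D                                   ≈⟨ solve 1 (\D -> D := con (+ 1) :* D) ≈-refl D ⟩
   ι (+ 1) * D                         ≈⟨ *-congʳ (≈-sym (inv p)) ⟩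
   (ι (+ 1) - x) * (ι (+ 1) + u) * D   ≈⟨ solve 3 (\x u D -> x :* u :* D := u :* (x :* D)) ≈-refl (ι (+ 1) - x) (ι (+ 1) + u) D ⟩
   (ι (+ 1) + u) * ((ι (+ 1) - x) * D) ≈⟨ *-congˡ z ⟩
   (ι (+ 1) + u) * ι (+ 0)             ≈⟨ solve 1 (\u -> u :* con (+ 0) := con (+ 0)) ≈-refl (ι (+ 1) + u) ⟩
   ι (+ 0) ∎

  -- The relation `G-rel` of Liouville's method. Multiplied by (1 - x)(1 - y)(1 - xy) it is
  -- polynomial, and `cancel` removes the three factors again.
  split : ∀ {x y u v w} -> u ≈ x * (ι (+ 1) + u) -> v ≈ y * (ι (+ 1) + v) -> w ≈ (x * y) * (ι (+ 1) + w) ->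
      u * v ≈ u * w + v * w + w
  split {x} {y} {u} {v} {w} p r s = begin
   u * v             ≈⟨ solve 2 (\a b -> a := (a :- b) :+ b) ≈-refl (u * v) (u * w + v * w + w) ⟩
   (u * v - (u * w + v * w + w)) + (u * w + v * w + w) ≈⟨ +-congʳ (cancel p (cancel r (cancel s zeroʹ))) ⟩
   ι (+ 0) + (u * w + v * w + w) ≈⟨ solve 1 (\a -> con (+ 0) :+ a := a) ≈-refl (u * w + v * w + w) ⟩
   u * w + v * w + w ∎
   where
   X = ι (+ 1) - x
   Y = ι (+ 1) - y
   W = ι (+ 1) - (x * y)
   zeroʹ : W * (Y * (X * (u * v - (u * w + v * w + w)))) ≈ ι (+ 0)
   zeroʹ = begin
    W * (Y * (X * (u * v - (u * w + v * w + w))))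
     ≈⟨ solve 6 (\X Y W u v w -> W :* (Y :* (X :* (u :* v :- (u :* w :+ v :* w :+ w)))) :=
       (X :* u) :* (Y :* v) :* W :- ((X :* u) :* (W :* w) :* Y :+ (Y :* v) :* (W :* w) :* X :+ (W :* w) :* X :* Y)) ≈-refl X Y W u v w ⟩
    (X * u) * (Y * v) * W - ((X * u) * (W * w) * Y + (Y * v) * (W * w) * X + (W * w) * X * Y)
     ≈⟨ +-cong (*-congʳ (*-cong (low p) (low r))) (-‿cong (+-cong (+-cong (*-congʳ (*-cong (low p) (low s))) (*-congʳ (*-cong (low r) (low s)))) (*-congʳ (*-congʳ (low s))))) ⟩
    x * y * W - (x * (x * y) * Y + y * (x * y) * X + (x * y) * X * Y)
     ≈⟨ solve 2 (\x y -> x :* y :* (con (+ 1) :- x :* y) :- (x :* (x :* y) :* (con (+ 1) :- y) :+ y :* (x :* y) :* (con (+ 1) :- x) :+ (x :* y) :* (con (+ 1) :- x) :* (con (+ 1) :- y)) := con (+ 0)) ≈-refl x y ⟩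
    ι (+ 0) ∎

  -- Used with x = qᵃ and t = θu: differentiating u = x(1 + u) gives the second hypothesis.
  square : ∀ {x u t a} -> u ≈ x * (ι (+ 1) + u) -> t ≈ a * x * (ι (+ 1) + u) + x * t -> t ≈ a * (u + u * u)
  square {x} {u} {t} {a} p r = begin
   t ≈⟨ solve 2 (\a b -> a := (a :- b) :+ b) ≈-refl t (a * (u + u * u)) ⟩
   (t - a * (u + u * u)) + a * (u + u * u) ≈⟨ +-congʳ (cancel p zeroʹ) ⟩
   ι (+ 0) + a * (u + u * u) ≈⟨ solve 1 (\a -> con (+ 0) :+ a := a) ≈-refl _ ⟩
   a * (u + u * u) ∎
   where
   X = ι (+ 1) - x
   zeroʹ : X * (t - a * (u + u * u)) ≈ ι (+ 0)
   zeroʹ = begin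
    X * (t - a * (u + u * u)) ≈⟨ solve 4 (\x t a u -> (con (+ 1) :- x) :* (t :- a :* (u :+ u :* u)) :=
      (t :- x :* t) :- a :* (((con (+ 1) :- x) :* u) :* (con (+ 1) :+ u))) ≈-refl x t a u ⟩
    (t - x * t) - a * ((X * u) * (ι (+ 1) + u)) ≈⟨ +-cong (+-congʳ r) (-‿cong (*-congˡ (*-congʳ (low p)))) ⟩
    ((a * x * (ι (+ 1) + u) + x * t) - x * t) - a * (x * (ι (+ 1) + u))
     ≈⟨ solve 4 (\x t a u -> ((a :* x :* (con (+ 1) :+ u) :+ x :* t) :- x :* t) :- a :* (x :* (con (+ 1) :+ u)) := con (+ 0)) ≈-refl x t a u ⟩
    ι (+ 0) ∎

 module _ (Z : ZRing) where
  open ZRing Z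

  product-rule : ∀ e t w u a -> (- (t * e)) * w + e * (- (a * (u * w))) ≈ - ((t + a * u) * (e * w))
  product-rule = solve 5 (\e t w u a -> (:- (t :* e)) :* w :+ e :* (:- (a :* (u :* w))) := :- ((t :+ a :* u) :* (e :* w))) refl

 module _ (Z : ZRing) where
  open ZRing Z

  -- One step of the telescoping sum, with a = q^(s(s+1)/2), b = q^(s+1), d = q^((s+1)N) and v =
  -- q^(N+1).
  shanks-step : ∀ S c R a b d v ->
   (S + (- c) * (((ι (+ 1) - b) * R) * ((d * b) * a))) + (- c) * ((R * (ι (+ 1) - v)) * ((d * b) * (a * b))) ≈
   (S + (- c) * (R * (d * (a * b)))) + (- (- c)) * (R * ((v * (d * b)) * (a * b)))
  shanks-step = solve 7 (\S c R a b d v ->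
   (S :+ (:- c) :* (((con (+ 1) :- b) :* R) :* ((d :* b) :* a))) :+ (:- c) :* ((R :* (con (+ 1) :- v)) :* ((d :* b) :* (a :* b))) :=
   (S :+ (:- c) :* (R :* (d :* (a :* b)))) :+ (:- (:- c)) :* (R :* ((v :* (d :* b)) :* (a :* b)))) refl

 module _ (Z : ZRing) where
  open ZRing Z

  shanks-base : ∀ R v ->
   ι (+ 0) + ι (+ 1) * ((R * (ι (+ 1) - v)) * (ι (+ 1) * ι (+ 1))) ≈
   (ι (+ 0) + ι (+ 1) * (R * (ι (+ 1) * ι (+ 1)))) + (- ι (+ 1)) * (R * (v * ι (+ 1)))
  shanks-base = solve 2 (\R v -> con (+ 0) :+ con (+ 1) :* ((R :* (con (+ 1) :- v)) :* (con (+ 1) :* con (+ 1))) :=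
   (con (+ 0) :+ con (+ 1) :* (R :* (con (+ 1) :* con (+ 1)))) :+ (:- con (+ 1)) :* (R :* (v :* con (+ 1)))) refl

 module _ (Z : ZRing) where
  open ZRing Z

  shanks-last : ∀ S c m a mʹ aʹ ->
   (S + (- c) * (ι (+ 1) * (m * a))) + (- c) * (ι (+ 1) * (mʹ * aʹ)) ≈ S + (- c) * (m * a + mʹ * aʹ)
  shanks-last = solve 6 (\S c m a mʹ aʹ -> (S :+ (:- c) :* (con (+ 1) :* (m :* a))) :+ (:- c) :* (con (+ 1) :* (mʹ :* aʹ)) :=
   S :+ (:- c) :* (m :* a :+ mʹ :* aʹ)) refl

-- Lambert series.

module Eis where
 open import Data.Nat.Base as N using (ℕ; zero; suc)
 open import Data.Nat.Divisibility using (_∣_; _∣?_; ∣m+n∣m⇒∣n; ∣m∣n⇒∣m+n; ∣-refl; >⇒∤)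
 open import Data.Bool.Base using (if_then_else_)
 open import Relation.Nullary using (Dec; yes; no; does)
 open import Relation.Nullary.Decidable using (dec-true; dec-false)
 open import Relation.Binary.PropositionalEquality
 open PS
 open Series using (psZ)
 open ZSolver
 open Sums
 open Geom

 module Geo = Geometric psZ
 module P = ZRing psZ

 -- The expansion of qᵃ/(1 - qᵃ); `u-rec` is its functional equation.
 u : ℕ -> PS
 u a zero    = Z.0ℤ
 u a (suc n) = if does (a ∣? suc n) then Z.1ℤ else Z.0ℤ

 u-low : ∀ a n -> n N.< a -> u a n ≡ Z.0ℤ
 u-low a zero    _  = refl
 u-low a (suc n) n< = cong (if_then Z.1ℤ else Z.0ℤ) (dec-false (a ∣? suc n) (>⇒∤ n<))

 u-shift : ∀ a m -> u (suc a) (suc a N.+ m) ≡ (con Z.1ℤ ⊕ u (suc a)) m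
 u-shift a zero    = cong (if_then Z.1ℤ else Z.0ℤ) (dec-true (suc a ∣? suc (a N.+ 0)) (subst (suc a ∣_) (sym (N.+-identityʳ (suc a))) ∣-refl))
 u-shift a (suc m) = trans (cong (if_then Z.1ℤ else Z.0ℤ) same) (sym (Z.+-identityˡ (u (suc a) (suc m))))
  where
  same : does (suc a ∣? (suc a N.+ suc m)) ≡ does (suc a ∣? suc m)
  same = does-cong (suc a ∣? (suc a N.+ suc m)) (suc a ∣? suc m) (\d -> ∣m+n∣m⇒∣n d ∣-refl) (∣m∣n⇒∣m+n ∣-refl)
   where
   does-cong : ∀ {A B : Set} (a? : Dec A) (b? : Dec B) -> (A -> B) -> (B -> A) -> does a? ≡ does b?
   does-cong (yes a) b? f g = sym (dec-true b? (f a))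
   does-cong (no ¬a) b? f g = sym (dec-false b? (\b -> ¬a (g b)))

 shift-ext : ∀ k f g -> (∀ n -> n N.< k -> f n ≡ Z.0ℤ) -> (∀ m -> f (k N.+ m) ≡ g m) -> f ≐ shift k g
 shift-ext zero    f g p r n       = r n
 shift-ext (suc k) f g p r zero    = p 0 (N.s≤s N.z≤n)
 shift-ext (suc k) f g p r (suc n) = shift-ext k (tail f) g (\n n< -> p (suc n) (N.s≤s n<)) r n

 u-rec : ∀ a -> u (suc a) ≐ mono (suc a) ** (con Z.1ℤ ⊕ u (suc a))
 u-rec a n = trans (shift-ext (suc a) (u (suc a)) _ (u-low (suc a)) (u-shift a) n) (sym (mono-** (suc a) _ n))

 θ-mono : ∀ k -> θ (mono k) ≐ con (+ k) ** mono k
 θ-mono k n = trans (go k n) (sym (**-con (+ k) (mono k) n))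
  where
  shifted : ∀ k n -> + n Z.* shift k (con Z.1ℤ) n ≡ + k Z.* shift k (con Z.1ℤ) n
  shifted zero    zero    = refl
  shifted zero    (suc n) = Z.*-zeroʳ (+ suc n)
  shifted (suc k) zero    = sym (Z.*-zeroʳ (+ suc k))
  shifted (suc k) (suc n) = trans (lem (+ n) (shift k (con Z.1ℤ) n)) (trans (+ˡ (shift k (con Z.1ℤ) n) (shifted k n)) (sym (lem (+ k) (shift k (con Z.1ℤ) n))))
   where
   lem : ∀ n a -> (+ 1 Z.+ n) Z.* a ≡ a Z.+ n Z.* a
   lem = arith
  go : ∀ k n -> θ (mono k) n ≡ + k Z.* mono k n
  go = shifted

 θ-cong : ∀ {f g} -> f ≐ g -> θ f ≐ θ g
 θ-cong p n = *ˡ (+ n) (p n)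

 θ-u : ∀ a -> θ (u (suc a)) ≐ con (+ suc a) ** (u (suc a) ⊕ u (suc a) ** u (suc a))
 θ-u a = Geo.square {mono (suc a)} {u (suc a)} {θ (u (suc a))} {con (+ suc a)} (u-rec a)
  (P.trans (θ-cong (u-rec a)) (P.trans (θ-** (mono (suc a)) (con Z.1ℤ ⊕ u (suc a)))
   (P.+-cong (P.*-congʳ {con Z.1ℤ ⊕ u (suc a)} (θ-mono (suc a))) (P.*-congˡ {mono (suc a)} θ1))))
  where
  θ1 : θ (con Z.1ℤ ⊕ u (suc a)) ≐ θ (u (suc a))
  θ1 zero    = refl
  θ1 (suc n) = *ˡ (+ suc n) (Z.+-identityˡ (u (suc a) (suc n)))

 -- The Lambert series with weights w(a) at qᵃ/(1 - qᵃ). The index i stands for a - 1, and the terms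
 -- with a > n do not reach degree n.
 S : (ℤ -> ℤ) -> PS
 S w n = Σ< n (\i -> w (+ suc i) Z.* u (suc i) n)

 T : ℕ -> (ℤ -> ℤ) -> PS
 T N w n = Σ< N (\i -> w (+ suc i) Z.* u (suc i) n)

 S-T : ∀ N w n -> n N.≤ N -> S w n ≡ T N w n
 S-T N w n n≤ = Σ-trunc n N _ n≤ \i n≤i _ -> trans (*ˡ (w (+ suc i)) (u-low (suc i) n (N.s≤s n≤i))) (Z.*-zeroʳ (w (+ suc i)))

 T-** : ∀ N w h n -> (T N w ** h) n ≡ Σ< N (\i -> w (+ suc i) Z.* (u (suc i) ** h) n)
 T-** zero    w h n = **-vanish n \i j _ -> refl
 T-** (suc N) w h n = trans (**-distribʳ h (T N w) (\k -> w (+ suc N) Z.* u (suc N) k) n)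
  (cong₂ Z._+_ (T-** N w h n) (**-scale (w (+ suc N)) (u (suc N)) h n))

 S-** : ∀ w v n -> (S w ** S v) n ≡ Σ< n (\i -> Σ< n (\j -> w (+ suc i) Z.* v (+ suc j) Z.* (u (suc i) ** u (suc j)) n))
 S-** w v n = begin
  (S w ** S v) n ≡⟨ **-cong-at n {S w} {T n w} {S v} {T n v} (\i j e -> cong₂ Z._*_ (S-T n w i (subst (i N.≤_) e (N.m≤m+n i j))) (S-T n v j (subst (j N.≤_) e (N.m≤n+m j i)))) ⟩
  (T n w ** T n v) n ≡⟨ T-** n w (T n v) n ⟩
  Σ< n (\i -> w (+ suc i) Z.* (u (suc i) ** T n v) n) ≡⟨ Σ-cong n (\i _ -> inner i) ⟩
  Σ< n (\i -> Σ< n (\j -> w (+ suc i) Z.* v (+ suc j) Z.* (u (suc i) ** u (suc j)) n)) ∎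
  where
  open ≡-Reasoning
  inner : ∀ i -> w (+ suc i) Z.* (u (suc i) ** T n v) n ≡ Σ< n (\j -> w (+ suc i) Z.* v (+ suc j) Z.* (u (suc i) ** u (suc j)) n)
  inner i = trans (*ˡ (w (+ suc i)) (trans (**-comm (u (suc i)) (T n v) n) (T-** n v (u (suc i)) n)))
   (trans (sym (Σ-* n (w (+ suc i)) _)) (Σ-cong n \j _ -> trans (sym (Z.*-assoc (w (+ suc i)) (v (+ suc j)) _))
    (*ˡ (w (+ suc i) Z.* v (+ suc j)) (**-comm (u (suc j)) (u (suc i)) n))))

 S-scale : ∀ c w n -> S (\x -> c Z.* w x) n ≡ c Z.* S w n
 S-scale c w n = trans (Σ-cong n (\i _ -> Z.*-assoc c (w (+ suc i)) (u (suc i) n))) (Σ-* n c _)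

 S-+ : ∀ w v n -> S (\x -> w x Z.+ v x) n ≡ S w n Z.+ S v n
 S-+ w v n = trans (Σ-cong n (\i _ -> Z.*-distribʳ-+ (u (suc i) n) (w (+ suc i)) (v (+ suc i)))) (Σ-+ n _ _)

 -- The data of one identity. Since g - f is a sum of two products of functions of one variable, its
 -- double sum is a combination of products of Lambert series. `poly c i` is N times the sum of f(k,
 -- c - k) over 1 ≤ k ≤ i, where N clears the denominators of the power sums. The diagonal becomes a
 -- derivative by a u_a² = θu_a - a u_a.
 module Identity (f g : ℤ -> ℤ -> ℤ) (fg : ∀ x y -> g x (x Z.+ y) Z.+ g (x Z.+ y) x ≡ f x y Z.+ f y x)
  (N : ℤ) (poly : ℤ -> ℤ -> ℤ) (full : ℤ -> ℤ) (poly0 : ∀ c -> poly c (+ 0) ≡ + 0)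
  (poly-step : ∀ c i -> poly c (+ 1 Z.+ i) ≡ poly c i Z.+ N Z.* f (+ 1 Z.+ i) (c Z.- (+ 1 Z.+ i)))
  (poly-full : ∀ i -> poly (+ 1 Z.+ i) i ≡ full (+ 1 Z.+ i))
  (w1 v1 w2 v2 : ℤ -> ℤ) (c1 c2 : ℤ) (g-f : ∀ x y -> g x y ≡ f x y Z.+ (c1 Z.* (w1 x Z.* v1 y) Z.+ c2 Z.* (w2 x Z.* v2 y)))
  (d : ℤ -> ℤ) (c3 : ℤ) (g-diag : ∀ x -> g x x ≡ c3 Z.* (x Z.* d x)) where

  identity : ∀ n -> N Z.* (c1 Z.* (S w1 ** S v1) n Z.+ c2 Z.* (S w2 ** S v2) n) Z.+ S full n ≡
          N Z.* (c3 Z.* (+ n Z.* S d n Z.- S (\x -> x Z.* d x) n))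
  identity n = step (sq f) (sq g) (Σ< n (\i -> φ i Z.* u (suc i) n)) (Σ< n (\i -> g (+ suc i) (+ suc i) Z.* G (suc i) (suc i)))
    (c1 Z.* (S w1 ** S v1) n Z.+ c2 Z.* (S w2 ** S v2) n) (S full n) (c3 Z.* (+ n Z.* S d n Z.- S (\x -> x Z.* d x) n)) liouville sq-lin φ-full diag
   where
   G : ℕ -> ℕ -> ℤ
   G a b = (u a ** u b) n
   open Liouville n G (\a -> u a n) (\a b -> **-comm (u a) (u b) n) (\a b n< -> **-low a b (u a) (u b) (u-low a) (u-low b) n n<)
    (\a b -> Geo.split {mono (suc a)} {mono (suc b)} {u (suc a)} {u (suc b)} {u (suc a N.+ suc b)} (u-rec a) (u-rec b)
     (P.trans (u-rec (a N.+ suc b)) (P.*-congʳ {con Z.1ℤ ⊕ u (suc a N.+ suc b)} (mono-+ (suc a) (suc b)))) n)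
    f g fg
   sq-lin : sq g ≡ sq f Z.+ (c1 Z.* (S w1 ** S v1) n Z.+ c2 Z.* (S w2 ** S v2) n)
   sq-lin = trans (Σ-cong n (\i _ -> trans (Σ-cong n (\j _ -> trans (cong (Z._* G (suc i) (suc j)) (g-f (+ suc i) (+ suc j)))
     (lem (f (+ suc i) (+ suc j)) c1 (w1 (+ suc i) Z.* v1 (+ suc j)) c2 (w2 (+ suc i) Z.* v2 (+ suc j)) (G (suc i) (suc j)))))
     (trans (Σ-+ n _ _) (+ˡ (Σ< n (\j -> f (+ suc i) (+ suc j) Z.* G (suc i) (suc j))) (trans (Σ-+ n _ _) (cong₂ Z._+_ (Σ-* n c1 _) (Σ-* n c2 _)))))))
    (trans (Σ-+ n _ _) (+ˡ (sq f) (trans (Σ-+ n _ _) (cong₂ Z._+_ (trans (Σ-* n c1 _) (*ˡ c1 (sym (S-** w1 v1 n)))) (trans (Σ-* n c2 _) (*ˡ c2 (sym (S-** w2 v2 n))))))))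
    where
    lem : ∀ f c a k b G -> (f Z.+ (c Z.* a Z.+ k Z.* b)) Z.* G ≡ f Z.* G Z.+ (c Z.* (a Z.* G) Z.+ k Z.* (b Z.* G))
    lem = arith
   φ-poly : ∀ c i -> N Z.* Σ< i (\k -> f (+ suc k) (c Z.- + suc k)) ≡ poly c (+ i)
   φ-poly c zero    = trans (Z.*-zeroʳ N) (sym (poly0 c))
   φ-poly c (suc i) = trans (Z.*-distribˡ-+ N (Σ< i (\k -> f (+ suc k) (c Z.- + suc k))) (f (+ suc i) (c Z.- + suc i)))
    (trans (cong (Z._+ N Z.* f (+ suc i) (c Z.- + suc i)) (φ-poly c i)) (sym (poly-step c (+ i))))
   φ-full : N Z.* Σ< n (\i -> φ i Z.* u (suc i) n) ≡ S full n
   φ-full = trans (sym (Σ-* n N _)) (Σ-cong n \i _ -> trans (sym (Z.*-assoc N (φ i) (u (suc i) n)))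
    (cong (Z._* u (suc i) n) (trans (φ-poly (+ suc i) i) (poly-full (+ i)))))
   diag : Σ< n (\i -> g (+ suc i) (+ suc i) Z.* G (suc i) (suc i)) ≡ c3 Z.* (+ n Z.* S d n Z.- S (\x -> x Z.* d x) n)
   diag = trans (Σ-cong n (\i _ -> trans (cong (Z._* G (suc i) (suc i)) (g-diag (+ suc i))) (cell i)))
    (trans (Σ-* n c3 _) (*ˡ c3 (trans (Σ-+ n _ _) (cong₂ Z._+_ (Σ-* n (+ n) _) (trans (Σ-cong n \i _ -> neg (+ suc i Z.* d (+ suc i)) (u (suc i) n)) (trans (Σ-* n (Z.- Z.1ℤ) _) (neg1 (S (\x -> x Z.* d x) n))))))))
    where
    neg : ∀ a b -> Z.- (a Z.* b) ≡ (Z.- Z.1ℤ) Z.* (a Z.* b)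
    neg = arith
    neg1 : ∀ a -> (Z.- Z.1ℤ) Z.* a ≡ Z.- a
    neg1 = arith
    lem : ∀ c x d G U t -> t ≡ x Z.* (U Z.+ G) -> c Z.* (x Z.* d) Z.* G ≡ c Z.* (d Z.* t Z.+ Z.- (x Z.* d Z.* U))
    lem c x d G U _ refl = go c x d G U
     where
     go : ∀ c x d G U -> c Z.* (x Z.* d) Z.* G ≡ c Z.* (d Z.* (x Z.* (U Z.+ G)) Z.+ Z.- (x Z.* d Z.* U))
     go = arith
    cell : ∀ i -> c3 Z.* (+ suc i Z.* d (+ suc i)) Z.* G (suc i) (suc i) ≡ c3 Z.* (+ n Z.* (d (+ suc i) Z.* u (suc i) n) Z.+ Z.- (+ suc i Z.* d (+ suc i) Z.* u (suc i) n))
    cell i = trans (lem c3 (+ suc i) (d (+ suc i)) (G (suc i) (suc i)) (u (suc i) n) (+ n Z.* u (suc i) n)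
      (trans (θ-u i n) (**-con (+ suc i) (u (suc i) ⊕ u (suc i) ** u (suc i)) n)))
     (*ˡ c3 (cong (Z._+ Z.- (+ suc i Z.* d (+ suc i) Z.* u (suc i) n)) (swap (d (+ suc i)) (+ n) (u (suc i) n))))
     where
     swap : ∀ d n u -> d Z.* (n Z.* u) ≡ n Z.* (d Z.* u)
     swap = arith
   step : ∀ f g φ Δ h F K -> g Z.+ φ ≡ f Z.+ Δ -> g ≡ f Z.+ h -> N Z.* φ ≡ F -> Δ ≡ K -> N Z.* h Z.+ F ≡ N Z.* K
   step f _ φ Δ h _ _ e refl refl refl = trans (sym (Z.*-distribˡ-+ N h φ)) (*ˡ N (cancel f (h Z.+ φ) Δ (trans (sym (Z.+-assoc f h φ)) e)))
    where
    cancel : ∀ f a b -> f Z.+ a ≡ f Z.+ b -> a ≡ b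
    cancel f a b p = trans (lem f a) (trans (+ˡ (Z.- f) p) (sym (lem f b)))
     where
     lem : ∀ f a -> a ≡ Z.- f Z.+ (f Z.+ a)
     lem = arith

-- Four instances of Liouville's identity.

module Ramanujan where
 open import Data.Fin.Base using (zero; suc)
 open import Data.Vec.Base using (_∷_; [])
 open import Data.Integer.Solver using (module +-*-Solver)
 open import Relation.Binary.PropositionalEquality
 open PS using (PS)
 open Eis
 open +-*-Solver

 pow : ℕ -> ℤ -> ℤ
 pow zero    x = + 1
 pow (suc k) x = x Z.* pow k x

 powe : ∀ {n} -> ℕ -> Polynomial n -> Polynomial n
 powe zero    x = con (+ 1)
 powe (suc k) x = x :* powe k x

 Sk : ℕ -> PS
 Sk k = S (pow k)

 Poly2 : Set
 Poly2 = ∀ {n} -> Polynomial n -> Polynomial n -> Polynomial n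

 val1 : (∀ {n} -> Polynomial n -> Polynomial n) -> ℤ -> ℤ
 val1 e x = ⟦ e (var zero) ⟧ (x ∷ [])

 val2 : Poly2 -> ℤ -> ℤ -> ℤ
 val2 e x y = ⟦ e (var zero) (var (suc zero)) ⟧ (x ∷ y ∷ [])

 -- `q⁻` at (x, x + y) equals `q⁺` at (x, y), and both forms are symmetric. Hence the same
 -- polynomial of one variable applied to `q⁺` and to `q⁻` gives a pair that satisfies the relation
 -- `fg`.
 q⁺ q⁻ : Poly2
 q⁺ x y = x :* x :+ x :* y :+ y :* y
 q⁻ x y = x :* x :- x :* y :+ y :* y

 module I1 where
  fe ge polye : Poly2
  fe x y = q⁺ x y
  ge x y = q⁻ x y
  polye c i = con (+ 6) :* c :^ 2 :* i :+ con -[1+ 2 ] :* c :* i :^ 2 :+ con -[1+ 2 ] :* c :* i :+ con (+ 2) :* i :^ 3 :+ con (+ 3) :* i :^ 2 :+ con (+ 1) :* i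
  fulle : ∀ {n} -> Polynomial n -> Polynomial n
  fulle x = con (+ 5) :* powe 3 x :+ (con -[1+ 5 ] :* powe 2 x :+ (con (+ 1) :* powe 1 x))

  open Identity (val2 fe) (val2 ge) (solve 2 (\x y -> ge x (x :+ y) :+ ge (x :+ y) x := fe x y :+ fe y x) refl)
   (+ 6) (val2 polye) (val1 fulle) (solve 1 (\c -> polye c (con (+ 0)) := con (+ 0)) refl)
   (solve 2 (\c i -> polye c (con (+ 1) :+ i) := polye c i :+ con (+ 6) :* fe (con (+ 1) :+ i) (c :- (con (+ 1) :+ i))) refl)
   (solve 1 (\i -> polye (con (+ 1) :+ i) i := fulle (con (+ 1) :+ i)) refl)
   (pow 1) (pow 1) (pow 1) (pow 1) (-[1+ 1 ]) (+ 0)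
   (solve 2 (\x y -> ge x y := fe x y :+ (con (-[1+ 1 ]) :* (powe 1 x :* powe 1 y) :+ con (+ 0) :* (powe 1 x :* powe 1 y))) refl)
   (pow 1) (+ 1) (solve 1 (\x -> ge x x := con (+ 1) :* (x :* powe 1 x)) refl) public

  full-S : ∀ n -> S (val1 fulle) n ≡ + 5 Z.* Sk 3 n Z.+ (-[1+ 5 ] Z.* Sk 2 n Z.+ (+ 1 Z.* Sk 1 n))
  full-S n = trans (S-+ (\x -> + 5 Z.* pow 3 x) (\x -> -[1+ 5 ] Z.* pow 2 x Z.+ (+ 1 Z.* pow 1 x)) n) (cong₂ Z._+_ (S-scale (+ 5) (pow 3) n) (trans (S-+ (\x -> -[1+ 5 ] Z.* pow 2 x) (\x -> + 1 Z.* pow 1 x) n) (cong₂ Z._+_ (S-scale (-[1+ 5 ]) (pow 2) n) (S-scale (+ 1) (pow 1) n))))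

 module I2 where
  fe ge polye : Poly2
  fe x y = q⁺ x y :* q⁺ x y
  ge x y = q⁻ x y :* q⁻ x y
  polye c i = con (+ 30) :* c :^ 4 :* i :+ con -[1+ 29 ] :* c :^ 3 :* i :^ 2 :+ con -[1+ 29 ] :* c :^ 3 :* i :+ con (+ 30) :* c :^ 2 :* i :^ 3 :+ con (+ 45) :* c :^ 2 :* i :^ 2 :+ con (+ 15) :* c :^ 2 :* i :+ con -[1+ 14 ] :* c :* i :^ 4 :+ con -[1+ 29 ] :* c :* i :^ 3 :+ con -[1+ 14 ] :* c :* i :^ 2 :+ con (+ 6) :* i :^ 5 :+ con (+ 15) :* i :^ 4 :+ con (+ 10) :* i :^ 3 :+ con mone :* i
  fulle : ∀ {n} -> Polynomial n -> Polynomial n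
  fulle x = con (+ 21) :* powe 5 x :+ (con -[1+ 29 ] :* powe 4 x :+ (con (+ 10) :* powe 3 x :+ (con mone :* powe 1 x)))

  open Identity (val2 fe) (val2 ge) (solve 2 (\x y -> ge x (x :+ y) :+ ge (x :+ y) x := fe x y :+ fe y x) refl)
   (+ 30) (val2 polye) (val1 fulle) (solve 1 (\c -> polye c (con (+ 0)) := con (+ 0)) refl)
   (solve 2 (\c i -> polye c (con (+ 1) :+ i) := polye c i :+ con (+ 30) :* fe (con (+ 1) :+ i) (c :- (con (+ 1) :+ i))) refl)
   (solve 1 (\i -> polye (con (+ 1) :+ i) i := fulle (con (+ 1) :+ i)) refl)
   (pow 3) (pow 1) (pow 1) (pow 3) (-[1+ 3 ]) (-[1+ 3 ])
   (solve 2 (\x y -> ge x y := fe x y :+ (con (-[1+ 3 ]) :* (powe 3 x :* powe 1 y) :+ con (-[1+ 3 ]) :* (powe 1 x :* powe 3 y))) refl)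
   (pow 3) (+ 1) (solve 1 (\x -> ge x x := con (+ 1) :* (x :* powe 3 x)) refl) public

  full-S : ∀ n -> S (val1 fulle) n ≡ + 21 Z.* Sk 5 n Z.+ (-[1+ 29 ] Z.* Sk 4 n Z.+ (+ 10 Z.* Sk 3 n Z.+ (mone Z.* Sk 1 n)))
  full-S n = trans (S-+ (\x -> + 21 Z.* pow 5 x) (\x -> -[1+ 29 ] Z.* pow 4 x Z.+ (+ 10 Z.* pow 3 x Z.+ (mone Z.* pow 1 x))) n) (cong₂ Z._+_ (S-scale (+ 21) (pow 5) n) (trans (S-+ (\x -> -[1+ 29 ] Z.* pow 4 x) (\x -> + 10 Z.* pow 3 x Z.+ (mone Z.* pow 1 x)) n) (cong₂ Z._+_ (S-scale (-[1+ 29 ]) (pow 4) n) (trans (S-+ (\x -> + 10 Z.* pow 3 x) (\x -> mone Z.* pow 1 x) n) (cong₂ Z._+_ (S-scale (+ 10) (pow 3) n) (S-scale (mone) (pow 1) n))))))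

 -- The value of xy(y - x) at (x, x + y) is xy(x + y), up to the order of factors. Here g vanishes
 -- on the diagonal, so no derivative appears: the outcome is E₄² = E₈.
 module I3 where
  fe ge polye : Poly2
  fe x y = (x :* y :* (x :+ y)) :^ 2
  ge x y = (x :* y :* (y :- x)) :^ 2
  polye c i = con (+ 10) :* c :^ 4 :* i :^ 3 :+ con (+ 15) :* c :^ 4 :* i :^ 2 :+ con (+ 5) :* c :^ 4 :* i :+ con -[1+ 14 ] :* c :^ 3 :* i :^ 4 :+ con -[1+ 29 ] :* c :^ 3 :* i :^ 3 :+ con -[1+ 14 ] :* c :^ 3 :* i :^ 2 :+ con (+ 6) :* c :^ 2 :* i :^ 5 :+ con (+ 15) :* c :^ 2 :* i :^ 4 :+ con (+ 10) :* c :^ 2 :* i :^ 3 :+ con mone :* c :^ 2 :* i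
  fulle : ∀ {n} -> Polynomial n -> Polynomial n
  fulle x = con (+ 1) :* powe 7 x :+ (con mone :* powe 3 x)

  open Identity (val2 fe) (val2 ge) (solve 2 (\x y -> ge x (x :+ y) :+ ge (x :+ y) x := fe x y :+ fe y x) refl)
   (+ 30) (val2 polye) (val1 fulle) (solve 1 (\c -> polye c (con (+ 0)) := con (+ 0)) refl)
   (solve 2 (\c i -> polye c (con (+ 1) :+ i) := polye c i :+ con (+ 30) :* fe (con (+ 1) :+ i) (c :- (con (+ 1) :+ i))) refl)
   (solve 1 (\i -> polye (con (+ 1) :+ i) i := fulle (con (+ 1) :+ i)) refl)
   (pow 3) (pow 3) (pow 1) (pow 1) (-[1+ 3 ]) (+ 0)
   (solve 2 (\x y -> ge x y := fe x y :+ (con (-[1+ 3 ]) :* (powe 3 x :* powe 3 y) :+ con (+ 0) :* (powe 1 x :* powe 1 y))) refl)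
   (pow 1) (+ 0) (solve 1 (\x -> ge x x := con (+ 0) :* (x :* powe 1 x)) refl) public

  full-S : ∀ n -> S (val1 fulle) n ≡ + 1 Z.* Sk 7 n Z.+ (mone Z.* Sk 3 n)
  full-S n = trans (S-+ (\x -> + 1 Z.* pow 7 x) (\x -> mone Z.* pow 3 x) n) (cong₂ Z._+_ (S-scale (+ 1) (pow 7) n) (S-scale (mone) (pow 3) n))

 -- The coefficients 2 and -7 are chosen so that the terms x³y³ cancel in g - f; of the products of
 -- Lambert series only the one of `Sk 1` and `Sk 5` remains.
 module I4 where
  fe ge polye : Poly2
  fe x y = con (+ 2) :* (q⁺ x y :* q⁺ x y :* q⁺ x y) :- con (+ 7) :* (x :* y :* (x :+ y)) :^ 2
  ge x y = con (+ 2) :* (q⁻ x y :* q⁻ x y :* q⁻ x y) :- con (+ 7) :* (x :* y :* (y :- x)) :^ 2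
  polye c i = con (+ 84) :* c :^ 6 :* i :+ con -[1+ 125 ] :* c :^ 5 :* i :^ 2 :+ con -[1+ 125 ] :* c :^ 5 :* i :+ con (+ 70) :* c :^ 4 :* i :^ 3 :+ con (+ 105) :* c :^ 4 :* i :^ 2 :+ con (+ 35) :* c :^ 4 :* i :+ con (+ 42) :* c :^ 2 :* i :^ 5 :+ con (+ 105) :* c :^ 2 :* i :^ 4 :+ con (+ 70) :* c :^ 2 :* i :^ 3 :+ con -[1+ 6 ] :* c :^ 2 :* i :+ con -[1+ 41 ] :* c :* i :^ 6 :+ con -[1+ 125 ] :* c :* i :^ 5 :+ con -[1+ 104 ] :* c :* i :^ 4 :+ con (+ 21) :* c :* i :^ 2 :+ con (+ 12) :* i :^ 7 :+ con (+ 42) :* i :^ 6 :+ con (+ 42) :* i :^ 5 :+ con -[1+ 13 ] :* i :^ 3 :+ con (+ 2) :* i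
  fulle : ∀ {n} -> Polynomial n -> Polynomial n
  fulle x = con (+ 40) :* powe 7 x :+ (con -[1+ 83 ] :* powe 6 x :+ (con (+ 42) :* powe 5 x :+ (con (+ 2) :* powe 1 x)))

  open Identity (val2 fe) (val2 ge) (solve 2 (\x y -> ge x (x :+ y) :+ ge (x :+ y) x := fe x y :+ fe y x) refl)
   (+ 42) (val2 polye) (val1 fulle) (solve 1 (\c -> polye c (con (+ 0)) := con (+ 0)) refl)
   (solve 2 (\c i -> polye c (con (+ 1) :+ i) := polye c i :+ con (+ 42) :* fe (con (+ 1) :+ i) (c :- (con (+ 1) :+ i))) refl)
   (solve 1 (\i -> polye (con (+ 1) :+ i) i := fulle (con (+ 1) :+ i)) refl)
   (pow 1) (pow 5) (pow 5) (pow 1) (-[1+ 11 ]) (-[1+ 11 ])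
   (solve 2 (\x y -> ge x y := fe x y :+ (con (-[1+ 11 ]) :* (powe 1 x :* powe 5 y) :+ con (-[1+ 11 ]) :* (powe 5 x :* powe 1 y))) refl)
   (pow 5) (+ 2) (solve 1 (\x -> ge x x := con (+ 2) :* (x :* powe 5 x)) refl) public

  full-S : ∀ n -> S (val1 fulle) n ≡ + 40 Z.* Sk 7 n Z.+ (-[1+ 83 ] Z.* Sk 6 n Z.+ (+ 42 Z.* Sk 5 n Z.+ (+ 2 Z.* Sk 1 n)))
  full-S n = trans (S-+ (\x -> + 40 Z.* pow 7 x) (\x -> -[1+ 83 ] Z.* pow 6 x Z.+ (+ 42 Z.* pow 5 x Z.+ (+ 2 Z.* pow 1 x))) n) (cong₂ Z._+_ (S-scale (+ 40) (pow 7) n) (trans (S-+ (\x -> -[1+ 83 ] Z.* pow 6 x) (\x -> + 42 Z.* pow 5 x Z.+ (+ 2 Z.* pow 1 x)) n) (cong₂ Z._+_ (S-scale (-[1+ 83 ]) (pow 6) n) (trans (S-+ (\x -> + 42 Z.* pow 5 x) (\x -> + 2 Z.* pow 1 x) n) (cong₂ Z._+_ (S-scale (+ 42) (pow 5) n) (S-scale (+ 2) (pow 1) n))))))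

-- Ramanujan's differential equations for E₂, E₄, E₆.

module EisODE where
 open ZSolver

 module ODE (Z : ZRing) where
  open ZRing Z

  -- Reduces an equation to a formal ring identity once X - Y is exhibited as a multiple c of L - R;
  -- nested uses combine several hypotheses.
  by-multiple : ∀ {X Y} c {L R} -> L ≈ R -> X ≈ Y + c * (L - R) -> X ≈ Y
  by-multiple {X} {Y} c {L} {R} h e = begin
   X               ≈⟨ e ⟩
   Y + c * (L - R) ≈⟨ +-congˡ (*-congˡ (+-congʳ h)) ⟩
   Y + c * (R - R) ≈⟨ solve 3 (\y c r -> y :+ c :* (r :- r) := y) refl Y c R ⟩
   Y ∎

  module _ (S1 S3 S5 S7 T1 T3 T5 : Carrier)
   (h1 : ι (+ 12) * (S1 * S1) + ι (+ 6) * T1 ≈ ι (+ 5) * S3 + S1)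
   (h2 : ι (+ 240) * (S1 * S3) + ι (+ 30) * T3 ≈ ι (+ 21) * S5 + ι (+ 10) * S3 - S1)
   (h3 : ι (+ 120) * (S3 * S3) + S3 ≈ S7)
   (h4 : ι (+ 504) * (S1 * S5) + ι (+ 42) * T5 ≈ ι (+ 20) * S7 + ι (+ 21) * S5 + S1) where

   e2 e₄ e6 : Carrier
   e2 = ι (+ 1) + ι -[1+ 23 ] * S1
   e₄ = ι (+ 1) + ι (+ 240) * S3
   e6 = ι (+ 1) + ι -[1+ 503 ] * S5

   θe2 : ι (+ 12) * (ι -[1+ 23 ] * T1) ≈ e2 * e2 - e₄
   θe2 = by-multiple (ι -[1+ 47 ]) h1 (solve 3 (\s t T ->
    con (+ 12) :* (con -[1+ 23 ] :* T) :=
    ((con (+ 1) :+ con -[1+ 23 ] :* s) :* (con (+ 1) :+ con -[1+ 23 ] :* s) :- (con (+ 1) :+ con (+ 240) :* t))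
    :+ con -[1+ 47 ] :* ((con (+ 12) :* (s :* s) :+ con (+ 6) :* T) :- (con (+ 5) :* t :+ s))) refl S1 S3 T1)

   θe4 : ι (+ 3) * (ι (+ 240) * T3) ≈ e2 * e₄ - e6
   θe4 = by-multiple (ι (+ 24)) h2 (solve 4 (\s t v T ->
    con (+ 3) :* (con (+ 240) :* T) :=
    ((con (+ 1) :+ con -[1+ 23 ] :* s) :* (con (+ 1) :+ con (+ 240) :* t) :- (con (+ 1) :+ con -[1+ 503 ] :* v))
    :+ con (+ 24) :* ((con (+ 240) :* (s :* t) :+ con (+ 30) :* T) :- (con (+ 21) :* v :+ con (+ 10) :* t :- s))) refl S1 S3 S5 T3)

   -- `h4` brings in `S7`, which `h3` eliminates; that is the use of E₈ = E₄².
   θe6 : ι (+ 2) * (ι -[1+ 503 ] * T5) ≈ e2 * e6 - e₄ * e₄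
   θe6 = by-multiple (ι -[1+ 23 ]) h4 (by-multiple (ι (+ 480)) h3 (solve 5 (\s t v w T ->
    con (+ 2) :* (con -[1+ 503 ] :* T) :=
    (((con (+ 1) :+ con -[1+ 23 ] :* s) :* (con (+ 1) :+ con -[1+ 503 ] :* v) :- (con (+ 1) :+ con (+ 240) :* t) :* (con (+ 1) :+ con (+ 240) :* t))
    :+ con -[1+ 23 ] :* ((con (+ 504) :* (s :* v) :+ con (+ 42) :* T) :- (con (+ 20) :* w :+ con (+ 21) :* v :+ s)))
    :+ con (+ 480) :* ((con (+ 120) :* (t :* t) :+ t) :- w)) refl S1 S3 S5 S7 T5))

module EisPS where
 open import Relation.Binary.PropositionalEquality
 open PS
 open Series using (psZ)
 open ZSolver
 open Eis using (S)
 open Ramanujan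
 open EisODE

 module P = ZRing psZ

 e2 e₄ e6 : PS
 e2 = con (+ 1) ⊕ con -[1+ 23 ] ** Sk 1
 e₄ = con (+ 1) ⊕ con (+ 240) ** Sk 3
 e6 = con (+ 1) ⊕ con -[1+ 503 ] ** Sk 5

 private
  h1 : con (+ 12) ** (Sk 1 ** Sk 1) ⊕ con (+ 6) ** θ (Sk 1) ≐ con (+ 5) ** Sk 3 ⊕ Sk 1
  h1 n = trans (cong₂ Z._+_ (**-con (+ 12) (Sk 1 ** Sk 1) n) (**-con (+ 6) (θ (Sk 1)) n))
   (trans (lem (+ n) (Sk 1 n) (Sk 2 n) (Sk 3 n) ((Sk 1 ** Sk 1) n) (trans (+ˡ (+ 6 Z.* (-[1+ 1 ] Z.* (Sk 1 ** Sk 1) n Z.+ + 0 Z.* (Sk 1 ** Sk 1) n)) (sym (I1.full-S n))) (I1.identity n)))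
    (cong (Z._+ Sk 1 n) (sym (**-con (+ 5) (Sk 3) n))))
   where
   lem : ∀ n s s2 t P -> + 6 Z.* (-[1+ 1 ] Z.* P Z.+ + 0 Z.* P) Z.+ (+ 5 Z.* t Z.+ (-[1+ 5 ] Z.* s2 Z.+ (+ 1 Z.* s))) ≡ + 6 Z.* (+ 1 Z.* (n Z.* s Z.- s2)) ->
      + 12 Z.* P Z.+ + 6 Z.* (n Z.* s) ≡ + 5 Z.* t Z.+ s
   lem n s s2 t P h = trans (l1 n s s2 P) (trans (cong (\z -> z Z.+ (+ 12 Z.* P Z.+ + 6 Z.* s2)) (sym h)) (l2 s s2 t P))
    where
    l1 : ∀ n s s2 P -> + 12 Z.* P Z.+ + 6 Z.* (n Z.* s) ≡ + 6 Z.* (+ 1 Z.* (n Z.* s Z.- s2)) Z.+ (+ 12 Z.* P Z.+ + 6 Z.* s2)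
    l1 = arith
    l2 : ∀ s s2 t P -> + 6 Z.* (-[1+ 1 ] Z.* P Z.+ + 0 Z.* P) Z.+ (+ 5 Z.* t Z.+ (-[1+ 5 ] Z.* s2 Z.+ (+ 1 Z.* s))) Z.+ (+ 12 Z.* P Z.+ + 6 Z.* s2) ≡ + 5 Z.* t Z.+ s
    l2 = arith

  h2 : con (+ 240) ** (Sk 1 ** Sk 3) ⊕ con (+ 30) ** θ (Sk 3) ≐ con (+ 21) ** Sk 5 ⊕ con (+ 10) ** Sk 3 ⊕ ⊖ Sk 1
  h2 n = trans (cong₂ Z._+_ (**-con (+ 240) (Sk 1 ** Sk 3) n) (**-con (+ 30) (θ (Sk 3)) n))
   (trans (lem (+ n) (Sk 1 n) (Sk 3 n) (Sk 4 n) (Sk 5 n) ((Sk 3 ** Sk 1) n) ((Sk 1 ** Sk 3) n) (**-comm (Sk 3) (Sk 1) n)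
     (trans (+ˡ (+ 30 Z.* (-[1+ 3 ] Z.* (Sk 3 ** Sk 1) n Z.+ -[1+ 3 ] Z.* (Sk 1 ** Sk 3) n)) (sym (I2.full-S n))) (I2.identity n)))
    (cong (Z._- Sk 1 n) (cong₂ Z._+_ (sym (**-con (+ 21) (Sk 5) n)) (sym (**-con (+ 10) (Sk 3) n)))))
   where
   lem : ∀ n s t f v Q P -> Q ≡ P -> + 30 Z.* (-[1+ 3 ] Z.* Q Z.+ -[1+ 3 ] Z.* P) Z.+ (+ 21 Z.* v Z.+ (-[1+ 29 ] Z.* f Z.+ (+ 10 Z.* t Z.+ (mone Z.* s)))) ≡ + 30 Z.* (+ 1 Z.* (n Z.* t Z.- f)) ->
      + 240 Z.* P Z.+ + 30 Z.* (n Z.* t) ≡ + 21 Z.* v Z.+ + 10 Z.* t Z.- s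
   lem n s t f v P P refl h = trans (l1 n t f P) (trans (cong (\z -> z Z.+ (+ 240 Z.* P Z.+ + 30 Z.* f)) (sym h)) (l2 s t f v P))
    where
    l1 : ∀ n t f P -> + 240 Z.* P Z.+ + 30 Z.* (n Z.* t) ≡ + 30 Z.* (+ 1 Z.* (n Z.* t Z.- f)) Z.+ (+ 240 Z.* P Z.+ + 30 Z.* f)
    l1 = arith
    l2 : ∀ s t f v P -> + 30 Z.* (-[1+ 3 ] Z.* P Z.+ -[1+ 3 ] Z.* P) Z.+ (+ 21 Z.* v Z.+ (-[1+ 29 ] Z.* f Z.+ (+ 10 Z.* t Z.+ (mone Z.* s)))) Z.+ (+ 240 Z.* P Z.+ + 30 Z.* f) ≡ + 21 Z.* v Z.+ + 10 Z.* t Z.- s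
    l2 = arith

  h3 : con (+ 120) ** (Sk 3 ** Sk 3) ⊕ Sk 3 ≐ Sk 7
  h3 n = trans (cong (Z._+ Sk 3 n) (**-con (+ 120) (Sk 3 ** Sk 3) n))
   (lem (Sk 3 n) (Sk 7 n) ((Sk 3 ** Sk 3) n) ((Sk 1 ** Sk 1) n) (+ n Z.* Sk 1 n Z.- Sk 2 n)
    (trans (+ˡ (+ 30 Z.* (-[1+ 3 ] Z.* (Sk 3 ** Sk 3) n Z.+ + 0 Z.* (Sk 1 ** Sk 1) n)) (sym (I3.full-S n))) (I3.identity n)))
   where
   lem : ∀ t w P Q D -> + 30 Z.* (-[1+ 3 ] Z.* P Z.+ + 0 Z.* Q) Z.+ (+ 1 Z.* w Z.+ (mone Z.* t)) ≡ + 30 Z.* (+ 0 Z.* D) -> + 120 Z.* P Z.+ t ≡ w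
   lem t w P Q D h = trans (l1 t P D) (trans (cong (\z -> z Z.+ (+ 120 Z.* P Z.+ t)) (sym h)) (l2 t w P Q))
    where
    l1 : ∀ t P D -> + 120 Z.* P Z.+ t ≡ + 30 Z.* (+ 0 Z.* D) Z.+ (+ 120 Z.* P Z.+ t)
    l1 = arith
    l2 : ∀ t w P Q -> + 30 Z.* (-[1+ 3 ] Z.* P Z.+ + 0 Z.* Q) Z.+ (+ 1 Z.* w Z.+ (mone Z.* t)) Z.+ (+ 120 Z.* P Z.+ t) ≡ w
    l2 = arith

  h4 : con (+ 504) ** (Sk 1 ** Sk 5) ⊕ con (+ 42) ** θ (Sk 5) ≐ con (+ 20) ** Sk 7 ⊕ con (+ 21) ** Sk 5 ⊕ Sk 1
  h4 n = trans (cong₂ Z._+_ (**-con (+ 504) (Sk 1 ** Sk 5) n) (**-con (+ 42) (θ (Sk 5)) n))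
   (trans (Z.*-cancelˡ-≡ (+ 2) _ _ (lem (+ n) (Sk 1 n) (Sk 5 n) (Sk 6 n) (Sk 7 n) ((Sk 5 ** Sk 1) n) ((Sk 1 ** Sk 5) n) (**-comm (Sk 5) (Sk 1) n)
     (trans (+ˡ (+ 42 Z.* (-[1+ 11 ] Z.* (Sk 1 ** Sk 5) n Z.+ -[1+ 11 ] Z.* (Sk 5 ** Sk 1) n)) (sym (I4.full-S n))) (I4.identity n))))
    (cong (Z._+ Sk 1 n) (cong₂ Z._+_ (sym (**-con (+ 20) (Sk 7) n)) (sym (**-con (+ 21) (Sk 5) n)))))
   where
   lem : ∀ n s v f w Q P -> Q ≡ P -> + 42 Z.* (-[1+ 11 ] Z.* P Z.+ -[1+ 11 ] Z.* Q) Z.+ (+ 40 Z.* w Z.+ (-[1+ 83 ] Z.* f Z.+ (+ 42 Z.* v Z.+ (+ 2 Z.* s)))) ≡ + 42 Z.* (+ 2 Z.* (n Z.* v Z.- f)) ->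
      + 2 Z.* (+ 504 Z.* P Z.+ + 42 Z.* (n Z.* v)) ≡ + 2 Z.* (+ 20 Z.* w Z.+ + 21 Z.* v Z.+ s)
   lem n s v f w P P refl h = trans (l1 n v f P) (trans (cong (\z -> z Z.+ (+ 1008 Z.* P Z.+ + 84 Z.* f)) (sym h)) (l2 s v f w P))
    where
    l1 : ∀ n t f P -> + 2 Z.* (+ 504 Z.* P Z.+ + 42 Z.* (n Z.* t)) ≡ + 42 Z.* (+ 2 Z.* (n Z.* t Z.- f)) Z.+ (+ 1008 Z.* P Z.+ + 84 Z.* f)
    l1 = arith
    l2 : ∀ s v f w P -> + 42 Z.* (-[1+ 11 ] Z.* P Z.+ -[1+ 11 ] Z.* P) Z.+ (+ 40 Z.* w Z.+ (-[1+ 83 ] Z.* f Z.+ (+ 42 Z.* v Z.+ (+ 2 Z.* s)))) Z.+ (+ 1008 Z.* P Z.+ + 84 Z.* f) ≡ + 2 Z.* (+ 20 Z.* w Z.+ + 21 Z.* v Z.+ s)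
    l2 = arith

  open ODE psZ hiding (e2; e₄; e6)

  θ-affine : ∀ c f -> θ (con (+ 1) ⊕ con c ** f) ≐ con c ** θ f
  θ-affine c f zero    = sym (trans (**-con c (θ f) 0) (Z.*-zeroʳ c))
  θ-affine c f (suc n) = trans (*ˡ (+ suc n) (trans (Z.+-identityˡ _) (**-con c f (suc n)))) (trans (lem (+ suc n) c (f (suc n))) (sym (**-con c (θ f) (suc n))))
   where
   lem : ∀ n c f -> n Z.* (c Z.* f) ≡ c Z.* (n Z.* f)
   lem = arith

 ramanujan2 : con (+ 12) ** θ e2 ≐ e2 ** e2 ⊕ ⊖ e₄
 ramanujan2 = P.trans (P.*-congˡ {con (+ 12)} (θ-affine -[1+ 23 ] (Sk 1))) (θe2 (Sk 1) (Sk 3) (Sk 5) (Sk 7) (θ (Sk 1)) (θ (Sk 3)) (θ (Sk 5)) h1 h2 h3 h4)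

 ramanujan4 : con (+ 3) ** θ e₄ ≐ e2 ** e₄ ⊕ ⊖ e6
 ramanujan4 = P.trans (P.*-congˡ {con (+ 3)} (θ-affine (+ 240) (Sk 3))) (θe4 (Sk 1) (Sk 3) (Sk 5) (Sk 7) (θ (Sk 1)) (θ (Sk 3)) (θ (Sk 5)) h1 h2 h3 h4)

 ramanujan6 : con (+ 2) ** θ e6 ≐ e2 ** e6 ⊕ ⊖ (e₄ ** e₄)
 ramanujan6 = P.trans (P.*-congˡ {con (+ 2)} (θ-affine -[1+ 503 ] (Sk 5))) (θe6 (Sk 1) (Sk 3) (Sk 5) (Sk 7) (θ (Sk 1)) (θ (Sk 3)) (θ (Sk 5)) h1 h2 h3 h4)

-- The Euler product, its inverse, and the series of the statement.

module Euler where
 open import Data.Nat.Base as N using (ℕ; zero; suc; _∸_; _/_)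
 open import Data.Nat.DivMod using (m<n⇒m/n≡0; m/n≡1+[m∸n]/n)
 open import Data.Nat.Divisibility using (_∣?_)
 open import Data.Nat.ListAction using (sum)
 open import Data.List.Base using (_∷_; map; filter; applyUpTo; upTo)
 open import Data.List.Properties using (map-upTo)
 open import Data.Bool.Base using (true; false; if_then_else_)
 open import Relation.Nullary using (does)
 import Relation.Nullary
 open import Relation.Unary using (Decidable)
 open import Relation.Binary.PropositionalEquality
 open import Function.Base using (_∘_)
 open import Defs hiding (e₄)
 open PS
 open Series using (psZ)
 open ZSolver
 open Sums
 open Geom
 open Eis
 open Ramanujan using (pow; Sk)
 open EisPS using (e₄)

 module Pz = ZRing psZ

 one-minus : ℕ -> PS
 one-minus a = con Z.1ℤ ⊕ ⊖ mono a

 Eₘ : ℕ -> PS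
 Eₘ zero    = con Z.1ℤ
 Eₘ (suc m) = Eₘ m ** one-minus (suc m)

 -- The infinite product read along the diagonal of the finite ones: by `Eₘ-step` the factors beyond
 -- n leave degree n unchanged.
 E : PS
 E n = Eₘ n n

 **-one-minus : ∀ f a -> f ** one-minus a ≐ f ⊕ ⊖ shift a f
 **-one-minus f a n = trans (**-comm f (one-minus a) n) (trans (**-distribʳ f (con Z.1ℤ) (⊖ mono a) n)
  (cong₂ Z._+_ (trans (**-con Z.1ℤ f n) (Z.*-identityˡ (f n))) (trans (neg n) (cong Z.-_ (mono-** a f n)))))
  where
  neg : ⊖ mono a ** f ≐ ⊖ (mono a ** f)
  neg n = trans (**-cong {g = f} {f} (\k -> lem (mono a k)) (\_ -> refl) n) (trans (**-scale (Z.- Z.1ℤ) (mono a) f n) (sym (lem ((mono a ** f) n))))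
   where
   lem : ∀ a -> Z.- a ≡ (Z.- Z.1ℤ) Z.* a
   lem = arith

 Eₘ-step : ∀ m n -> n N.≤ m -> Eₘ (suc m) n ≡ Eₘ m n
 Eₘ-step m n n≤ = trans (**-one-minus (Eₘ m) (suc m) n) (trans (+ˡ (Eₘ m n) (cong Z.-_ (shift-low (suc m) (Eₘ m) n (N.s≤s n≤)))) (Z.+-identityʳ (Eₘ m n)))

 stable : (F : ℕ -> PS) -> (∀ m n -> n N.≤ m -> F (suc m) n ≡ F m n) -> ∀ N n -> n N.≤ N -> F n n ≡ F N n
 stable F h zero    .zero N.z≤n = refl
 stable F h (suc N) n n≤ with n N.≟ suc N
 ... | Relation.Nullary.yes refl = refl
 ... | Relation.Nullary.no ne = trans (stable F h N n n≤N) (sym (h N n n≤N))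
  where n≤N = N.≤-pred (N.≤∧≢⇒< n≤ ne)

 E-Eₘ : ∀ N n -> n N.≤ N -> E n ≡ Eₘ N n
 E-Eₘ = stable Eₘ Eₘ-step

 u-one-minus : ∀ a -> u (suc a) ** one-minus (suc a) ≐ mono (suc a)
 u-one-minus a = Pz.trans (Pz.*-comm (u (suc a)) (one-minus (suc a))) (Geo.low {mono (suc a)} {u (suc a)} (u-rec a))

 θ-one-minus : ∀ a -> θ (one-minus a) ≐ ⊖ (con (+ a) ** mono a)
 θ-one-minus a n = trans (lem n (mono a n)) (cong Z.-_ (θ-mono a n))
  where
  lem : ∀ n b -> + n Z.* (con Z.1ℤ n Z.- b) ≡ Z.- (+ n Z.* b)
  lem zero    b = refl
  lem (suc n) b = l (+ suc n) b
   where
   l : ∀ n b -> n Z.* (+ 0 Z.- b) ≡ Z.- (n Z.* b)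
   l = arith

 T-suc : ∀ m -> T (suc m) (pow 1) ≐ T m (pow 1) ⊕ con (+ suc m) ** u (suc m)
 T-suc m n = +ˡ (T m (pow 1) n) (trans (cong (Z._* u (suc m) n) (Z.*-identityʳ (+ suc m))) (sym (**-con (+ suc m) (u (suc m)) n)))

 -- Logarithmic differentiation: the factor 1 - qᵃ contributes -a qᵃ/(1 - qᵃ), and `u-one-minus`
 -- removes the quotient.
 θ-Eₘ : ∀ m -> θ (Eₘ m) ≐ ⊖ (T m (pow 1) ** Eₘ m)
 θ-Eₘ zero    zero    = refl
 θ-Eₘ zero    (suc n) = trans (Z.*-zeroʳ (+ suc n)) (cong Z.-_ (sym (**-vanish (suc n) {T 0 (pow 1)} {con Z.1ℤ} \i j _ -> refl)))
 θ-Eₘ (suc m) = Pz.trans (θ-** (Eₘ m) (one-minus (suc m))) (Pz.trans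
  (Pz.+-cong (Pz.*-congʳ {one-minus (suc m)} (θ-Eₘ m)) (Pz.*-congˡ {Eₘ m} (Pz.trans (θ-one-minus (suc m)) (Pz.-‿cong (Pz.*-congˡ {con (+ suc m)} (Pz.sym (u-one-minus m)))))))
  (Pz.trans (product-rule psZ (Eₘ m) (T m (pow 1)) (one-minus (suc m)) (u (suc m)) (con (+ suc m)))
   (Pz.-‿cong (Pz.*-congʳ {Eₘ m ** one-minus (suc m)} (Pz.sym (T-suc m))))))

 θ-E : θ E ≐ ⊖ (Sk 1 ** E)
 θ-E n = trans (θ-Eₘ n n) (cong Z.-_ (**-cong-at n {T n (pow 1)} {Sk 1} {Eₘ n} {E} \i j e ->
  cong₂ Z._*_ (sym (S-T n (pow 1) i (subst (i N.≤_) e (N.m≤m+n i j)))) (sym (E-Eₘ n j (subst (j N.≤_) e (N.m≤n+m j i))))))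

 Pₘ : ℕ -> PS
 Pₘ m n = + invProdCoeff m n

 applyUpTo-cong : ∀ {f g : ℕ -> ℕ} n -> (∀ i -> f i ≡ g i) -> applyUpTo f n ≡ applyUpTo g n
 applyUpTo-cong zero    h = refl
 applyUpTo-cong (suc n) h = cong₂ _∷_ (h 0) (applyUpTo-cong n (h ∘ suc))

 -- The multiplicity j of the part m + 1 is either 0 or at least 1; the second case is a shift by m
 -- + 1 of the whole series.
 Pₘ-suc : ∀ m -> Pₘ (suc m) ≐ Pₘ m ⊕ shift (suc m) (Pₘ (suc m))
 Pₘ-suc m n with n N.<? suc m
 ... | Relation.Nullary.yes n< = trans (cong (\k -> + sum (map (\j -> invProdCoeff m (n ∸ j N.* suc m)) (upTo (suc k)))) (m<n⇒m/n≡0 n<))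
    (trans (cong +_ (N.+-identityʳ _)) (sym (trans (+ˡ (Pₘ m n) (shift-low (suc m) (Pₘ (suc m)) n n<)) (Z.+-identityʳ _))))
 ... | Relation.Nullary.no n≮ = trans (cong (\k -> + sum (map (\j -> invProdCoeff m (n ∸ j N.* suc m)) (upTo (suc k)))) (m/n≡1+[m∸n]/n (N.≮⇒≥ n≮)))
    (trans (cong (\l -> + sum l) (map-upTo (\j -> invProdCoeff m (n ∸ j N.* suc m)) (suc (suc k))))
    (+ˡ (Pₘ m n) (trans (cong (\l -> + sum l) (trans (applyUpTo-cong (suc k) (\j -> cong (invProdCoeff m) (sym (N.∸-+-assoc n (suc m) (j N.* suc m)))))
      (sym (map-upTo (\j -> invProdCoeff m (n ∸ suc m ∸ j N.* suc m)) (suc k)))))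
     (sym (trans (cong (shift (suc m) (Pₘ (suc m))) (sym (N.m+[n∸m]≡n (N.≮⇒≥ n≮)))) (shift-+ (suc m) (Pₘ (suc m)) (n ∸ suc m)))))))
  where
  k = (n ∸ suc m) / suc m

 EP : ∀ m -> Eₘ m ** Pₘ m ≐ con Z.1ℤ
 EP zero    = \n -> trans (**-con Z.1ℤ (Pₘ 0) n) (trans (Z.*-identityˡ _) (base n))
  where
  base : ∀ n -> Pₘ 0 n ≡ con Z.1ℤ n
  base zero    = refl
  base (suc n) = refl
 EP (suc m) = Pz.trans (Pz.*-assoc (Eₘ m) (one-minus (suc m)) (Pₘ (suc m))) (Pz.trans (Pz.*-congˡ {Eₘ m} lem) (EP m))
  where
  lem : one-minus (suc m) ** Pₘ (suc m) ≐ Pₘ m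
  lem n = trans (**-comm (one-minus (suc m)) (Pₘ (suc m)) n) (trans (**-one-minus (Pₘ (suc m)) (suc m) n)
   (trans (cong (Z._- shift (suc m) (Pₘ (suc m)) n) (Pₘ-suc m n)) (l (Pₘ m n) (shift (suc m) (Pₘ (suc m)) n))))
   where
   l : ∀ a b -> a Z.+ b Z.- b ≡ a
   l = arith

 Pₘ-step : ∀ m n -> n N.≤ m -> Pₘ (suc m) n ≡ Pₘ m n
 Pₘ-step m n n≤ = trans (Pₘ-suc m n) (trans (+ˡ (Pₘ m n) (shift-low (suc m) (Pₘ (suc m)) n (N.s≤s n≤))) (Z.+-identityʳ _))

 Pt : PS
 Pt n = + pinv n

 E**P : E ** Pt ≐ con Z.1ℤ
 E**P n = trans (**-cong-at n {E} {Eₘ n} {Pt} {Pₘ n} \i j e -> cong₂ Z._*_ (E-Eₘ n i (subst (i N.≤_) e (N.m≤m+n i j)))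
  (stable Pₘ Pₘ-step n j (subst (j N.≤_) e (N.m≤n+m j i)))) (EP n n)

 sum-** : ∀ (a b : ℕ -> ℕ) n -> + sum (applyUpTo (\j -> a j N.* b (n ∸ j)) (suc n)) ≡ ((\i -> + a i) ** (\j -> + b j)) n
 sum-** a b zero    = trans (cong +_ (N.+-identityʳ _)) (Z.pos-* (a 0) (b 0))
 sum-** a b (suc n) = cong₂ Z._+_ (Z.pos-* (a 0) (b (suc n))) (sum-** (a ∘ suc) b n)

 sum-filter : ∀ {P : ℕ -> Set} (P? : Decidable P) (f g : ℕ -> ℕ) N -> + sum (map f (filter P? (applyUpTo g N))) ≡
       Σ< N (\i -> + f (g i) Z.* (if does (P? (g i)) then Z.1ℤ else Z.0ℤ))
 sum-filter P? f g zero    = refl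
 sum-filter P? f g (suc N) = trans (step (does (P? (g 0))) refl) (sym (Σ-first N F))
  where
  F : ℕ -> ℤ
  F i = + f (g i) Z.* (if does (P? (g i)) then Z.1ℤ else Z.0ℤ)
  rest = filter P? (applyUpTo (g ∘ suc) N)
  step : ∀ b -> does (P? (g 0)) ≡ b -> + sum (map f (filter P? (applyUpTo g (suc N)))) ≡ F 0 Z.+ Σ< N (F ∘ suc)
  step b e rewrite e with b
  ... | true  = cong₂ Z._+_ (sym (Z.*-identityʳ (+ f (g 0)))) (sum-filter P? f (g ∘ suc) N)
  ... | false = trans (sum-filter P? f (g ∘ suc) N) (sym (trans (cong (Z._+ Σ< N (F ∘ suc)) (Z.*-zeroʳ (+ f (g 0)))) (Z.+-identityˡ _)))

 -- The list definition filters the divisors, the Lambert series sums over all d with the indicator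
 -- of divisibility; both are governed by the same decision procedure.
 E4coeff-e4 : ∀ n -> + E₄coeff n ≡ e₄ n
 E4coeff-e4 zero    = refl
 E4coeff-e4 (suc n) = trans (Z.pos-* 240 (σ₃ (suc n))) (trans (*ˡ (+ 240) (trans (sum-filter (_∣? suc n) (\d -> d N.^ 3) suc (suc n))
   (Σ-cong (suc n) \i _ -> cong (Z._* u (suc i) (suc n)) (cube (suc i)))))
  (sym (trans (Z.+-identityˡ _) (**-con (+ 240) (Sk 3) (suc n)))))
  where
  cube : ∀ d -> + (d N.^ 3) ≡ pow 3 (+ d)
  cube d = trans (Z.pos-* d (d N.^ 2)) (*ˡ (+ d) (trans (Z.pos-* d (d N.^ 1)) (*ˡ (+ d) (Z.pos-* d 1))))

 e4-series : ∀ n -> + Defs.e₄ n ≡ (e₄ ** Pt) n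
 e4-series n = trans (cong (\l -> + sum l) (map-upTo (\j -> E₄coeff j N.* pinv (n ∸ j)) (suc n)))
  (trans (sum-** E₄coeff pinv n) (**-cong {g = Pt} E4coeff-e4 (\_ -> refl) n))

-- Integer polynomials as coefficient lists.

module Poly where
 open import Data.Bool.Base using (Bool; true; false; T; _∧_)
 open import Data.Unit.Base using (tt)
 open PS using (+ˡ; *ˡ)
 open LInt
 open Base

 infixl 6 _⊞_ _⊟_
 infixl 7 _⊠_ _·_
 infixr 8 _↑_
 infix 4 _==_

 Poly : Set
 Poly = List ℤ

 _⊞_ _⊟_ _⊠_ : Poly -> Poly -> Poly
 []      ⊞ q       = q
 (a ∷ p) ⊞ []      = a ∷ p
 (a ∷ p) ⊞ (b ∷ q) = (a Z.+ b) ∷ (p ⊞ q)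

 _·_ : ℤ -> Poly -> Poly
 c · []      = []
 c · (a ∷ p) = (c Z.* a) ∷ (c · p)

 p ⊟ q = p ⊞ (mone · q)

 []      ⊠ q = []
 (a ∷ p) ⊠ q = (a · q) ⊞ (+ 0 ∷ (p ⊠ q))

 _↑_ : Poly -> ℕ -> Poly
 p ↑ zero  = + 1 ∷ []
 p ↑ suc n = p ⊠ p ↑ n

 -- x d/dx, with exponents starting at k
 xd : ℕ -> Poly -> Poly
 xd k []      = []
 xd k (a ∷ p) = (+ k Z.* a) ∷ xd (suc k) p

 -- The substitution X ↦ cX; with c = 13 it expresses the Fricke involution.
 dil : ℤ -> Poly -> Poly
 dil c []      = []
 dil c (a ∷ p) = a ∷ (c · dil c p)

 nth : Poly -> ℕ -> ℤ
 nth []      k       = + 0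
 nth (a ∷ p) zero    = a
 nth (a ∷ p) (suc k) = nth p k

 isZero : ℤ -> Bool
 isZero (+ zero) = true
 isZero _        = false

 null : Poly -> Bool
 null []      = true
 null (a ∷ p) = isZero a ∧ null p

 -- Equality up to trailing zeros. As a Boolean it lets the polynomial identities below be settled
 -- by evaluation.
 _==_ : Poly -> Poly -> Bool
 p == q = null (p ⊟ q)

 ∧-fst : ∀ {a b} -> T (a ∧ b) -> T a
 ∧-fst {true} _ = tt

 ∧-snd : ∀ {a b} -> T (a ∧ b) -> T b
 ∧-snd {true} t = t

 isZero-sound : ∀ a -> T (isZero a) -> a ≡ + 0
 isZero-sound (+ zero) _ = I.refl

 nth-⊞ : ∀ p q k -> nth (p ⊞ q) k ≡ nth p k Z.+ nth q k
 nth-⊞ []      q       k       = sy (Z.+-identityˡ _)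
 nth-⊞ (a ∷ p) []      k       = sy (Z.+-identityʳ _)
 nth-⊞ (a ∷ p) (b ∷ q) zero    = I.refl
 nth-⊞ (a ∷ p) (b ∷ q) (suc k) = nth-⊞ p q k

 nth-· : ∀ c p k -> nth (c · p) k ≡ c Z.* nth p k
 nth-· c []      k       = sy (Z.*-zeroʳ c)
 nth-· c (a ∷ p) zero    = I.refl
 nth-· c (a ∷ p) (suc k) = nth-· c p k

 nth-null : ∀ p -> T (null p) -> ∀ k -> nth p k ≡ + 0
 nth-null []      t k       = I.refl
 nth-null (a ∷ p) t zero    = isZero-sound a (∧-fst t)
 nth-null (a ∷ p) t (suc k) = nth-null p (∧-snd {isZero a} t) k

 nth-== : ∀ p q -> T (p == q) -> ∀ k -> nth p k ≡ nth q k
 nth-== p q t k = lem (nth p k) (nth q k) (tr (sy (tr (nth-⊞ p (mone · q) k) (+ˡ (nth p k) (nth-· mone q k)))) (nth-null (p ⊟ q) t k))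
  where
  l : ∀ a b -> a ≡ (a Z.+ mone Z.* b) Z.+ b
  l = arith
  lem : ∀ a b -> a Z.+ mone Z.* b ≡ + 0 -> a ≡ b
  lem a b e = tr (l a b) (tr (cong (Z._+ b) e) (Z.+-identityˡ b))

 infix 4 _≃p_
 _≃p_ : Poly -> Poly -> Set
 p ≃p q = ∀ k -> nth p k ≡ nth q k

 nth-⊠0 : ∀ a p q -> nth ((a ∷ p) ⊠ q) 0 ≡ a Z.* nth q 0
 nth-⊠0 a p q = tr (nth-⊞ (a · q) (+ 0 ∷ (p ⊠ q)) 0) (tr (Z.+-identityʳ _) (nth-· a q 0))

 nth-⊠s : ∀ a p q k -> nth ((a ∷ p) ⊠ q) (suc k) ≡ a Z.* nth q (suc k) Z.+ nth (p ⊠ q) k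
 nth-⊠s a p q k = tr (nth-⊞ (a · q) (+ 0 ∷ (p ⊠ q)) (suc k)) (cong (Z._+ nth (p ⊠ q) k) (nth-· a q (suc k)))

 nth-dil : ∀ c p k -> nth (dil c p) k ≡ (c Z.^ k) Z.* nth p k
 nth-dil c []      k       = sy (Z.*-zeroʳ (c Z.^ k))
 nth-dil c (a ∷ p) zero    = sy (Z.*-identityˡ a)
 nth-dil c (a ∷ p) (suc k) = tr (nth-· c (dil c p) k) (tr (*ˡ c (nth-dil c p k)) (sy (Z.*-assoc c (c Z.^ k) (nth p k))))

 nth-·⊠ : ∀ c p q k -> nth ((c · p) ⊠ q) k ≡ c Z.* nth (p ⊠ q) k
 nth-·⊠ c []      q k       = sy (Z.*-zeroʳ c)
 nth-·⊠ c (a ∷ p) q zero    = tr (nth-⊠0 (c Z.* a) (c · p) q) (tr (Z.*-assoc c a (nth q 0)) (*ˡ c (sy (nth-⊠0 a p q))))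
 nth-·⊠ c (a ∷ p) q (suc k) = tr (nth-⊠s (c Z.* a) (c · p) q k) (tr (cong₂ Z._+_ (Z.*-assoc c a (nth q (suc k))) (nth-·⊠ c p q k))
  (tr (sy (Z.*-distribˡ-+ c (a Z.* nth q (suc k)) (nth (p ⊠ q) k))) (*ˡ c (sy (nth-⊠s a p q k)))))

 dil-⊠ : ∀ c p q k -> (c Z.^ k) Z.* nth (p ⊠ q) k ≡ nth (dil c p ⊠ dil c q) k
 dil-⊠ c []      q k       = Z.*-zeroʳ (c Z.^ k)
 dil-⊠ c (a ∷ p) q zero    = tr (Z.*-identityˡ _) (tr (nth-⊠0 a p q) (sy (tr (nth-⊠0 a (c · dil c p) (dil c q)) (*ˡ a (tr (nth-dil c q 0) (Z.*-identityˡ _))))))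
 dil-⊠ c (a ∷ p) q (suc k) = begin
  c Z.* (c Z.^ k) Z.* nth ((a ∷ p) ⊠ q) (suc k)                              ≡⟨ *ˡ (c Z.* (c Z.^ k)) (nth-⊠s a p q k) ⟩
  c Z.* (c Z.^ k) Z.* (a Z.* nth q (suc k) Z.+ nth (p ⊠ q) k)                ≡⟨ lem c (c Z.^ k) a (nth q (suc k)) (nth (p ⊠ q) k) ⟩
  a Z.* (c Z.* (c Z.^ k) Z.* nth q (suc k)) Z.+ c Z.* ((c Z.^ k) Z.* nth (p ⊠ q) k)
   ≡⟨ cong₂ Z._+_ (*ˡ a (sy (nth-dil c q (suc k)))) (tr (*ˡ c (dil-⊠ c p q k)) (sy (nth-·⊠ c (dil c p) (dil c q) k))) ⟩
  a Z.* nth (dil c q) (suc k) Z.+ nth ((c · dil c p) ⊠ dil c q) k            ≡⟨ sy (nth-⊠s a (c · dil c p) (dil c q) k) ⟩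
  nth ((a ∷ (c · dil c p)) ⊠ dil c q) (suc k) ∎
  where
  open I.≡-Reasoning
  lem : ∀ c k a b d -> c Z.* k Z.* (a Z.* b Z.+ d) ≡ a Z.* (c Z.* k Z.* b) Z.+ c Z.* (k Z.* d)
  lem = arith

 ⊠-cong-nth : ∀ p pʹ q qʹ -> p ≃p pʹ -> q ≃p qʹ -> p ⊠ q ≃p pʹ ⊠ qʹ
 ⊠-cong-nth p pʹ q qʹ e f k = tr (conv p q k) (tr (conv-cong k (nth p) (nth pʹ) (nth q) (nth qʹ) e f) (sy (conv pʹ qʹ k)))
  where
  open PS using (_**_; **-cong; **-vanish)
  open PS using ()
  conv : ∀ p q k -> nth (p ⊠ q) k ≡ (nth p PS.** nth q) k
  conv []      q k       = sy (PS.**-vanish k {\_ -> + 0} {nth q} (\_ _ _ -> I.refl))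
  conv (a ∷ p) q zero    = nth-⊠0 a p q
  conv (a ∷ p) q (suc k) = tr (nth-⊠s a p q k) (+ˡ (a Z.* nth q (suc k)) (conv p q k))
  conv-cong : ∀ k f fʹ g gʹ -> (∀ i -> f i ≡ fʹ i) -> (∀ i -> g i ≡ gʹ i) -> (f PS.** g) k ≡ (fʹ PS.** gʹ) k
  conv-cong k f fʹ g gʹ e h = PS.**-cong {f} {fʹ} {g} {gʹ} e h k

 module Eval where
  open BaseL

  ev : Poly -> Carrier -> Carrier
  ev []      X = ι (+ 0)
  ev (a ∷ p) X = ι a + X * ev p X

  ev-⊞ : ∀ p q X -> ev (p ⊞ q) X ≈ ev p X + ev q X
  ev-⊞ []      q       X = solve 1 (\x -> x := :0 :+ x) refl (ev q X)
  ev-⊞ (a ∷ p) []      X = solve 1 (\x -> x := x :+ :0) refl (ev (a ∷ p) X)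
  ev-⊞ (a ∷ p) (b ∷ q) X = trans (+-cong (ι-+ a b) (*-congˡ (ev-⊞ p q X)))
   (solve 5 (\a b X p q -> (a :+ b) :+ X :* (p :+ q) := (a :+ X :* p) :+ (b :+ X :* q)) refl (ι a) (ι b) X (ev p X) (ev q X))

  ev-· : ∀ c p X -> ev (c · p) X ≈ ι c * ev p X
  ev-· c []      X = solve 1 (\c -> :0 := c :* :0) refl (ι c)
  ev-· c (a ∷ p) X = trans (+-cong (ι-* c a) (*-congˡ (ev-· c p X)))
   (solve 4 (\c a X p -> c :* a :+ X :* (c :* p) := c :* (a :+ X :* p)) refl (ι c) (ι a) X (ev p X))

  ev-⊟ : ∀ p q X -> ev (p ⊟ q) X ≈ ev p X - ev q X
  ev-⊟ p q X = trans (ev-⊞ p (mone · q) X) (trans (+-congˡ (ev-· mone q X)) (solve 2 (\p q -> p :+ con mone :* q := p :- q) refl (ev p X) (ev q X)))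

  ev-⊠ : ∀ p q X -> ev (p ⊠ q) X ≈ ev p X * ev q X
  ev-⊠ []      q X = solve 1 (\q -> :0 := :0 :* q) refl (ev q X)
  ev-⊠ (a ∷ p) q X = trans (ev-⊞ (a · q) (+ 0 ∷ (p ⊠ q)) X) (trans (+-cong (ev-· a q X) (+-congˡ (*-congˡ (ev-⊠ p q X))))
   (solve 4 (\a q X p -> a :* q :+ (:0 :+ X :* (p :* q)) := (a :+ X :* p) :* q) refl (ι a) (ev q X) X (ev p X)))

  ev-1 : ∀ X -> ev (+ 1 ∷ []) X ≈ ι (+ 1)
  ev-1 X = solve 1 (\X -> :1 :+ X :* :0 := :1) refl X

  ev-↑ : ∀ p n X -> ev (p ↑ n) X ≈ ev p X ^ n
  ev-↑ p zero    X = ev-1 X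
  ev-↑ p (suc n) X = trans (ev-⊠ p (p ↑ n) X) (*-congˡ (ev-↑ p n X))

  ev-null : ∀ p X -> T (null p) -> ev p X ≈ ι (+ 0)
  ev-null []      X t = refl
  ev-null (a ∷ p) X t = trans (+-cong (ι-≡ (isZero-sound a (∧-fst t))) (*-congˡ (ev-null p X (∧-snd {isZero a} t)))) (solve 1 (\X -> :0 :+ X :* :0 := :0) refl X)

  ev-== : ∀ p q X -> T (p == q) -> ev p X ≈ ev q X
  ev-== p q X t = sub-0 (trans (sym (ev-⊟ p q X)) (ev-null (p ⊟ q) X t))

  ev-xd-suc : ∀ k p X -> ev (xd (suc k) p) X ≈ ev (xd k p) X + ev p X
  ev-xd-suc k []      X = solve 0 (:0 := :0 :+ :0) refl
  ev-xd-suc k (a ∷ p) X = trans (+-cong (trans (ι-* (+ suc k) a) (*-congʳ (ι-+ (+ 1) (+ k)))) (*-congˡ (ev-xd-suc (suc k) p X)))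
   (trans (solve 5 (\k a X p q -> (:1 :+ k) :* a :+ X :* (q :+ p) := (k :* a :+ X :* q) :+ (a :+ X :* p)) refl (ι (+ k)) (ι a) X (ev p X) (ev (xd (suc k) p) X))
    (+-congʳ (+-congʳ (sym (ι-* (+ k) a)))))

  -- `xd 0 p` is X p′(X), so this is the chain rule in terms of the logarithmic derivative e of X.
  θ-ev : ∀ {X e} -> θ X ≈ X * e -> ∀ p -> θ (ev p X) ≈ e * ev (xd 0 p) X
  θ-ev {X} {e} h []      = trans (θ-ι (+ 0)) (solve 1 (\e -> :0 := e :* :0) refl e)
  θ-ev {X} {e} h (a ∷ p) = begin
   θ (ι a + X * ev p X)                                ≈⟨ trans (θ-+ (ι a) (X * ev p X)) (+-cong (θ-ι a) (trans (θ-* X (ev p X)) (+-cong (*-congʳ h) (*-congˡ (θ-ev h p))))) ⟩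
   ι (+ 0) + ((X * e) * ev p X + X * (e * ev (xd 0 p) X)) ≈⟨ solve 4 (\X e p r -> :0 :+ ((X :* e) :* p :+ X :* (e :* r)) := e :* (:0 :+ X :* (r :+ p))) refl X e (ev p X) (ev (xd 0 p) X) ⟩
   e * (ι (+ 0) + X * (ev (xd 0 p) X + ev p X))        ≈⟨ *-congˡ (+-congˡ (*-congˡ (sym (ev-xd-suc 0 p X)))) ⟩
   e * (ι (+ 0) + X * ev (xd 1 p) X) ∎

-- The pentagonal number theorem and its residue classes modulo 13.

module Pent where
 open import Data.Nat.Base as N using (ℕ; zero; suc; _∸_; _%_; _/_)
 open import Data.Nat.DivMod using (m≡m%n+[m/n]*n; m%n<n; [m+kn]%n≡m%n)
 import Data.Nat.Tactic.RingSolver as ℕR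
 open import Data.Bool.Base using (Bool; true; false; T)
 open import Data.Bool.ListAction using (all)
 open import Data.List.Base using (upTo)
 open import Data.List.Relation.Unary.All using (lookup)
 open import Data.List.Relation.Unary.All.Properties using (all⁺)
 open import Data.List.Membership.Propositional.Properties using (∈-upTo⁺)
 open import Relation.Binary.PropositionalEquality
 open import Function.Base using (_∘_)
 import Relation.Nullary
 open PS
 open Series
 open Classes using (sum<)
 open ZSolver
 open Geom
 open Euler

 R : ℕ -> ℕ -> PS
 R s zero    = con Z.1ℤ
 R s (suc k) = R s k ** one-minus (s N.+ suc k)

 R-first : ∀ s k -> R s (suc k) ≐ one-minus (suc s) ** R (suc s) k
 R-first s zero    = Pz.trans (Pz.*-comm (con Z.1ℤ) (one-minus (s N.+ 1))) (Pz.*-congʳ {con Z.1ℤ} \n -> cong (\k -> one-minus k n) (N.+-comm s 1))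
 R-first s (suc k) = Pz.trans (Pz.*-cong (R-first s k) (\n -> cong (\k -> one-minus k n) (N.+-suc s (suc k))))
  (Pz.*-assoc (one-minus (suc s)) (R (suc s) k) (one-minus (suc s N.+ suc k)))

 R-Eₘ : ∀ n -> R 0 n ≐ Eₘ n
 R-Eₘ zero    m = refl
 R-Eₘ (suc n) = Pz.*-congʳ {one-minus (suc n)} (R-Eₘ n)

 sgn : ℕ -> ℤ
 sgn zero    = + 1
 sgn (suc n) = Z.- sgn n

 tri : ℕ -> ℕ
 tri zero    = 0
 tri (suc n) = tri n N.+ suc n

 -- Shanks's finite form: the sum over s ≤ n of (-1)^s (q)_n/(q)_s q^(sn + s(s+1)/2) is a truncated
 -- pentagonal series. The quotient (q)_n/(q)_s is the product `R s (n ∸ s)`.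
 term : ℕ -> ℕ -> PS
 term n s = con (sgn s) ** (R s (n ∸ s) ** (mono (s N.* n) ** mono (tri s)))

 left : ℕ -> ℕ -> PS
 left N s = (⊖ con (sgn s)) ** (R s (N ∸ s) ** (mono (suc s N.* suc N) ** mono (tri s)))

 mono-≡ : ∀ {k l} -> k ≡ l -> mono k ≐ mono l
 mono-≡ refl _ = refl

 R-≡ : ∀ s {k l} -> k ≡ l -> R s k ≐ R s l
 R-≡ s refl _ = refl

 R-last : ∀ {s N} -> s N.≤ N -> R s (suc N ∸ s) ≐ R s (N ∸ s) ** one-minus (suc N)
 R-last {s} {N} s≤ n = trans (R-≡ s (N.+-∸-assoc 1 s≤) n)
  (cong (\k -> (R s (N ∸ s) ** one-minus k) n) (trans (N.+-suc s (N ∸ s)) (cong suc (N.m+[n∸m]≡n s≤))))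

 -- Replacing N by N + 1 changes a partial sum only by the boundary term `left`; the induction step
 -- uses `R-last` and `R-first` to split off the last and the first factor of the products.
 telescope : ∀ N s -> s N.≤ N -> sum< (suc s) (term (suc N)) ≐ sum< (suc s) (term N) ⊕ left N s
 telescope N zero _ = Pz.trans (Pz.+-congˡ {con Z.0ℤ} (Pz.*-congˡ {con (+ 1)} (Pz.*-congʳ {con (+ 1) ** con (+ 1)} (R-last {0} {N} N.z≤n))))
  (Pz.trans (shanks-base psZ (R 0 N) (mono (suc N))) (Pz.+-congˡ {con Z.0ℤ ⊕ term N 0}
   (Pz.*-congˡ {⊖ con (+ 1)} (Pz.*-congˡ {R 0 N} (Pz.*-congʳ {con (+ 1)} (mono-≡ {suc N} (sym (N.+-identityʳ (suc N)))))))))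
 telescope N (suc s) s< = begin
  sum< (suc s) (term (suc N)) ⊕ term (suc N) (suc s)
   ≈⟨ +-cong (telescope N s (N.<⇒≤ s<)) (*-cong {con (sgn (suc s))} (con-⊖ c) (*-cong (R-last {suc s} s<) (*-cong mdb mab))) ⟩
  (sum< (suc s) (term N) ⊕ left N s) ⊕ (⊖ con c) ** ((Rʹ ** one-minus (suc N)) ** ((d ** b) ** (a ** b)))
   ≈⟨ +-congʳ {(⊖ con c) ** ((Rʹ ** one-minus (suc N)) ** ((d ** b) ** (a ** b)))} (+-congˡ {sum< (suc s) (term N)} (*-congˡ {⊖ con c} (*-cong Rs (*-congʳ {a} mdb)))) ⟩
  (sum< (suc s) (term N) ⊕ (⊖ con c) ** ((one-minus (suc s) ** Rʹ) ** ((d ** b) ** a))) ⊕ (⊖ con c) ** ((Rʹ ** one-minus (suc N)) ** ((d ** b) ** (a ** b)))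
   ≈⟨ shanks-step psZ (sum< (suc s) (term N)) (con c) Rʹ a b d v ⟩
  (sum< (suc s) (term N) ⊕ (⊖ con c) ** (Rʹ ** (d ** (a ** b)))) ⊕ (⊖ (⊖ con c)) ** (Rʹ ** ((v ** (d ** b)) ** (a ** b)))
   ≈⟨ +-cong (+-congˡ {sum< (suc s) (term N)} (*-cong (Pz.sym (con-⊖ c)) (*-congˡ {Rʹ} (*-congˡ {d} (Pz.sym mab)))))
     (*-cong (-‿cong (Pz.sym (con-⊖ c))) (*-congˡ {Rʹ} (*-cong (Pz.sym (Pz.trans (mono-+ (suc N) (suc s N.* suc N)) (*-congˡ {v} mdb))) (Pz.sym mab)))) ⟩
  (sum< (suc s) (term N) ⊕ term N (suc s)) ⊕ left N (suc s) ∎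
  where
  open Pz using (begin_; step-≈-⟩; _∎; +-cong; +-congˡ; +-congʳ; *-cong; *-congˡ; *-congʳ; -‿cong)
  c = sgn s
  Rʹ = R (suc s) (N ∸ suc s)
  a = mono (tri s)
  b = mono (suc s)
  d = mono (suc s N.* N)
  v = mono (suc N)
  mdb : mono (suc s N.* suc N) ≐ d ** b
  mdb n = trans (mono-≡ (trans (N.*-suc (suc s) N) (N.+-comm (suc s) (suc s N.* N))) n) (mono-+ (suc s N.* N) (suc s) n)
  mab : mono (tri (suc s)) ≐ a ** b
  mab = mono-+ (tri s) (suc s)
  Rs : R s (N ∸ s) ≐ one-minus (suc s) ** Rʹ
  Rs n = trans (R-≡ s (N.+-∸-assoc 1 s<) n) (R-first s (N ∸ suc s) n)

 pm pp : ℕ -> ℕ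
 pm n = suc n N.* suc n N.+ tri n
 pp n = n N.* n N.+ tri n

 -- pm n and pp (n + 1) are the generalised pentagonal numbers of index ±(n + 1).
 Pen : ℕ -> PS
 Pen zero    = con (+ 1)
 Pen (suc n) = Pen n ⊕ con (sgn (suc n)) ** (mono (pm n) ⊕ mono (pp (suc n)))

 shanks : ∀ n -> sum< (suc n) (term n) ≐ Pen n
 shanks zero zero    = refl
 shanks zero (suc n) = trans (Z.+-identityˡ _) (trans (**-con (+ 1) (con (+ 1) ** (con (+ 1) ** con (+ 1))) (suc n)) (trans (Z.*-identityˡ _)
  (trans (**-con (+ 1) (con (+ 1) ** con (+ 1)) (suc n)) (trans (Z.*-identityˡ _) (**-con (+ 1) (con (+ 1)) (suc n))))))
 shanks (suc N) = begin
  sum< (suc N) (term (suc N)) ⊕ term (suc N) (suc N)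
   ≈⟨ +-cong (telescope N N N.≤-refl) (*-cong {con (sgn (suc N))} (con-⊖ (sgn N)) (*-congʳ {mono (suc N N.* suc N) ** mono (tri (suc N))} (R-≡ (suc N) (N.n∸n≡0 N)))) ⟩
  (sum< (suc N) (term N) ⊕ left N N) ⊕ (⊖ con (sgn N)) ** (con (+ 1) ** (mono (suc N N.* suc N) ** mono (tri (suc N))))
   ≈⟨ +-congʳ {(⊖ con (sgn N)) ** (con (+ 1) ** (mono (suc N N.* suc N) ** mono (tri (suc N))))} (+-cong (shanks N) (*-congˡ {⊖ con (sgn N)} (*-congʳ {mono (suc N N.* suc N) ** mono (tri N)} (R-≡ N (N.n∸n≡0 N))))) ⟩
  (Pen N ⊕ (⊖ con (sgn N)) ** (con (+ 1) ** (mono (suc N N.* suc N) ** mono (tri N)))) ⊕ (⊖ con (sgn N)) ** (con (+ 1) ** (mono (suc N N.* suc N) ** mono (tri (suc N))))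
   ≈⟨ shanks-last psZ (Pen N) (con (sgn N)) (mono (suc N N.* suc N)) (mono (tri N)) (mono (suc N N.* suc N)) (mono (tri (suc N))) ⟩
  Pen N ⊕ (⊖ con (sgn N)) ** (mono (suc N N.* suc N) ** mono (tri N) ⊕ mono (suc N N.* suc N) ** mono (tri (suc N)))
   ≈⟨ +-congˡ {Pen N} (*-cong (Pz.sym (con-⊖ (sgn N))) (+-cong (Pz.sym (mono-+ (suc N N.* suc N) (tri N))) (Pz.sym (mono-+ (suc N N.* suc N) (tri (suc N)))))) ⟩
  Pen (suc N) ∎
  where open Pz using (begin_; step-≈-⟩; _∎; +-cong; +-congˡ; +-congʳ; *-cong; *-congˡ; *-congʳ; -‿cong)

 mono-off : ∀ k n -> n ≢ k -> mono k n ≡ Z.0ℤ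
 mono-off zero    zero    ne = Relation.Nullary.contradiction refl ne
 mono-off zero    (suc n) ne = refl
 mono-off (suc k) zero    ne = refl
 mono-off (suc k) (suc n) ne = mono-off k n (ne ∘ cong suc)

 -- In degree n only the summand s = 0 of the finite identity survives, and this summand is the
 -- product up to n.
 E-Pen : ∀ n -> E n ≡ Pen n n
 E-Pen n = trans (sym (trans (first n) (trans (trans (**-con (+ 1) (R 0 n ** (con (+ 1) ** con (+ 1))) n) (Z.*-identityˡ _))
   (trans (trans (**-comm (R 0 n) (con (+ 1) ** con (+ 1)) n) (trans (**-assoc (con (+ 1)) (con (+ 1)) (R 0 n) n) (trans (**-con (+ 1) (con (+ 1) ** R 0 n) n) (trans (Z.*-identityˡ _) (trans (**-con (+ 1) (R 0 n) n) (Z.*-identityˡ _))))))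
    (R-Eₘ n n))))) (shanks n n)
  where
  high : ∀ s -> term n (suc s) n ≡ Z.0ℤ
  high s = trans (**-con (sgn (suc s)) _ n) (trans (*ˡ (sgn (suc s)) (trans (**-comm (R (suc s) (n ∸ suc s)) (mono (suc s N.* n) ** mono (tri (suc s))) n)
   (**-low (suc s N.* n N.+ tri (suc s)) 0 (mono (suc s N.* n) ** mono (tri (suc s))) (R (suc s) (n ∸ suc s))
    (\i i< -> trans (sym (mono-+ (suc s N.* n) (tri (suc s)) i)) (mono-off _ i (N.<⇒≢ i<))) (\_ ()) n
    (subst (n N.<_) (sym (N.+-identityʳ _)) (subst (N._< suc s N.* n N.+ tri (suc s)) (N.+-identityʳ n)
     (N.+-mono-≤-< (N.m≤m+n n (s N.* n)) (N.<-≤-trans (N.s≤s N.z≤n) (N.m≤n+m (suc s) (tri s))))))))) (Z.*-zeroʳ (sgn (suc s))))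
  first : ∀ k -> sum< (suc k) (term n) n ≡ term n 0 n
  first zero    = trans (cong (Z._+ term n 0 n) (zero0 n)) (Z.+-identityˡ _)
   where
   zero0 : ∀ n -> con Z.0ℤ n ≡ Z.0ℤ
   zero0 zero    = refl
   zero0 (suc _) = refl
  first (suc k) = trans (cong₂ Z._+_ (first k) (high k)) (Z.+-identityʳ _)

 Pen-step : ∀ n m -> m ≢ pm n -> m ≢ pp (suc n) -> Pen (suc n) m ≡ Pen n m
 Pen-step n m a b = trans (+ˡ (Pen n m) (trans (**-con (sgn (suc n)) (mono (pm n) ⊕ mono (pp (suc n))) m)
  (trans (*ˡ (sgn (suc n)) (cong₂ Z._+_ (mono-off (pm n) m a) (mono-off (pp (suc n)) m b))) (Z.*-zeroʳ (sgn (suc n)))))) (Z.+-identityʳ _)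

 E-Penʹ : ∀ N n -> n N.≤ N -> E n ≡ Pen N n
 E-Penʹ N n n≤ = trans (E-Pen n) (stable Pen (\m k k≤ -> Pen-step m k
  (N.<⇒≢ (N.<-≤-trans (N.s≤s k≤) (N.≤-trans (N.m≤m*n (suc m) (suc m)) (N.m≤m+n _ (tri m)))))
  (N.<⇒≢ (N.<-≤-trans (N.s≤s k≤) (N.≤-trans (N.m≤m*n (suc m) (suc m)) (N.m≤m+n _ (tri (suc m))))))) N n n≤)

 tri-13 : ∀ k -> tri (13 N.+ k) ≡ tri k N.+ (13 N.* k N.+ 91)
 tri-13 k = go (tri k) k
  where
  go : ∀ t k -> t N.+ (1 N.+ k) N.+ (2 N.+ k) N.+ (3 N.+ k) N.+ (4 N.+ k) N.+ (5 N.+ k) N.+ (6 N.+ k) N.+ (7 N.+ k) N.+ (8 N.+ k) N.+ (9 N.+ k)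
    N.+ (10 N.+ k) N.+ (11 N.+ k) N.+ (12 N.+ k) N.+ (13 N.+ k) ≡ t N.+ (13 N.* k N.+ 91)
  go = ℕR.solve-∀

 pm-13 : ∀ k -> pm (13 N.+ k) ≡ pm k N.+ (3 N.* k N.+ 22) N.* 13
 pm-13 k = trans (cong ((14 N.+ k) N.* (14 N.+ k) N.+_) (tri-13 k)) (go (tri k) k)
  where
  go : ∀ t k -> (14 N.+ k) N.* (14 N.+ k) N.+ (t N.+ (13 N.* k N.+ 91)) ≡ (1 N.+ k) N.* (1 N.+ k) N.+ t N.+ (3 N.* k N.+ 22) N.* 13
  go = ℕR.solve-∀

 pp-13 : ∀ k -> pp (13 N.+ k) ≡ pp k N.+ (3 N.* k N.+ 20) N.* 13
 pp-13 k = trans (cong ((13 N.+ k) N.* (13 N.+ k) N.+_) (tri-13 k)) (go (tri k) k)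
  where
  go : ∀ t k -> (13 N.+ k) N.* (13 N.+ k) N.+ (t N.+ (13 N.* k N.+ 91)) ≡ k N.* k N.+ t N.+ (3 N.* k N.+ 20) N.* 13
  go = ℕR.solve-∀

 residue-13 : ∀ (f c : ℕ -> ℕ) -> (∀ k -> f (13 N.+ k) ≡ f k N.+ c k N.* 13) -> ∀ r j -> f (r N.+ j N.* 13) % 13 ≡ f r % 13
 residue-13 f c h r zero    = cong (\k -> f k % 13) (N.+-identityʳ r)
 residue-13 f c h r (suc j) = trans (cong (\k -> f k % 13) (+13 r (j N.* 13)))
  (trans (cong (_% 13) (h (r N.+ j N.* 13))) (trans ([m+kn]%n≡m%n (f (r N.+ j N.* 13)) (c (r N.+ j N.* 13)) 13) (residue-13 f c h r j)))

 -- The seven classes r for which 24r + 1 is a square modulo 13.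
 pentagonal : ℕ -> Bool
 pentagonal 0  = true
 pentagonal 1  = true
 pentagonal 2  = true
 pentagonal 5  = true
 pentagonal 7  = true
 pentagonal 9  = true
 pentagonal 12 = true
 pentagonal _  = false

 below13 : ∀ (b : ℕ -> Bool) -> T (all b (upTo 13)) -> ∀ r -> r N.< 13 -> T (b r)
 below13 b t r r< = lookup (all⁺ b (upTo 13) t) (∈-upTo⁺ r<)

 pentagonal-pm : ∀ k -> T (pentagonal (pm k % 13))
 pentagonal-pm k = subst (\z -> T (pentagonal z)) (sym (trans (cong (\z -> pm z % 13) (m≡m%n+[m/n]*n k 13)) (residue-13 pm (\k -> 3 N.* k N.+ 22) pm-13 (k % 13) (k / 13))))
  (below13 (\r -> pentagonal (pm r % 13)) _ (k % 13) (m%n<n k 13))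

 pentagonal-pp : ∀ k -> T (pentagonal (pp k % 13))
 pentagonal-pp k = subst (\z -> T (pentagonal z)) (sym (trans (cong (\z -> pp z % 13) (m≡m%n+[m/n]*n k 13)) (residue-13 pp (\k -> 3 N.* k N.+ 20) pp-13 (k % 13) (k / 13))))
  (below13 (\r -> pentagonal (pp r % 13)) _ (k % 13) (m%n<n k 13))

 E-support : ∀ m -> pentagonal (m % 13) ≡ false -> E m ≡ Z.0ℤ
 E-support m h = trans (E-Pen m) (go m)
  where
  off : ∀ {z} -> T (pentagonal (z % 13)) -> m ≢ z
  off t refl = subst T h t
  m≢0 : m ≢ 0
  m≢0 = off {0} _
  go : ∀ n -> Pen n m ≡ Z.0ℤ
  go zero    = mono-off 0 m m≢0
  go (suc n) = trans (Pen-step n m (off {pm n} (pentagonal-pm n)) (off {pp (suc n)} (pentagonal-pp (suc n)))) (go n)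

 sgn-13 : ∀ k -> sgn (13 N.+ k) ≡ Z.- sgn k
 sgn-13 k = lem (sgn k)
  where
  lem : ∀ a -> Z.- Z.- Z.- Z.- Z.- Z.- Z.- Z.- Z.- Z.- Z.- Z.- Z.- a ≡ Z.- a
  lem = arith

 sgn-*13 : ∀ j -> sgn (j N.* 13) ≡ sgn j
 sgn-*13 zero    = refl
 sgn-*13 (suc j) = trans (sgn-13 (j N.* 13)) (cong Z.-_ (sgn-*13 j))

 pp-7 : ∀ j -> pp (2 N.+ j N.* 13) ≡ 7 N.+ pp j N.* 13 N.* 13
 pp-7 zero    = refl
 pp-7 (suc j) = trans (pp-13 (2 N.+ j N.* 13)) (trans (cong (N._+ (3 N.* (2 N.+ j N.* 13) N.+ 20) N.* 13) (pp-7 j)) (go (tri j) j))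
  where
  go : ∀ t j -> 7 N.+ (j N.* j N.+ t) N.* 13 N.* 13 N.+ (3 N.* (2 N.+ j N.* 13) N.+ 20) N.* 13 ≡
    7 N.+ ((1 N.+ j) N.* (1 N.+ j) N.+ (t N.+ (1 N.+ j))) N.* 13 N.* 13
  go = ℕR.solve-∀

 pm-7 : ∀ j -> pm (10 N.+ j N.* 13) ≡ 7 N.+ pm j N.* 13 N.* 13
 pm-7 zero    = refl
 pm-7 (suc j) = trans (pm-13 (10 N.+ j N.* 13)) (trans (cong (N._+ (3 N.* (10 N.+ j N.* 13) N.+ 22) N.* 13) (pm-7 j)) (go (tri j) j))
  where
  go : ∀ t j -> 7 N.+ ((1 N.+ j) N.* (1 N.+ j) N.+ t) N.* 13 N.* 13 N.+ (3 N.* (10 N.+ j N.* 13) N.+ 22) N.* 13 ≡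
    7 N.+ ((2 N.+ j) N.* (2 N.+ j) N.+ (t N.+ (1 N.+ j))) N.* 13 N.* 13
  go = ℕR.solve-∀

 sect-mono : ∀ k a m -> k ≡ 7 N.+ a N.* 13 -> mono k (7 N.+ m N.* 13) ≡ mono a m
 sect-mono _ a m refl with m N.≟ a
 ... | Relation.Nullary.yes refl = trans (one (7 N.+ m N.* 13)) (sym (one m))
  where
  one : ∀ k -> mono k k ≡ + 1
  one zero    = refl
  one (suc k) = one k
 ... | Relation.Nullary.no ne = trans (mono-off (7 N.+ a N.* 13) _ \e -> ne (N.*-cancelʳ-≡ m a 13 (N.+-cancelˡ-≡ 7 _ _ e))) (sym (mono-off a m ne))

 not7 : ∀ {k} m -> k % 13 ≢ 7 -> 7 N.+ m N.* 13 ≢ k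
 not7 m ne refl = ne ([m+kn]%n≡m%n 7 m 13)

 -- Class 7 is met only through `pp (2 + 13j)` = 7 + 169 `pp j` and `pm (10 + 13j)` = 7 + 169
 -- `pm j`; the signs agree because 13 is odd. Stopping at index 13J misses the partner of the last
 -- term of `Pen J`, since `pp (2 + 13J)` lies beyond; this is the correction term.
 class7 : ∀ J m -> Pen (J N.* 13) (7 N.+ m N.* 13) ≡ Vp (Pen J) m Z.- sgn J Z.* mono (pp J N.* 13) m
 class7 zero    m = trans (mono-off 0 (7 N.+ m N.* 13) (\())) (sym (trans (cong₂ Z._-_ (V-con (+ 1) m) (Z.*-identityˡ _)) (Z.+-inverseʳ (con (+ 1) m))))
 class7 (suc J) m = begin
  Pen (13 N.+ n) i                                ≡⟨ trans (drop 12 (\()) (\())) (drop 11 (\()) (\())) ⟩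
  Pen (11 N.+ n) i                                ≡⟨ +ˡ (Pen (10 N.+ n) i) (trans (**-con (sgn (11 N.+ n)) _ i) (*ˡ (sgn (11 N.+ n)) (+ˡ (mono (pm (10 N.+ n)) i) (gone pp (\k -> 3 N.* k N.+ 20) pp-13 11 (\()))))) ⟩
  Pen (10 N.+ n) i Z.+ sgn (11 N.+ n) Z.* (mono (pm (10 N.+ n)) i Z.+ + 0)
   ≡⟨ cong₂ (\x y -> x Z.+ sgn (11 N.+ n) Z.* (y Z.+ + 0)) (trans (drop 9 (\()) (\())) (trans (drop 8 (\()) (\())) (trans (drop 7 (\()) (\())) (trans (drop 6 (\()) (\()))
     (trans (drop 5 (\()) (\())) (trans (drop 4 (\()) (\())) (trans (drop 3 (\()) (\())) (drop 2 (\()) (\())))))))))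
     (sect-mono (pm (10 N.+ n)) (pm J N.* 13) m (pm-7 J)) ⟩
  Pen (2 N.+ n) i Z.+ sgn (11 N.+ n) Z.* (mono (pm J N.* 13) m Z.+ + 0)
   ≡⟨ cong (Z._+ sgn (11 N.+ n) Z.* (mono (pm J N.* 13) m Z.+ + 0)) (trans (+ˡ (Pen (1 N.+ n) i) (trans (**-con (sgn (2 N.+ n)) _ i) (*ˡ (sgn (2 N.+ n))
     (cong₂ Z._+_ (gone pm (\k -> 3 N.* k N.+ 22) pm-13 1 (\())) (sect-mono (pp (2 N.+ n)) (pp J N.* 13) m (pp-7 J))))))
     (cong (Z._+ sgn (2 N.+ n) Z.* (+ 0 Z.+ mono (pp J N.* 13) m)) (trans (drop 0 (\()) (\())) (class7 J m)))) ⟩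
  (Vp (Pen J) m Z.- sgn J Z.* B) Z.+ sgn (2 N.+ n) Z.* (+ 0 Z.+ B) Z.+ sgn (11 N.+ n) Z.* (A Z.+ + 0)
   ≡⟨ lem (Vp (Pen J) m) (sgn J) (sgn n) A B C (sgn-*13 J) ⟩
  (Vp (Pen J) m Z.+ Z.- sgn J Z.* (A Z.+ C)) Z.- (Z.- sgn J) Z.* C
   ≡⟨ cong (Z._- (Z.- sgn J) Z.* C) (sym (trans (V-⊕ (Pen J) _ m) (+ˡ (Vp (Pen J) m) (trans (V-** (con (sgn (suc J))) (mono (pm J) ⊕ mono (pp (suc J))) m)
     (trans (**-cong {g = Vp (mono (pm J) ⊕ mono (pp (suc J)))} (V-con (sgn (suc J))) (\_ -> refl) m)
     (trans (**-con (sgn (suc J)) (Vp (mono (pm J) ⊕ mono (pp (suc J)))) m) (*ˡ (sgn (suc J)) (trans (V-⊕ (mono (pm J)) (mono (pp (suc J))) m) (cong₂ Z._+_ (V-mono (pm J) m) (V-mono (pp (suc J)) m)))))))))) ⟩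
  Vp (Pen (suc J)) m Z.- sgn (suc J) Z.* C ∎
  where
  open ≡-Reasoning
  n = J N.* 13
  i = 7 N.+ m N.* 13
  A = mono (pm J N.* 13) m
  B = mono (pp J N.* 13) m
  C = mono (pp (suc J) N.* 13) m
  gone : ∀ (f c : ℕ -> ℕ) -> (∀ k -> f (13 N.+ k) ≡ f k N.+ c k N.* 13) -> ∀ r -> f r % 13 ≢ 7 -> mono (f (r N.+ n)) i ≡ + 0
  gone f c h r ne = mono-off (f (r N.+ n)) i (not7 m (\e -> ne (trans (sym (residue-13 f c h r J)) e)))
  drop : ∀ r -> pm r % 13 ≢ 7 -> pp (suc r) % 13 ≢ 7 -> Pen (suc r N.+ n) i ≡ Pen (r N.+ n) i
  drop r a b = Pen-step (r N.+ n) i (not7 m (\e -> a (trans (sym (residue-13 pm (\k -> 3 N.* k N.+ 22) pm-13 r J)) e)))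
   (not7 m (\e -> b (trans (sym (residue-13 pp (\k -> 3 N.* k N.+ 20) pp-13 (suc r) J)) e)))
  lem : ∀ v s sʹ a b c -> sʹ ≡ s -> (v Z.- s Z.* b) Z.+ (Z.- Z.- sʹ) Z.* (+ 0 Z.+ b) Z.+ (Z.- Z.- Z.- Z.- Z.- Z.- Z.- Z.- Z.- Z.- Z.- sʹ) Z.* (a Z.+ + 0) ≡
     (v Z.+ Z.- s Z.* (a Z.+ c)) Z.- (Z.- s) Z.* c
  lem v s _ a b c refl = go v s a b c
   where
   go : ∀ v s a b c -> (v Z.- s Z.* b) Z.+ (Z.- Z.- s) Z.* (+ 0 Z.+ b) Z.+ (Z.- Z.- Z.- Z.- Z.- Z.- Z.- Z.- Z.- Z.- Z.- s) Z.* (a Z.+ + 0) ≡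
     (v Z.+ Z.- s Z.* (a Z.+ c)) Z.- (Z.- s) Z.* c
   go = arith

 V-agree : ∀ f g m -> (∀ w -> w N.≤ m -> f w ≡ g w) -> Vp f m ≡ Vp g m
 V-agree f g m h = subst (\k -> Vp f k ≡ Vp g k) (sym (m≡m%n+[m/n]*n m 13)) (go (m % 13) (m%n<n m 13))
  where
  go : ∀ ρ -> ρ N.< 13 -> Vp f (ρ N.+ m / 13 N.* 13) ≡ Vp g (ρ N.+ m / 13 N.* 13)
  go zero    _  = trans (sect-V0 f (m / 13)) (trans (h (m / 13) (N.≤-trans (N.m≤m*n (m / 13) 13) (subst (m / 13 N.* 13 N.≤_) (sym (m≡m%n+[m/n]*n m 13)) (N.m≤n+m _ (m % 13))))) (sym (sect-V0 g (m / 13))))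
  go (suc ρ) ρ< = trans (sect-V ρ ρ< f (m / 13)) (sym (sect-V ρ ρ< g (m / 13)))

 -- For η = q^(1/24) (q;q)_∞ the statement is that the terms q^((24n+1)/24) with 24n + 1 divisible
 -- by 13 add up to η(169τ). The index m + 1 pushes the correction term of `class7` beyond degree m.
 E-class7 : sect 7 E ≐ Vp E
 E-class7 m = begin
  E (7 N.+ m N.* 13)                                      ≡⟨ E-Penʹ (suc m N.* 13) (7 N.+ m N.* 13) (N.+-monoˡ-≤ (m N.* 13) (N.≤ᵇ⇒≤ 7 13 _)) ⟩
  Pen (suc m N.* 13) (7 N.+ m N.* 13)                     ≡⟨ class7 (suc m) m ⟩
  Vp (Pen (suc m)) m Z.- sgn (suc m) Z.* mono (pp (suc m) N.* 13) m ≡⟨ cong₂ (\x y -> x Z.- sgn (suc m) Z.* y)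
    (V-agree (Pen (suc m)) E m (\w w≤ -> sym (E-Penʹ (suc m) w (N.m≤n⇒m≤1+n w≤)))) (mono-off (pp (suc m) N.* 13) m (N.<⇒≢ big)) ⟩
  Vp E m Z.- sgn (suc m) Z.* + 0                          ≡⟨ lem (Vp E m) (sgn (suc m)) ⟩
  Vp E m ∎
  where
  open ≡-Reasoning
  lem : ∀ a s -> a Z.- s Z.* + 0 ≡ a
  lem = arith
  big : m N.< pp (suc m) N.* 13
  big = N.<-≤-trans (N.n<1+n m) (N.≤-trans (N.m≤m*n (suc m) (suc m)) (N.≤-trans (N.m≤m+n _ (tri (suc m))) (N.m≤m*n (pp (suc m)) 13)))

-- Verified initial segments of expansions.

module Num where
 open import Data.List.Base using (List; []; _∷_; take; upTo)
 open import Data.Bool.Base using (Bool; T)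
 open import Data.Bool.ListAction using (all)
 open PS using (PS; _⊕_; _**_; _≐_; +ˡ; *ˡ; **-cong-at; **-vanish; shift; **-con; mono; mono-**) renaming (con to conp; θ to θp)
 open Series using (at; Vp; V-split)
 open LInt
 open Base
 open Poly

 nth-take : ∀ N p k -> k N.< N -> nth (take N p) k ≡ nth p k
 nth-take (suc N) []      k       k<         = I.refl
 nth-take (suc N) (a ∷ p) zero    k<         = I.refl
 nth-take (suc N) (a ∷ p) (suc k) (N.s≤s k<) = nth-take N p k k<

 ⊠-** : ∀ p q k -> nth (p ⊠ q) k ≡ (nth p ** nth q) k
 ⊠-** []      q k       = sy (**-vanish k {\_ -> + 0} {nth q} (\_ _ _ -> I.refl))
 ⊠-** (a ∷ p) q zero    = nth-⊠0 a p q
 ⊠-** (a ∷ p) q (suc k) = tr (nth-⊠s a p q k) (+ˡ (a Z.* nth q (suc k)) (⊠-** p q k))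

 shiftl : ℕ -> Poly -> Poly
 shiftl zero    p = p
 shiftl (suc k) p = + 0 ∷ shiftl k p

 nth-shift : ∀ k p n -> nth (shiftl k p) n ≡ shift k (nth p) n
 nth-shift zero    p n       = I.refl
 nth-shift (suc k) p zero    = I.refl
 nth-shift (suc k) p (suc n) = nth-shift k p n

 spreadl : Poly -> Poly
 spreadl []      = []
 spreadl (a ∷ p) = a ∷ shiftl 12 (spreadl p)

 nth-xd : ∀ j p k -> nth (xd j p) k ≡ + (j N.+ k) Z.* nth p k
 nth-xd j []      k       = sy (Z.*-zeroʳ (+ (j N.+ k)))
 nth-xd j (a ∷ p) zero    = cong (\i -> + i Z.* a) (sy (N.+-identityʳ j))
 nth-xd j (a ∷ p) (suc k) = tr (nth-xd (suc j) p k) (cong (\i -> + i Z.* nth p k) (sy (N.+-suc j k)))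

 module Numeric where
  open BaseL

  -- X is a series without negative exponents; entries of l from position N on carry no information.
  record Num (N : ℕ) (X : Carrier) (l : Poly) : Set where
   constructor numeric
   field
    series : PS
    is     : emb series ≈ X
    agrees : ∀ k -> k N.< N -> series k ≡ nth l k

  num-co : ∀ {N X l} -> Num N X l -> ∀ k -> k N.< N -> co X (+ k) ≡ nth l k
  num-co (numeric f e h) k k< = tr (co-cong (sym e) (+ k)) (tr (co-emb f (+ k)) (h k k<))

  num-low : ∀ {N X l} -> Num N X l -> Low X (+ 0)
  num-low (numeric f e h) = Low-cong e (Low-emb f)

  num-≈ : ∀ {N X Y l} -> X ≈ Y -> Num N X l -> Num N Y l
  num-≈ p (numeric f e h) = numeric f (trans e p) h

  num-emb : ∀ N f l -> (∀ k -> k N.< N -> f k ≡ nth l k) -> Num N (emb f) l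
  num-emb N f l h = numeric f refl h

  check : (PS) -> Poly -> ℕ -> Bool
  check f l N = all (\k -> isZero (f k Z.- nth l k)) (upTo N)

  num-check : ∀ N f g l -> f ≐ g -> T (check g l N) -> Num N (emb f) l
  num-check N f g l e t = num-emb N f l \k k< -> tr (e k)
   (Z.i-j≡0⇒i≡j (g k) (nth l k) (isZero-sound _ (lookup (all⁺ (\k -> isZero (g k Z.- nth l k)) (upTo N) t) (∈-upTo⁺ k<))))
   where
   open import Data.List.Relation.Unary.All using (lookup)
   open import Data.List.Relation.Unary.All.Properties using (all⁺)
   open import Data.List.Membership.Propositional.Properties using (∈-upTo⁺)

  num-+ : ∀ {N X Y l m} -> Num N X l -> Num N Y m -> Num N (X + Y) (l ⊞ m)
  num-+ {l = l} {m} (numeric f e h) (numeric g d j) = numeric (f ⊕ g) (trans (emb-⊕ f g) (+-cong e d)) \k k< -> tr (cong₂ Z._+_ (h k k<) (j k k<)) (sy (nth-⊞ l m k))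

  num-* : ∀ {N X Y l m} -> Num N X l -> Num N Y m -> Num N (X * Y) (take N (l ⊠ m))
  num-* {N} {l = l} {m} (numeric f e h) (numeric g d j) = numeric (f ** g) (trans (emb-** f g) (*-cong e d)) \k k< ->
   tr (**-cong-at k {f} {nth l} {g} {nth m} \a b s -> cong₂ Z._*_ (h a (N.≤-<-trans (I.subst (a N.≤_) s (N.m≤m+n a b)) k<)) (j b (N.≤-<-trans (I.subst (b N.≤_) s (N.m≤n+m b a)) k<)))
    (tr (sy (⊠-** l m k)) (sy (nth-take N (l ⊠ m) k k<)))

  num-ι : ∀ {N} c -> Num N (ι c) (c ∷ [])
  num-ι c = numeric (conp c) (emb-con c) \ { zero _ -> I.refl ; (suc k) _ -> I.refl }

  num-ι* : ∀ {N X l} c -> Num N X l -> Num N (ι c * X) (c · l)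
  num-ι* {l = l} c (numeric f e h) = numeric (conp c ** f) (trans (emb-** (conp c) f) (*-cong (emb-con c) e)) \k k< -> tr (**-con c f k) (tr (*ˡ c (h k k<)) (sy (nth-· c l k)))

  num-θ : ∀ {N X l} -> Num N X l -> Num N (θ X) (xd 0 l)
  num-θ {l = l} (numeric f e h) = numeric (θp f) (trans (emb-θ f) (θ-cong e)) \k k< -> tr (*ˡ (+ k) (h k k<)) (sy (nth-xd 0 l k))

  num-q : ∀ {N X l} k -> Num N X l -> Num N (q (+ k) * X) (take N (shiftl k l))
  num-q {N} {l = l} k (numeric f e h) = numeric (mono k ** f) (trans (emb-** (mono k) f) (*-cong (embq k) e)) \n n< ->
    tr (mono-** k f n) (tr (go k f l n n< h) (tr (sy (nth-shift k l n)) (sy (nth-take N (shiftl k l) n n<))))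
   where
   embq : ∀ k -> emb (mono k) ≈ q (+ k)
   embq k = co-ext \z -> tr (co-emb (mono k) z) (tr (lem z) (sy (q-co (+ k) z)))
    where
    open Series using (at-shift)
    open import Data.Integer.Tactic.RingSolver using () renaming (solve-∀ to arith)
    l1 : ∀ z k -> z ≡ z Z.- k Z.+ k
    l1 = arith
    lem : ∀ z -> at (mono k) z ≡ at (conp (+ 1)) (z Z.- + k)
    lem z = tr (cong (at (mono k)) (l1 z (+ k))) (at-shift k (conp (+ 1)) (z Z.- + k))
   go : ∀ j f l n -> n N.< N -> (∀ k -> k N.< N -> f k ≡ nth l k) -> shift j f n ≡ shift j (nth l) n
   go zero    f l n       n< h = h n n<
   go (suc j) f l zero    n< h = I.refl
   go (suc j) f l (suc n) n< h = go j f l n (N.<-trans (N.n<1+n n) n<) h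

  num-V : ∀ {N X l} -> Num N X l -> Num N (V X) (take N (spreadl l))
  num-V {N} {l = l} (numeric f e h) = numeric (Vp f) (trans (emb-V f) (V-cong e)) \k k< -> tr (go N k k< f l h) (sy (nth-take N (spreadl l) k k<))
   where
   spread-nth : ∀ l k -> nth (spreadl l) k ≡ Vp (nth l) k
   spread-nth []      k = tr (sy (zeros k)) I.refl
    where
    open Series using (sect-ext; sect-V0; sect-V)
    zeros : ∀ k -> Vp (\_ -> + 0) k ≡ + 0
    zeros = sect-ext {g = \_ -> + 0} \ { zero _ m -> sect-V0 (\_ -> + 0) m ; (suc ρ) ρ< m -> sect-V ρ ρ< (\_ -> + 0) m }
   spread-nth (a ∷ l) zero    = I.refl
   spread-nth (a ∷ l) (suc k) = tr (nth-shift 12 (spreadl l) k) (tr (PS.shift-cong 12 (spread-nth l) k) (sy (spread-shift 12 (nth l) k)))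
    where
    open PS using ()
    open Series using (spread-shift)
   go : ∀ M k -> k N.< M -> ∀ f l -> (∀ k -> k N.< M -> f k ≡ nth l k) -> Vp f k ≡ nth (spreadl l) k
   go M k k< f l h = tr (V-agree f (nth l) k (\w w≤ -> h w (N.≤-<-trans w≤ k<))) (sy (spread-nth l k))
    where open Pent using (V-agree)

  evl : ℕ -> Poly -> Poly -> Poly
  evl N []      m = + 0 ∷ []
  evl N (a ∷ p) m = (a ∷ []) ⊞ take N (m ⊠ evl N p m)

  open Eval using (ev)

  num-ev : ∀ {N X m} -> Num N X m -> ∀ p -> Num N (ev p X) (evl N p m)
  num-ev n []      = num-ι (+ 0)
  num-ev n (a ∷ p) = num-+ (num-ι a) (num-* n (num-ev n p))

-- Eisenstein series, the Hauptmodul and their derivatives.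

module Forms where
 open Ramanujan using (Sk)
 open LInt
 open Base
 open Poly
 open Num

 -- The roots of `Al` and `Bl`, of discriminants -27 and -16, are the values of x at the elliptic
 -- points of order 3 and 2. `P4`, `P6` and `P4ʹ`, `P6ʹ` are the numerators of E₄, E₆ and of their
 -- images under q ↦ q¹³. `Rl` is -24 `Cl` + (`P4` - 169 `P4ʹ`)/6, which arises from the equation
 -- for θε.
 Al Bl Cl P4 P4ʹ P6 P6ʹ Rl Dl Jl : Poly
 Al  = + 1 ∷ + 5 ∷ + 13 ∷ []
 Bl  = + 1 ∷ + 6 ∷ + 13 ∷ []
 Cl  = Al ⊠ Bl
 P4  = + 1 ∷ + 247 ∷ + 3380 ∷ + 15379 ∷ + 28561 ∷ []
 P4ʹ = + 1 ∷ + 7 ∷ + 20 ∷ + 19 ∷ + 1 ∷ []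
 P6  = + 1 ∷ -[1+ 493 ] ∷ -[1+ 20617 ] ∷ -[1+ 237275 ] ∷ -[1+ 1313805 ] ∷ -[1+ 3712929 ] ∷ -[1+ 4826808 ] ∷ []
 P6ʹ = + 1 ∷ + 10 ∷ + 46 ∷ + 108 ∷ + 122 ∷ + 38 ∷ mone ∷ []
 Rl  = (-[1+ 23 ] · Cl) ⊞ (-[1+ 27 ] ∷ -[1+ 155 ] ∷ + 0 ∷ + 2028 ∷ + 4732 ∷ [])
 Dl  = Al ↑ 4 ⊠ Bl ↑ 3
 Jl  = P4ʹ ↑ 3 ⊠ Al

 module FormsL where
  open BaseL
  open Eval
  open Numeric

  E P E2 E4 E6 S1 : Carrier
  E  = emb Euler.E
  P  = emb Euler.Pt
  E2 = emb EisPS.e2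
  E4 = emb EisPS.e₄
  E6 = emb EisPS.e6
  S1 = emb (Sk 1)

  EP : E * P ≈ ι (+ 1)
  EP = trans (sym (emb-** Euler.E Euler.Pt)) (trans (emb-cong Euler.E**P) (emb-con (+ 1)))

  emb-⊖ : ∀ f -> emb (PS.⊖ f) ≈ - emb f
  emb-⊖ f = co-ext \z -> tr (co-emb (PS.⊖ f) z) (tr (lem z) (tr (cong Z.-_ (sy (co-emb f z))) (sy (co-neg (emb f) z))))
   where
   open Series using (at)
   lem : ∀ z -> at (PS.⊖ f) z ≡ Z.- at f z
   lem (+ n)    = ≡refl
   lem -[1+ n ] = ≡refl

  E2-S1 : E2 ≈ ι (+ 1) + ι -[1+ 23 ] * S1
  E2-S1 = trans (emb-⊕ _ _) (+-cong (emb-con (+ 1)) (trans (emb-** _ _) (*-congʳ (emb-con -[1+ 23 ]))))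

  private
   ode : ∀ k f g h -> (PS.con k PS.** PS.θ f) PS.≐ ((g PS.** h) PS.⊕ (PS.⊖ f)) -> ι k * θ (emb f) ≈ emb g * emb h - emb f
   ode k f g h p = trans (trans (*-cong (sym (emb-con k)) (sym (emb-θ f))) (sym (emb-** _ _))) (trans (emb-cong p) (trans (emb-⊕ _ _) (+-cong (emb-** g h) (emb-⊖ f))))

  θE2 : ι (+ 12) * θ E2 ≈ E2 * E2 - E4
  θE2 = trans (trans (*-cong (sym (emb-con (+ 12))) (sym (emb-θ EisPS.e2))) (sym (emb-** _ _))) (trans (emb-cong EisPS.ramanujan2) (trans (emb-⊕ _ _) (+-cong (emb-** _ _) (emb-⊖ _))))

  θE4 : ι (+ 3) * θ E4 ≈ E2 * E4 - E6
  θE4 = trans (trans (*-cong (sym (emb-con (+ 3))) (sym (emb-θ EisPS.e₄))) (sym (emb-** _ _))) (trans (emb-cong EisPS.ramanujan4) (trans (emb-⊕ _ _) (+-cong (emb-** _ _) (emb-⊖ _))))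

  θE6 : ι (+ 2) * θ E6 ≈ E2 * E6 - E4 * E4
  θE6 = trans (trans (*-cong (sym (emb-con (+ 2))) (sym (emb-θ EisPS.e6))) (sym (emb-** _ _))) (trans (emb-cong EisPS.ramanujan6) (trans (emb-⊕ _ _) (+-cong (emb-** _ _) (trans (emb-⊖ _) (-‿cong (emb-** _ _))))))

  θE : θ E ≈ - (S1 * E)
  θE = trans (sym (emb-θ Euler.E)) (trans (emb-cong Euler.θ-E) (trans (emb-⊖ _) (-‿cong (emb-** _ _))))

  θP : θ P ≈ S1 * P
  θP = begin
   θ P                                    ≈⟨ solve 1 (\t -> t := :1 :* t) refl (θ P) ⟩
   ι (+ 1) * θ P                          ≈⟨ *-congʳ (sym EP) ⟩
   (E * P) * θ P                          ≈⟨ solve 4 (\e p t s -> (e :* p) :* t := p :* ((:- (s :* e)) :* p :+ e :* t) :+ s :* p :* (e :* p)) refl E P (θ P) S1 ⟩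
   P * ((- (S1 * E)) * P + E * θ P) + S1 * P * (E * P) ≈⟨ +-cong (*-congˡ (trans (+-congʳ (*-congʳ (sym θE))) (trans (sym (θ-* E P)) (trans (θ-cong EP) (θ-ι (+ 1)))))) (*-congˡ EP) ⟩
   P * ι (+ 0) + S1 * P * ι (+ 1)         ≈⟨ solve 2 (\p s -> p :* :0 :+ s :* p :* :1 := s :* p) refl P S1 ⟩
   S1 * P ∎

  -- `t` is 1/x, written as a product, and `ε` is the logarithmic derivative θx/x, a form of weight
  -- 2.
  x t ε : Carrier
  x = q (+ 1) * (V E * V E * (P * P))
  t = q mone * (E * E * (V P * V P))
  ε = ι (+ 1) + (ι (+ 2) * S1 + ι -[1+ 25 ] * V S1)

  VEP : V E * V P ≈ ι (+ 1)
  VEP = trans (sym (V-* E P)) (trans (V-cong EP) (V-ι (+ 1)))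

  xt : x * t ≈ ι (+ 1)
  xt = begin
   x * t ≈⟨ solve 6 (\q r e p eʹ pʹ -> q :* (eʹ :* eʹ :* (p :* p)) :* (r :* (e :* e :* (pʹ :* pʹ))) := (q :* r) :* ((e :* p) :* (e :* p)) :* ((eʹ :* pʹ) :* (eʹ :* pʹ))) refl (q (+ 1)) (q mone) E P (V E) (V P) ⟩
   (q (+ 1) * q mone) * ((E * P) * (E * P)) * ((V E * V P) * (V E * V P)) ≈⟨ *-cong (*-cong (q-inv (+ 1)) (*-cong EP EP)) (*-cong VEP VEP) ⟩
   ι (+ 1) * (ι (+ 1) * ι (+ 1)) * (ι (+ 1) * ι (+ 1)) ≈⟨ solve 0 (:1 :* (:1 :* :1) :* (:1 :* :1) := :1) refl ⟩
   ι (+ 1) ∎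

  θVE : θ (V E) ≈ - (ι (+ 13) * V S1 * V E)
  θVE = trans (θV E) (trans (*-congˡ (trans (V-cong θE) (trans (V-neg _) (-‿cong (V-* S1 E))))) (solve 3 (\k s e -> k :* (:- (s :* e)) := :- (k :* s :* e)) refl (ι (+ 13)) (V S1) (V E)))

  θx : θ x ≈ x * ε
  θx = begin
   θ (q (+ 1) * (V E * V E * (P * P)))
    ≈⟨ trans (θ-* _ _) (+-cong (*-congʳ (θ-q (+ 1))) (*-congˡ (trans (θ-* _ _) (+-cong (*-congʳ (trans (θ-* _ _) (+-cong (*-congʳ θVE) (*-congˡ θVE)))) (*-congˡ (trans (θ-* _ _) (+-cong (*-congʳ θP) (*-congˡ θP)))))))) ⟩
   (ι (+ 1) * q (+ 1)) * (V E * V E * (P * P)) + q (+ 1) * ((- (ι (+ 13) * V S1 * V E) * V E + V E * - (ι (+ 13) * V S1 * V E)) * (P * P) + V E * V E * (S1 * P * P + P * (S1 * P)))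
    ≈⟨ solve 5 (\q e p s sʹ -> (:1 :* q) :* (e :* e :* (p :* p)) :+ q :* (((:- (con (+ 13) :* sʹ :* e)) :* e :+ e :* (:- (con (+ 13) :* sʹ :* e))) :* (p :* p) :+ e :* e :* (s :* p :* p :+ p :* (s :* p)))
      := (q :* (e :* e :* (p :* p))) :* (:1 :+ (con (+ 2) :* s :+ con -[1+ 25 ] :* sʹ))) refl (q (+ 1)) (V E) P S1 (V S1) ⟩
   x * ε ∎

  θt : θ t ≈ t * (- ε)
  θt = begin
   θ t                              ≈⟨ solve 1 (\a -> a := :1 :* a) refl (θ t) ⟩
   ι (+ 1) * θ t                    ≈⟨ *-congʳ (sym xt) ⟩
   (x * t) * θ t                    ≈⟨ solve 4 (\x t d e -> (x :* t) :* d := t :* ((x :* e) :* t :+ x :* d) :+ (x :* t) :* (t :* (:- e))) refl x t (θ t) ε ⟩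
   t * ((x * ε) * t + x * θ t) + (x * t) * (t * - ε) ≈⟨ +-cong (*-congˡ (trans (+-congʳ (*-congʳ (sym θx))) (trans (sym (θ-* x t)) (trans (θ-cong xt) (θ-ι (+ 1)))))) (*-congʳ xt) ⟩
   t * ι (+ 0) + ι (+ 1) * (t * - ε) ≈⟨ solve 2 (\t e -> t :* :0 :+ :1 :* (t :* (:- e)) := t :* (:- e)) refl t ε ⟩
   t * - ε ∎

  E2ʹ E4ʹ E6ʹ M : Carrier
  E2ʹ = V E2
  E4ʹ = V E4
  E6ʹ = V E6
  M   = ι (+ 13) * E2ʹ

  -- E₂ and 13 E₂(13τ) have the same defect of modularity; their difference is the modular form 12ε.
  M-ε : M ≈ E2 + ι (+ 12) * ε
  M-ε = trans (*-congˡ (trans (V-cong E2-S1) (trans (V-+ _ _) (+-cong (V-ι (+ 1)) (V-ι* -[1+ 23 ] S1)))))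
   (trans (solve 2 (\s sʹ -> con (+ 13) :* (:1 :+ con -[1+ 23 ] :* sʹ) := (:1 :+ con -[1+ 23 ] :* s) :+ con (+ 12) :* (:1 :+ (con (+ 2) :* s :+ con -[1+ 25 ] :* sʹ))) refl S1 (V S1))
    (+-congʳ (sym E2-S1)))

  V-sub : ∀ X Y -> V (X - Y) ≈ V X - V Y
  V-sub X Y = trans (V-+ X (- Y)) (+-congˡ (V-neg Y))

  private
   θ-prime : ∀ k X A B C -> ι k * θ X ≈ A * B - C -> ι k * θ (V X) ≈ ι (+ 13) * V A * V B - ι (+ 13) * V C
   θ-prime k X A B C h = begin
    ι k * θ (V X)              ≈⟨ *-congˡ (θV X) ⟩
    ι k * (ι (+ 13) * V (θ X)) ≈⟨ solve 3 (\k a b -> k :* (a :* b) := a :* (k :* b)) refl (ι k) (ι (+ 13)) (V (θ X)) ⟩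
    ι (+ 13) * (ι k * V (θ X)) ≈⟨ *-congˡ (trans (sym (V-ι* k (θ X))) (trans (V-cong h) (trans (V-sub _ _) (+-congʳ (V-* A B))))) ⟩
    ι (+ 13) * (V A * V B - V C) ≈⟨ solve 4 (\k a b c -> k :* (a :* b :- c) := k :* a :* b :- k :* c) refl (ι (+ 13)) (V A) (V B) (V C) ⟩
    ι (+ 13) * V A * V B - ι (+ 13) * V C ∎

  θE4ʹ : ι (+ 3) * θ E4ʹ ≈ M * E4ʹ - ι (+ 13) * E6ʹ
  θE4ʹ = θ-prime (+ 3) E4 E2 E4 E6 θE4

  θE6ʹ : ι (+ 2) * θ E6ʹ ≈ M * E6ʹ - ι (+ 13) * (E4ʹ * E4ʹ)
  θE6ʹ = trans (θ-prime (+ 2) E6 E2 E6 (E4 * E4) θE6) (+-congˡ (-‿cong (*-congˡ (V-* E4 E4))))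

  -- Ramanujan's equation for E₂ is subtracted from the one for 13 E₂(13τ), and the latter series is
  -- then expressed by E₂ and ε.
  θε : ι (+ 144) * θ ε ≈ ι (+ 24) * (E2 * ε) + ι (+ 144) * (ε * ε) + (E4 - ι (+ 169) * E4ʹ)
  θε = begin
   ι (+ 144) * θ ε ≈⟨ solve 2 (\e d -> con (+ 144) :* d := con (+ 12) :* ((e :+ con (+ 12) :* d) :- e)) refl (θ E2) (θ ε) ⟩
   ι (+ 12) * ((θ E2 + ι (+ 12) * θ ε) - θ E2) ≈⟨ *-congˡ (+-congʳ (sym (trans (θ-cong M-ε) (trans (θ-+ E2 (ι (+ 12) * ε)) (+-congˡ (θ-ι* (+ 12) ε)))))) ⟩
   ι (+ 12) * (θ M - θ E2) ≈⟨ solve 2 (\a b -> con (+ 12) :* (a :- b) := con (+ 12) :* a :- con (+ 12) :* b) refl (θ M) (θ E2) ⟩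
   ι (+ 12) * θ M - ι (+ 12) * θ E2 ≈⟨ +-cong (trans (*-congˡ (θ-ι* (+ 13) E2ʹ)) (trans (solve 1 (\a -> con (+ 12) :* (con (+ 13) :* a) := con (+ 13) :* (con (+ 12) :* a)) refl (θ E2ʹ)) (*-congˡ (θ-prime (+ 12) E2 E2 E2 E4 θE2)))) (-‿cong θE2) ⟩
   ι (+ 13) * (ι (+ 13) * E2ʹ * E2ʹ - ι (+ 13) * E4ʹ) - (E2 * E2 - E4)
    ≈⟨ solve 4 (\e eʹ f fʹ -> con (+ 13) :* (con (+ 13) :* eʹ :* eʹ :- con (+ 13) :* fʹ) :- (e :* e :- f) := (con (+ 13) :* eʹ) :* (con (+ 13) :* eʹ) :- e :* e :+ (f :- con (+ 169) :* fʹ)) refl E2 E2ʹ E4 E4ʹ ⟩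
   M * M - E2 * E2 + (E4 - ι (+ 169) * E4ʹ) ≈⟨ +-congʳ (+-congʳ (*-cong M-ε M-ε)) ⟩
   (E2 + ι (+ 12) * ε) * (E2 + ι (+ 12) * ε) - E2 * E2 + (E4 - ι (+ 169) * E4ʹ)
    ≈⟨ solve 3 (\e d r -> (e :+ con (+ 12) :* d) :* (e :+ con (+ 12) :* d) :- e :* e :+ r := con (+ 24) :* (e :* d) :+ con (+ 144) :* (d :* d) :+ r) refl E2 ε (E4 - ι (+ 169) * E4ʹ) ⟩
   ι (+ 24) * (E2 * ε) + ι (+ 144) * (ε * ε) + (E4 - ι (+ 169) * E4ʹ) ∎

-- Polynomial expressions.

module PolyExp where
 open import Data.Bool.Base using (T)
 open LInt
 open Base
 open Poly

 -- A syntax with two readings, a coefficient list and an element of the ring; comparing lists then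
 -- proves an identity between values at x.
 data PExp : Set where
  lit       : Poly -> PExp
  sc        : ℤ -> PExp -> PExp
  _⊹_ _**p_ : PExp -> PExp -> PExp

 infixl 6 _⊹_
 infixl 7 _**p_

 list : PExp -> Poly
 list (lit p)  = p
 list (sc c e) = c · list e
 list (e ⊹ f)  = list e ⊞ list f
 list (e **p f) = list e ⊠ list f

 module PExpL where
  open BaseL
  open Eval

  val : PExp -> Carrier -> Carrier
  val (lit p)  X = ev p X
  val (sc c e) X = ι c * val e X
  val (e ⊹ f)  X = val e X + val f X
  val (e **p f) X = val e X * val f X

  ev-list : ∀ e X -> ev (list e) X ≈ val e X
  ev-list (lit p)  X = refl
  ev-list (sc c e) X = trans (ev-· c (list e) X) (*-congˡ (ev-list e X))
  ev-list (e ⊹ f)  X = trans (ev-⊞ (list e) (list f) X) (+-cong (ev-list e X) (ev-list f X))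
  ev-list (e **p f) X = trans (ev-⊠ (list e) (list f) X) (*-cong (ev-list e X) (ev-list f X))

  val-== : ∀ e f X -> T (list e == list f) -> val e X ≈ val f X
  val-== e f X t = trans (sym (ev-list e X)) (trans (ev-== (list e) (list f) X t) (ev-list f X))

-- Linear differential equations for the errors of the parametrisation.

module Descent where
 open ZSolver
 open EisODE

 -- The linear differential equations satisfied by r = F₄ c - ε² p₄ and s = F₆ a c - ε³ p₆;
 -- primed letters are derivatives.
 module Linear (Z : ZRing) where
  open ZRing Z
  open ODE Z using (by-multiple)

  module _ (a c xc xk p4 p6 xp4 xp6 d F4 F6 M ε E2 εʹ F4ʹ F6ʹ σ κ h : Carrier)
   (hε : ι (+ 144) * (c * εʹ) ≈ ι (+ 24) * (E2 * ε * c) + ι (+ 144) * (ε * ε * c) + ε * ε * d + σ)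
   (h4 : ι (+ 3) * F4ʹ ≈ M * F4 - κ * F6)
   (h6 : ι (+ 2) * F6ʹ ≈ M * F6 - κ * (F4 * F4))
   (hM : M ≈ E2 + h * ε)
   (I₄ : ι (+ 24) * (h * a * c * p4) + ι (+ 72) * (a * xc * p4) ≈ ι (+ 24) * (κ * c * p6) + a * p4 * (ι (+ 144) * c + d) + ι (+ 72) * (a * c * xp4))
   (I6 : ι (+ 24) * (h * a * c * p6) + ι (+ 48) * (xk * p6) ≈ ι (+ 24) * (κ * (a * a) * (p4 * p4)) + a * p6 * (ι (+ 144) * c + d) + ι (+ 48) * (a * c * xp6)) where

   r s : Carrier
   r = F4 * c - ε * ε * p4
   s = F6 * (a * c) - ε * ε * ε * p6

   -- If F₄c, F₆ac and ε² p₄, ε³ p₆ are identified and σ = 0, everything reduces to ε³ times `I₄`.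
   -- The polynomial identity `I₄` therefore makes the equation homogeneous in r, s, σ; `I6` plays
   -- the same part for `s-eq`.
   r-eq : ι (+ 72) * (a * c * ((F4ʹ * c + F4 * (ε * xc)) - (ι (+ 2) * (ε * εʹ) * p4 + ε * ε * (ε * xp4)))) ≈
      (ι (+ 24) * (a * c * M) * r + ι (+ 72) * (a * xc * ε) * r) + - (ι (+ 24) * (κ * c) * s + ε * a * p4 * σ)
   r-eq = by-multiple (ι (+ 24) * (a * c * c)) h4 (by-multiple (- (a * ε * p4)) hε (by-multiple (ι (+ 24) * (a * c * (ε * ε) * p4)) hM (by-multiple (ε * ε * ε) I₄
    (solve 18 (\a c xc p4 p6 xp4 d F4 F6 M ε E2 εʹ F4ʹ σ κ h xk ->
     con (+ 72) :* (a :* c :* ((F4ʹ :* c :+ F4 :* (ε :* xc)) :- (con (+ 2) :* (ε :* εʹ) :* p4 :+ ε :* ε :* (ε :* xp4)))) :=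
     ((((con (+ 24) :* (a :* c :* M) :* (F4 :* c :- ε :* ε :* p4) :+ con (+ 72) :* (a :* xc :* ε) :* (F4 :* c :- ε :* ε :* p4)) :+ :- (con (+ 24) :* (κ :* c) :* (F6 :* (a :* c) :- ε :* ε :* ε :* p6) :+ ε :* a :* p4 :* σ))
      :+ con (+ 24) :* (a :* c :* c) :* (con (+ 3) :* F4ʹ :- (M :* F4 :- κ :* F6)))
      :+ (:- (a :* ε :* p4)) :* (con (+ 144) :* (c :* εʹ) :- (con (+ 24) :* (E2 :* ε :* c) :+ con (+ 144) :* (ε :* ε :* c) :+ ε :* ε :* d :+ σ)))
      :+ con (+ 24) :* (a :* c :* (ε :* ε) :* p4) :* (M :- (E2 :+ h :* ε))
      :+ (ε :* ε :* ε) :* ((con (+ 24) :* (h :* a :* c :* p4) :+ con (+ 72) :* (a :* xc :* p4)) :- (con (+ 24) :* (κ :* c :* p6) :+ a :* p4 :* (con (+ 144) :* c :+ d) :+ con (+ 72) :* (a :* c :* xp4))))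
     refl a c xc p4 p6 xp4 d F4 F6 M ε E2 εʹ F4ʹ σ κ h xk))))

   s-eq : ι (+ 48) * (a * c * ((F6ʹ * (a * c) + F6 * (ε * xk)) - (ι (+ 3) * (ε * ε * εʹ) * p6 + ε * ε * ε * (ε * xp6)))) ≈
      (ι (+ 24) * (a * c * M) * s + ι (+ 48) * (ε * xk) * s) + - (ι (+ 24) * (κ * (a * a) * (F4 * c + ε * ε * p4)) * r + ε * ε * a * p6 * σ)
   s-eq = by-multiple (ι (+ 24) * (a * c * (a * c))) h6 (by-multiple (- (a * (ε * ε) * p6)) hε (by-multiple (ι (+ 24) * (a * c * (ε * ε * ε) * p6)) hM (by-multiple (ε * ε * ε * ε) I6
    (solve 17 (\a c xk p4 p6 xp6 d F4 F6 M ε E2 εʹ F6ʹ σ κ h ->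
     con (+ 48) :* (a :* c :* ((F6ʹ :* (a :* c) :+ F6 :* (ε :* xk)) :- (con (+ 3) :* (ε :* ε :* εʹ) :* p6 :+ ε :* ε :* ε :* (ε :* xp6)))) :=
     ((((con (+ 24) :* (a :* c :* M) :* (F6 :* (a :* c) :- ε :* ε :* ε :* p6) :+ con (+ 48) :* (ε :* xk) :* (F6 :* (a :* c) :- ε :* ε :* ε :* p6)) :+ :- (con (+ 24) :* (κ :* (a :* a) :* (F4 :* c :+ ε :* ε :* p4)) :* (F4 :* c :- ε :* ε :* p4) :+ ε :* ε :* a :* p6 :* σ))
      :+ con (+ 24) :* (a :* c :* (a :* c)) :* (con (+ 2) :* F6ʹ :- (M :* F6 :- κ :* (F4 :* F4))))
      :+ (:- (a :* (ε :* ε) :* p6)) :* (con (+ 144) :* (c :* εʹ) :- (con (+ 24) :* (E2 :* ε :* c) :+ con (+ 144) :* (ε :* ε :* c) :+ ε :* ε :* d :+ σ)))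
      :+ con (+ 24) :* (a :* c :* (ε :* ε :* ε) :* p6) :* (M :- (E2 :+ h :* ε))
      :+ (ε :* ε :* ε :* ε) :* ((con (+ 24) :* (h :* a :* c :* p6) :+ con (+ 48) :* (xk :* p6)) :- (con (+ 24) :* (κ :* (a :* a) :* (p4 :* p4)) :+ a :* p6 :* (con (+ 144) :* c :+ d) :+ con (+ 48) :* (a :* c :* xp6))))
     refl a c xk p4 p6 xp6 d F4 F6 M ε E2 εʹ F6ʹ σ κ h))))

-- Parametrisation of E₄ and E₆ at level 13.

module Param where
 open import Data.List.Base using ([]; _∷_)
 open PS using (+ˡ; *ˡ)
 open Ramanujan using (Sk)
 open LInt
 open LL
 open Base
 open Poly
 open Num
 open Forms
 open PolyExp
 open Descent
 open EisODE

 s1l e4l e6l El pl : Poly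
 s1l = + 0 ∷ + 1 ∷ + 3 ∷ + 4 ∷ + 7 ∷ + 6 ∷ + 12 ∷ + 8 ∷ + 15 ∷ + 13 ∷ + 18 ∷ + 12 ∷ + 28 ∷ + 14 ∷ + 24 ∷ + 24 ∷ + 31 ∷ + 18 ∷ + 39 ∷ + 20 ∷ + 42 ∷ + 32 ∷ + 36 ∷ + 24 ∷ + 60 ∷ + 31 ∷ + 42 ∷ + 40 ∷ []
 e4l = + 1 ∷ + 240 ∷ []
 e6l = + 1 ∷ -[1+ 503 ] ∷ []
 El  = + 1 ∷ mone ∷ mone ∷ + 0 ∷ + 0 ∷ + 1 ∷ + 0 ∷ + 1 ∷ + 0 ∷ + 0 ∷ + 0 ∷ + 0 ∷ mone ∷ + 0 ∷ + 0 ∷ mone ∷ + 0 ∷ + 0 ∷ + 0 ∷ + 0 ∷ + 0 ∷ + 0 ∷ + 1 ∷ + 0 ∷ + 0 ∷ + 0 ∷ + 1 ∷ []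
 pl  = + 1 ∷ + 1 ∷ + 2 ∷ + 3 ∷ + 5 ∷ + 7 ∷ + 11 ∷ + 15 ∷ + 22 ∷ + 30 ∷ + 42 ∷ + 56 ∷ + 77 ∷ + 101 ∷ []

 module ParamL where
  open BaseL
  open Eval
  open Numeric
  open FormsL
  open PExpL
  open Linear zr using (r-eq; s-eq)
  open ODE zr using (by-multiple)

  num-S1 : Num 28 S1 s1l
  num-S1 = num-check 28 (Sk 1) (Sk 1) s1l (\_ -> ≡refl) _

  num-E : Num 28 E El
  num-E = num-check 28 Euler.E (\n -> Pent.Pen n n) El Pent.E-Pen _

  num-restrict : ∀ {M N X l} -> N N.≤ M -> Num M X l -> Num N X l
  num-restrict N≤ (numeric f e h) = numeric f e \k k< -> h k (N.≤-trans k< N≤)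

  num-P : Num 14 P pl
  num-P = num-check 14 Euler.Pt Euler.Pt pl (\_ -> ≡refl) _

  num-E4 : Num 2 E4 e4l
  num-E4 = num-check 2 EisPS.e₄ EisPS.e₄ e4l (\_ -> ≡refl) _

  num-E6 : Num 2 E6 e6l
  num-E6 = num-check 2 EisPS.e6 EisPS.e6 e6l (\_ -> ≡refl) _

  num-ε : Num 28 ε _
  num-ε = num-+ (num-ι (+ 1)) (num-+ (num-ι* (+ 2) num-S1) (num-ι* -[1+ 25 ] (num-V num-S1)))

  num-x : Num 14 x _
  num-x = num-q 1 (num-* (num-* (num-V E14) (num-V E14)) (num-* num-P num-P))
   where E14 = num-restrict (N.≤ᵇ⇒≤ 14 28 _) num-E

  num-E2 : Num 28 E2 _
  num-E2 = num-≈ (sym E2-S1) (num-+ (num-ι (+ 1)) (num-ι* -[1+ 23 ] num-S1))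

  num-M : Num 28 M _
  num-M = num-ι* (+ 13) (num-V num-E2)

  dl : Poly
  dl = P4 ⊞ -[1+ 168 ] · P4ʹ

  a c xc xk d : Carrier
  a  = ev Al x
  c  = ev Cl x
  xc = ev (xd 0 Cl) x
  xk = ev (xd 0 (Al ⊠ Cl)) x
  d  = ev dl x

  -- The errors of the four formulas to be proved. `σ` is the combination of them that enters
  -- through θε.
  r1 r2 r3 r4 σ : Carrier
  r1 = E4 * c - ε * ε * ev P4 x
  r2 = E6 * (a * c) - ε * ε * ε * ev P6 x
  r3 = E4ʹ * c - ε * ε * ev P4ʹ x
  r4 = E6ʹ * (a * c) - ε * ε * ε * ev P6ʹ x
  σ  = r1 - ι (+ 169) * r3

  -- `θε` multiplied by c, with E₄ and E₄(13τ) replaced by their parametrisations; the errors made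
  -- in doing so add up to σ.
  hε : ι (+ 144) * (c * θ ε) ≈ ι (+ 24) * (E2 * ε * c) + ι (+ 144) * (ε * ε * c) + ε * ε * d + σ
  hε = begin
   ι (+ 144) * (c * θ ε) ≈⟨ solve 2 (\c e -> con (+ 144) :* (c :* e) := c :* (con (+ 144) :* e)) refl c (θ ε) ⟩
   c * (ι (+ 144) * θ ε) ≈⟨ *-congˡ θε ⟩
   c * (ι (+ 24) * (E2 * ε) + ι (+ 144) * (ε * ε) + (E4 - ι (+ 169) * E4ʹ))
    ≈⟨ solve 7 (\c e2 e f fʹ p pʹ -> c :* (con (+ 24) :* (e2 :* e) :+ con (+ 144) :* (e :* e) :+ (f :- con (+ 169) :* fʹ)) :=
      con (+ 24) :* (e2 :* e :* c) :+ con (+ 144) :* (e :* e :* c) :+ e :* e :* (p :+ con -[1+ 168 ] :* pʹ) :+ ((f :* c :- e :* e :* p) :- con (+ 169) :* (fʹ :* c :- e :* e :* pʹ)))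
      refl c E2 ε E4 E4ʹ (ev P4 x) (ev P4ʹ x) ⟩
   ι (+ 24) * (E2 * ε * c) + ι (+ 144) * (ε * ε * c) + ε * ε * (ev P4 x + ι -[1+ 168 ] * ev P4ʹ x) + σ
    ≈⟨ +-congʳ (+-congˡ (*-congˡ (sym (ev-list (lit P4 ⊹ sc -[1+ 168 ] (lit P4ʹ)) x)))) ⟩
   ι (+ 24) * (E2 * ε * c) + ι (+ 144) * (ε * ε * c) + ε * ε * d + σ ∎

  θac : θ (a * c) ≈ ε * xk
  θac = trans (θ-cong (sym (ev-⊠ Al Cl x))) (θ-ev θx (Al ⊠ Cl))

  θ-r : ∀ F p -> θ (F * c - ε * ε * ev p x) ≈ (θ F * c + F * (ε * xc)) - (ι (+ 2) * (ε * θ ε) * ev p x + ε * ε * (ε * ev (xd 0 p) x))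
  θ-r F p = trans (trans (θ-+ _ _) (+-cong (trans (θ-* F c) (+-congˡ (*-congˡ (θ-ev θx Cl)))) (trans (θ-neg _) (-‿cong (trans (θ-* _ _) (+-cong (*-congʳ (θ-* ε ε)) (*-congˡ (θ-ev θx p))))))))
   (solve 8 (\f c fʹ e xc eʹ p xp -> (fʹ :* c :+ f :* (e :* xc)) :- ((eʹ :* e :+ e :* eʹ) :* p :+ e :* e :* (e :* xp)) :=
    (fʹ :* c :+ f :* (e :* xc)) :- (con (+ 2) :* (e :* eʹ) :* p :+ e :* e :* (e :* xp))) refl F c (θ F) ε xc (θ ε) (ev p x) (ev (xd 0 p) x))

  θ-s : ∀ F p -> θ (F * (a * c) - ε * ε * ε * ev p x) ≈ (θ F * (a * c) + F * (ε * xk)) - (ι (+ 3) * (ε * ε * θ ε) * ev p x + ε * ε * ε * (ε * ev (xd 0 p) x))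
  θ-s F p = trans (trans (θ-+ _ _) (+-cong (trans (θ-* F (a * c)) (+-congˡ (*-congˡ θac))) (trans (θ-neg _) (-‿cong (trans (θ-* _ _) (+-cong (*-congʳ (trans (θ-* _ _) (+-congʳ (*-congʳ (θ-* ε ε))))) (*-congˡ (θ-ev θx p))))))))
   (solve 8 (\f c fʹ e xc eʹ p xp -> (fʹ :* c :+ f :* (e :* xc)) :- (((eʹ :* e :+ e :* eʹ) :* e :+ e :* e :* eʹ) :* p :+ e :* e :* e :* (e :* xp)) :=
    (fʹ :* c :+ f :* (e :* xc)) :- (con (+ 3) :* (e :* e :* eʹ) :* p :+ e :* e :* e :* (e :* xp))) refl F (a * c) (θ F) ε xk (θ ε) (ev p x) (ev (xd 0 p) x))

  -- The parameters separate the two uses: h = 0 and κ = 1 for the forms at τ, h = 12 and κ = 13 for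
  -- those at 13τ, where `M-ε` and the chain rule intervene.
  I₄ I4ʳ I6 I6ʳ : ℤ -> ℤ -> Poly -> Poly -> PExp
  I₄  h κ p4 p6 = sc (+ 24) (sc h (lit Al) **p lit Cl **p lit p4) ⊹ sc (+ 72) (lit Al **p lit (xd 0 Cl) **p lit p4)
  I4ʳ h κ p4 p6 = sc (+ 24) (sc κ (lit Cl) **p lit p6) ⊹ lit Al **p lit p4 **p (sc (+ 144) (lit Cl) ⊹ lit dl) ⊹ sc (+ 72) (lit Al **p lit Cl **p lit (xd 0 p4))
  I6  h κ p4 p6 = sc (+ 24) (sc h (lit Al) **p lit Cl **p lit p6) ⊹ sc (+ 48) (lit (xd 0 (Al ⊠ Cl)) **p lit p6)
  I6ʳ h κ p4 p6 = sc (+ 24) (sc κ (lit Al **p lit Al) **p (lit p4 **p lit p4)) ⊹ lit Al **p lit p6 **p (sc (+ 144) (lit Cl) ⊹ lit dl) ⊹ sc (+ 48) (lit Al **p lit Cl **p lit (xd 0 p6))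

  E2-split : E2 ≈ E2 + ι (+ 0) * ε
  E2-split = solve 2 (\a b -> a := a :+ :0 :* b) refl E2 ε

  θE4¹ : ι (+ 3) * θ E4 ≈ E2 * E4 - ι (+ 1) * E6
  θE4¹ = trans θE4 (solve 2 (\a b -> a :- b := a :- :1 :* b) refl (E2 * E4) E6)

  θE6¹ : ι (+ 2) * θ E6 ≈ E2 * E6 - ι (+ 1) * (E4 * E4)
  θE6¹ = trans θE6 (solve 2 (\a b -> a :- b := a :- :1 :* b) refl (E2 * E6) (E4 * E4))

  module Eq (h κ : ℤ) (p4 p6 : Poly) (F4 F6 M : Carrier)
   (h4 : ι (+ 3) * θ F4 ≈ M * F4 - ι κ * F6) (h6 : ι (+ 2) * θ F6 ≈ M * F6 - ι κ * (F4 * F4)) (hM : M ≈ E2 + ι h * ε)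
   (i4 : val (I₄ h κ p4 p6) x ≈ val (I4ʳ h κ p4 p6) x) (i6 : val (I6 h κ p4 p6) x ≈ val (I6ʳ h κ p4 p6) x) where

   r s : Carrier
   r = F4 * c - ε * ε * ev p4 x
   s = F6 * (a * c) - ε * ε * ε * ev p6 x

   θr-eq : ι (+ 72) * (a * c * θ r) ≈ (ι (+ 24) * (a * c * M) * r + ι (+ 72) * (a * xc * ε) * r) + - (ι (+ 24) * (ι κ * c) * s + ε * a * ev p4 x * σ)
   θr-eq = trans (*-congˡ (*-congˡ (θ-r F4 p4))) (r-eq a c xc xk (ev p4 x) (ev p6 x) (ev (xd 0 p4) x) (ev (xd 0 p6) x) d F4 F6 M ε E2 (θ ε) (θ F4) (θ F6) σ (ι κ) (ι h) hε h4 h6 hM i4 i6)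

   θs-eq : ι (+ 48) * (a * c * θ s) ≈ (ι (+ 24) * (a * c * M) * s + ι (+ 48) * (ε * xk) * s) + - (ι (+ 24) * (ι κ * (a * a) * (F4 * c + ε * ε * ev p4 x)) * r + ε * ε * a * ev p6 x * σ)
   θs-eq = trans (*-congˡ (*-congˡ (θ-s F6 p6))) (s-eq a c xc xk (ev p4 x) (ev p6 x) (ev (xd 0 p4) x) (ev (xd 0 p6) x) d F4 F6 M ε E2 (θ ε) (θ F4) (θ F6) σ (ι κ) (ι h) hε h4 h6 hM i4 i6)

  module Eq1 = Eq (+ 0) (+ 1) P4 P6 E4 E6 E2 θE4¹ θE6¹ E2-split (val-== (I₄ (+ 0) (+ 1) P4 P6) (I4ʳ (+ 0) (+ 1) P4 P6) x _) (val-== (I6 (+ 0) (+ 1) P4 P6) (I6ʳ (+ 0) (+ 1) P4 P6) x _)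
  module Eq2 = Eq (+ 12) (+ 13) P4ʹ P6ʹ E4ʹ E6ʹ M θE4ʹ θE6ʹ M-ε (val-== (I₄ (+ 12) (+ 13) P4ʹ P6ʹ) (I4ʳ (+ 12) (+ 13) P4ʹ P6ʹ) x _) (val-== (I6 (+ 12) (+ 13) P4ʹ P6ʹ) (I6ʳ (+ 12) (+ 13) P4ʹ P6ʹ) x _)

  0<14 : 0 N.< 14
  0<14 = N.s≤s N.z≤n

  Val : Carrier -> ℤ -> Set
  Val X v = Low X (+ 0) × (co X (+ 0) ≡ v)

  num-val : ∀ {N X l} -> 0 N.< N -> Num N X l -> Val X (nth l 0)
  num-val 0<N n = num-low n , num-co n 0 0<N

  val-* : ∀ {X Y v w} -> Val X v -> Val Y w -> Val (X * Y) (v Z.* w)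
  val-* (l , e) (m , f) = co-low l m , tr (co-lead l m) (cong₂ Z._*_ e f)

  val-+ : ∀ {X Y v w} -> Val X v -> Val Y w -> Val (X + Y) (v Z.+ w)
  val-+ {X} {Y} (l , e) (m , f) = Low-+ l m , tr (co-+ X Y (+ 0)) (cong₂ Z._+_ e f)

  val-ι : ∀ c -> Val (ι c) c
  val-ι c = num-val (N.s≤s N.z≤n) (num-ι {1} c)

  lead : ∀ {F r n v} -> Val F v -> Low r (+ n) -> co (F * r) (+ n) ≡ v Z.* co r (+ n)
  lead {r = r} {n} (l , e) low = tr (co-lead l low) (cong (Z._* co r (+ n)) e)

  n14 : ∀ {X l} -> Num 28 X l -> Num 14 X l
  n14 = num-restrict (N.≤ᵇ⇒≤ 14 28 _)

  num-a : Num 14 a _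
  num-a = num-ev num-x Al
  num-c : Num 14 c _
  num-c = num-ev num-x Cl
  num-xc : Num 14 xc _
  num-xc = num-ev num-x (xd 0 Cl)
  num-xk : Num 14 xk _
  num-xk = num-ev num-x (xd 0 (Al ⊠ Cl))
  num-E2ʹ : Num 14 E2 _
  num-E2ʹ = n14 num-E2
  num-εʹ : Num 14 ε _
  num-εʹ = n14 num-ε

  val-a : Val a (+ 1)
  val-a = num-val 0<14 num-a
  val-c : Val c (+ 1)
  val-c = num-val 0<14 num-c
  val-xc : Val xc (+ 0)
  val-xc = num-val 0<14 num-xc
  val-xk : Val xk (+ 0)
  val-xk = num-val 0<14 num-xk
  val-ε : Val ε (+ 1)
  val-ε = num-val 0<14 num-εʹ
  val-ev : ∀ p -> Val (ev p x) _
  val-ev p = num-val 0<14 (num-ev num-x p)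
  val-E2 : Val E2 (+ 1)
  val-E2 = num-val 0<14 num-E2ʹ
  val-M : Val M (+ 13)
  val-M = num-val 0<14 (n14 num-M)
  val-E4 : Val E4 (+ 1)
  val-E4 = num-val (N.s≤s N.z≤n) num-E4
  val-E6 : Val E6 (+ 1)
  val-E6 = num-val (N.s≤s N.z≤n) num-E6
  val-E4ʹ : Val E4ʹ (+ 1)
  val-E4ʹ = num-val (N.s≤s N.z≤n) (num-V num-E4)
  val-E6ʹ : Val E6ʹ (+ 1)
  val-E6ʹ = num-val (N.s≤s N.z≤n) (num-V num-E6)

  -- the coefficient of qⁿ in k a c rʹ = F r + G r - (H s + K σ)
  compare : ∀ {k F G H K f g h j} {r s : Carrier} n -> ι k * (a * c * θ r) ≈ (F * r + G * r) + - (H * s + K * σ) ->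
   Val F f -> Val G g -> Val H h -> Val K j -> Low r (+ n) -> Low s (+ n) -> Low σ (+ n) ->
   k Z.* (+ n Z.* co r (+ n)) ≡ (f Z.* co r (+ n) Z.+ g Z.* co r (+ n)) Z.- (h Z.* co s (+ n) Z.+ j Z.* co σ (+ n))
  compare {k} {F} {G} {H} {K} {r = r} {s} n e vF vG vH vK lr ls lσ = tr (sy lhs) (tr (co-cong e (+ n))
   (tr (co-+ (F * r + G * r) (- (H * s + K * σ)) (+ n)) (cong₂ Z._+_ (tr (co-+ (F * r) (G * r) (+ n)) (cong₂ Z._+_ (lead vF lr) (lead vG lr)))
    (tr (co-neg (H * s + K * σ) (+ n)) (cong Z.-_ (tr (co-+ (H * s) (K * σ) (+ n)) (cong₂ Z._+_ (lead vH ls) (lead vK lσ))))))))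
   where
   lhs : co (ι k * (a * c * θ r)) (+ n) ≡ k Z.* (+ n Z.* co r (+ n))
   lhs = tr (co-ι k (a * c * θ r) (+ n)) (*ˡ k (tr (lead (val-* val-a val-c) (Low-θ lr)) (tr (Z.*-identityˡ _) (co-θ r (+ n)))))

  module _ (n : ℕ) (l1 : Low r1 (+ n)) (l2 : Low r2 (+ n)) (l3 : Low r3 (+ n)) (l4 : Low r4 (+ n)) where

   lσ : Low σ (+ n)
   lσ = Low-+ l1 (Low-neg (Low-ι (+ 169) l3))

   c1 = compare n Eq1.θr-eq (val-* (val-ι (+ 24)) (val-* (val-* val-a val-c) val-E2)) (val-* (val-ι (+ 72)) (val-* (val-* val-a val-xc) val-ε))
      (val-* (val-ι (+ 24)) (val-* (val-ι (+ 1)) val-c)) (val-* (val-* val-ε val-a) (val-ev P4)) l1 l2 lσ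
   c2 = compare n Eq1.θs-eq (val-* (val-ι (+ 24)) (val-* (val-* val-a val-c) val-E2)) (val-* (val-ι (+ 48)) (val-* val-ε val-xk))
      (val-* (val-ι (+ 24)) (val-* (val-* (val-ι (+ 1)) (val-* val-a val-a)) (val-+ (val-* val-E4 val-c) (val-* (val-* val-ε val-ε) (val-ev P4))))) (val-* (val-* (val-* val-ε val-ε) val-a) (val-ev P6)) l2 l1 lσ
   c3 = compare n Eq2.θr-eq (val-* (val-ι (+ 24)) (val-* (val-* val-a val-c) val-M)) (val-* (val-ι (+ 72)) (val-* (val-* val-a val-xc) val-ε))
      (val-* (val-ι (+ 24)) (val-* (val-ι (+ 13)) val-c)) (val-* (val-* val-ε val-a) (val-ev P4ʹ)) l3 l4 lσ
   c4 = compare n Eq2.θs-eq (val-* (val-ι (+ 24)) (val-* (val-* val-a val-c) val-M)) (val-* (val-ι (+ 48)) (val-* val-ε val-xk))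
      (val-* (val-ι (+ 24)) (val-* (val-* (val-ι (+ 13)) (val-* val-a val-a)) (val-+ (val-* val-E4ʹ val-c) (val-* (val-* val-ε val-ε) (val-ev P4ʹ))))) (val-* (val-* (val-* val-ε val-ε) val-a) (val-ev P6ʹ)) l4 l3 lσ

   co-σ : co σ (+ n) ≡ co r1 (+ n) Z.- + 169 Z.* co r3 (+ n)
   co-σ = tr (co-sub r1 (ι (+ 169) * r3) (+ n)) (+ˡ (co r1 (+ n)) (cong Z.-_ (co-ι (+ 169) r3 (+ n))))

  -- The coefficients of r₁, …, r₄ satisfy a linear system whose determinant vanishes only for n = 0, 1, 13.
  module System (N R1 R2 R3 R4 S : ℤ)
   (c1 : + 72 Z.* (N Z.* R1) ≡ (+ 24 Z.* R1 Z.+ + 0 Z.* R1) Z.- (+ 24 Z.* R2 Z.+ + 1 Z.* S))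
   (c2 : + 48 Z.* (N Z.* R2) ≡ (+ 24 Z.* R2 Z.+ + 0 Z.* R2) Z.- (+ 48 Z.* R1 Z.+ + 1 Z.* S))
   (c3 : + 72 Z.* (N Z.* R3) ≡ (+ 312 Z.* R3 Z.+ + 0 Z.* R3) Z.- (+ 312 Z.* R4 Z.+ + 1 Z.* S))
   (c4 : + 48 Z.* (N Z.* R4) ≡ (+ 312 Z.* R4 Z.+ + 0 Z.* R4) Z.- (+ 624 Z.* R3 Z.+ + 1 Z.* S))
   (cS : S ≡ R1 Z.- + 169 Z.* R3) where

   zero-factor : ∀ x y -> x ≢ + 0 -> x Z.* y ≡ + 0 -> y ≡ + 0
   zero-factor x y ne e with Z.i*j≡0⇒i≡0∨j≡0 x e
   ... | inj₁ x0 = ⊥-elim (ne x0)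
   ... | inj₂ y0 = y0

   private
    d1 = Z.i≡j⇒i-j≡0 c1
    d2 = Z.i≡j⇒i-j≡0 c2
    d3 = Z.i≡j⇒i-j≡0 c3
    d4 = Z.i≡j⇒i-j≡0 c4

    comb : ∀ u v X Y {Z} -> X ≡ + 0 -> Y ≡ + 0 -> Z ≡ u Z.* X Z.+ v Z.* Y -> Z ≡ + 0
    comb u v _ _ ≡refl ≡refl e = tr e (cong₂ Z._+_ (Z.*-zeroʳ u) (Z.*-zeroʳ v))

   u1 u3 : ℤ
   u1 = + 12 Z.* (+ 6 Z.* N Z.+ + 1) Z.* R1 Z.+ S
   u3 = + 12 Z.* (+ 6 Z.* N Z.+ + 13) Z.* R3 Z.+ S

   -- Eliminating R₂ from `c1` and `c2` leaves a multiple of N - 1; in the same way R₄ disappears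
   -- from `c3` and `c4` with a factor N - 13.
   k1 : (+ 2 Z.* (N Z.- + 1)) Z.* u1 ≡ + 0
   k1 = comb (+ 2 Z.* N Z.- + 1) mone _ _ d1 d2 (go N R1 R2 S)
    where
    go : ∀ N R1 R2 S -> (+ 2 Z.* (N Z.- + 1)) Z.* (+ 12 Z.* (+ 6 Z.* N Z.+ + 1) Z.* R1 Z.+ S) ≡
      (+ 2 Z.* N Z.- + 1) Z.* (+ 72 Z.* (N Z.* R1) Z.- ((+ 24 Z.* R1 Z.+ + 0 Z.* R1) Z.- (+ 24 Z.* R2 Z.+ + 1 Z.* S))) Z.+
      mone Z.* (+ 48 Z.* (N Z.* R2) Z.- ((+ 24 Z.* R2 Z.+ + 0 Z.* R2) Z.- (+ 48 Z.* R1 Z.+ + 1 Z.* S)))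
    go = arith

   k3 : (+ 48 Z.* (N Z.- + 13)) Z.* u3 ≡ + 0
   k3 = comb (+ 48 Z.* N Z.- + 312) -[1+ 311 ] _ _ d3 d4 (go N R3 R4 S)
    where
    go : ∀ N R1 R2 S -> (+ 48 Z.* (N Z.- + 13)) Z.* (+ 12 Z.* (+ 6 Z.* N Z.+ + 13) Z.* R1 Z.+ S) ≡
      (+ 48 Z.* N Z.- + 312) Z.* (+ 72 Z.* (N Z.* R1) Z.- ((+ 312 Z.* R1 Z.+ + 0 Z.* R1) Z.- (+ 312 Z.* R2 Z.+ + 1 Z.* S))) Z.+
      -[1+ 311 ] Z.* (+ 48 Z.* (N Z.* R2) Z.- ((+ 312 Z.* R2 Z.+ + 0 Z.* R2) Z.- (+ 624 Z.* R1 Z.+ + 1 Z.* S)))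
    go = arith

   rest : R1 ≡ + 0 -> R3 ≡ + 0 -> (R2 ≡ + 0) × (R4 ≡ + 0)
   rest e1 e3 = zero-factor (+ 24) R2 (\()) (comb (+ 1) (mone) _ _ d1 eA (goA N R1 R2 S)) , zero-factor (+ 312) R4 (\()) (comb (+ 1) (mone) _ _ d3 eB (goB N R3 R4 S))
    where
    S0 : S ≡ + 0
    S0 = tr cS (cong₂ (\a b -> a Z.- + 169 Z.* b) e1 e3)
    eA : (+ 72 Z.* N Z.- + 24) Z.* R1 Z.+ S ≡ + 0
    eA = tr (cong₂ (\a b -> (+ 72 Z.* N Z.- + 24) Z.* a Z.+ b) e1 S0) (cong (Z._+ + 0) (Z.*-zeroʳ (+ 72 Z.* N Z.- + 24)))
    eB : (+ 72 Z.* N Z.- + 312) Z.* R3 Z.+ S ≡ + 0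
    eB = tr (cong₂ (\a b -> (+ 72 Z.* N Z.- + 312) Z.* a Z.+ b) e3 S0) (cong (Z._+ + 0) (Z.*-zeroʳ (+ 72 Z.* N Z.- + 312)))
    goA : ∀ N R1 R2 S -> + 24 Z.* R2 ≡ + 1 Z.* (+ 72 Z.* (N Z.* R1) Z.- ((+ 24 Z.* R1 Z.+ + 0 Z.* R1) Z.- (+ 24 Z.* R2 Z.+ + 1 Z.* S))) Z.+ mone Z.* ((+ 72 Z.* N Z.- + 24) Z.* R1 Z.+ S)
    goA = arith
    goB : ∀ N R1 R2 S -> + 312 Z.* R2 ≡ + 1 Z.* (+ 72 Z.* (N Z.* R1) Z.- ((+ 312 Z.* R1 Z.+ + 0 Z.* R1) Z.- (+ 312 Z.* R2 Z.+ + 1 Z.* S))) Z.+ mone Z.* ((+ 72 Z.* N Z.- + 312) Z.* R1 Z.+ S)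
    goB = arith

   -- With S = R₁ - 169 R₃ the relations u₁ = u₃ = 0 combine to 432 N² S = 0, which is why only N =
   -- 0 is lost here.
   generic : u1 ≡ + 0 -> u3 ≡ + 0 -> N ≢ + 0 -> (∀ k -> N ≡ + k -> (R1 ≡ + 0) × (R3 ≡ + 0))
   generic e1 e3 N≢0 k ≡refl = zero-factor (+ 12 Z.* (+ 6 Z.* N Z.+ + 1)) R1 (nz (k N.* 6) 0) (drop (+ 12 Z.* (+ 6 Z.* N Z.+ + 1)) R1 e1) , zero-factor (+ 12 Z.* (+ 6 Z.* N Z.+ + 13)) R3 (nz (k N.* 6) 12) (drop (+ 12 Z.* (+ 6 Z.* N Z.+ + 13)) R3 e3)
    where
    nz : ∀ m j -> + 12 Z.* (+ 6 Z.* N Z.+ + suc j) ≢ + 0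
    nz m j e = pos (6 N.* k) j (subst (\z -> + 12 Z.* (z Z.+ + suc j) ≡ + 0) (sy (Z.pos-* 6 k)) e)
     where
     pos : ∀ m j -> + 12 Z.* (+ m Z.+ + suc j) ≢ + 0
     pos m j e with Z.i*j≡0⇒i≡0∨j≡0 (+ 12) e
     ... | inj₂ f = N.1+n≢0 (tr (sy (N.+-suc m j)) (Z.+-injective f))
    S0 : S ≡ + 0
    S0 = zero-factor (+ 432) S (\()) (zero-factor N (+ 432 Z.* S) N≢0 (zero-factor N (N Z.* (+ 432 Z.* S)) N≢0 (comb (+ 6 Z.* N Z.+ + 13) (-[1+ 168 ] Z.* (+ 6 Z.* N Z.+ + 1)) u1 u3 e1 e3
     (tr (go0 N R1 R3 S) (tr (cong (\s -> N Z.* (N Z.* (+ 432 Z.* S)) Z.+ (+ 12 Z.* (+ 6 Z.* N Z.+ + 13) Z.* (+ 6 Z.* N Z.+ + 1)) Z.* (s Z.- S)) cS) (go N R1 R3 S))))))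
     where
     go0 : ∀ N R1 R3 S -> N Z.* (N Z.* (+ 432 Z.* S)) ≡ N Z.* (N Z.* (+ 432 Z.* S)) Z.+ (+ 12 Z.* (+ 6 Z.* N Z.+ + 13) Z.* (+ 6 Z.* N Z.+ + 1)) Z.* (S Z.- S)
     go0 = arith
     go : ∀ N R1 R3 S -> N Z.* (N Z.* (+ 432 Z.* S)) Z.+ (+ 12 Z.* (+ 6 Z.* N Z.+ + 13) Z.* (+ 6 Z.* N Z.+ + 1)) Z.* ((R1 Z.- + 169 Z.* R3) Z.- S) ≡
       (+ 6 Z.* N Z.+ + 13) Z.* (+ 12 Z.* (+ 6 Z.* N Z.+ + 1) Z.* R1 Z.+ S) Z.+ (-[1+ 168 ] Z.* (+ 6 Z.* N Z.+ + 1)) Z.* (+ 12 Z.* (+ 6 Z.* N Z.+ + 13) Z.* R3 Z.+ S)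
     go = arith
    drop : ∀ k R -> k Z.* R Z.+ S ≡ + 0 -> k Z.* R ≡ + 0
    drop k R e = tr (sy (Z.+-identityʳ _)) (tr (+ˡ (k Z.* R) (sy S0)) e)

   -- At N = 1 eliminating R₂ gives no information and R₁ = 0 has to be read off an expansion; at N
   -- = 13 the same holds for R₄ and R₃. The other unknown is then annihilated by 59 or by 949.
   all-zero : ∀ k -> N ≡ + suc k -> (N ≡ + 1 -> R1 ≡ + 0) -> (N ≡ + 13 -> R3 ≡ + 0) -> (R1 ≡ + 0) × (R3 ≡ + 0)
   all-zero k e at-1 at-13 with N Z.≟ + 1 | N Z.≟ + 13
   ... | yes N1 | _ = at-1 N1 , zero-factor (+ 59) R3 (\()) (comb (+ 1) mone _ _ u30 (Z.i≡j⇒i-j≡0 (tr cS (cong (\r -> r Z.- + 169 Z.* R3) (at-1 N1)))) (go N N1))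
    where
    u30 : u3 ≡ + 0
    u30 = zero-factor (+ 48 Z.* (N Z.- + 13)) u3 (\z -> nope (subst (\N -> + 48 Z.* (N Z.- + 13) ≡ + 0) N1 z)) k3
     where
     nope : + 48 Z.* (+ 1 Z.- + 13) ≢ + 0
     nope ()
    go : ∀ N -> N ≡ + 1 -> + 59 Z.* R3 ≡ + 1 Z.* (+ 12 Z.* (+ 6 Z.* N Z.+ + 13) Z.* R3 Z.+ S) Z.+ mone Z.* (S Z.- (+ 0 Z.- + 169 Z.* R3))
    go _ ≡refl = lem R3 S
     where
     lem : ∀ R S -> + 59 Z.* R ≡ + 1 Z.* (+ 228 Z.* R Z.+ S) Z.+ mone Z.* (S Z.- (+ 0 Z.- + 169 Z.* R))
     lem = arith
   ... | no _ | yes N13 = zero-factor (+ 949) R1 (\()) (comb (+ 1) mone _ _ u10 (Z.i≡j⇒i-j≡0 (tr cS (cong (\r -> R1 Z.- + 169 Z.* r) (at-13 N13)))) (go N N13)) , at-13 N13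
    where
    u10 : u1 ≡ + 0
    u10 = zero-factor (+ 2 Z.* (N Z.- + 1)) u1 (\z -> nope (subst (\N -> + 2 Z.* (N Z.- + 1) ≡ + 0) N13 z)) k1
     where
     nope : + 2 Z.* (+ 13 Z.- + 1) ≢ + 0
     nope ()
    go : ∀ N -> N ≡ + 13 -> + 949 Z.* R1 ≡ + 1 Z.* (+ 12 Z.* (+ 6 Z.* N Z.+ + 1) Z.* R1 Z.+ S) Z.+ mone Z.* (S Z.- (R1 Z.- + 169 Z.* + 0))
    go _ ≡refl = lem R1 S
     where
     lem : ∀ R S -> + 949 Z.* R ≡ + 1 Z.* (+ 948 Z.* R Z.+ S) Z.+ mone Z.* (S Z.- (R Z.- + 169 Z.* + 0))
     lem = arith
   ... | no N1 | no N13 = generic (zero-factor (+ 2 Z.* (N Z.- + 1)) u1 (\z -> N1 (root (+ 2) (+ 1) (\()) z)) k1) (zero-factor (+ 48 Z.* (N Z.- + 13)) u3 (\z -> N13 (root (+ 48) (+ 13) (\()) z)) k3)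
      (\z -> 0≢s (tr (sy z) e)) (suc k) e
    where
    0≢s : ∀ {k} -> + 0 ≢ + suc k
    0≢s ()
    root : ∀ c k -> c ≢ + 0 -> c Z.* (N Z.- k) ≡ + 0 -> N ≡ k
    root c k ne z = Z.i-j≡0⇒i≡j N k (zero-factor c (N Z.- k) ne z)

  -- the expansions at the two values of n where the linear system is singular, and at n = 0

  num-r1 : Num 2 r1 _
  num-r1 = num-+ (num-* num-E4 (n2 num-c)) (num-neg (num-* (num-* (n2 num-εʹ) (n2 num-εʹ)) (n2 (num-ev num-x P4))))
   where
   n2 : ∀ {X l} -> Num 14 X l -> Num 2 X l
   n2 = num-restrict (N.≤ᵇ⇒≤ 2 14 _)
   num-neg : ∀ {N X l} -> Num N X l -> Num N (- X) (mone · l)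
   num-neg {X = X} n = num-≈ (solve 1 (\x -> con mone :* x := :- x) refl X) (num-ι* mone n)

  num-E4¹⁴ : Num 14 E4 (+ 1 ∷ + 240 ∷ + 2160 ∷ + 6720 ∷ + 17520 ∷ + 30240 ∷ + 60480 ∷ + 82560 ∷ + 140400 ∷ + 181680 ∷ + 272160 ∷ + 319680 ∷ + 490560 ∷ + 527520 ∷ [])
  num-E4¹⁴ = num-check 14 EisPS.e₄ EisPS.e₄ _ (\_ -> ≡refl) _

  num-r3 : Num 14 r3 _
  num-r3 = num-+ (num-* (num-V num-E4¹⁴) num-c) (num-neg (num-* (num-* num-εʹ num-εʹ) (num-ev num-x P4ʹ)))
   where
   num-neg : ∀ {N X l} -> Num N X l -> Num N (- X) (mone · l)
   num-neg {X = X} n = num-≈ (solve 1 (\x -> con mone :* x := :- x) refl X) (num-ι* mone n)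

  val-sub : ∀ {X Y v w} -> Val X v -> Val Y w -> Val (X - Y) (v Z.- w)
  val-sub {X} {Y} (l , e) (m , f) = Low-+ l (Low-neg m) , tr (co-sub X Y (+ 0)) (cong₂ Z._-_ e f)

  val-r2 : Val r2 (+ 0)
  val-r2 = val-sub (val-* val-E6 (val-* val-a val-c)) (val-* (val-* (val-* val-ε val-ε) val-ε) (val-ev P6))
  val-r4 : Val r4 (+ 0)
  val-r4 = val-sub (val-* val-E6ʹ (val-* val-a val-c)) (val-* (val-* (val-* val-ε val-ε) val-ε) (val-ev P6ʹ))

  -- The orders of all four errors are raised together, because the system couples their
  -- coefficients at the same exponent.
  descent : ∀ n -> (Low r1 (+ n) × Low r2 (+ n)) × (Low r3 (+ n) × Low r4 (+ n))
  descent zero = (num-low num-r1 , proj₁ val-r2) , (num-low num-r3 , proj₁ val-r4)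
  descent (suc zero) = (Low-step (num-low num-r1) (num-co num-r1 0 (N.s≤s N.z≤n)) , Low-step (proj₁ val-r2) (proj₂ val-r2)) ,
            (Low-step (num-low num-r3) (num-co num-r3 0 (N.s≤s N.z≤n)) , Low-step (proj₁ val-r4) (proj₂ val-r4))
  descent (suc (suc k)) with descent (suc k)
  ... | (l1 , l2) , (l3 , l4) = (Low-step l1 (proj₁ z) , Low-step l2 (proj₁ zʹ)) , (Low-step l3 (proj₂ z) , Low-step l4 (proj₂ zʹ))
   where
   n = suc k
   open System (+ n) (co r1 (+ n)) (co r2 (+ n)) (co r3 (+ n)) (co r4 (+ n)) (co σ (+ n))
    (c1 n l1 l2 l3 l4) (c2 n l1 l2 l3 l4) (c3 n l1 l2 l3 l4) (c4 n l1 l2 l3 l4) (co-σ n l1 l2 l3 l4)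
   z = all-zero k ≡refl (\e -> subst (\m -> co r1 m ≡ + 0) (sy e) (num-co num-r1 1 (N.≤ᵇ⇒≤ 2 2 _)))
             (\e -> subst (\m -> co r3 m ≡ + 0) (sy e) (num-co num-r3 13 (N.≤ᵇ⇒≤ 14 14 _)))
   zʹ = rest (proj₁ z) (proj₂ z)

  E4-level13 : E4 * c ≈ ε * ε * ev P4 x
  E4-level13 = sub-0 (Low-all r1 \n -> proj₁ (proj₁ (descent n)))
  E6-level13 : E6 * (a * c) ≈ ε * ε * ε * ev P6 x
  E6-level13 = sub-0 (Low-all r2 \n -> proj₂ (proj₁ (descent n)))
  E4ʹ-level13 : E4ʹ * c ≈ ε * ε * ev P4ʹ x
  E4ʹ-level13 = sub-0 (Low-all r3 \n -> proj₁ (proj₂ (descent n)))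
  E6ʹ-level13 : E6ʹ * (a * c) ≈ ε * ε * ε * ev P6ʹ x
  E6ʹ-level13 = sub-0 (Low-all r4 \n -> proj₂ (proj₂ (descent n)))

-- The discriminant at level one and its formula at level 13.

module Delta where
 open import Data.List.Base using ([]; _∷_; take)
 open import Data.Bool.Base using (T)
 open PS using (+ˡ; *ˡ)
 open LInt
 open Base
 open Poly
 open PolyExp
 open Num
 open Forms
 open Param

 module DeltaL where
  open BaseL
  open Eval
  open PExpL
  open Numeric
  open FormsL
  open ParamL

  ^-* : ∀ X Y n -> X ^ n * Y ^ n ≈ (X * Y) ^ n
  ^-* X Y zero    = solve 0 (:1 :* :1 := :1) refl
  ^-* X Y (suc n) = trans (solve 4 (\x y a b -> x :* a :* (y :* b) := x :* y :* (a :* b)) refl X Y (X ^ n) (Y ^ n)) (*-congˡ (^-* X Y n))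

  1^ : ∀ n -> ι (+ 1) ^ n ≈ ι (+ 1)
  1^ zero    = refl
  1^ (suc n) = trans (*-congˡ (1^ n)) (solve 0 (:1 :* :1 := :1) refl)

  EP^ : ∀ n -> E ^ n * P ^ n ≈ ι (+ 1)
  EP^ n = trans (^-* E P n) (trans (^-cong n EP) (1^ n))

  val-^1 : ∀ {X} k -> Val X (+ 1) -> Val (X ^ k) (+ 1)
  val-^1 zero    v = val-ι (+ 1)
  val-^1 (suc k) v = val-* v (val-^1 k v)

  val-P : Val P (+ 1)
  val-P = num-val 0<14 num-P
  val-E : Val E (+ 1)
  val-E = num-val (N.s≤s N.z≤n) num-E

  θP^ : ∀ n -> θ (P ^ n) ≈ ι (+ n) * (S1 * P ^ n)
  θP^ zero    = trans (θ-ι (+ 1)) (solve 1 (\s -> :0 := :0 :* s) refl (S1 * ι (+ 1)))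
  θP^ (suc n) = trans (θ-^ P n) (trans (*-congˡ (*-congˡ θP)) (*-congˡ (solve 3 (\r s p -> r :* (s :* p) := s :* (p :* r)) refl (P ^ n) S1 P)))

  pwl : ℕ -> Poly -> ℕ -> Poly
  pwl K l zero    = + 1 ∷ []
  pwl K l (suc n) = take K (l ⊠ pwl K l n)

  num-pw : ∀ {K X l} -> Num K X l -> ∀ n -> Num K (X ^ n) (pwl K l n)
  num-pw h zero    = num-ι (+ 1)
  num-pw h (suc n) = num-* h (num-pw h n)

  abstract
   E²⁴ P²⁴ : Carrier
   E²⁴ = E ^ 24
   P²⁴ = P ^ 24

   EP²⁴ : E²⁴ * P²⁴ ≈ ι (+ 1)
   EP²⁴ = EP^ 24

   θP²⁴ : θ P²⁴ ≈ ι (+ 24) * (S1 * P²⁴)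
   θP²⁴ = θP^ 24

   num-E²⁴ : Num 3 E²⁴ (+ 1 ∷ -[1+ 23 ] ∷ + 252 ∷ [])
   num-E²⁴ = num-pw {3} {E} {+ 1 ∷ mone ∷ mone ∷ []} (num-check 3 Euler.E (\n -> Pent.Pen n n) (+ 1 ∷ mone ∷ mone ∷ []) Pent.E-Pen _) 24

   val-E²⁴ : Val E²⁴ (+ 1)
   val-E²⁴ = val-^1 24 val-E
   val-P²⁴ : Val P²⁴ (+ 1)
   val-P²⁴ = val-^1 24 val-P

  Δ Δ⁻ Δʹ Δʹ⁻ : Carrier
  Δ   = q (+ 1) * E²⁴
  Δ⁻  = q mone * P²⁴
  Δʹ  = V Δ
  Δʹ⁻ = V Δ⁻

  ΔΔ⁻ : Δ * Δ⁻ ≈ ι (+ 1)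
  ΔΔ⁻ = trans (solve 4 (\q r e p -> q :* e :* (r :* p) := (q :* r) :* (e :* p)) refl (q (+ 1)) (q mone) (E²⁴) (P²⁴))
   (trans (*-cong (q-inv (+ 1)) EP²⁴) (solve 0 (:1 :* :1 := :1) refl))

  ΔʹΔʹ⁻ : Δʹ * Δʹ⁻ ≈ ι (+ 1)
  ΔʹΔʹ⁻ = trans (sym (V-* Δ Δ⁻)) (trans (V-cong ΔΔ⁻) (V-ι (+ 1)))

  private
   D = E4 ^ 3 - E6 ^ 2

   θD : θ D ≈ E2 * D
   θD = begin
    θ D ≈⟨ trans (θ-+ _ _) (+-cong (θ-^ E4 2) (trans (θ-neg _) (-‿cong (θ-^ E6 1)))) ⟩
    ι (+ 3) * (E4 ^ 2 * θ E4) - ι (+ 2) * (E6 ^ 1 * θ E6)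
     ≈⟨ solve 4 (\a b aʹ bʹ -> con (+ 3) :* (a :* (a :* :1) :* aʹ) :- con (+ 2) :* (b :* :1 :* bʹ) := a :* a :* (con (+ 3) :* aʹ) :- b :* (con (+ 2) :* bʹ)) refl E4 E6 (θ E4) (θ E6) ⟩
    E4 * E4 * (ι (+ 3) * θ E4) - E6 * (ι (+ 2) * θ E6) ≈⟨ +-cong (*-congˡ θE4) (-‿cong (*-congˡ θE6)) ⟩
    E4 * E4 * (E2 * E4 - E6) - E6 * (E2 * E6 - E4 * E4)
     ≈⟨ solve 3 (\a b e -> a :* a :* (e :* a :- b) :- b :* (e :* b :- a :* a) := e :* (a :* (a :* (a :* :1)) :- b :* (b :* :1))) refl E4 E6 E2 ⟩
    E2 * D ∎

   h = D * P²⁴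

   θh : θ h ≈ h
   θh = begin
    θ (D * P²⁴) ≈⟨ trans (θ-* D P²⁴) (+-cong (*-congʳ θD) (*-congˡ θP²⁴)) ⟩
    E2 * D * P²⁴ + D * (ι (+ 24) * (S1 * P²⁴)) ≈⟨ +-congʳ (*-congʳ (*-congʳ E2-S1)) ⟩
    (ι (+ 1) + ι -[1+ 23 ] * S1) * D * P²⁴ + D * (ι (+ 24) * (S1 * P²⁴))
     ≈⟨ solve 3 (\s d p -> (:1 :+ con -[1+ 23 ] :* s) :* d :* p :+ d :* (con (+ 24) :* (s :* p)) := d :* p) refl S1 D P²⁴ ⟩
    h ∎

   num-^ : ∀ {N X l} k -> Num N X l -> ∃ \m -> Num N (X ^ k) m
   num-^ zero    n = _ , num-ι (+ 1)
   num-^ (suc k) n = _ , num-* n (proj₂ (num-^ k n))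

   num-D : Num 2 D _
   num-D = num-+ (proj₂ (num-^ 3 num-E4)) (num-≈ (solve 1 (\x -> con mone :* x := :- x) refl (E6 ^ 2)) (num-ι* mone (proj₂ (num-^ 2 num-E6))))

   low-D : Low D (+ 1)
   low-D = Low-step (num-low num-D) (num-co num-D 0 (N.s≤s N.z≤n))

   θ-eigen : ∀ {X v} -> θ X ≈ X -> co X (+ 1) ≡ v -> X ≈ ι v * q (+ 1)
   θ-eigen {X} {v} θX lead = co-ext \z -> tr (go z) (sy (co-ι v (q (+ 1)) z))
    where
    open Series using (at)
    open PS using ()
    off : ∀ z -> z ≢ + 1 -> co X z ≡ + 0
    off z ne with Z.i*j≡0⇒i≡0∨j≡0 (z Z.- + 1) {co X z} (tr (lem z (co X z)) (Z.i≡j⇒i-j≡0 (tr (sy (co-θ X z)) (co-cong θX z))))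
     where
     lem : ∀ z a -> (z Z.- + 1) Z.* a ≡ z Z.* a Z.- a
     lem = arith
    ... | inj₁ e = ⊥-elim (ne (Z.i-j≡0⇒i≡j z (+ 1) e))
    ... | inj₂ e = e
    go : ∀ z -> co X z ≡ v Z.* co (q (+ 1)) z
    go z with z Z.≟ + 1
    ... | yes ≡refl = tr lead (sy (tr (cong (v Z.*_) (q-co (+ 1) (+ 1))) (Z.*-identityʳ v)))
    ... | no ne = tr (off z ne) (sy (tr (cong (v Z.*_) (tr (q-co (+ 1) z) (zero-at (z Z.- + 1) (\e -> ne (Z.i-j≡0⇒i≡j z (+ 1) e))))) (Z.*-zeroʳ v)))
     where
     zero-at : ∀ w -> w ≢ + 0 -> at (PS.con (+ 1)) w ≡ + 0
     zero-at (+ zero)  ne = ⊥-elim (ne ≡refl)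
     zero-at (+ suc n) ne = ≡refl
     zero-at -[1+ n ]  ne = ≡refl

   lead-D : co D (+ 1) ≡ + 1728
   lead-D = num-co num-D 1 (N.≤ᵇ⇒≤ 2 2 _)

   lead-h : co (D * P²⁴) (+ 1) ≡ + 1728
   lead-h = tr (co-lead low-D (proj₁ val-P²⁴)) (cong₂ Z._*_ lead-D (proj₂ val-P²⁴))

   h≈ : h ≈ ι (+ 1728) * q (+ 1)
   h≈ = θ-eigen θh lead-h

  -- By Ramanujan's equations θD = E₂ D for D = E₄³ - E₆², and 24 `S1` = 1 - E₂, so D/(q;q)_∞²⁴ is
  -- fixed by θ and hence a multiple of q. The expansion of D gives the factor 1728.
  discriminant : E4 ^ 3 - E6 ^ 2 ≈ ι (+ 1728) * Δ
  discriminant = begin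
   D                                ≈⟨ solve 1 (\d -> d := d :* :1) refl D ⟩
   D * ι (+ 1)                      ≈⟨ *-congˡ (sym EP²⁴) ⟩
   D * (E²⁴ * P²⁴)            ≈⟨ solve 3 (\d e p -> d :* (e :* p) := (d :* p) :* e) refl D (E²⁴) (P²⁴) ⟩
   h * E²⁴                       ≈⟨ *-congʳ h≈ ⟩
   ι (+ 1728) * q (+ 1) * E²⁴    ≈⟨ *-assoc _ _ _ ⟩
   ι (+ 1728) * Δ ∎

  discriminantʹ : E4ʹ ^ 3 - E6ʹ ^ 2 ≈ ι (+ 1728) * Δʹ
  discriminantʹ = trans (sym (trans (V-sub _ _) (+-cong (V-^ E4 3) (-‿cong (V-^ E6 2))))) (trans (V-cong discriminant) (V-ι* (+ 1728) Δ))

  unit-ε : Unitlike ε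
  unit-ε = + 0 , proj₁ val-ε , \e -> case (tr (sy (proj₂ val-ε)) e)
   where
   case : + 1 ≢ + 0
   case ()

  unit-val : ∀ {X v} -> v ≢ + 0 -> Val X v -> Unitlike X
  unit-val ne (l , e) = + 0 , l , \z -> ne (tr (sy e) z)

  unit-a : Unitlike (ev Al x)
  unit-a = unit-val {v = + 1} (\()) val-a
  unit-b : Unitlike (ev Bl x)
  unit-b = unit-val {v = + 1} (\()) (val-ev Bl)

  low-q : ∀ k -> Low (q k) k
  low-q k z z< = tr (q-co k z) (zero-at (z Z.- k) (subst (z Z.- k Z.<_) (Z.+-inverseʳ k) (Z.+-monoˡ-< (Z.- k) z<)))
   where
   open Series using (at)
   open PS using ()
   zero-at : ∀ w -> w Z.< + 0 -> at (PS.con (+ 1)) w ≡ + 0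
   zero-at (+ n) (Z.+<+ ())
   zero-at -[1+ n ] _ = ≡refl

  co-q-lead : ∀ k -> co (q k) k ≡ + 1
  co-q-lead k = tr (q-co k k) (cong (at (PS.con (+ 1))) (Z.+-inverseʳ k))
   where
   open Series using (at)
   open PS using ()

  Lead : Carrier -> ℤ -> ℤ -> Set
  Lead X k v = Low X k × (co X k ≡ v)

  lead-q : ∀ k {X v} -> Val X v -> Lead (q k * X) k v
  lead-q k {X} {v} (l , e) = subst (Low (q k * X)) (Z.+-identityʳ k) (co-low (low-q k) l) ,
   tr (cong (co (q k * X)) (sy (Z.+-identityʳ k))) (tr (co-lead (low-q k) l) (tr (cong₂ Z._*_ (co-q-lead k) e) (Z.*-identityˡ v)))

  lead-* : ∀ {X Y k l v w} -> Lead X k v -> Lead Y l w -> Lead (X * Y) (k Z.+ l) (v Z.* w)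
  lead-* (l , e) (m , f) = co-low l m , tr (co-lead l m) (cong₂ Z._*_ e f)

  unit-lead : ∀ {X k v} -> v ≢ + 0 -> Lead X k v -> Unitlike X
  unit-lead {k = k} ne (l , e) = k , l , \z -> ne (tr (sy e) z)

  val-VP : Val (V P) (+ 1)
  val-VP = num-val 0<14 (num-V num-P)

  lead-t : Lead t mone (+ 1)
  lead-t = lead-q mone (val-* (val-* val-E val-E) (val-* val-VP val-VP))

  lead-Δ⁻ : Lead Δ⁻ mone (+ 1)
  lead-Δ⁻ = lead-q mone (val-P²⁴)

  1≢0 : + 1 ≢ + 0
  1≢0 ()

  private
   -- Inserting the parametrisations into F₄³ - F₆² = 1728 G leaves p₄³A² - p₆²C = 1728 A x^k with C
   -- = AB, which `chk` verifies: k = 1 for Δ(τ), k = 13 for Δ(13τ). The denominator `Dl` is A C³.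
   level13 : ∀ F4 F6 G p4 p6 k -> F4 ^ 3 - F6 ^ 2 ≈ ι (+ 1728) * G -> F4 * c ≈ ε * ε * ev p4 x -> F6 * (a * c) ≈ ε * ε * ε * ev p6 x ->
    T (list (lit (p4 ↑ 3) **p lit (Al ↑ 2)) == list (sc mone (sc mone (lit (p6 ↑ 2) **p lit Cl)) ⊹ sc (+ 1728) (lit Al **p lit ((+ 0 ∷ + 1 ∷ []) ↑ k)))) ->
    G * ev Dl x ≈ ε ^ 6 * x ^ k
   level13 F4 F6 G p4 p6 k hG h4 h6 chk = cancel (Unitlike-* (ι-Unitlike (+ 1728) (\())) unit-a) (begin
    ι (+ 1728) * a * (G * ev Dl x) ≈⟨ *-congˡ (*-congˡ D≈) ⟩
    ι (+ 1728) * a * (G * (a * c ^ 3)) ≈⟨ solve 4 (\k a g c -> k :* a :* (g :* (a :* c)) := (k :* g) :* (a :* a :* c)) refl (ι (+ 1728)) a G (c ^ 3) ⟩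
    (ι (+ 1728) * G) * (a * a * c ^ 3) ≈⟨ *-congʳ (sym hG) ⟩
    (F4 ^ 3 - F6 ^ 2) * (a * a * c ^ 3)
     ≈⟨ solve 4 (\f g a c -> (f :* (f :* (f :* :1)) :- g :* (g :* :1)) :* (a :* a :* (c :* (c :* (c :* :1)))) :=
       a :* a :* ((f :* c) :* (f :* c) :* (f :* c)) :- c :* ((g :* (a :* c)) :* (g :* (a :* c)))) refl F4 F6 a c ⟩
    a * a * ((F4 * c) * (F4 * c) * (F4 * c)) - c * ((F6 * (a * c)) * (F6 * (a * c)))
     ≈⟨ +-cong (*-congˡ (*-cong (*-cong h4 h4) h4)) (-‿cong (*-congˡ (*-cong h6 h6))) ⟩
    a * a * ((ε * ε * p) * (ε * ε * p) * (ε * ε * p)) - c * ((ε * ε * ε * r) * (ε * ε * ε * r))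
     ≈⟨ solve 5 (\a c e p r -> a :* a :* ((e :* e :* p) :* (e :* e :* p) :* (e :* e :* p)) :- c :* ((e :* e :* e :* r) :* (e :* e :* e :* r)) :=
       e :* (e :* (e :* (e :* (e :* (e :* :1))))) :* ((p :* (p :* (p :* :1))) :* (a :* (a :* :1)) :- (r :* (r :* :1)) :* c)) refl a c ε p r ⟩
    ε ^ 6 * (p ^ 3 * a ^ 2 - r ^ 2 * c) ≈⟨ *-congˡ (trans (+-cong (*-cong (sym (ev-↑ p4 3 x)) (sym (ev-↑ Al 2 x))) (-‿cong (*-congʳ (sym (ev-↑ p6 2 x)))))
      (trans (+-congʳ (val-== (lit (p4 ↑ 3) **p lit (Al ↑ 2)) (sc mone (sc mone (lit (p6 ↑ 2) **p lit Cl)) ⊹ sc (+ 1728) (lit Al **p lit ((+ 0 ∷ + 1 ∷ []) ↑ k))) x chk))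
       (solve 3 (\u a k -> (con mone :* (con mone :* u) :+ con (+ 1728) :* (a :* k)) :- u := con (+ 1728) :* (a :* k)) refl (ev (p6 ↑ 2) x * c) a (ev ((+ 0 ∷ + 1 ∷ []) ↑ k) x)))) ⟩
    ε ^ 6 * (ι (+ 1728) * (a * ev ((+ 0 ∷ + 1 ∷ []) ↑ k) x)) ≈⟨ solve 4 (\e k a x -> e :* (k :* (a :* x)) := k :* a :* (e :* x)) refl (ε ^ 6) (ι (+ 1728)) a (ev ((+ 0 ∷ + 1 ∷ []) ↑ k) x) ⟩
    ι (+ 1728) * a * (ε ^ 6 * ev ((+ 0 ∷ + 1 ∷ []) ↑ k) x) ≈⟨ *-congˡ (*-congˡ (trans (ev-↑ (+ 0 ∷ + 1 ∷ []) k x) (^-cong k (solve 1 (\x -> :0 :+ x :* (:1 :+ x :* :0) := x) refl x)))) ⟩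
    ι (+ 1728) * a * (ε ^ 6 * x ^ k) ∎)
    where
    p = ev p4 x
    r = ev p6 x
    D≈ : ev Dl x ≈ a * c ^ 3
    D≈ = trans (val-== (lit Dl) (lit Al **p lit (Cl ↑ 3)) x _) (*-congˡ (ev-↑ Cl 3 x))

  Δ-level13 : Δ * ev Dl x ≈ ε ^ 6 * x ^ 1
  Δ-level13 = level13 E4 E6 Δ P4 P6 1 discriminant E4-level13 E6-level13 _

  Δʹ-level13 : Δʹ * ev Dl x ≈ ε ^ 6 * x ^ 13
  Δʹ-level13 = level13 E4ʹ E6ʹ Δʹ P4ʹ P6ʹ 13 discriminantʹ E4ʹ-level13 E6ʹ-level13 _

-- Forms on X₀(13) as rational functions of a Hauptmodul.

module Side where
 open import Data.Bool.Base using (T)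
 open PS using (+ˡ; *ˡ)
 open LInt
 open Base
 open Poly
 open PolyExp

 -- data of a form  eᵐ p(X) / (Aᵅ Bᵝ e^μ Xˢ)
 record Shape : Set where
  constructor shape
  field
   m μ α β s : ℕ
   num       : Poly

 infixl 7 _⊗_
 _⊗_ : Shape -> Shape -> Shape
 shape m μ α β s p ⊗ shape mʹ μʹ αʹ βʹ sʹ pʹ = shape (m N.+ mʹ) (μ N.+ μʹ) (α N.+ αʹ) (β N.+ βʹ) (s N.+ sʹ) (p ⊠ pʹ)

 ones : Shape
 ones = shape 0 0 0 0 0 (+ 1 ∷ [])

 infixr 8 _⊗^_
 _⊗^_ : Shape -> ℕ -> Shape
 S ⊗^ zero  = ones
 S ⊗^ suc n = S ⊗ S ⊗^ n

 stepe : Poly -> Poly -> Poly -> ℕ -> ℕ -> ℕ -> Poly -> PExp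
 stepe A B R n α β Q = (sc (+ n) (lit R **p lit Q) ⊹ sc (+ 24) (lit A **p lit B **p lit (xd 0 Q))) ⊹
  (sc -[1+ 23 ] (sc (+ α) (lit (xd 0 A) **p lit B) **p lit Q ⊹ sc (+ β) (lit (xd 0 B) **p lit A) **p lit Q) ⊹ sc -[1+ 11 ] (lit A **p lit B **p lit Q))

 module SideL where
  open BaseL
  open Eval
  open PExpL

  -- Used twice: with x, ε and M = 13 E₂(13τ), and with 1/x, -ε and E₂ for the Fricke transforms.
  -- The field `θe` shows that, up to terms with M, derivatives stay within polynomials in X times
  -- powers of e.
  record Curve : Set where
   field
    X Xi e M : Carrier
    A B R    : Poly
    XXi      : X * Xi ≈ ι (+ 1)
    θX       : θ X ≈ X * e
    unit-e   : Unitlike e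
    unit-A   : Unitlike (ev A X)
    unit-B   : Unitlike (ev B X)
    θe       : ι (+ 24) * (ev A X * ev B X * θ e) ≈ ι (+ 4) * (M * e * (ev A X * ev B X)) + e * e * ev R X

   a b : Carrier
   a = ev A X
   b = ev B X

   den : Shape -> Carrier
   den (shape m μ α β s p) = a ^ α * (b ^ β * (e ^ μ * X ^ s))

   Is : Carrier -> Shape -> Set
   Is f S = f * den S ≈ e ^ Shape.m S * ev (Shape.num S) X

   is-≈ : ∀ {f g S} -> f ≈ g -> Is f S -> Is g S
   is-≈ p i = trans (*-congʳ (sym p)) i

   is-1 : Is (ι (+ 1)) ones
   is-1 = *-cong refl (trans (solve 0 (:1 :* (:1 :* (:1 :* :1)) := :1) refl) (sym (ev-1 X)))

   is-* : ∀ {f g S T} -> Is f S -> Is g T -> Is (f * g) (S ⊗ T)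
   is-* {f} {g} {shape m μ α β s p} {shape mʹ μʹ αʹ βʹ sʹ pʹ} i j = begin
    f * g * (a ^ (α N.+ αʹ) * (b ^ (β N.+ βʹ) * (e ^ (μ N.+ μʹ) * X ^ (s N.+ sʹ))))
     ≈⟨ *-congˡ (*-cong (^-+ a α αʹ) (*-cong (^-+ b β βʹ) (*-cong (^-+ e μ μʹ) (^-+ X s sʹ)))) ⟩
    f * g * ((a ^ α * a ^ αʹ) * ((b ^ β * b ^ βʹ) * ((e ^ μ * e ^ μʹ) * (X ^ s * X ^ sʹ))))
     ≈⟨ solve 10 (\f g a aʹ b bʹ e eʹ x xʹ -> f :* g :* ((a :* aʹ) :* ((b :* bʹ) :* ((e :* eʹ) :* (x :* xʹ)))) :=
       (f :* (a :* (b :* (e :* x)))) :* (g :* (aʹ :* (bʹ :* (eʹ :* xʹ))))) refl f g (a ^ α) (a ^ αʹ) (b ^ β) (b ^ βʹ) (e ^ μ) (e ^ μʹ) (X ^ s) (X ^ sʹ) ⟩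
    (f * (a ^ α * (b ^ β * (e ^ μ * X ^ s)))) * (g * (a ^ αʹ * (b ^ βʹ * (e ^ μʹ * X ^ sʹ)))) ≈⟨ *-cong i j ⟩
    (e ^ m * ev p X) * (e ^ mʹ * ev pʹ X) ≈⟨ solve 4 (\a b c d -> (a :* b) :* (c :* d) := (a :* c) :* (b :* d)) refl (e ^ m) (ev p X) (e ^ mʹ) (ev pʹ X) ⟩
    (e ^ m * e ^ mʹ) * (ev p X * ev pʹ X) ≈⟨ *-cong (sym (^-+ e m mʹ)) (sym (ev-⊠ p pʹ X)) ⟩
    e ^ (m N.+ mʹ) * ev (p ⊠ pʹ) X ∎

   is-^ : ∀ {f S} n -> Is f S -> Is (f ^ n) (S ⊗^ n)
   is-^ zero    i = is-1
   is-^ {f} {S} (suc n) i = is-* {S = S} {S ⊗^ n} i (is-^ n i)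

   is-reduce : ∀ {f m μ α β s p} i j q -> T (p == q ⊠ (A ↑ i ⊠ B ↑ j)) -> Is f (shape m μ (i N.+ α) (j N.+ β) s p) -> Is f (shape m μ α β s q)
   is-reduce {f} {m} {μ} {α} {β} {s} {p} i j q chk h = cancel (Unitlike-* (Unitlike-^ i unit-A) (Unitlike-^ j unit-B)) (begin
    a ^ i * b ^ j * (f * (a ^ α * (b ^ β * (e ^ μ * X ^ s))))
     ≈⟨ solve 6 (\u v f a b y -> u :* v :* (f :* (a :* (b :* y))) := f :* ((u :* a) :* ((v :* b) :* y))) refl (a ^ i) (b ^ j) f (a ^ α) (b ^ β) (e ^ μ * X ^ s) ⟩
    f * ((a ^ i * a ^ α) * ((b ^ j * b ^ β) * (e ^ μ * X ^ s))) ≈⟨ *-congˡ (*-cong (sym (^-+ a i α)) (*-congʳ (sym (^-+ b j β)))) ⟩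
    f * (a ^ (i N.+ α) * (b ^ (j N.+ β) * (e ^ μ * X ^ s))) ≈⟨ h ⟩
    e ^ m * ev p X ≈⟨ *-congˡ (trans (ev-== p (q ⊠ (A ↑ i ⊠ B ↑ j)) X chk) (trans (ev-⊠ q (A ↑ i ⊠ B ↑ j) X) (*-congˡ (trans (ev-⊠ (A ↑ i) (B ↑ j) X) (*-cong (ev-↑ A i X) (ev-↑ B j X)))))) ⟩
    e ^ m * (ev q X * (a ^ i * b ^ j)) ≈⟨ solve 3 (\e q u -> e :* (q :* u) := u :* (e :* q)) refl (e ^ m) (ev q X) (a ^ i * b ^ j) ⟩
    a ^ i * b ^ j * (e ^ m * ev q X) ∎)

   is-weight2 : ∀ {f μ s p} -> Is f (shape (suc μ) μ 0 0 s p) -> f * X ^ s ≈ e * ev p X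
   is-weight2 {f} {μ} {s} {p} h = cancel (Unitlike-^ μ unit-e) (begin
    e ^ μ * (f * X ^ s) ≈⟨ solve 3 (\e f x -> e :* (f :* x) := f :* (:1 :* (:1 :* (e :* x)))) refl (e ^ μ) f (X ^ s) ⟩
    f * (ι (+ 1) * (ι (+ 1) * (e ^ μ * X ^ s))) ≈⟨ h ⟩
    e * e ^ μ * ev p X ≈⟨ solve 3 (\e u p -> e :* u :* p := u :* (e :* p)) refl e (e ^ μ) (ev p X) ⟩
    e ^ μ * (e * ev p X) ∎)

   is-Xi : ∀ d -> Is (Xi ^ d) (shape 0 0 0 0 d (+ 1 ∷ []))
   is-Xi d = begin
    Xi ^ d * (ι (+ 1) * (ι (+ 1) * (ι (+ 1) * X ^ d))) ≈⟨ solve 2 (\y x -> y :* (:1 :* (:1 :* (:1 :* x))) := x :* y) refl (Xi ^ d) (X ^ d) ⟩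
    X ^ d * Xi ^ d ≈⟨ powers d ⟩
    ι (+ 1) ≈⟨ solve 0 (:1 := :1 :* :1) refl ⟩
    ι (+ 1) * ι (+ 1) ≈⟨ *-congˡ (sym (ev-1 X)) ⟩
    ι (+ 1) * ev (+ 1 ∷ []) X ∎
    where
    powers : ∀ d -> X ^ d * Xi ^ d ≈ ι (+ 1)
    powers zero    = solve 0 (:1 :* :1 := :1) refl
    powers (suc d) = trans (solve 4 (\x y u v -> x :* u :* (y :* v) := (x :* y) :* (u :* v)) refl X Xi (X ^ d) (Xi ^ d)) (trans (*-cong XXi (powers d)) (solve 0 (:1 :* :1 := :1) refl))

   -- For the first curve `E * p n` has weight 2n + 1/2, and the next term is 24 times its Serre
   -- derivative, taken with M for E₂: the eta factor contributes E₂ - M = -12e. The second curve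
   -- does the same with η(13τ), E₂ and -ε.
   p : ℕ -> Carrier
   p zero    = ι (+ 1)
   p (suc n) = (ι (+ 24) * θ (p n) - ι (+ (4 N.* n)) * M * p n) - ι (+ 12) * (e * p n)

   θ-^ʹ : ∀ Y n -> Y * θ (Y ^ n) ≈ ι (+ n) * (Y ^ n * θ Y)
   θ-^ʹ Y zero    = trans (*-congˡ (θ-ι (+ 1))) (solve 2 (\y t -> y :* :0 := :0 :* (:1 :* t)) refl Y (θ Y))
   θ-^ʹ Y (suc n) = trans (*-congˡ (θ-^ Y n)) (solve 4 (\y n u t -> y :* (n :* (u :* t)) := n :* (y :* u :* t)) refl Y (ι (+ suc n)) (Y ^ n) (θ Y))

   -- `p n` is eⁿ times a function of X. By `θe` the derivative of eⁿ produces 4nM, which cancels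
   -- the term with M in the definition of `p`.
   is-p-suc : ∀ n {α β Q} -> Is (p n) (shape n 0 α β 0 Q) -> Is (p (suc n)) (shape (suc n) 0 (suc α) (suc β) 0 (list (stepe A B R n α β Q)))
   is-p-suc n {α} {β} {Q} h = cancel unit-e (begin
    e * (p (suc n) * (a * a ^ α * (b * b ^ β * (ι (+ 1) * ι (+ 1)))))
     ≈⟨ solve 9 (\e pʹ p k M a u b v -> e :* (((con (+ 24) :* pʹ :- k :* M :* p) :- con (+ 12) :* (e :* p)) :* (a :* u :* (b :* v :* (:1 :* :1)))) :=
       con (+ 24) :* (e :* (a :* b) :* (pʹ :* (u :* v))) :- (k :* M :* e :+ con (+ 12) :* (e :* e)) :* (a :* b) :* (p :* (u :* (v :* (:1 :* :1))))) refl
       e (θ (p n)) (p n) (ι (+ (4 N.* n))) M a (a ^ α) b (b ^ β) ⟩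
    ι (+ 24) * (e * (a * b) * (θ (p n) * W)) - (ι (+ (4 N.* n)) * M * e + ι (+ 12) * (e * e)) * (a * b) * (p n * (a ^ α * (b ^ β * (ι (+ 1) * ι (+ 1)))))
     ≈⟨ +-cong (*-congˡ main) (-‿cong (*-cong (*-congʳ (+-congʳ (*-congʳ (*-congʳ (trans (ι-≡ (Z.pos-* 4 n)) (ι-* (+ 4) (+ n))))))) h)) ⟩
    ι (+ 24) * (a * b * (ι (+ n) * (e ^ n * θ e) * ev Q X + e * (e ^ n * (e * ev (xd 0 Q) X))) - e * (e ^ n * ev Q X) * (ι (+ α) * (e * xa) * b + ι (+ β) * (e * xb) * a))
     - (ι (+ 4) * ι (+ n) * M * e + ι (+ 12) * (e * e)) * (a * b) * (e ^ n * ev Q X)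
     ≈⟨ solve 13 (\a b n u t e Q xQ α β xa xb M ->
       con (+ 24) :* (a :* b :* (n :* (u :* t) :* Q :+ e :* (u :* (e :* xQ))) :- e :* (u :* Q) :* (α :* (e :* xa) :* b :+ β :* (e :* xb) :* a)) :- (con (+ 4) :* n :* M :* e :+ con (+ 12) :* (e :* e)) :* (a :* b) :* (u :* Q) :=
       n :* u :* Q :* (con (+ 24) :* (a :* b :* t)) :- n :* u :* Q :* (con (+ 4) :* (M :* e :* (a :* b))) :+
       e :* (e :* u) :* (con (+ 24) :* (a :* b :* xQ) :+ (con -[1+ 23 ] :* (α :* (xa :* b) :* Q :+ β :* (xb :* a) :* Q) :+ con -[1+ 11 ] :* (a :* b :* Q)))) refl
       a b (ι (+ n)) (e ^ n) (θ e) e (ev Q X) (ev (xd 0 Q) X) (ι (+ α)) (ι (+ β)) xa xb M ⟩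
    ι (+ n) * e ^ n * ev Q X * (ι (+ 24) * (a * b * θ e)) - ι (+ n) * e ^ n * ev Q X * (ι (+ 4) * (M * e * (a * b))) + e * (e * e ^ n) * tl
     ≈⟨ +-congʳ (+-congʳ (*-congˡ θe)) ⟩
    ι (+ n) * e ^ n * ev Q X * (ι (+ 4) * (M * e * (a * b)) + e * e * ev R X) - ι (+ n) * e ^ n * ev Q X * (ι (+ 4) * (M * e * (a * b))) + e * (e * e ^ n) * tl
     ≈⟨ solve 8 (\n u Q k e R t d -> n :* u :* Q :* (k :+ e :* e :* R) :- n :* u :* Q :* k :+ e :* (e :* u) :* (d :+ t) := e :* (e :* u :* ((n :* (R :* Q) :+ d) :+ t))) refl
       (ι (+ n)) (e ^ n) (ev Q X) (ι (+ 4) * (M * e * (a * b))) e (ev R X) _ _ ⟩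
    e * (e * e ^ n * val (stepe A B R n α β Q) X) ≈⟨ *-congˡ (*-congˡ (sym (ev-list (stepe A B R n α β Q) X))) ⟩
    e * (e * e ^ n * ev (list (stepe A B R n α β Q)) X) ∎)
    where
    W = a ^ α * b ^ β
    xa = ev (xd 0 A) X
    xb = ev (xd 0 B) X
    tl = ι (+ 24) * (a * b * ev (xd 0 Q) X) + (ι -[1+ 23 ] * (ι (+ α) * (xa * b) * ev Q X + ι (+ β) * (xb * a) * ev Q X) + ι -[1+ 11 ] * (a * b * ev Q X))
    hʹ : p n * W ≈ e ^ n * ev Q X
    hʹ = trans (solve 3 (\p u v -> p :* (u :* v) := p :* (u :* (v :* (:1 :* :1)))) refl (p n) (a ^ α) (b ^ β)) h
    θW : a * b * θ W ≈ W * (ι (+ α) * (e * xa) * b + ι (+ β) * (e * xb) * a)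
    θW = begin
     a * b * θ W ≈⟨ *-congˡ (θ-* (a ^ α) (b ^ β)) ⟩
     a * b * (θ (a ^ α) * b ^ β + a ^ α * θ (b ^ β)) ≈⟨ solve 6 (\a b u uʹ v vʹ -> a :* b :* (uʹ :* v :+ u :* vʹ) := b :* v :* (a :* uʹ) :+ a :* u :* (b :* vʹ)) refl a b (a ^ α) (θ (a ^ α)) (b ^ β) (θ (b ^ β)) ⟩
     b * b ^ β * (a * θ (a ^ α)) + a * a ^ α * (b * θ (b ^ β)) ≈⟨ +-cong (*-congˡ (trans (θ-^ʹ a α) (*-congˡ (*-congˡ (θ-ev θX A))))) (*-congˡ (trans (θ-^ʹ b β) (*-congˡ (*-congˡ (θ-ev θX B))))) ⟩
     b * b ^ β * (ι (+ α) * (a ^ α * (e * xa))) + a * a ^ α * (ι (+ β) * (b ^ β * (e * xb)))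
      ≈⟨ solve 8 (\a b u v α β xa xb -> b :* v :* (α :* (u :* xa)) :+ a :* u :* (β :* (v :* xb)) := u :* v :* (α :* xa :* b :+ β :* xb :* a)) refl a b (a ^ α) (b ^ β) (ι (+ α)) (ι (+ β)) (e * xa) (e * xb) ⟩
     W * (ι (+ α) * (e * xa) * b + ι (+ β) * (e * xb) * a) ∎
    main : e * (a * b) * (θ (p n) * W) ≈ a * b * (ι (+ n) * (e ^ n * θ e) * ev Q X + e * (e ^ n * (e * ev (xd 0 Q) X))) - e * (e ^ n * ev Q X) * (ι (+ α) * (e * xa) * b + ι (+ β) * (e * xb) * a)
    main = begin
     e * (a * b) * (θ (p n) * W) ≈⟨ solve 6 (\e a pʹ W p Wʹ -> e :* a :* (pʹ :* W) := e :* a :* (pʹ :* W :+ p :* Wʹ) :- e :* p :* (a :* Wʹ)) refl e (a * b) (θ (p n)) W (p n) (θ W) ⟩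
     e * (a * b) * (θ (p n) * W + p n * θ W) - e * p n * (a * b * θ W)
      ≈⟨ +-cong (*-congˡ (trans (sym (θ-* (p n) W)) (trans (θ-cong hʹ) (trans (θ-* (e ^ n) (ev Q X)) (+-congˡ (*-congˡ (θ-ev θX Q))))))) (-‿cong (*-congˡ θW)) ⟩
     e * (a * b) * (θ (e ^ n) * ev Q X + e ^ n * (e * ev (xd 0 Q) X)) - e * p n * (W * (ι (+ α) * (e * xa) * b + ι (+ β) * (e * xb) * a))
      ≈⟨ solve 9 (\e a uʹ Q u y p W z -> e :* a :* (uʹ :* Q :+ u :* y) :- e :* p :* (W :* z) := a :* ((e :* uʹ) :* Q :+ e :* (u :* y)) :- e :* (p :* W) :* z) refl
        e (a * b) (θ (e ^ n)) (ev Q X) (e ^ n) (e * ev (xd 0 Q) X) (p n) W (ι (+ α) * (e * xa) * b + ι (+ β) * (e * xb) * a) ⟩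
     a * b * ((e * θ (e ^ n)) * ev Q X + e * (e ^ n * (e * ev (xd 0 Q) X))) - e * (p n * W) * (ι (+ α) * (e * xa) * b + ι (+ β) * (e * xb) * a)
      ≈⟨ +-cong (*-congˡ (+-congʳ (*-congʳ (θ-^ʹ e n)))) (-‿cong (*-congʳ (*-congˡ hʹ))) ⟩
     a * b * (ι (+ n) * (e ^ n * θ e) * ev Q X + e * (e ^ n * (e * ev (xd 0 Q) X))) - e * (e ^ n * ev Q X) * (ι (+ α) * (e * xa) * b + ι (+ β) * (e * xb) * a) ∎

   private
    zero-factor : ∀ x y -> x ≢ + 0 -> x Z.* y ≡ + 0 -> y ≡ + 0
    zero-factor x y ne e with Z.i*j≡0⇒i≡0∨j≡0 x e
    ... | inj₁ x0 = Data.Empty.⊥-elim (ne x0)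
     where import Data.Empty
    ... | inj₂ y0 = y0

    -- Up to the nonzero factor c(n + 1) the series is the derivative of a power of Y, and
    -- derivatives have constant term 0.
    ct-power : ∀ Y c n -> c ≢ + 0 -> θ Y ≈ ι c * (Y * e) -> ct (e * Y ^ suc n) ≡ + 0
    ct-power Y c n ne h = zero-factor (+ suc n) _ (\()) (zero-factor c _ ne (tr (*ˡ c (sy (co-ι (+ suc n) (e * Y ^ suc n) (+ 0)))) (tr (sy (co-ι c _ (+ 0)))
     (tr (co-cong (begin
      ι c * (ι (+ suc n) * (e * (Y * Y ^ n))) ≈⟨ solve 5 (\c n e y u -> c :* (n :* (e :* (y :* u))) := n :* (u :* (c :* (y :* e)))) refl (ι c) (ι (+ suc n)) e Y (Y ^ n) ⟩
      ι (+ suc n) * (Y ^ n * (ι c * (Y * e))) ≈⟨ *-congˡ (*-congˡ (sym h)) ⟩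
      ι (+ suc n) * (Y ^ n * θ Y) ≈⟨ sym (θ-^ Y n) ⟩
      θ (Y ^ suc n) ∎) (+ 0)) (ct-θ (Y ^ suc n))))))

   θXi : θ Xi ≈ ι mone * (Xi * e)
   θXi = begin
    θ Xi ≈⟨ solve 1 (\t -> t := :1 :* t) refl (θ Xi) ⟩
    ι (+ 1) * θ Xi ≈⟨ *-congʳ (sym XXi) ⟩
    X * Xi * θ Xi ≈⟨ solve 4 (\x y t e -> x :* y :* t := y :* (x :* e :* y :+ x :* t) :- (x :* y) :* (y :* e)) refl X Xi (θ Xi) e ⟩
    Xi * (X * e * Xi + X * θ Xi) - X * Xi * (Xi * e) ≈⟨ +-cong (*-congˡ (trans (+-congʳ (*-congʳ (sym θX))) (trans (sym (θ-* X Xi)) (trans (θ-cong XXi) (θ-ι (+ 1)))))) (-‿cong (*-congʳ XXi)) ⟩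
    Xi * ι (+ 0) - ι (+ 1) * (Xi * e) ≈⟨ solve 2 (\y e -> y :* :0 :- :1 :* (y :* e) := con mone :* (y :* e)) refl Xi e ⟩
    ι mone * (Xi * e) ∎

   ct-0 : ∀ Y -> Y ≈ ι (+ 0) -> ct Y ≡ + 0
   ct-0 Y h = tr (co-cong (trans h ι-0) (+ 0)) (co-0 (+ 0))

   ct-pos : ∀ φ k -> ct (e * (ev φ X * X ^ suc k)) ≡ + 0
   ct-pos []      k = ct-0 _ (solve 2 (\e x -> e :* (:0 :* x) := :0) refl e (X ^ suc k))
   ct-pos (u ∷ φ) k = tr (co-cong (solve 5 (\e u x p y -> e :* ((u :+ x :* p) :* y) := u :* (e :* y) :+ e :* (p :* (x :* y))) refl e (ι u) X (ev φ X) (X ^ suc k)) (+ 0))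
    (tr (co-+ _ _ (+ 0)) (cong₂ Z._+_ (tr (co-ι u _ (+ 0)) (tr (*ˡ u (ct-power X (+ 1) k (\()) (trans θX (solve 1 (\y -> y := :1 :* y) refl (X * e))))) (Z.*-zeroʳ u))) (ct-pos φ (suc k))))

   ct-coeff : ∀ φ s -> ct (e * (ev φ X * Xi ^ s)) ≡ ct e Z.* nth φ s
   ct-coeff []      s = tr (ct-0 _ (solve 2 (\e x -> e :* (:0 :* x) := :0) refl e (Xi ^ s))) (sy (Z.*-zeroʳ (ct e)))
   ct-coeff (u ∷ φ) zero = tr (co-cong (solve 4 (\e u x p -> e :* ((u :+ x :* p) :* :1) := u :* e :+ e :* (p :* (x :* :1))) refl e (ι u) X (ev φ X)) (+ 0))
    (tr (co-+ _ _ (+ 0)) (tr (cong₂ Z._+_ (co-ι u e (+ 0)) (ct-pos φ 0)) (tr (Z.+-identityʳ _) (Z.*-comm u (ct e)))))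
   ct-coeff (u ∷ φ) (suc s) = tr (co-cong (trans (solve 6 (\e u x p y z -> e :* ((u :+ x :* p) :* (y :* z)) := u :* (e :* (y :* z)) :+ e :* (p :* ((x :* y) :* z))) refl e (ι u) X (ev φ X) Xi (Xi ^ s))
     (+-congˡ (*-congˡ (*-congˡ (trans (*-congʳ XXi) (solve 1 (\y -> :1 :* y := y) refl (Xi ^ s))))))) (+ 0))
    (tr (co-+ _ _ (+ 0)) (tr (cong₂ Z._+_ (tr (co-ι u _ (+ 0)) (tr (*ˡ u (ct-power Xi mone s (\()) θXi)) (Z.*-zeroʳ u))) (ct-coeff φ s)) (Z.+-identityˡ _)))

   -- The residue computation on a curve of genus 0: in e φ(X) X^(-s) every power of X other than X⁰
   -- gives a derivative.
   ct-weight2 : ∀ {f} φ s -> f * X ^ s ≈ e * ev φ X -> ct f ≡ ct e Z.* nth φ s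
   ct-weight2 {f} φ s h = tr (co-cong (begin
    f ≈⟨ solve 1 (\f -> f := f :* :1) refl f ⟩
    f * ι (+ 1) ≈⟨ *-congˡ (sym (inverse s)) ⟩
    f * (X ^ s * Xi ^ s) ≈⟨ sym (*-assoc f (X ^ s) (Xi ^ s)) ⟩
    f * X ^ s * Xi ^ s ≈⟨ *-congʳ h ⟩
    e * ev φ X * Xi ^ s ≈⟨ *-assoc e (ev φ X) (Xi ^ s) ⟩
    e * (ev φ X * Xi ^ s) ∎) (+ 0)) (ct-coeff φ s)
    where
    inverse : ∀ d -> X ^ d * Xi ^ d ≈ ι (+ 1)
    inverse zero    = solve 0 (:1 :* :1 := :1) refl
    inverse (suc d) = trans (solve 4 (\x y u v -> x :* u :* (y :* v) := (x :* y) :* (u :* v)) refl X Xi (X ^ d) (Xi ^ d)) (trans (*-cong XXi (inverse d)) (solve 0 (:1 :* :1 := :1) refl))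

   is-clear : ∀ {f m μ α β s p} q -> T (p == q ⊠ (A ↑ α ⊠ B ↑ β)) -> Is f (shape m μ α β s p) -> Is f (shape m μ 0 0 s q)
   is-clear {f} {m} {μ} {α} {β} {s} {p} q chk h = is-reduce {f} {m} {μ} {0} {0} {s} {p} α β q chk
    (subst (\α -> Is f (shape m μ α (β N.+ 0) s p)) (sy (N.+-identityʳ α)) (subst (\β -> Is f (shape m μ α β s p)) (sy (N.+-identityʳ β)) h))

   is-weight0 : ∀ {f μ s p} -> Is f (shape μ μ 0 0 s p) -> f * X ^ s ≈ ev p X
   is-weight0 {f} {μ} {s} {p} h = cancel (Unitlike-^ μ unit-e) (trans (solve 3 (\e f x -> e :* (f :* x) := f :* (:1 :* (:1 :* (e :* x)))) refl (e ^ μ) f (X ^ s)) h)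

-- Polynomial data on both sides of the Fricke involution.

module Curves where
 open import Data.Nat.Base as N using (ℕ; zero; suc; _∸_; _/_; _≡ᵇ_)
 open import Data.List.Base using ([]; _∷_; _++_; length)
 open import Data.Nat.DivMod using (/-monoˡ-≤; +-distrib-/-∣ˡ)
 open import Data.Nat.Divisibility using (∣-refl)
 open import Data.Bool.Base using (Bool; true; _∧_)
 open PS using (+ˡ; *ˡ)
 open LInt
 open Base
 open Poly
 open PolyExp
 open Forms
 open Side

 rev : Poly -> Poly
 rev []      = []
 rev (a ∷ p) = rev p ++ (a ∷ [])

 record Lists : Set where
  field
   A B R p4 p4ʹ p6 p6ʹ : Poly
   quo : Poly -> Poly -> Poly

  D : Poly
  D = A ↑ 4 ⊠ B ↑ 3

 -- Division in increasing powers by a polynomial with constant term 1, whatever the remainder. Each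
 -- quotient is certified afterwards by multiplying back, in `Q-ok` and `weight2?`.
 quol : Poly -> Poly -> Poly
 quol p []      = []
 quol p (_ ∷ d) = go (length p ∸ length d) p
  where
  go : ℕ -> Poly -> Poly
  go zero    p       = []
  go (suc n) []      = []
  go (suc n) (a ∷ p) = a ∷ go n (p ⊟ (a · d))

 lists1 lists2 : Lists
 lists1 = record { A = Al ; B = Bl ; R = Rl ; p4 = P4 ; p4ʹ = P4ʹ ; p6 = P6 ; p6ʹ = P6ʹ ; quo = quol }
 -- the Fricke involution exchanges x and 1/(13x)
 lists2 = record { A = rev Al ; B = rev Bl ; R = mone · rev (+ 48 · Cl ⊞ Rl) ; p4 = rev P4ʹ ; p4ʹ = rev P4
         ; p6 = mone · rev P6ʹ ; p6ʹ = mone · rev P6 ; quo = \p d -> rev (quol (rev p) (rev d)) }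

 -- Bounds for the powers of A and B in the denominator of f/εⁿ, for f of weight 2n without poles in
 -- the upper half plane. At an elliptic point of order 3 or 2 the order of ε in τ is 2 or 1, while
 -- a simple root of A or B counts 3 or 2.
 αt βt : ℕ -> ℕ
 αt n = (2 N.* n) / 3
 βt n = n / 2

 α-step : ∀ n -> αt (suc n) N.≤ suc (αt n)
 α-step n = N.≤-trans (/-monoˡ-≤ 3 (N.≤-trans (N.≤-reflexive (N.*-suc 2 n)) (N.+-monoˡ-≤ (2 N.* n) (N.≤ᵇ⇒≤ 2 3 _)))) (N.≤-reflexive (+-distrib-/-∣ˡ {3} (2 N.* n) {3} (∣-refl {3})))

 β-step : ∀ n -> βt (suc n) N.≤ suc (βt n)
 β-step n = N.≤-trans (/-monoˡ-≤ 2 (N.n≤1+n (suc n))) (N.≤-reflexive (+-distrib-/-∣ˡ {2} n {2} (∣-refl {2})))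

 module Tables (D : Lists) where
  open Lists D hiding (D)

  it jt : ℕ -> ℕ
  it n = suc (αt n) ∸ αt (suc n)
  jt n = suc (βt n) ∸ βt (suc n)

  step : ℕ -> Poly -> Poly
  step n Q = list (stepe A B R n (αt n) (βt n) Q)

  Q : ℕ -> Poly
  Q zero    = + 1 ∷ []
  Q (suc n) = quo (step n (Q n)) (A ↑ it n ⊠ B ↑ jt n)

  Q-ok : ℕ -> Bool
  Q-ok n = step n (Q n) == Q (suc n) ⊠ (A ↑ it n ⊠ B ↑ jt n)

  ps : ℕ -> Shape
  ps n = shape n 0 (αt n) (βt n) 0 (Q n)

 module Product (D : Lists) where
  open Lists D hiding (D)
  open Tables D public

  s4 s4ʹ s6 s6ʹ sδ sδʹ : Shape
  s4  = shape 2 0 1 1 0 p4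
  s4ʹ = shape 2 0 1 1 0 p4ʹ
  s6  = shape 3 0 2 1 0 p6
  s6ʹ = shape 3 0 2 1 0 p6ʹ
  sδ  = shape 0 6 0 0 1 (Lists.D D)
  sδʹ = shape 0 6 0 0 13 (Lists.D D)

  -- The shape of E₄^a0 E₆^b0 Δ^(-c0) X^(-d0) at τ, times E₄^a E₆^b Δ^(-c) at 13τ, times π. On the
  -- second side τ and 13τ change places.
  full : ℕ -> ℕ -> ℕ -> ℕ -> ℕ -> ℕ -> ℕ -> Shape -> Shape
  full a0 b0 c0 d0 a b c π = (s4 ⊗^ a0 ⊗ s6 ⊗^ b0 ⊗ sδ ⊗^ c0 ⊗ shape 0 0 0 0 d0 (+ 1 ∷ [])) ⊗ (s4ʹ ⊗^ a ⊗ s6ʹ ⊗^ b ⊗ sδʹ ⊗^ c) ⊗ π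

  cleared : Shape -> Poly
  cleared S = quo (Shape.num S) (A ↑ Shape.α S ⊠ B ↑ Shape.β S)

  weight2? : Shape -> Bool
  weight2? S = (Shape.num S == cleared S ⊠ (A ↑ Shape.α S ⊠ B ↑ Shape.β S)) ∧ (Shape.m S ≡ᵇ suc (Shape.μ S))

  J : Poly
  J = p4ʹ ↑ 3 ⊠ A

 -- Compatibility of numerators under X ↦ 13X, with the powers of 13 that come from X^s and from the
 -- constants of the trace.
 fricke? : ℤ -> ℤ -> Shape -> Shape -> Bool
 fricke? c1 c2 S1 S2 = (c2 · dil (+ 13) (Product.cleared lists2 S2) == (c1 Z.* (+ 13) Z.^ Shape.s S1) · Product.cleared lists1 S1) ∧ (Shape.s S1 ≡ᵇ Shape.s S2)

 trace? : ℤ -> ℤ -> (Lists -> Shape) -> Bool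
 trace? c1 c2 S = Product.weight2? lists1 (S lists1) ∧ (Product.weight2? lists2 (S lists2) ∧ fricke? c1 c2 (S lists1) (S lists2))

 fullp : ℕ -> ℕ -> ℕ -> ℕ -> ℕ -> ℕ -> ℕ -> (Lists -> Shape) -> Lists -> Shape
 fullp a0 b0 c0 d0 a b c π D = Product.full D a0 b0 c0 d0 a b c (π D)

 -- Exponents a ≤ 2, b ≤ 1 and c of a monomial E₄^a E₆^b Δ^(-c) of weight 4 - 2i, which complements
 -- weight 2i - 2 to weight 2. The last clause serves i = 13.
 Fe : ℕ -> ℕ × ℕ × ℕ
 Fe 0  = 1 , 0 , 0
 Fe 1  = 2 , 1 , 1
 Fe 2  = 0 , 0 , 0
 Fe 3  = 1 , 1 , 1
 Fe 4  = 2 , 0 , 1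
 Fe 5  = 0 , 1 , 1
 Fe 6  = 1 , 0 , 1
 Fe 7  = 2 , 1 , 2
 Fe 8  = 0 , 0 , 1
 Fe 9  = 1 , 1 , 2
 Fe 10 = 2 , 0 , 2
 Fe 11 = 0 , 1 , 2
 Fe 12 = 1 , 0 , 2
 Fe _  = 2 , 1 , 3

 pl : ℕ -> Lists -> Shape
 pl n D = Tables.ps D n

 allQ : ℕ -> Bool
 allQ zero    = true
 allQ (suc n) = allQ n ∧ (Tables.Q-ok lists1 n ∧ Tables.Q-ok lists2 n)

-- The two curves and the shapes of the basic forms on them.

module Trace where
 open import Data.Nat.Base as N using (ℕ; zero; suc; _∸_)
 open import Data.List.Base using ([]; _∷_; _++_; length)
 open import Data.Bool.Base using (T; _∧_)
 open PS using (+ˡ; *ˡ)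
 open LInt
 open LL
 open Base
 open Poly
 open PolyExp
 open Num
 open Forms
 open Param
 open Delta
 open Side
 open Curves

 module TraceL where
  open BaseL
  open Eval
  open PExpL
  open Numeric
  open FormsL
  open ParamL
  open DeltaL
  open SideL

  ev-snoc : ∀ p u X -> ev (p ++ (u ∷ [])) X ≈ ev p X + ι u * X ^ length p
  ev-snoc []      u X = solve 2 (\u x -> u :+ x :* :0 := :0 :+ u :* :1) refl (ι u) X
  ev-snoc (w ∷ p) u X = trans (+-congˡ (*-congˡ (ev-snoc p u X))) (solve 5 (\w x p u y -> w :+ x :* (p :+ u :* y) := (w :+ x :* p) :+ u :* (x :* y)) refl (ι w) X (ev p X) (ι u) (X ^ length p))

  length-rev : ∀ p -> length (rev p) ≡ length p
  length-rev []      = ≡refl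
  length-rev (u ∷ p) = tr (len (rev p)) (cong suc (length-rev p))
   where
   len : ∀ q -> length (q ++ (u ∷ [])) ≡ suc (length q)
   len []      = ≡refl
   len (w ∷ q) = cong suc (len q)

  -- Since t = 1/x, reversing coefficients is the substitution x ↦ 1/x; the factor t on the left
  -- avoids the predecessor of the length.
  ev-rev : ∀ p -> t * ev (rev p) t ≈ t ^ length p * ev p x
  ev-rev []      = solve 1 (\t -> t :* :0 := :1 :* :0) refl t
  ev-rev (u ∷ p) = begin
   t * ev (rev p ++ (u ∷ [])) t ≈⟨ *-congˡ (trans (ev-snoc (rev p) u t) (+-congˡ (*-congˡ (reflexive (cong (t ^_) (length-rev p)))))) ⟩
   t * (ev (rev p) t + ι u * t ^ length p) ≈⟨ solve 4 (\t r u y -> t :* (r :+ u :* y) := t :* r :+ u :* (t :* y)) refl t (ev (rev p) t) (ι u) (t ^ length p) ⟩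
   t * ev (rev p) t + ι u * (t * t ^ length p) ≈⟨ +-congʳ (ev-rev p) ⟩
   t ^ length p * ev p x + ι u * (t * t ^ length p) ≈⟨ solve 4 (\y p u t -> y :* p :+ u :* (t :* y) := u :* (t :* y) :+ :1 :* (y :* p)) refl (t ^ length p) (ev p x) (ι u) t ⟩
   ι u * (t * t ^ length p) + ι (+ 1) * (t ^ length p * ev p x) ≈⟨ +-congˡ (*-congʳ (sym xt)) ⟩
   ι u * (t * t ^ length p) + x * t * (t ^ length p * ev p x) ≈⟨ solve 5 (\u t y x p -> u :* (t :* y) :+ x :* t :* (y :* p) := t :* y :* (u :+ x :* p)) refl (ι u) t (t ^ length p) x (ev p x) ⟩
   t * t ^ length p * (ι u + x * ev p x) ∎

  tx : t * x ≈ ι (+ 1)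
  tx = trans (*-comm t x) xt

  unit-t : Unitlike t
  unit-t = unit-lead 1≢0 lead-t

  rev-eq : ∀ p -> ev (rev p) t ≈ t ^ (length p ∸ 1) * ev p x
  rev-eq []      = solve 0 (:0 := :1 :* :0) refl
  rev-eq (u ∷ p) = cancel unit-t (trans (ev-rev (u ∷ p)) (*-assoc t (t ^ length p) (ev (u ∷ p) x)))

  unit-rev : ∀ p -> Unitlike (ev p x) -> Unitlike (ev (rev p) t)
  unit-rev p v = unit-≈ (sym (rev-eq p)) (Unitlike-* (Unitlike-^ (length p ∸ 1) unit-t) v)
   where
   unit-≈ : ∀ {X Y} -> X ≈ Y -> Unitlike X -> Unitlike Y
   unit-≈ e (k , l , ne) = k , Low-cong e l , \z -> ne (tr (co-cong e k) z)

  unit-neg : ∀ {X} -> Unitlike X -> Unitlike (- X)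
  unit-neg {X} (k , l , ne) = k , Low-neg l , \z -> ne (tr (lem (co X k)) (cong Z.-_ (tr (sy (co-neg X k)) z)))
   where
   lem : ∀ w -> w ≡ Z.- Z.- w
   lem = arith

  ab-c : ev Al x * ev Bl x ≈ c
  ab-c = sym (ev-⊠ Al Bl x)

  -- `hε` with the errors now known to be 0, E₂ replaced by M - 12ε, and a factor 6 cancelled.
  θε-c : ι (+ 24) * (ev Al x * ev Bl x * θ ε) ≈ ι (+ 4) * (M * ε * (ev Al x * ev Bl x)) + ε * ε * ev Rl x
  θε-c = cancel (ι-Unitlike (+ 6) (\())) (begin
   ι (+ 6) * (ι (+ 24) * (ev Al x * ev Bl x * θ ε)) ≈⟨ *-congˡ (*-congˡ (*-congʳ ab-c)) ⟩
   ι (+ 6) * (ι (+ 24) * (c * θ ε)) ≈⟨ solve 1 (\y -> con (+ 6) :* (con (+ 24) :* y) := con (+ 144) :* y) refl (c * θ ε) ⟩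
   ι (+ 144) * (c * θ ε) ≈⟨ hε ⟩
   ι (+ 24) * (E2 * ε * c) + ι (+ 144) * (ε * ε * c) + ε * ε * d + σ ≈⟨ +-congˡ (+-cong (0-sub E4-level13) (-‿cong (*-congˡ (0-sub E4ʹ-level13)))) ⟩
   ι (+ 24) * (E2 * ε * c) + ι (+ 144) * (ε * ε * c) + ε * ε * d + (ι (+ 0) - ι (+ 169) * ι (+ 0))
    ≈⟨ solve 4 (\e2 e c d -> con (+ 24) :* (e2 :* e :* c) :+ con (+ 144) :* (e :* e :* c) :+ e :* e :* d :+ (:0 :- con (+ 169) :* :0) :=
      con (+ 6) :* (con (+ 4) :* ((e2 :+ con (+ 12) :* e) :* e :* c)) :+ e :* e :* (con -[1+ 143 ] :* c :+ d)) refl E2 ε c d ⟩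
   ι (+ 6) * (ι (+ 4) * ((E2 + ι (+ 12) * ε) * ε * c)) + ε * ε * (ι -[1+ 143 ] * c + d)
    ≈⟨ +-cong (*-congˡ (*-congˡ (*-cong (*-congʳ (sym M-ε)) (sym ab-c)))) (*-congˡ (val-== (sc -[1+ 143 ] (lit Cl) ⊹ lit dl) (sc (+ 6) (lit Rl)) x _)) ⟩
   ι (+ 6) * (ι (+ 4) * (M * ε * (ev Al x * ev Bl x))) + ε * ε * (ι (+ 6) * ev Rl x)
    ≈⟨ solve 3 (\y e r -> con (+ 6) :* y :+ e :* (con (+ 6) :* r) := con (+ 6) :* (y :+ e :* r)) refl (ι (+ 4) * (M * ε * (ev Al x * ev Bl x))) (ε * ε) (ev Rl x) ⟩
   ι (+ 6) * (ι (+ 4) * (M * ε * (ev Al x * ev Bl x)) + ε * ε * ev Rl x) ∎)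

  curve1 curve2 : Curve
  curve1 = record
   { X = x ; Xi = t ; e = ε ; M = M ; A = Al ; B = Bl ; R = Rl ; XXi = xt ; θX = θx
   ; unit-e = unit-ε ; unit-A = unit-a ; unit-B = unit-b ; θe = θε-c }
  curve2 = record
   { X = t ; Xi = x ; e = - ε ; M = E2 ; A = rev Al ; B = rev Bl ; R = Lists.R lists2 ; XXi = tx ; θX = θt
   ; unit-e = unit-neg unit-ε ; unit-A = unit-rev Al unit-a ; unit-B = unit-rev Bl unit-b
   ; θe = begin
     ι (+ 24) * (ev (rev Al) t * ev (rev Bl) t * θ (- ε)) ≈⟨ *-congˡ (*-cong ab2 (θ-neg ε)) ⟩
     ι (+ 24) * (t ^ 4 * (ev Al x * ev Bl x) * - θ ε) ≈⟨ solve 3 (\y ab e -> con (+ 24) :* (y :* ab :* (:- e)) := :- (y :* (con (+ 24) :* (ab :* e)))) refl (t ^ 4) (ev Al x * ev Bl x) (θ ε) ⟩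
     - (t ^ 4 * (ι (+ 24) * (ev Al x * ev Bl x * θ ε))) ≈⟨ -‿cong (*-congˡ (trans θε-c (+-congʳ (*-congˡ (*-congʳ (*-congʳ M-ε)))))) ⟩
     - (t ^ 4 * (ι (+ 4) * ((E2 + ι (+ 12) * ε) * ε * (ev Al x * ev Bl x)) + ε * ε * ev Rl x))
      ≈⟨ solve 5 (\y e2 e ab r -> :- (y :* (con (+ 4) :* ((e2 :+ con (+ 12) :* e) :* e :* ab) :+ e :* e :* r)) :=
        con (+ 4) :* (e2 :* (:- e) :* (y :* ab)) :+ (:- e) :* (:- e) :* (con mone :* (y :* (con (+ 48) :* ab :+ r)))) refl (t ^ 4) E2 ε (ev Al x * ev Bl x) (ev Rl x) ⟩
     ι (+ 4) * (E2 * - ε * (t ^ 4 * (ev Al x * ev Bl x))) + - ε * - ε * (ι mone * (t ^ 4 * (ι (+ 48) * (ev Al x * ev Bl x) + ev Rl x)))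
      ≈⟨ +-cong (*-congˡ (*-congˡ (sym ab2))) (*-congˡ (trans (*-congˡ (trans (*-congˡ (trans (+-congʳ (*-congˡ ab-c)) (sym (ev-list (sc (+ 48) (lit Cl) ⊹ lit Rl) x)))) (sym (rev-eq (+ 48 · Cl ⊞ Rl))))) (sym (ev-· mone (rev (+ 48 · Cl ⊞ Rl)) t)))) ⟩
     ι (+ 4) * (E2 * - ε * (ev (rev Al) t * ev (rev Bl) t)) + - ε * - ε * ev (Lists.R lists2) t ∎ }
   where
   ab2 : ev (rev Al) t * ev (rev Bl) t ≈ t ^ 4 * (ev Al x * ev Bl x)
   ab2 = trans (*-cong (rev-eq Al) (rev-eq Bl)) (solve 3 (\t a b -> t :* (t :* :1) :* a :* (t :* (t :* :1) :* b) := t :* (t :* (t :* (t :* :1))) :* (a :* b)) refl t (ev Al x) (ev Bl x))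

  module C1 = Curve curve1
  module C2 = Curve curve2
  module S1s = Product lists1
  module S2s = Product lists2

  private
   shape4 : ∀ F p -> F * c ≈ ε * ε * ev p x -> C1.Is F (shape 2 0 1 1 0 p)
   shape4 F p h = trans (solve 3 (\f a b -> f :* ((a :* :1) :* ((b :* :1) :* (:1 :* :1))) := f :* (a :* b)) refl F (ev Al x) (ev Bl x))
    (trans (*-congˡ ab-c) (trans h (solve 2 (\e p -> e :* e :* p := e :* (e :* :1) :* p) refl ε (ev p x))))

   shape6 : ∀ F p -> F * (a * c) ≈ ε * ε * ε * ev p x -> C1.Is F (shape 3 0 2 1 0 p)
   shape6 F p h = trans (solve 3 (\f a b -> f :* ((a :* (a :* :1)) :* ((b :* :1) :* (:1 :* :1))) := f :* (a :* (a :* b))) refl F (ev Al x) (ev Bl x))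
    (trans (*-congˡ (*-congˡ ab-c)) (trans h (solve 2 (\e p -> e :* e :* e :* p := e :* (e :* (e :* :1)) :* p) refl ε (ev p x))))

   shapeδ : ∀ G G⁻ k -> G * G⁻ ≈ ι (+ 1) -> G * ev Dl x ≈ ε ^ 6 * x ^ k -> C1.Is G⁻ (shape 0 6 0 0 k Dl)
   shapeδ G G⁻ k hG h = begin
    G⁻ * (ι (+ 1) * (ι (+ 1) * (ε ^ 6 * x ^ k))) ≈⟨ *-congˡ (*-congˡ (*-congˡ (sym h))) ⟩
    G⁻ * (ι (+ 1) * (ι (+ 1) * (G * ev Dl x))) ≈⟨ solve 3 (\g g⁻ d -> g⁻ :* (:1 :* (:1 :* (g :* d))) := (g :* g⁻) :* d) refl G G⁻ (ev Dl x) ⟩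
    G * G⁻ * ev Dl x ≈⟨ *-congʳ hG ⟩
    ι (+ 1) * ev Dl x ∎

   flip4 : ∀ F p -> length p ∸ 1 ≡ 4 -> F * c ≈ ε * ε * ev p x -> C2.Is F (shape 2 0 1 1 0 (rev p))
   flip4 F p len h = begin
    F * ((ev (rev Al) t * ι (+ 1)) * ((ev (rev Bl) t * ι (+ 1)) * (ι (+ 1) * ι (+ 1)))) ≈⟨ *-congˡ (*-cong (*-congʳ (rev-eq Al)) (*-congʳ (*-congʳ (rev-eq Bl)))) ⟩
    F * ((t ^ 2 * ev Al x * ι (+ 1)) * ((t ^ 2 * ev Bl x * ι (+ 1)) * (ι (+ 1) * ι (+ 1))))
     ≈⟨ solve 4 (\f t a b -> f :* ((t :* (t :* :1) :* a :* :1) :* ((t :* (t :* :1) :* b :* :1) :* (:1 :* :1))) := t :* (t :* (t :* (t :* :1))) :* (f :* (a :* b))) refl F t (ev Al x) (ev Bl x) ⟩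
    t ^ 4 * (F * (ev Al x * ev Bl x)) ≈⟨ *-congˡ (trans (*-congˡ ab-c) h) ⟩
    t ^ 4 * (ε * ε * ev p x) ≈⟨ solve 3 (\y e p -> y :* (e :* e :* p) := (:- e) :* ((:- e) :* :1) :* (y :* p)) refl (t ^ 4) ε (ev p x) ⟩
    (- ε) ^ 2 * (t ^ 4 * ev p x) ≈⟨ *-congˡ (trans (*-congʳ (reflexive (cong (t ^_) (sy len)))) (sym (rev-eq p))) ⟩
    (- ε) ^ 2 * ev (rev p) t ∎

   flip6 : ∀ F p -> length p ∸ 1 ≡ 6 -> F * (a * c) ≈ ε * ε * ε * ev p x -> C2.Is F (shape 3 0 2 1 0 (mone · rev p))
   flip6 F p len h = begin
    F * ((ev (rev Al) t * (ev (rev Al) t * ι (+ 1))) * ((ev (rev Bl) t * ι (+ 1)) * (ι (+ 1) * ι (+ 1)))) ≈⟨ *-congˡ (*-cong (*-cong (rev-eq Al) (*-congʳ (rev-eq Al))) (*-congʳ (*-congʳ (rev-eq Bl)))) ⟩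
    F * ((t ^ 2 * ev Al x * (t ^ 2 * ev Al x * ι (+ 1))) * ((t ^ 2 * ev Bl x * ι (+ 1)) * (ι (+ 1) * ι (+ 1))))
     ≈⟨ solve 4 (\f t a b -> f :* ((t :* (t :* :1) :* a :* (t :* (t :* :1) :* a :* :1)) :* ((t :* (t :* :1) :* b :* :1) :* (:1 :* :1))) := t :* (t :* (t :* (t :* (t :* (t :* :1))))) :* (f :* (a :* (a :* b)))) refl F t (ev Al x) (ev Bl x) ⟩
    t ^ 6 * (F * (ev Al x * (ev Al x * ev Bl x))) ≈⟨ *-congˡ (trans (*-congˡ (*-congˡ ab-c)) h) ⟩
    t ^ 6 * (ε * ε * ε * ev p x) ≈⟨ solve 3 (\y e p -> y :* (e :* e :* e :* p) := (:- e) :* ((:- e) :* ((:- e) :* :1)) :* (con mone :* (y :* p))) refl (t ^ 6) ε (ev p x) ⟩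
    (- ε) ^ 3 * (ι mone * (t ^ 6 * ev p x)) ≈⟨ *-congˡ (trans (*-congˡ (trans (*-congʳ (reflexive (cong (t ^_) (sy len)))) (sym (rev-eq p)))) (sym (ev-· mone (rev p) t))) ⟩
    (- ε) ^ 3 * ev (mone · rev p) t ∎

   t^x^ : ∀ k l -> t ^ (k N.+ l) * x ^ l ≈ t ^ k
   t^x^ k zero    = trans (*-congʳ (reflexive (cong (t ^_) (N.+-identityʳ k)))) (solve 1 (\y -> y :* :1 := y) refl (t ^ k))
   t^x^ k (suc l) = trans (*-congʳ (reflexive (cong (t ^_) (N.+-suc k l)))) (trans (solve 4 (\t y x z -> t :* y :* (x :* z) := (t :* x) :* (y :* z)) refl t (t ^ (k N.+ l)) x (x ^ l))
    (trans (*-cong tx (t^x^ k l)) (solve 1 (\y -> :1 :* y := y) refl (t ^ k))))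

   -- `Dl` has degree 14, so t¹⁴ `Dl`(x) is the reversed polynomial, and the factor x^l turns the
   -- exponent of t into k = 14 - l.
   flipδ : ∀ G G⁻ k l -> k N.+ l ≡ 14 -> G * G⁻ ≈ ι (+ 1) -> G * ev Dl x ≈ ε ^ 6 * x ^ l -> C2.Is G⁻ (shape 0 6 0 0 k (Lists.D lists2))
   flipδ G G⁻ k l kl hG h = begin
    G⁻ * (ι (+ 1) * (ι (+ 1) * ((- ε) ^ 6 * t ^ k))) ≈⟨ *-congˡ (*-congˡ (*-congˡ (*-cong (solve 1 (\e -> (:- e) :* ((:- e) :* ((:- e) :* ((:- e) :* ((:- e) :* ((:- e) :* :1))))) := e :* (e :* (e :* (e :* (e :* (e :* :1)))))) refl ε) (sym (t^x^ k l))))) ⟩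
    G⁻ * (ι (+ 1) * (ι (+ 1) * (ε ^ 6 * (t ^ (k N.+ l) * x ^ l)))) ≈⟨ solve 4 (\g e y z -> g :* (:1 :* (:1 :* (e :* (y :* z)))) := g :* (y :* (e :* z))) refl G⁻ (ε ^ 6) (t ^ (k N.+ l)) (x ^ l) ⟩
    G⁻ * (t ^ (k N.+ l) * (ε ^ 6 * x ^ l)) ≈⟨ *-congˡ (*-cong (reflexive (cong (t ^_) kl)) (sym h)) ⟩
    G⁻ * (t ^ 14 * (G * ev Dl x)) ≈⟨ solve 4 (\g⁻ y g d -> g⁻ :* (y :* (g :* d)) := (g :* g⁻) :* (y :* d)) refl G⁻ (t ^ 14) G (ev Dl x) ⟩
    G * G⁻ * (t ^ 14 * ev Dl x) ≈⟨ *-cong hG (sym (trans (val-== (lit (Lists.D lists2)) (lit (rev Dl)) t _) (rev-eq Dl))) ⟩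
    ι (+ 1) * ev (Lists.D lists2) t ∎

  i4  = shape4 E4 P4 E4-level13
  i4ʹ = shape4 E4ʹ P4ʹ E4ʹ-level13
  i6  = shape6 E6 P6 E6-level13
  i6ʹ = shape6 E6ʹ P6ʹ E6ʹ-level13
  iδ  = shapeδ Δ Δ⁻ 1 ΔΔ⁻ Δ-level13
  iδʹ = shapeδ Δʹ Δʹ⁻ 13 ΔʹΔʹ⁻ Δʹ-level13
  k4  = flip4 E4ʹ P4ʹ ≡refl E4ʹ-level13
  k4ʹ = flip4 E4 P4 ≡refl E4-level13
  k6  = flip6 E6ʹ P6ʹ ≡refl E6ʹ-level13
  k6ʹ = flip6 E6 P6 ≡refl E6-level13
  kδ  = flipδ Δʹ Δʹ⁻ 1 13 ≡refl ΔʹΔʹ⁻ Δʹ-level13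
  kδʹ = flipδ Δ Δ⁻ 13 1 ≡refl ΔΔ⁻ Δ-level13

  private
   split : ∀ n -> T (allQ (suc n)) -> T (allQ n) × (T (Tables.Q-ok lists1 n) × T (Tables.Q-ok lists2 n))
   split n h = ∧-fst {allQ n} {Tables.Q-ok lists1 n ∧ Tables.Q-ok lists2 n} h , ∧-fst {Tables.Q-ok lists1 n} {Tables.Q-ok lists2 n} r , ∧-snd {Tables.Q-ok lists1 n} {Tables.Q-ok lists2 n} r
    where r = ∧-snd {allQ n} {Tables.Q-ok lists1 n ∧ Tables.Q-ok lists2 n} h

  is-p1 : ∀ n -> T (allQ n) -> C1.Is (C1.p n) (S1s.ps n)
  is-p1 zero    _ = C1.is-1
  is-p1 (suc n) h = C1.is-reduce {C1.p (suc n)} {suc n} {0} {αt (suc n)} {βt (suc n)} {0} {S1s.step n (S1s.Q n)} (S1s.it n) (S1s.jt n) (S1s.Q (suc n)) (proj₁ (proj₂ (split n h)))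
   (I.subst₂ (\α β -> C1.Is (C1.p (suc n)) (shape (suc n) 0 α β 0 (S1s.step n (S1s.Q n)))) (sy (N.m∸n+n≡m (α-step n))) (sy (N.m∸n+n≡m (β-step n)))
    (C1.is-p-suc n {αt n} {βt n} {S1s.Q n} (is-p1 n (proj₁ (split n h)))))

  is-p2 : ∀ n -> T (allQ n) -> C2.Is (C2.p n) (S2s.ps n)
  is-p2 zero    _ = C2.is-1
  is-p2 (suc n) h = C2.is-reduce {C2.p (suc n)} {suc n} {0} {αt (suc n)} {βt (suc n)} {0} {S2s.step n (S2s.Q n)} (S2s.it n) (S2s.jt n) (S2s.Q (suc n)) (proj₂ (proj₂ (split n h)))
   (I.subst₂ (\α β -> C2.Is (C2.p (suc n)) (shape (suc n) 0 α β 0 (S2s.step n (S2s.Q n)))) (sy (N.m∸n+n≡m (α-step n))) (sy (N.m∸n+n≡m (β-step n)))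
    (C2.is-p-suc n {αt n} {βt n} {S2s.Q n} (is-p2 n (proj₁ (split n h)))))

-- Constant terms of traces from level 13 to level one.

module TraceLemma where
 open import Data.Nat.Base as N using (ℕ; zero; suc; _≡ᵇ_)
 open import Data.Bool.Base using (T; _∧_)
 open PS using (+ˡ; *ˡ)
 open LInt
 open LL
 open Base
 open Poly
 open PolyExp
 open Forms
 open Param
 open Delta
 open Side
 open Curves
 open Trace
 open BaseL
 open Eval
 open PExpL
 open FormsL
 open ParamL hiding (a; c; d)
 open DeltaL
 open SideL
 open TraceL

 -- The relation p(13X) = 13^k q(X), multiplicative in both entries, between numerators on the two
 -- sides of the Fricke involution.
 Scaled : ℕ -> Poly -> Poly -> Set
 Scaled k p q = ∀ n -> nth (dil (+ 13) p) n ≡ (+ 13) Z.^ k Z.* nth q n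

 scaled-⊠ : ∀ {k l p q pʹ qʹ} -> Scaled k p q -> Scaled l pʹ qʹ -> Scaled (k N.+ l) (p ⊠ pʹ) (q ⊠ qʹ)
 scaled-⊠ {k} {l} {p} {q} {pʹ} {qʹ} h hʹ n =
  nth (dil (+ 13) (p ⊠ pʹ)) n ≡⟪ nth-dil (+ 13) (p ⊠ pʹ) n ⟫
  (+ 13) Z.^ n Z.* nth (p ⊠ pʹ) n ≡⟪ dil-⊠ (+ 13) p pʹ n ⟫
  nth (dil (+ 13) p ⊠ dil (+ 13) pʹ) n ≡⟪ ⊠-cong-nth (dil (+ 13) p) (K · q) (dil (+ 13) pʹ) (Kʹ · qʹ) (\i -> tr (h i) (sy (nth-· K q i))) (\i -> tr (hʹ i) (sy (nth-· Kʹ qʹ i))) n ⟫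
  nth ((K · q) ⊠ (Kʹ · qʹ)) n ≡⟪ nth-·⊠ K q (Kʹ · qʹ) n ⟫
  K Z.* nth (q ⊠ (Kʹ · qʹ)) n ≡⟪ *ˡ K (scale-right q qʹ n) ⟫
  K Z.* (Kʹ Z.* nth (q ⊠ qʹ) n) ≡⟪ sy (Z.*-assoc K Kʹ _) ⟫
  K Z.* Kʹ Z.* nth (q ⊠ qʹ) n ≡⟪ cong (Z._* nth (q ⊠ qʹ) n) (sy (Z.^-distribˡ-+-* (+ 13) k l)) ⟫
  (+ 13) Z.^ (k N.+ l) Z.* nth (q ⊠ qʹ) n ■
  where
  K  = (+ 13) Z.^ k
  Kʹ = (+ 13) Z.^ l
  move : ∀ a K b c -> a Z.* (K Z.* b) Z.+ K Z.* c ≡ K Z.* (a Z.* b Z.+ c)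
  move = arith
  swap : ∀ a K b -> a Z.* (K Z.* b) ≡ K Z.* (a Z.* b)
  swap = arith
  scale-right : ∀ q r n -> nth (q ⊠ (Kʹ · r)) n ≡ Kʹ Z.* nth (q ⊠ r) n
  scale-right []      r n       = sy (Z.*-zeroʳ Kʹ)
  scale-right (a ∷ q) r zero    = tr (nth-⊠0 a q (Kʹ · r)) (tr (*ˡ a (nth-· Kʹ r 0)) (tr (swap a Kʹ (nth r 0)) (*ˡ Kʹ (sy (nth-⊠0 a q r)))))
  scale-right (a ∷ q) r (suc n) = tr (nth-⊠s a q (Kʹ · r) n) (tr (cong₂ Z._+_ (*ˡ a (nth-· Kʹ r (suc n))) (scale-right q r n))
   (tr (move a Kʹ (nth r (suc n)) (nth (q ⊠ r) n)) (*ˡ Kʹ (sy (nth-⊠s a q r n)))))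

 scaled-1 : Scaled 0 (+ 1 ∷ []) (+ 1 ∷ [])
 scaled-1 zero    = ≡refl
 scaled-1 (suc n) = ≡refl

 scaled-↑ : ∀ {k p q} n -> Scaled k p q -> Scaled (n N.* k) (p ↑ n) (q ↑ n)
 scaled-↑ zero    h = scaled-1
 scaled-↑ {k} {p} {q} (suc n) h = scaled-⊠ {k} {n N.* k} {p} {q} {p ↑ n} {q ↑ n} h (scaled-↑ n h)

 scaled-== : ∀ {k p q} -> T (dil (+ 13) p == (+ 13) Z.^ k · q) -> Scaled k p q
 scaled-== {k} {p} {q} h n = tr (nth-== (dil (+ 13) p) ((+ 13) Z.^ k · q) h n) (nth-· ((+ 13) Z.^ k) q n)

 1^ᶻ : ∀ k -> (+ 13) Z.^ k ≢ + 0
 1^ᶻ k e = case (Z.i^n≡0⇒i≡0 (+ 13) k e)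
  where
  case : + 13 ≢ + 0
  case ()

 j jʹ : Carrier
 j  = E4 ^ 3 * Δ⁻
 jʹ = V j

 jʹ-≈ : jʹ ≈ E4ʹ ^ 3 * Δʹ⁻
 jʹ-≈ = trans (V-* (E4 ^ 3) Δ⁻) (*-congʳ (V-^ E4 3))

 module _ (D : Lists) where
  Jp Jʹp : Poly
  Jp  = Lists.p4 D ↑ 3 ⊠ Lists.A D
  Jʹp = Lists.p4ʹ D ↑ 3 ⊠ Lists.A D

 private
  module On (C : Curve) where
   open Curve C

   j-clear : ∀ F G k p D q -> T ((p ↑ 3 ⊠ D) == q ⊠ (A ↑ 3 ⊠ B ↑ 3)) -> Is F (shape 2 0 1 1 0 p) -> Is G (shape 0 6 0 0 k D) -> F ^ 3 * G * X ^ k ≈ ev q X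
   j-clear F G k p D q chk f g = is-weight0 {F ^ 3 * G} {6} {k} {q} (is-clear {F ^ 3 * G} {6} {6} {3} {3} {k} {p ↑ 3 ⊠ D} q chk (is-* {F ^ 3} {G} {shape 6 0 3 3 0 (p ↑ 3)} {shape 0 6 0 0 k D} (is-^ {F} {shape 2 0 1 1 0 p} 3 f) g))

   twist : ∀ f J Jʹ φ ψ ψʹ s l i -> f * X ^ s ≈ e * ev φ X -> J * X ^ 1 ≈ ev ψ X -> Jʹ * X ^ 13 ≈ ev ψʹ X ->
    f * J ^ l * Jʹ ^ i * X ^ (s N.+ l N.* 1 N.+ i N.* 13) ≈ e * ev (φ ⊠ ψ ↑ l ⊠ ψʹ ↑ i) X
   twist f J Jʹ φ ψ ψʹ s l i hf hJ hJʹ = begin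
    f * J ^ l * Jʹ ^ i * X ^ (s N.+ l N.* 1 N.+ i N.* 13) ≈⟨ *-congˡ (trans (^-+ X (s N.+ l N.* 1) (i N.* 13)) (*-congʳ (^-+ X s (l N.* 1)))) ⟩
    f * J ^ l * Jʹ ^ i * (X ^ s * X ^ (l N.* 1) * X ^ (i N.* 13)) ≈⟨ solve 6 (\f a b x y z -> f :* a :* b :* (x :* y :* z) := f :* x :* (a :* y) :* (b :* z)) refl f (J ^ l) (Jʹ ^ i) (X ^ s) (X ^ (l N.* 1)) (X ^ (i N.* 13)) ⟩
    f * X ^ s * (J ^ l * X ^ (l N.* 1)) * (Jʹ ^ i * X ^ (i N.* 13)) ≈⟨ *-cong (*-cong hf (pw J ψ 1 hJ l)) (pw Jʹ ψʹ 13 hJʹ i) ⟩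
    e * ev φ X * ev (ψ ↑ l) X * ev (ψʹ ↑ i) X ≈⟨ trans (trans (*-congʳ (*-assoc _ _ _)) (*-assoc _ _ _)) (*-congˡ (trans (*-congʳ (sym (ev-⊠ φ (ψ ↑ l) X))) (sym (ev-⊠ (φ ⊠ ψ ↑ l) (ψʹ ↑ i) X)))) ⟩
    e * ev (φ ⊠ ψ ↑ l ⊠ ψʹ ↑ i) X ∎
    where
    pw : ∀ Y χ k -> Y * X ^ k ≈ ev χ X -> ∀ n -> Y ^ n * X ^ (n N.* k) ≈ ev (χ ↑ n) X
    pw Y χ k h zero    = trans (solve 0 (:1 :* :1 := :1) refl) (sym (ev-1 X))
    pw Y χ k h (suc n) = trans (*-congˡ (^-+ X k (n N.* k))) (trans (solve 4 (\y u x v -> y :* u :* (x :* v) := (y :* x) :* (u :* v)) refl Y (Y ^ n) (X ^ k) (X ^ (n N.* k)))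
     (trans (*-cong h (pw Y χ k h n)) (sym (ev-⊠ χ (χ ↑ n) X))))

  module O1 = On curve1
  module O2 = On curve2

  J1 = Jp lists1
  J1ʹ = Jʹp lists1
  J2 = Jp lists2
  J2ʹ = Jʹp lists2

  -- The classical formula for the invariant j on X₀(13); the next three give j(13τ) by x and both
  -- functions by t.
  j-x : j * x ^ 1 ≈ ev J1 x
  j-x = O1.j-clear E4 Δ⁻ 1 P4 Dl J1 _ i4 iδ
  jʹ-x : jʹ * x ^ 13 ≈ ev J1ʹ x
  jʹ-x = trans (*-congʳ jʹ-≈) (O1.j-clear E4ʹ Δʹ⁻ 13 P4ʹ Dl J1ʹ _ i4ʹ iδʹ)
  jʹ-t : jʹ * t ^ 1 ≈ ev J2 t
  jʹ-t = trans (*-congʳ jʹ-≈) (O2.j-clear E4ʹ Δʹ⁻ 1 (Lists.p4 lists2) (Lists.D lists2) J2 _ k4 kδ)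
  j-t : j * t ^ 13 ≈ ev J2ʹ t
  j-t = O2.j-clear E4 Δ⁻ 13 (Lists.p4ʹ lists2) (Lists.D lists2) J2ʹ _ k4ʹ kδʹ

  scaled-J : Scaled 1 J2 J1
  scaled-J = scaled-== {1} {J2} {J1} _
  scaled-Jʹ : Scaled 13 J2ʹ J1ʹ
  scaled-Jʹ = scaled-== {13} {J2ʹ} {J1ʹ} _

 record Weight2Pair (c1 c2 : ℤ) (f1 f2 : Carrier) : Set where
  field
   s     : ℕ
   φ1 φ2 : Poly
   on1   : f1 * x ^ s ≈ ε * ev φ1 x
   on2   : f2 * t ^ s ≈ - ε * ev φ2 t
   match : ∀ n -> c2 Z.* nth (dil (+ 13) φ2) n ≡ c1 Z.* (+ 13) Z.^ s Z.* nth φ1 n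

 -- The Fricke involution sends ε to −13ε and x to 1/(13x), so both constant terms are the same coefficient up to sign.
 trace : ∀ {c1 c2 f1 f2} -> Weight2Pair c1 c2 f1 f2 -> ∀ l i -> ct ((ι c1 * U (f1 * j ^ l) + ι c2 * (f2 * jʹ ^ l)) * j ^ i) ≡ + 0
 trace {c1} {c2} {f1} {f2} pair l i =
  ct ((ι c1 * U (f1 * j ^ l) + ι c2 * (f2 * jʹ ^ l)) * j ^ i)
   ≡⟪ co-cong (solve 5 (\a u b v y -> (a :* u :+ b :* v) :* y := a :* (u :* y) :+ b :* (v :* y)) refl (ι c1) (U (f1 * j ^ l)) (ι c2) (f2 * jʹ ^ l) (j ^ i)) (+ 0) ⟫
  ct (ι c1 * (U (f1 * j ^ l) * j ^ i) + ι c2 * (f2 * jʹ ^ l * j ^ i)) ≡⟪ tr (co-+ _ _ (+ 0)) (cong₂ Z._+_ (co-ι c1 _ (+ 0)) (co-ι c2 _ (+ 0))) ⟫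
  c1 Z.* ct (U (f1 * j ^ l) * j ^ i) Z.+ c2 Z.* ct (f2 * jʹ ^ l * j ^ i)
   ≡⟪ cong₂ (\a b -> c1 Z.* a Z.+ c2 Z.* b) (tr (co-cong (sym (UV (f1 * j ^ l) (j ^ i))) (+ 0)) (tr (ct-U _) (tr (co-cong (*-congˡ (V-^ j i)) (+ 0))
     (C1.ct-weight2 Φ1 N (O1.twist f1 j jʹ φ1 J1 J1ʹ s l i on1 j-x jʹ-x))))) (C2.ct-weight2 Φ2 N (O2.twist f2 jʹ j φ2 J2 J2ʹ s l i on2 jʹ-t j-t)) ⟫
  c1 Z.* (ct ε Z.* nth Φ1 N) Z.+ c2 Z.* (ct (- ε) Z.* nth Φ2 N) ≡⟪ cong (\a -> c1 Z.* (ct ε Z.* nth Φ1 N) Z.+ c2 Z.* (a Z.* nth Φ2 N)) (co-neg ε (+ 0)) ⟫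
  c1 Z.* (ct ε Z.* nth Φ1 N) Z.+ c2 Z.* (Z.- ct ε Z.* nth Φ2 N) ≡⟪ regroup c1 c2 (ct ε) (nth Φ1 N) (nth Φ2 N) ⟫
  ct ε Z.* (c1 Z.* nth Φ1 N Z.- c2 Z.* nth Φ2 N) ≡⟪ cong (ct ε Z.*_) (Z.i≡j⇒i-j≡0 equal) ⟫
  ct ε Z.* + 0 ≡⟪ Z.*-zeroʳ (ct ε) ⟫
  + 0 ■
  where
  open Weight2Pair pair
  N = s N.+ l N.* 1 N.+ i N.* 13
  Φ1 = φ1 ⊠ J1 ↑ l ⊠ J1ʹ ↑ i
  Φ2 = φ2 ⊠ J2 ↑ l ⊠ J2ʹ ↑ i
  regroup : ∀ c d e a b -> c Z.* (e Z.* a) Z.+ d Z.* (Z.- e Z.* b) ≡ e Z.* (c Z.* a Z.- d Z.* b)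
  regroup = arith
  shuffle : ∀ k c b -> k Z.* (c Z.* b) ≡ c Z.* (k Z.* b)
  shuffle = arith
  K = (+ 13) Z.^ s
  el = l N.* 1
  di = i N.* 13
  ψ1 = J1 ↑ l ⊠ J1ʹ ↑ i
  ψ2 = J2 ↑ l ⊠ J2ʹ ↑ i
  assoc : ∀ p q r n -> nth (p ⊠ q ⊠ r) n ≡ nth (p ⊠ (q ⊠ r)) n
  assoc p q r n = tr (⊠-**n (p ⊠ q) r n) (tr (PS.**-cong {nth (p ⊠ q)} {nth p PS.** nth q} {nth r} {nth r} (⊠-**n p q) (\_ -> ≡refl) n)
   (tr (PS.**-assoc (nth p) (nth q) (nth r) n) (sy (tr (⊠-**n p (q ⊠ r) n) (PS.**-cong {nth p} {nth p} {nth (q ⊠ r)} {nth q PS.** nth r} (\_ -> ≡refl) (⊠-**n q r) n)))))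
   where
   open PS using ()
   open Num using () renaming (⊠-** to ⊠-**n)
  scaled-ψ : Scaled (el N.+ di) ψ2 ψ1
  scaled-ψ = scaled-⊠ {el} {di} {J2 ↑ l} {J1 ↑ l} {J2ʹ ↑ i} {J1ʹ ↑ i} (scaled-↑ {1} {J2} {J1} l scaled-J) (scaled-↑ {13} {J2ʹ} {J1ʹ} i scaled-Jʹ)
  H = (+ 13) Z.^ (el N.+ di)
  c-scale : ∀ n -> nth ((c2 · dil (+ 13) φ2) ⊠ dil (+ 13) ψ2) n ≡ nth ((c1 Z.* K · φ1) ⊠ (H · ψ1)) n
  c-scale = ⊠-cong-nth (c2 · dil (+ 13) φ2) (c1 Z.* K · φ1) (dil (+ 13) ψ2) (H · ψ1) (\n -> tr (nth-· c2 (dil (+ 13) φ2) n) (tr (match n) (sy (nth-· (c1 Z.* K) φ1 n)))) (\n -> tr (scaled-ψ n) (sy (nth-· H ψ1 n)))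
  comm : ∀ p q n -> nth (p ⊠ q) n ≡ nth (q ⊠ p) n
  comm p q n = tr (⊠-**n p q n) (tr (PS.**-comm (nth p) (nth q) n) (sy (⊠-**n q p n)))
   where
   open PS using ()
   open Num using () renaming (⊠-** to ⊠-**n)
  -- Multiplication by 13^N turns the coefficient at N into one of a dilated polynomial, to which
  -- `match` and `scaled-ψ` apply.
  equal : c1 Z.* nth Φ1 N ≡ c2 Z.* nth Φ2 N
  equal = Z.*-cancelˡ-≡ ((+ 13) Z.^ N) _ _ {{Z.≢-nonZero (1^ᶻ N)}} (sy (
   (+ 13) Z.^ N Z.* (c2 Z.* nth Φ2 N) ≡⟪ tr (shuffle ((+ 13) Z.^ N) c2 (nth Φ2 N)) (cong (\a -> c2 Z.* ((+ 13) Z.^ N Z.* a)) (assoc φ2 (J2 ↑ l) (J2ʹ ↑ i) N)) ⟫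
   c2 Z.* ((+ 13) Z.^ N Z.* nth (φ2 ⊠ ψ2) N) ≡⟪ cong (c2 Z.*_) (dil-⊠ (+ 13) φ2 ψ2 N) ⟫
   c2 Z.* nth (dil (+ 13) φ2 ⊠ dil (+ 13) ψ2) N ≡⟪ sy (nth-·⊠ c2 (dil (+ 13) φ2) (dil (+ 13) ψ2) N) ⟫
   nth ((c2 · dil (+ 13) φ2) ⊠ dil (+ 13) ψ2) N ≡⟪ c-scale N ⟫
   nth ((c1 Z.* K · φ1) ⊠ (H · ψ1)) N ≡⟪ tr (nth-·⊠ (c1 Z.* K) φ1 (H · ψ1) N) (cong (c1 Z.* K Z.*_) (tr (comm φ1 (H · ψ1) N) (tr (nth-·⊠ H ψ1 φ1 N) (cong (H Z.*_) (comm ψ1 φ1 N))))) ⟫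
   c1 Z.* K Z.* (H Z.* nth (φ1 ⊠ ψ1) N) ≡⟪ regroupʹ c1 K H (nth (φ1 ⊠ ψ1) N) ⟫
   K Z.* H Z.* (c1 Z.* nth (φ1 ⊠ ψ1) N) ≡⟪ cong₂ (\a b -> a Z.* (c1 Z.* b)) (tr (sy (Z.^-distribˡ-+-* (+ 13) s (el N.+ di))) (cong ((+ 13) Z.^_) (sy (N.+-assoc s el di)))) (sy (assoc φ1 (J1 ↑ l) (J1ʹ ↑ i) N)) ⟫
   (+ 13) Z.^ N Z.* (c1 Z.* nth Φ1 N) ■))
   where
   regroupʹ : ∀ c K H b -> c Z.* K Z.* (H Z.* b) ≡ K Z.* H Z.* (c Z.* b)
   regroupʹ = arith

 module _ (a0 b0 c0 d0 a b c : ℕ) (π : Lists -> Shape) {π1 π2 : Carrier} (h1 : C1.Is π1 (π lists1)) (h2 : C2.Is π2 (π lists2)) where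
  form1 form2 : Carrier
  form1 = (E4 ^ a0 * E6 ^ b0 * Δ⁻ ^ c0 * t ^ d0) * (E4ʹ ^ a * E6ʹ ^ b * Δʹ⁻ ^ c) * π1
  form2 = (E4ʹ ^ a0 * E6ʹ ^ b0 * Δʹ⁻ ^ c0 * x ^ d0) * (E4 ^ a * E6 ^ b * Δ⁻ ^ c) * π2

  private
   S : Lists -> Shape
   S D = Product.full D a0 b0 c0 d0 a b c (π D)

   module Assemble (C : Curve) (D : Lists) where
    open Curve C using (Is; is-*; is-^; is-Xi; Xi)
    open Product D using (s4; s4ʹ; s6; s6ʹ; sδ; sδʹ)
    full : ∀ {F4 F4ʹ F6 F6ʹ G Gʹ P} -> Is F4 s4 -> Is F4ʹ s4ʹ -> Is F6 s6 -> Is F6ʹ s6ʹ -> Is G sδ -> Is Gʹ sδʹ -> Is P (π D) ->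
     Is ((F4 ^ a0 * F6 ^ b0 * G ^ c0 * Xi ^ d0) * (F4ʹ ^ a * F6ʹ ^ b * Gʹ ^ c) * P) (S D)
    full f fʹ g gʹ h hʹ p = is-* {S = U1 ⊗ U2} {π D} (is-* {S = U1} {U2}
     (is-* {S = s4 ⊗^ a0 ⊗ s6 ⊗^ b0 ⊗ sδ ⊗^ c0} {shape 0 0 0 0 d0 (+ 1 ∷ [])} (is-* {S = s4 ⊗^ a0 ⊗ s6 ⊗^ b0} {sδ ⊗^ c0} (is-* {S = s4 ⊗^ a0} {s6 ⊗^ b0} (is-^ {S = s4} a0 f) (is-^ {S = s6} b0 g)) (is-^ {S = sδ} c0 h)) (is-Xi d0))
     (is-* {S = s4ʹ ⊗^ a ⊗ s6ʹ ⊗^ b} {sδʹ ⊗^ c} (is-* {S = s4ʹ ⊗^ a} {s6ʹ ⊗^ b} (is-^ {S = s4ʹ} a fʹ) (is-^ {S = s6ʹ} b gʹ)) (is-^ {S = sδʹ} c hʹ))) p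
     where
     U1 = s4 ⊗^ a0 ⊗ s6 ⊗^ b0 ⊗ sδ ⊗^ c0 ⊗ shape 0 0 0 0 d0 (+ 1 ∷ [])
     U2 = s4ʹ ⊗^ a ⊗ s6ʹ ⊗^ b ⊗ sδʹ ⊗^ c

  pair : ∀ c1 c2 -> T (trace? c1 c2 (fullp a0 b0 c0 d0 a b c π)) -> Weight2Pair c1 c2 form1 form2
  pair c1 c2 chk = record
   { s = s1 ; φ1 = φ1 ; φ2 = φ2
   ; on1 = C1.is-weight2 {form1} {μ1} {s1} {φ1} (subst (\m -> C1.Is form1 (shape m μ1 0 0 s1 φ1)) m1 (C1.is-clear {form1} {Shape.m (S lists1)} {μ1} {Shape.α (S lists1)} {Shape.β (S lists1)} {s1} {Shape.num (S lists1)} φ1 q1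
     (Assemble.full curve1 lists1 i4 i4ʹ i6 i6ʹ iδ iδʹ h1)))
   ; on2 = C2.is-weight2 {form2} {μ2} {s1} {φ2} (subst (\s -> C2.Is form2 (shape (suc μ2) μ2 0 0 s φ2)) (sy s≡) (subst (\m -> C2.Is form2 (shape m μ2 0 0 s2 φ2)) m2 (C2.is-clear {form2} {Shape.m (S lists2)} {μ2} {Shape.α (S lists2)} {Shape.β (S lists2)} {s2} {Shape.num (S lists2)} φ2 q2
     (Assemble.full curve2 lists2 k4 k4ʹ k6 k6ʹ kδ kδʹ h2))))
   ; match = \n -> tr (sy (nth-· c2 (dil (+ 13) φ2) n)) (tr (nth-== (c2 · dil (+ 13) φ2) ((c1 Z.* (+ 13) Z.^ s1) · φ1) fr n) (nth-· (c1 Z.* (+ 13) Z.^ s1) φ1 n)) }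
   where
   φ1 = Product.cleared lists1 (S lists1)
   φ2 = Product.cleared lists2 (S lists2)
   s1 = Shape.s (S lists1)
   s2 = Shape.s (S lists2)
   μ1 = Shape.μ (S lists1)
   μ2 = Shape.μ (S lists2)
   W1 = Product.weight2? lists1 (S lists1)
   W2 = Product.weight2? lists2 (S lists2)
   Fr = fricke? c1 c2 (S lists1) (S lists2)
   w1 : T W1
   w1 = ∧-fst {W1} {W2 ∧ Fr} chk
   w2 : T W2
   w2 = ∧-fst {W2} {Fr} (∧-snd {W1} {W2 ∧ Fr} chk)
   wf : T Fr
   wf = ∧-snd {W2} {Fr} (∧-snd {W1} {W2 ∧ Fr} chk)
   Q1 = Shape.num (S lists1) == φ1 ⊠ (Lists.A lists1 ↑ Shape.α (S lists1) ⊠ Lists.B lists1 ↑ Shape.β (S lists1))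
   Q2 = Shape.num (S lists2) == φ2 ⊠ (Lists.A lists2 ↑ Shape.α (S lists2) ⊠ Lists.B lists2 ↑ Shape.β (S lists2))
   q1 = ∧-fst {Q1} {Shape.m (S lists1) ≡ᵇ suc μ1} w1
   q2 = ∧-fst {Q2} {Shape.m (S lists2) ≡ᵇ suc μ2} w2
   m1 = N.≡ᵇ⇒≡ (Shape.m (S lists1)) (suc μ1) (∧-snd {Q1} {Shape.m (S lists1) ≡ᵇ suc μ1} w1)
   m2 = N.≡ᵇ⇒≡ (Shape.m (S lists2)) (suc μ2) (∧-snd {Q2} {Shape.m (S lists2) ≡ᵇ suc μ2} w2)
   F1 = c2 · dil (+ 13) φ2 == (c1 Z.* (+ 13) Z.^ s1) · φ1
   fr = ∧-fst {F1} {s1 ≡ᵇ s2} wf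
   s≡ = N.≡ᵇ⇒≡ s1 s2 (∧-snd {F1} {s1 ≡ᵇ s2} wf)

-- Level one forms described by constant terms.

module LevelOne where
 open import Data.Nat.Tactic.RingSolver using () renaming (solve-∀ to arithℕ)
 open PS using (+ˡ; *ˡ)
 open LInt
 open Base
 open Poly
 open Num
 open Forms
 open Param
 open Delta
 open TraceLemma
 open BaseL
 open Eval
 open Numeric
 open FormsL
 open ParamL hiding (a; c; d)
 open DeltaL

 i≤∣i∣ : ∀ i -> i Z.≤ + Z.∣ i ∣
 i≤∣i∣ (+ n)    = Z.≤-refl
 i≤∣i∣ -[1+ n ] = Z.-≤+

 lead-cong : ∀ {X Y k v} -> X ≈ Y -> Lead X k v -> Lead Y k v
 lead-cong e (l , h) = Low-cong e l , tr (sy (co-cong e _)) h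

 lead-val : ∀ {X v} -> Val X v -> Lead X (+ 0) v
 lead-val (l , e) = l , e

 lead-j : Lead j mone (+ 1)
 lead-j = lead-* (lead-val (val-* val-E4 (val-* val-E4 (val-* val-E4 (val-ι (+ 1)))))) lead-Δ⁻

 lead-j^ : ∀ n -> Lead (j ^ n) (Z.- (+ n)) (+ 1)
 lead-j^ zero    = lead-val (val-ι (+ 1))
 lead-j^ (suc n) = subst (\k -> Lead (j ^ suc n) k (+ 1)) (lem n) (lead-* lead-j (lead-j^ n))
  where
  lem : ∀ n -> mone Z.+ Z.- (+ n) ≡ -[1+ n ]
  lem zero    = ≡refl
  lem (suc n) = ≡refl

 Perp : Carrier -> Carrier -> Set
 Perp B X = ∀ k -> ct (X * (B * j ^ k)) ≡ + 0

 perp-cong : ∀ {B X Y} -> X ≈ Y -> Perp B X -> Perp B Y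
 perp-cong e p k = tr (co-cong (*-congʳ (sym e)) (+ 0)) (p k)

 perp-combine : ∀ {B X Y} c -> Perp B X -> Perp B Y -> Perp B (X - ι c * Y)
 perp-combine {B} {X} {Y} c p r k = co-cong (solve 4 (\x c y b -> (x :- c :* y) :* b := x :* b :- c :* (y :* b)) refl X (ι c) Y (B * j ^ k)) (+ 0)
  ⟫ (co-sub _ _ (+ 0) ⟫ (cong₂ Z._-_ (p k) (co-ι c _ (+ 0) ⟫ (*ˡ c (r k) ⟫ Z.*-zeroʳ c))))
  where
  infixr 5 _⟫_
  _⟫_ : ∀ {a b c : ℤ} -> a ≡ b -> b ≡ c -> a ≡ c
  _⟫_ = tr

 module _ {B kB} (lead-B : Lead B kB (+ 1)) where
  private
   lead-b : ∀ k -> Lead (B * j ^ k) (kB Z.+ Z.- (+ k)) (+ 1)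
   lead-b k = lead-* lead-B (lead-j^ k)

  perp-lead : ∀ {X} -> Perp B X -> ∀ k -> Low X (Z.- kB Z.+ + k) -> co X (Z.- kB Z.+ + k) ≡ + 0
  perp-lead {X} p k l =
   co X m ≡⟪ sy (Z.*-identityʳ _) ⟫
   co X m Z.* + 1 ≡⟪ *ˡ (co X m) (sy (proj₂ (lead-b k))) ⟫
   co X m Z.* co (B * j ^ k) (kB Z.+ Z.- (+ k)) ≡⟪ sy (co-lead l (proj₁ (lead-b k))) ⟫
   co (X * (B * j ^ k)) (m Z.+ (kB Z.+ Z.- (+ k))) ≡⟪ cong (co (X * (B * j ^ k))) (lem kB (+ k)) ⟫
   ct (X * (B * j ^ k)) ≡⟪ p k ⟫
   + 0 ■
   where
   m = Z.- kB Z.+ + k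
   lem : ∀ b k -> (Z.- b Z.+ k) Z.+ (b Z.+ Z.- k) ≡ + 0
   lem = arith

  -- B j^k has leading coefficient 1 at the exponent kB - k, so the relations for k = 0, 1, 2, ...
  -- successively kill the coefficients of X from -kB upwards.
  perp-zero : ∀ {X} -> Perp B X -> Low X (Z.- kB) -> X ≈ ι (+ 0)
  perp-zero {X} p l = Low-all X \n -> Low-weaken (le n) (low (n N.+ Z.∣ kB ∣))
   where
   low : ∀ n -> Low X (Z.- kB Z.+ + n)
   low zero    = subst (Low X) (sy (Z.+-identityʳ (Z.- kB))) l
   low (suc n) = subst (Low X) (step (Z.- kB) (+ n)) (Low-step (low n) (perp-lead p n (low n)))
    where
    step : ∀ b n -> + 1 Z.+ (b Z.+ n) ≡ b Z.+ (+ 1 Z.+ n)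
    step = arith
   le : ∀ n -> + n Z.≤ Z.- kB Z.+ + (n N.+ Z.∣ kB ∣)
   le n = subst (Z._≤ Z.- kB Z.+ + (n N.+ Z.∣ kB ∣)) (lem kB (+ n)) (Z.+-monoʳ-≤ (Z.- kB) (Z.≤-trans (Z.+-monoʳ-≤ (+ n) (i≤∣i∣ kB)) (Z.≤-reflexive ≡refl)))
    where
    lem : ∀ b n -> Z.- b Z.+ (n Z.+ b) ≡ n
    lem = arith

  module _ {A kA} (lead-A : Lead A kA (+ 1)) (kA+kB : kA Z.+ kB ≡ mone) (pairing : ∀ i -> Perp B (A * j ^ i)) where
   monol : ℕ -> ℤ -> Poly
   monol zero    c = c ∷ []
   monol (suc n) c = + 0 ∷ monol n c

   ev-mono : ∀ n c X -> ev (monol n c) X ≈ ι c * X ^ n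
   ev-mono zero    c X = solve 2 (\c x -> c :+ x :* :0 := c :* :1) refl (ι c) X
   ev-mono (suc n) c X = trans (+-congˡ (*-congˡ (ev-mono n c X))) (solve 3 (\c x y -> :0 :+ x :* (c :* y) := c :* (x :* y)) refl (ι c) X (X ^ n))

   private
    go : ∀ d {X} -> Perp B X -> Low X (Z.- kB Z.+ Z.- (+ d)) -> ∃ \ρ -> X ≈ A * ev ρ j
    go zero {X} p l = [] , trans (perp-zero p (subst (Low X) (Z.+-identityʳ (Z.- kB)) l)) (solve 1 (\a -> :0 := a :* :0) refl A)
    go (suc d) {X} p l = let ρ , e = go d {X - ι c * Y} (perp-combine c p (pairing d)) lowʹ in
     ρ ⊞ monol d c , (begin
      X ≈⟨ solve 2 (\x y -> x := (x :- y) :+ y) refl X (ι c * Y) ⟩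
      X - ι c * Y + ι c * Y ≈⟨ +-cong e (solve 3 (\c a y -> c :* (a :* y) := a :* (c :* y)) refl (ι c) A (j ^ d)) ⟩
      A * ev ρ j + A * (ι c * j ^ d) ≈⟨ sym (distribˡ A (ev ρ j) (ι c * j ^ d)) ⟩
      A * (ev ρ j + ι c * j ^ d) ≈⟨ *-congˡ (sym (trans (ev-⊞ ρ (monol d c) j) (+-congˡ (ev-mono d c j)))) ⟩
      A * ev (ρ ⊞ monol d c) j ∎)
     where
     m = Z.- kB Z.+ -[1+ d ]
     c = co X m
     Y = A * j ^ d
     m≡ : kA Z.+ Z.- (+ d) ≡ m
     m≡ = lem kA kB (Z.- (+ d)) kA+kB ⟫ cong (\s -> Z.- kB Z.+ s) (neg d)
      where
      infixr 5 _⟫_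
      _⟫_ : ∀ {a b c : ℤ} -> a ≡ b -> b ≡ c -> a ≡ c
      _⟫_ = tr
      neg : ∀ d -> mone Z.+ Z.- (+ d) ≡ -[1+ d ]
      neg zero    = ≡refl
      neg (suc d) = ≡refl
      lem0 : ∀ a b d -> a Z.+ d ≡ Z.- b Z.+ ((a Z.+ b) Z.+ d)
      lem0 = arith
      lem : ∀ a b d -> a Z.+ b ≡ mone -> a Z.+ d ≡ Z.- b Z.+ (mone Z.+ d)
      lem a b d e = tr (lem0 a b d) (cong (\s -> Z.- b Z.+ (s Z.+ d)) e)
     lead-Y : Lead Y m (+ 1)
     lead-Y = subst (\k -> Lead Y k (+ 1)) m≡ (lead-* lead-A (lead-j^ d))
     lowʹ : Low (X - ι c * Y) (Z.- kB Z.+ Z.- (+ d))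
     lowʹ = subst (Low (X - ι c * Y)) (up d) (Low-step (Low-+ l (Low-neg (Low-ι c (proj₁ lead-Y)))) zero-at)
      where
      up0 : ∀ b d -> + 1 Z.+ (b Z.+ (mone Z.+ d)) ≡ b Z.+ d
      up0 = arith
      neg : ∀ d -> -[1+ d ] ≡ mone Z.+ Z.- (+ d)
      neg zero    = ≡refl
      neg (suc d) = ≡refl
      up : ∀ d -> Z.suc (Z.- kB Z.+ -[1+ d ]) ≡ Z.- kB Z.+ Z.- (+ d)
      up d = tr (cong (\s -> + 1 Z.+ (Z.- kB Z.+ s)) (neg d)) (up0 (Z.- kB) (Z.- (+ d)))
      zero-at : co (X - ι c * Y) m ≡ + 0
      zero-at = tr (co-sub X (ι c * Y) m) (tr (cong (Z._-_ c) (tr (co-ι c Y m) (tr (*ˡ c (proj₂ lead-Y)) (Z.*-identityʳ c)))) (Z.+-inverseʳ c))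

   -- Because kA + kB = -1, the leading exponents of the series A jⁱ are exactly the integers below
   -- -kB. Subtracting multiples of them leads to a series covered by `perp-zero`.
   dual : ∀ {X} -> Perp B X -> ∃ \ρ -> X ≈ A * ev ρ j
   dual {X} p = go (proj₁ (below X) N.+ Z.∣ kB ∣) p (Low-weaken le (proj₂ (below X)))
    where
    d = proj₁ (below X)
    flip : ∀ k -> Z.- k Z.≤ + Z.∣ k ∣
    flip k = subst (\n -> Z.- k Z.≤ + n) (Z.∣-i∣≡∣i∣ k) (i≤∣i∣ (Z.- k))
    le : Z.- kB Z.+ Z.- (+ (d N.+ Z.∣ kB ∣)) Z.≤ Z.- (+ d)
    le = Z.≤-trans (Z.+-monoˡ-≤ (Z.- (+ (d N.+ Z.∣ kB ∣))) (flip kB)) (Z.≤-reflexive (lem (+ Z.∣ kB ∣) (+ d)))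
     where
     lem : ∀ k d -> k Z.+ Z.- (d Z.+ k) ≡ Z.- d
     lem = arith

 -- jʹ = −E₄²E₆/Δ, so that every level one form of weight two is a derivative

 θΔ⁻ : θ Δ⁻ ≈ - (E2 * Δ⁻)
 θΔ⁻ = begin
  θ (q mone * P²⁴) ≈⟨ trans (θ-* _ _) (+-cong (*-congʳ (θ-q mone)) (*-congˡ θP²⁴)) ⟩
  ι mone * q mone * P²⁴ + q mone * (ι (+ 24) * (S1 * P²⁴))
   ≈⟨ solve 3 (\r p s -> con mone :* r :* p :+ r :* (con (+ 24) :* (s :* p)) := :- ((:1 :+ con -[1+ 23 ] :* s) :* (r :* p))) refl (q mone) P²⁴ S1 ⟩
  - ((ι (+ 1) + ι -[1+ 23 ] * S1) * Δ⁻) ≈⟨ -‿cong (*-congʳ (sym E2-S1)) ⟩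
  - (E2 * Δ⁻) ∎

 A2 : Carrier
 A2 = E4 ^ 2 * E6 * Δ⁻

 θj : θ j ≈ - A2
 θj = begin
  θ (E4 ^ 3 * Δ⁻) ≈⟨ trans (θ-* _ _) (+-cong (*-congʳ (θ-^ E4 2)) (*-congˡ θΔ⁻)) ⟩
  ι (+ 3) * (E4 ^ 2 * θ E4) * Δ⁻ + E4 ^ 3 * - (E2 * Δ⁻)
   ≈⟨ solve 5 (\u e eʹ f d -> con (+ 3) :* (u :* eʹ) :* d :+ e :* u :* (:- (f :* d)) := u :* (con (+ 3) :* eʹ) :* d :- u :* (f :* e) :* d) refl (E4 ^ 2) E4 (θ E4) E2 Δ⁻ ⟩
  E4 ^ 2 * (ι (+ 3) * θ E4) * Δ⁻ - E4 ^ 2 * (E2 * E4) * Δ⁻ ≈⟨ +-congʳ (*-congʳ (*-congˡ θE4)) ⟩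
  E4 ^ 2 * (E2 * E4 - E6) * Δ⁻ - E4 ^ 2 * (E2 * E4) * Δ⁻ ≈⟨ solve 4 (\u w s d -> u :* (w :- s) :* d :- u :* w :* d := :- (u :* s :* d)) refl (E4 ^ 2) (E2 * E4) E6 Δ⁻ ⟩
  - A2 ∎

 ct-A2 : ∀ n -> ct (A2 * j ^ n) ≡ + 0
 ct-A2 n = cancelled (tr (sy (co-ι -[1+ n ] (A2 * j ^ n) (+ 0))) (tr (co-cong (sym total) (+ 0)) (ct-θ (j ^ suc n))))
  where
  total : θ (j ^ suc n) ≈ ι -[1+ n ] * (A2 * j ^ n)
  total = trans (θ-^ j n) (trans (*-congˡ (*-congˡ θj)) (trans (solve 3 (\k y a -> k :* (y :* (:- a)) := (:- k) :* (a :* y)) refl (ι (+ suc n)) (j ^ n) A2) (*-congʳ (sym (ι-- (+ suc n))))))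
  cancelled : ∀ {w} -> -[1+ n ] Z.* w ≡ + 0 -> w ≡ + 0
  cancelled {w} e = Z.*-cancelˡ-≡ -[1+ n ] w (+ 0) (tr e (sy (Z.*-zeroʳ -[1+ n ])))

 ct-A2-ev : ∀ p n -> ct (A2 * (j ^ n * ev p j)) ≡ + 0
 ct-A2-ev []      n = tr (co-cong (solve 2 (\a y -> a :* (y :* :0) := :0 :* :0) refl A2 (j ^ n)) (+ 0)) (co-ι (+ 0) (ι (+ 0)) (+ 0))
 ct-A2-ev (u ∷ p) n = tr (co-cong (solve 5 (\a y u j p -> a :* (y :* (u :+ j :* p)) := u :* (a :* y) :+ a :* ((j :* y) :* p)) refl A2 (j ^ n) (ι u) j (ev p j)) (+ 0))
  (tr (co-+ _ _ (+ 0)) (tr (cong₂ Z._+_ (tr (co-ι u _ (+ 0)) (tr (*ˡ u (ct-A2 n)) (Z.*-zeroʳ u))) (ct-A2-ev p (suc n))) ≡refl))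

 E6²Δ⁻ : E6 ^ 2 * Δ⁻ ≈ j - ι (+ 1728)
 E6²Δ⁻ = begin
  E6 ^ 2 * Δ⁻ ≈⟨ solve 3 (\f e d -> f :* d := e :* d :- (e :- f) :* d) refl (E6 ^ 2) (E4 ^ 3) Δ⁻ ⟩
  j - (E4 ^ 3 - E6 ^ 2) * Δ⁻ ≈⟨ +-congˡ (-‿cong (trans (*-congʳ discriminant) (trans (*-assoc _ _ _) (trans (*-congˡ ΔΔ⁻) (solve 0 (con (+ 1728) :* :1 := con (+ 1728)) refl))))) ⟩
  j - ι (+ 1728) ∎

 mon : ℕ -> ℕ -> ℕ -> ℕ -> Carrier
 mon a b m k = E4 ^ a * E6 ^ b * (Δ ^ m * Δ⁻ ^ k)

 private
  six : ∀ n k -> 6 N.+ n ≡ k N.* 6 N.+ 1 -> ∃ \kʹ -> (k ≡ suc kʹ) × (n ≡ kʹ N.* 6 N.+ 1)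
  six n (suc k) e = k , ≡refl , cong (N._∸ 6) e

  base : ∀ {a b X} -> ct X ≡ + 0 -> X ≈ a * b -> ct (a * b) ≡ + 0
  base e h = tr (co-cong (sym h) (+ 0)) e

 -- The hypothesis is half the condition of weight 2. The relations E₄³/Δ = j, E₆²/Δ = j - 1728 and
 -- Δ · 1/Δ = 1 reduce the monomial until only E₄²E₆/Δ times a polynomial in j is left.
 ct-mon : ∀ a b m k p -> a N.* 2 N.+ b N.* 3 N.+ m N.* 6 ≡ k N.* 6 N.+ 1 -> ct (mon a b m k * ev p j) ≡ + 0
 ct-mon (suc (suc (suc a))) b m k p e with six (a N.* 2 N.+ b N.* 3 N.+ m N.* 6) k e
 ... | kʹ , ≡refl , eʹ = base (ct-mon a b m kʹ (+ 0 ∷ p) eʹ)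
  (solve 6 (\u e v w d p -> u :* v :* w :* (:0 :+ (e :* (e :* (e :* :1)) :* d) :* p) := e :* (e :* (e :* u)) :* v :* (w :* d) :* p) refl (E4 ^ a) E4 (E6 ^ b) (Δ ^ m * Δ⁻ ^ kʹ) Δ⁻ (ev p j)
  ⟫ *-congʳ (*-congˡ (trans (*-assoc _ _ _) (*-congˡ (*-comm _ _)))))
  where
  infixr 5 _⟫_
  _⟫_ : ∀ {a b c} -> a ≈ b -> b ≈ c -> a ≈ c
  _⟫_ = trans
 ct-mon a (suc (suc b)) m k p e with six (a N.* 2 N.+ b N.* 3 N.+ m N.* 6) k (tr (lem (a N.* 2) (b N.* 3) (m N.* 6)) e)
  where
  lem : ∀ a b m -> 6 N.+ (a N.+ b N.+ m) ≡ a N.+ (3 N.+ (3 N.+ b)) N.+ m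
  lem = arithℕ
 ... | kʹ , ≡refl , eʹ = base (ct-mon a b m kʹ ((+ 0 ∷ p) ⊟ (+ 1728 · p)) eʹ) (begin
  mon a b m kʹ * ev ((+ 0 ∷ p) ⊟ (+ 1728 · p)) j ≈⟨ *-congˡ (trans (ev-⊟ (+ 0 ∷ p) (+ 1728 · p) j) (+-congˡ (-‿cong (ev-· (+ 1728) p j)))) ⟩
  mon a b m kʹ * (ι (+ 0) + j * ev p j - ι (+ 1728) * ev p j) ≈⟨ *-congˡ (trans (solve 3 (\k j p -> :0 :+ j :* p :- k :* p := (j :- k) :* p) refl (ι (+ 1728)) j (ev p j)) (*-congʳ (sym E6²Δ⁻))) ⟩
  E4 ^ a * E6 ^ b * (Δ ^ m * Δ⁻ ^ kʹ) * (E6 ^ 2 * Δ⁻ * ev p j)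
   ≈⟨ solve 7 (\u v f x y d p -> u :* v :* (x :* y) :* (f :* (f :* :1) :* d :* p) := u :* (f :* (f :* v)) :* (x :* (d :* y)) :* p) refl (E4 ^ a) (E6 ^ b) E6 (Δ ^ m) (Δ⁻ ^ kʹ) Δ⁻ (ev p j) ⟩
  mon a (suc (suc b)) m (suc kʹ) * ev p j ∎)
 ct-mon a b (suc m) k p e with six (a N.* 2 N.+ b N.* 3 N.+ m N.* 6) k (tr (lem (a N.* 2) (b N.* 3) (m N.* 6)) e)
  where
  lem : ∀ a b m -> 6 N.+ (a N.+ b N.+ m) ≡ a N.+ b N.+ (6 N.+ m)
  lem = arithℕ
 ... | kʹ , ≡refl , eʹ = base (ct-mon a b m kʹ p eʹ) (begin
  E4 ^ a * E6 ^ b * (Δ ^ m * Δ⁻ ^ kʹ) * ev p j ≈⟨ solve 5 (\u v x y p -> u :* v :* (x :* y) :* p := u :* v :* (:1 :* (x :* y)) :* p) refl (E4 ^ a) (E6 ^ b) (Δ ^ m) (Δ⁻ ^ kʹ) (ev p j) ⟩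
  E4 ^ a * E6 ^ b * (ι (+ 1) * (Δ ^ m * Δ⁻ ^ kʹ)) * ev p j ≈⟨ *-congʳ (*-congˡ (trans (*-congʳ (sym ΔΔ⁻)) (solve 4 (\d d⁻ x y -> d :* d⁻ :* (x :* y) := d :* x :* (d⁻ :* y)) refl Δ Δ⁻ (Δ ^ m) (Δ⁻ ^ kʹ)))) ⟩
  mon a b (suc m) (suc kʹ) * ev p j ∎)
 ct-mon 2 1 0 1 p e = base (ct-A2-ev p 0)
  (solve 4 (\e f d p -> e :* (e :* :1) :* f :* d :* (:1 :* p) := e :* (e :* :1) :* (f :* :1) :* (:1 :* (d :* :1)) :* p) refl E4 E6 Δ⁻ (ev p j))
 ct-mon 2 1 0 0 p ()
 ct-mon 2 1 0 (suc (suc k)) p ()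
 ct-mon 0 0 0 zero p ()
 ct-mon 0 0 0 (suc k) p ()
 ct-mon 1 0 0 zero p ()
 ct-mon 1 0 0 (suc k) p ()
 ct-mon 2 0 0 zero p ()
 ct-mon 2 0 0 (suc k) p ()
 ct-mon 0 1 0 zero p ()
 ct-mon 0 1 0 (suc k) p ()
 ct-mon 1 1 0 zero p ()
 ct-mon 1 1 0 (suc k) p ()

 -- A formal substitute for Z having weight v: the monomials involved are those of weight 2 - v.
 Annihilated : ℤ -> Carrier -> Set
 Annihilated v Z = ∀ a b m k -> v Z.+ + (a N.* 4 N.+ b N.* 6 N.+ m N.* 12) ≡ + (k N.* 12 N.+ 2) -> ct (Z * mon a b m k) ≡ + 0

 -- Level one forms of weight w, described through their action by multiplication:
 -- they send series orthogonal to all monomials of complementary weight to such series.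
 record Mod (w : ℤ) (X : Carrier) : Set where
  constructor mod
  field
   act : ∀ v Z -> Annihilated v Z -> Annihilated (v Z.+ w) (Z * X)

 open Mod

 mod-≈ : ∀ {w X Y} -> X ≈ Y -> Mod w X -> Mod w Y
 mod-≈ e h = mod \v Z r a b m k eq -> tr (co-cong (*-congʳ (*-congˡ (sym e))) (+ 0)) (act h v Z r a b m k eq)

 mod-weight : ∀ {w wʹ X} -> w ≡ wʹ -> Mod w X -> Mod wʹ X
 mod-weight ≡refl h = h

 mod-* : ∀ {w wʹ X Y} -> Mod w X -> Mod wʹ Y -> Mod (w Z.+ wʹ) (X * Y)
 mod-* {w} {wʹ} {X} {Y} h hʹ = mod \v Z r a b m k eq -> tr (co-cong (*-congʳ (sym (*-assoc Z X Y))) (+ 0))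
  (act hʹ (v Z.+ w) (Z * X) (act h v Z r) a b m k (tr (cong (Z._+ + (a N.* 4 N.+ b N.* 6 N.+ m N.* 12)) (Z.+-assoc v w wʹ)) eq))

 mod-+ : ∀ {w X Y} -> Mod w X -> Mod w Y -> Mod w (X + Y)
 mod-+ {w} {X} {Y} h hʹ = mod \v Z r a b m k eq -> tr (co-cong (solve 4 (\z x y m -> z :* (x :+ y) :* m := z :* x :* m :+ z :* y :* m) refl Z X Y (mon a b m k)) (+ 0))
  (tr (co-+ _ _ (+ 0)) (cong₂ Z._+_ (act h v Z r a b m k eq) (act hʹ v Z r a b m k eq)))

 mod-0 : ∀ {w X} -> X ≈ ι (+ 0) -> Mod w X
 mod-0 e = mod \v Z r a b m k eq -> tr (co-cong (trans (*-congʳ (*-congˡ e)) (solve 2 (\z m -> z :* :0 :* m := :0 :* :0) refl Z (mon a b m k))) (+ 0)) (co-ι (+ 0) (ι (+ 0)) (+ 0))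

 mod-ι : ∀ c -> Mod (+ 0) (ι c)
 mod-ι c = mod \v Z r a b m k eq -> tr (co-cong (solve 3 (\z c m -> z :* c :* m := c :* (z :* m)) refl Z (ι c) (mon a b m k)) (+ 0))
  (tr (co-ι c _ (+ 0)) (tr (*ˡ c (r a b m k (tr (cong (Z._+ + (a N.* 4 N.+ b N.* 6 N.+ m N.* 12)) (sy (Z.+-identityʳ v))) eq))) (Z.*-zeroʳ c)))

 mod-E4 : Mod (+ 4) E4
 mod-E4 = mod \v Z r a b m k eq -> tr (co-cong (solve 5 (\z e u v w -> z :* e :* (u :* v :* w) := z :* (e :* u :* v :* w)) refl Z E4 (E4 ^ a) (E6 ^ b) (Δ ^ m * Δ⁻ ^ k)) (+ 0))
  (r (suc a) b m k (tr (lem v (+ (a N.* 4 N.+ b N.* 6 N.+ m N.* 12))) eq))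
  where
  lem : ∀ v n -> v Z.+ (+ 4 Z.+ n) ≡ v Z.+ + 4 Z.+ n
  lem = arith

 mod-E6 : Mod (+ 6) E6
 mod-E6 = mod \v Z r a b m k eq -> tr (co-cong (solve 5 (\z e u v w -> z :* e :* (u :* v :* w) := z :* (u :* (e :* v) :* w)) refl Z E6 (E4 ^ a) (E6 ^ b) (Δ ^ m * Δ⁻ ^ k)) (+ 0))
  (r a (suc b) m k (tr (cong (\n -> v Z.+ + n) (lemℕ (a N.* 4) (b N.* 6) (m N.* 12))) (tr (lem v (+ (a N.* 4 N.+ b N.* 6 N.+ m N.* 12))) eq)))
  where
  lemℕ : ∀ a b m -> a N.+ (6 N.+ b) N.+ m ≡ 6 N.+ (a N.+ b N.+ m)
  lemℕ = arithℕ
  lem : ∀ v n -> v Z.+ (+ 6 Z.+ n) ≡ v Z.+ + 6 Z.+ n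
  lem = arith

 mod-Δ : Mod (+ 12) Δ
 mod-Δ = mod \v Z r a b m k eq -> tr (co-cong (solve 5 (\z e u v w -> z :* e :* (u :* (v :* w)) := z :* (u :* (e :* v :* w))) refl Z Δ (E4 ^ a * E6 ^ b) (Δ ^ m) (Δ⁻ ^ k)) (+ 0))
  (r a b (suc m) k (tr (cong (\n -> v Z.+ + n) (lemℕ (a N.* 4) (b N.* 6) (m N.* 12))) (tr (lem v (+ (a N.* 4 N.+ b N.* 6 N.+ m N.* 12))) eq)))
  where
  lemℕ : ∀ a b m -> a N.+ b N.+ (12 N.+ m) ≡ 12 N.+ (a N.+ b N.+ m)
  lemℕ = arithℕ
  lem : ∀ v n -> v Z.+ (+ 12 Z.+ n) ≡ v Z.+ + 12 Z.+ n
  lem = arith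

 mod-Δ⁻ : Mod -[1+ 11 ] Δ⁻
 mod-Δ⁻ = mod \v Z r a b m k eq -> tr (co-cong (solve 5 (\z e u v w -> z :* e :* (u :* (v :* w)) := z :* (u :* (v :* (e :* w)))) refl Z Δ⁻ (E4 ^ a * E6 ^ b) (Δ ^ m) (Δ⁻ ^ k)) (+ 0))
  (r a b m (suc k) (tr (lem v (+ (a N.* 4 N.+ b N.* 6 N.+ m N.* 12))) (cong (\s -> + 12 Z.+ s) eq)))
  where
  lem : ∀ v n -> v Z.+ n ≡ + 12 Z.+ (v Z.+ -[1+ 11 ] Z.+ n)
  lem = arith

 mod-^ : ∀ {w X} n -> Mod w X -> Mod (+ n Z.* w) (X ^ n)
 mod-^ {w} zero    h = mod-weight (sy (Z.*-zeroˡ w)) (mod-ι (+ 1))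
 mod-^ {w} {X} (suc n) h = mod-weight (lem (+ n) w) (mod-* {w} {+ n Z.* w} {X} {X ^ n} h (mod-^ n h))
  where
  lem : ∀ n w -> w Z.+ n Z.* w ≡ (+ 1 Z.+ n) Z.* w
  lem = arith

 mod-j : Mod (+ 0) j
 mod-j = mod-* {+ 12} { -[1+ 11 ]} {E4 ^ 3} {Δ⁻} (mod-^ {+ 4} {E4} 3 mod-E4) mod-Δ⁻

 mod-ev : ∀ p -> Mod (+ 0) (ev p j)
 mod-ev []      = mod-ι (+ 0)
 mod-ev (u ∷ p) = mod-+ {X = ι u} {j * ev p j} (mod-ι u) (mod-* {+ 0} {+ 0} {j} {ev p j} mod-j (mod-ev p))

 -- By `ct-mon` the series 1 is annihilated by all monomials of weight 2, so X = 1 · X is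
 -- annihilated in weight 2, in particular by the empty monomial.
 mod-ct : ∀ {X} -> Mod (+ 2) X -> ct X ≡ + 0
 mod-ct {X} h = tr (co-cong (solve 1 (\x -> x := :1 :* x :* (:1 :* :1 :* (:1 :* :1))) refl X) (+ 0))
  (act h (+ 0) (ι (+ 1)) (\a b m k e -> tr (co-cong (solve 2 (\y j -> :1 :* y := y :* (:1 :+ j :* :0)) refl (mon a b m k) j) (+ 0))
    (ct-mon a b m k (+ 1 ∷ []) (halve a b m k (Z.+-injective e)))) 0 0 0 0 ≡refl)
  where
  halve : ∀ a b m k -> a N.* 4 N.+ b N.* 6 N.+ m N.* 12 ≡ k N.* 12 N.+ 2 -> a N.* 2 N.+ b N.* 3 N.+ m N.* 6 ≡ k N.* 6 N.+ 1
  halve a b m k e = N.*-cancelˡ-≡ _ _ 2 (tr (l a b m) (tr e (r k)))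
   where
   l : ∀ a b m -> 2 N.* (a N.* 2 N.+ b N.* 3 N.+ m N.* 6) ≡ a N.* 4 N.+ b N.* 6 N.+ m N.* 12
   l = arithℕ
   r : ∀ k -> k N.* 12 N.+ 2 ≡ 2 N.* (k N.* 6 N.+ 1)
   r = arithℕ

 mod-perp : ∀ {X} -> Mod (+ 2) X -> Perp (ι (+ 1)) X
 mod-perp {X} h k = mod-ct {X * (ι (+ 1) * j ^ k)} (mod-* {+ 2} {+ 0} {X} {ι (+ 1) * j ^ k} h
  (mod-* {+ 0} {+ 0} {ι (+ 1)} {j ^ k} (mod-ι (+ 1)) (mod-weight (Z.*-zeroʳ (+ k)) (mod-^ {+ 0} {j} k mod-j))))

-- Traces as level one forms of known weight.

module Tau where
 open import Data.Nat.Base as N using (ℕ; zero; suc; _∸_; _≡ᵇ_; _≤ᵇ_)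
 open import Data.Bool.Base using (Bool; true; T; _∧_)
 open PS using (+ˡ; *ˡ)
 open LInt
 open LL
 open Base
 open Poly
 open Forms
 open Param hiding (pl)
 open Delta
 open Side
 open Curves
 open Trace
 open TraceLemma
 open LevelOne
 open BaseL
 open Eval
 open FormsL
 open ParamL hiding (a; c; d)
 open DeltaL
 open SideL
 open TraceL

 below? : ℕ -> (ℕ -> Bool) -> Bool
 below? zero    f = true
 below? (suc n) f = below? n f ∧ f n

 below-sound : ∀ k f -> T (below? k f) -> ∀ n -> n N.< k -> T (f n)
 below-sound (suc k) f t n (N.s≤s n≤) with N.m≤n⇒m<n∨m≡n n≤
 ... | inj₁ n<     = below-sound k f (∧-fst {below? k f} {f k} t) n n<
 ... | inj₂ I.refl = ∧-snd {below? k f} {f k} t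

 below-sound2 : ∀ k (f : ℕ -> ℕ -> Bool) -> T (below? k \m -> below? k (f m)) -> ∀ m n -> m N.< k -> n N.< k -> T (f m n)
 below-sound2 k f t m n m< n< = below-sound k (f m) (below-sound k (\m -> below? k (f m)) t m m<) n n<

 ae be ce : ℕ -> ℕ
 ae i = proj₁ (Fe i)
 be i = proj₁ (proj₂ (Fe i))
 ce i = proj₂ (proj₂ (Fe i))

 F : ℕ -> Carrier
 F i = E4 ^ ae i * E6 ^ be i * Δ⁻ ^ ce i

 lead-^ : ∀ {X k v} n -> Lead X k v -> Lead (X ^ n) (+ n Z.* k) (v Z.^ n)
 lead-^ {X} {k} zero    h = subst (\m -> Lead (ι (+ 1)) m (+ 1)) (sy (Z.*-zeroˡ k)) (lead-val (val-ι (+ 1)))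
 lead-^ {X} {k} {v} (suc n) h = subst (\m -> Lead (X ^ suc n) m (v Z.^ suc n)) (lem (+ n) k) (lead-* h (lead-^ n h))
  where
  lem : ∀ n w -> w Z.+ n Z.* w ≡ (+ 1 Z.+ n) Z.* w
  lem = arith

 lead-F : ∀ i -> Lead (F i) (Z.- (+ ce i)) (+ 1)
 lead-F i = I.subst₂ (Lead (F i)) (ex (+ ae i) (+ be i) (+ ce i))
   (cong₂ Z._*_ (cong₂ Z._*_ (Z.^-zeroˡ (ae i)) (Z.^-zeroˡ (be i))) (Z.^-zeroˡ (ce i)))
   (lead-* (lead-* (lead-^ (ae i) (lead-val val-E4)) (lead-^ (be i) (lead-val val-E6))) (lead-^ (ce i) lead-Δ⁻))
  where
  ex : ∀ a b c -> a Z.* + 0 Z.+ b Z.* + 0 Z.+ c Z.* mone ≡ Z.- c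
  ex = arith

 unit-F : ∀ i -> Unitlike (F i)
 unit-F i = unit-lead 1≢0 (lead-F i)

 mod-F : ∀ i -> Mod (+ ae i Z.* + 4 Z.+ + be i Z.* + 6 Z.+ + ce i Z.* -[1+ 11 ]) (F i)
 mod-F i = mod-* (mod-* (mod-^ (ae i) mod-E4) (mod-^ (be i) mod-E6)) (mod-^ (ce i) mod-Δ⁻)

 lead-A2 : Lead A2 mone (+ 1)
 lead-A2 = lead-* (lead-* (lead-^ 2 (lead-val val-E4)) (lead-val val-E6)) lead-Δ⁻

 -- The checks are wrapped in records so that they are only ever evaluated on numerals.
 record Fricke-ok (c1 c2 : ℤ) (a0 b0 c0 d0 i : ℕ) (π : Lists -> Shape) : Set where
  constructor fricke-ok
  field
   holds : T (trace? c1 c2 (fullp a0 b0 c0 d0 (ae i) (be i) (ce i) π))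

 weight? : ℕ -> Bool
 weight? i = (ae i ≤ᵇ 2) ∧ ((be i ≤ᵇ 1) ∧ ((2 ∸ ae i) N.* 4 N.+ (1 ∸ be i) N.* 6 N.+ ce i N.* 12 ≡ᵇ 10 N.+ 2 N.* i))

 record Weight-ok (i : ℕ) : Set where
  constructor weight-ok
  field
   holds : T (weight? i)

 -- `τ l` is a normalised trace of a level 13 form of weight 2i - 2 times jˡ: the term with U
 -- accounts for 13 cosets, the other term for the Fricke coset.
 module Tau (c1 c2 : ℤ) (a0 b0 c0 d0 i : ℕ) (π : Lists -> Shape) {π1 π2 : Carrier} (h1 : C1.Is π1 (π lists1)) (h2 : C2.Is π2 (π lists2)) where
  base1 base2 : Carrier
  base1 = E4 ^ a0 * E6 ^ b0 * Δ⁻ ^ c0 * t ^ d0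
  base2 = E4ʹ ^ a0 * E6ʹ ^ b0 * Δʹ⁻ ^ c0 * x ^ d0

  τ : ℕ -> Carrier
  τ l = ι c1 * U (base1 * π1 * j ^ l) + ι c2 * (base2 * π2 * jʹ ^ l)

  private
   Fʹ : Carrier
   Fʹ = E4ʹ ^ ae i * E6ʹ ^ be i * Δʹ⁻ ^ ce i

   VF : Fʹ ≈ V (F i)
   VF = sym (trans (V-* _ _) (*-cong (trans (V-* _ _) (*-cong (V-^ E4 (ae i)) (V-^ E6 (be i)))) (V-^ Δ⁻ (ce i))))

  -- `F i` lifts the weight to 2. By `UV` it enters the argument of U as its image under V, which
  -- gives the pair of forms required by `trace`.
  perp : Fricke-ok c1 c2 a0 b0 c0 d0 i π -> ∀ l -> Perp (ι (+ 1)) (τ l * F i)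
  perp ok l k = tr (co-cong (begin
   (ι c1 * U (base1 * π1 * j ^ l) + ι c2 * (base2 * π2 * jʹ ^ l)) * F i * (ι (+ 1) * j ^ k)
    ≈⟨ solve 8 (\a u b s p j f y -> (a :* u :+ b :* (s :* p :* j)) :* f :* (:1 :* y) := (a :* (u :* f) :+ b :* (s :* f :* p :* j)) :* y) refl (ι c1) (U (base1 * π1 * j ^ l)) (ι c2) base2 π2 (jʹ ^ l) (F i) (j ^ k) ⟩
   (ι c1 * (U (base1 * π1 * j ^ l) * F i) + ι c2 * (base2 * F i * π2 * jʹ ^ l)) * j ^ k
    ≈⟨ *-congʳ (+-congʳ (*-congˡ (trans (sym (UV _ (F i))) (U-cong (trans (*-congˡ (sym VF)) (solve 4 (\s p j f -> s :* p :* j :* f := s :* f :* p :* j) refl base1 π1 (j ^ l) Fʹ)))))) ⟩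
   (ι c1 * U (form1 a0 b0 c0 d0 (ae i) (be i) (ce i) π h1 h2 * j ^ l) + ι c2 * (form2 a0 b0 c0 d0 (ae i) (be i) (ce i) π h1 h2 * jʹ ^ l)) * j ^ k ∎) (+ 0))
   (trace (pair a0 b0 c0 d0 (ae i) (be i) (ce i) π h1 h2 c1 c2 (Fricke-ok.holds ok)) l k)

  -- `dual` gives τ F = `A2` ρ(j) with `A2` = E₄²E₆/Δ. Since a ≤ 2 and b ≤ 1, dividing by F leaves
  -- E₄^(2-a) E₆^(1-b) Δ^(c-1) ρ(j).
  modular : Fricke-ok c1 c2 a0 b0 c0 d0 i π -> Weight-ok i -> ∀ l -> Mod (+ (2 N.* i) Z.- + 2) (τ l)
  modular ok (weight-ok wt) l = mod-≈ (sym τ≈) (mod-weight weight≡ (mod-* (mod-* (mod-* (mod-^ (2 ∸ ae i) mod-E4) (mod-^ (1 ∸ be i) mod-E6)) (mod-* (mod-^ (ce i) mod-Δ) mod-Δ⁻)) (mod-ev ρ)))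
   where
   a = ae i
   b = be i
   c = ce i
   wt1 = 2 ∸ a
   wt2 = 1 ∸ b
   dualised : ∃ \ρ -> τ l * F i ≈ A2 * ev ρ j
   dualised = dual (lead-val (val-ι (+ 1))) lead-A2 ≡refl (\i k -> tr (co-cong (solve 3 (\a y z -> a :* y :* (:1 :* z) := a :* (y :* (z :* (:1 :+ z :* :0)))) refl A2 (j ^ i) (j ^ k)) (+ 0))
    (tr (co-cong (trans (*-congˡ (*-congˡ (solve 1 (\z -> z :* (:1 :+ z :* :0) := z) refl (j ^ k)))) (*-congˡ (sym (^-+ j i k)))) (+ 0)) (ct-A2 (i N.+ k)))) (perp ok l)
   ρ = proj₁ dualised
   comp = E4 ^ wt1 * E6 ^ wt2 * (Δ ^ c * Δ⁻)
   ok1 : a N.≤ 2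
   ok1 = N.≤ᵇ⇒≤ a 2 (∧-fst {a ≤ᵇ 2} {(b ≤ᵇ 1) ∧ (wt1 N.* 4 N.+ wt2 N.* 6 N.+ c N.* 12 ≡ᵇ 10 N.+ 2 N.* i)} wt)
   wtʹ = ∧-snd {a ≤ᵇ 2} {(b ≤ᵇ 1) ∧ (wt1 N.* 4 N.+ wt2 N.* 6 N.+ c N.* 12 ≡ᵇ 10 N.+ 2 N.* i)} wt
   ok2 : b N.≤ 1
   ok2 = N.≤ᵇ⇒≤ b 1 (∧-fst {b ≤ᵇ 1} {wt1 N.* 4 N.+ wt2 N.* 6 N.+ c N.* 12 ≡ᵇ 10 N.+ 2 N.* i} wtʹ)
   ok3 : wt1 N.* 4 N.+ wt2 N.* 6 N.+ c N.* 12 ≡ 10 N.+ 2 N.* i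
   ok3 = N.≡ᵇ⇒≡ _ _ (∧-snd {b ≤ᵇ 1} {wt1 N.* 4 N.+ wt2 N.* 6 N.+ c N.* 12 ≡ᵇ 10 N.+ 2 N.* i} wtʹ)
   Δ^ : ∀ n -> Δ ^ n * Δ⁻ ^ n ≈ ι (+ 1)
   Δ^ n = trans (^-* Δ Δ⁻ n) (trans (^-cong n ΔΔ⁻) (1^ n))
   F-comp : F i * comp ≈ A2
   F-comp = begin
    E4 ^ a * E6 ^ b * Δ⁻ ^ c * (E4 ^ wt1 * E6 ^ wt2 * (Δ ^ c * Δ⁻))
     ≈⟨ solve 7 (\u v w uʹ vʹ wʹ d -> u :* v :* w :* (uʹ :* vʹ :* (wʹ :* d)) := (u :* uʹ) :* (v :* vʹ) :* ((wʹ :* w) :* d)) refl (E4 ^ a) (E6 ^ b) (Δ⁻ ^ c) (E4 ^ wt1) (E6 ^ wt2) (Δ ^ c) Δ⁻ ⟩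
    (E4 ^ a * E4 ^ wt1) * (E6 ^ b * E6 ^ wt2) * ((Δ ^ c * Δ⁻ ^ c) * Δ⁻)
     ≈⟨ *-cong (*-cong (trans (sym (^-+ E4 a wt1)) (reflexive (cong (E4 ^_) (N.m+[n∸m]≡n ok1)))) (trans (sym (^-+ E6 b wt2)) (reflexive (cong (E6 ^_) (N.m+[n∸m]≡n ok2))))) (*-congʳ (Δ^ c)) ⟩
    E4 ^ 2 * (E6 * ι (+ 1)) * (ι (+ 1) * Δ⁻) ≈⟨ solve 3 (\e f d -> e :* (f :* :1) :* (:1 :* d) := e :* f :* d) refl (E4 ^ 2) E6 Δ⁻ ⟩
    A2 ∎
   τ≈ : τ l ≈ comp * ev ρ j
   τ≈ = cancel (unit-F i) (trans (*-comm _ _) (trans (proj₂ dualised) (trans (*-congʳ (sym F-comp)) (*-assoc _ _ _))))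
   weight≡ : + wt1 Z.* + 4 Z.+ + wt2 Z.* + 6 Z.+ (+ c Z.* + 12 Z.+ -[1+ 11 ]) Z.+ + 0 ≡ + (2 N.* i) Z.- + 2
   weight≡ = tr (cong₂ (\u v -> u Z.+ v Z.+ (+ c Z.* + 12 Z.+ -[1+ 11 ]) Z.+ + 0) (sy (Z.pos-* wt1 4)) (sy (Z.pos-* wt2 6)))
    (tr (cong (\u -> + (wt1 N.* 4) Z.+ + (wt2 N.* 6) Z.+ (u Z.+ -[1+ 11 ]) Z.+ + 0) (sy (Z.pos-* c 12)))
    (tr (l1 (+ (wt1 N.* 4)) (+ (wt2 N.* 6)) (+ (c N.* 12))) (tr (cong (\n -> + n Z.- + 12) ok3) (l2 (+ (2 N.* i))))))
    where
    l1 : ∀ u v w -> u Z.+ v Z.+ (w Z.+ -[1+ 11 ]) Z.+ + 0 ≡ u Z.+ v Z.+ w Z.- + 12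
    l1 = arith
    l2 : ∀ n -> (+ 10 Z.+ n) Z.- + 12 ≡ n Z.- + 2
    l2 = arith

 all≤6 : ∀ n -> n N.< 7 -> T (allQ n)
 all≤6 n n< = below-sound 7 allQ _ n n<

 -- The powers of 13 anticipate the vectors below: `R7` contributes 13ⁿ, `vG` the factor 13³ of its
 -- class 7 term, `vH` the factor 169 in front of h.
 module TauG (n : ℕ) (n<7 : n N.< 7) = Tau (+ 1) ((+ 13) Z.^ (3 N.+ n)) 1 0 0 0 (3 N.+ n) (pl n) (is-p1 n (all≤6 n n<7)) (is-p2 n (all≤6 n n<7))
 module TauH (n : ℕ) (n<7 : n N.< 7) = Tau (+ 169) ((+ 13) Z.^ n) 1 1 1 1 n (pl n) (is-p1 n (all≤6 n n<7)) (is-p2 n (all≤6 n n<7))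
 module TauΓ (m n : ℕ) (m<7 : m N.< 7) (n<7 : n N.< 7) = Tau (+ 1) ((+ 13) Z.^ (m N.+ n)) 0 0 0 1 (suc (m N.+ n)) (\D -> pl m D ⊗ pl n D)
  (C1.is-* {S = pl m lists1} {pl n lists1} (is-p1 m (all≤6 m m<7)) (is-p1 n (all≤6 n n<7))) (C2.is-* {S = pl m lists2} {pl n lists2} (is-p2 m (all≤6 m m<7)) (is-p2 n (all≤6 n n<7)))

 abstract
  τG-modular : ∀ n n< l -> Mod (+ (2 N.* (3 N.+ n)) Z.- + 2) (TauG.τ n n< l)
  τG-modular n n< = TauG.modular n n<
   (fricke-ok (below-sound 7 (\n -> trace? (+ 1) ((+ 13) Z.^ (3 N.+ n)) (fullp 1 0 0 0 (ae (3 N.+ n)) (be (3 N.+ n)) (ce (3 N.+ n)) (pl n))) _ n n<))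
   (weight-ok (below-sound 7 (\n -> weight? (3 N.+ n)) _ n n<))

  τH-modular : ∀ n n< l -> Mod (+ (2 N.* n) Z.- + 2) (TauH.τ n n< l)
  τH-modular n n< = TauH.modular n n<
   (fricke-ok (below-sound 7 (\n -> trace? (+ 169) ((+ 13) Z.^ n) (fullp 1 1 1 1 (ae n) (be n) (ce n) (pl n))) _ n n<))
   (weight-ok (below-sound 7 weight? _ n n<))

  γ-perp : ∀ m n m< n< -> Perp (ι (+ 1)) (TauΓ.τ m n m< n< 0 * F (suc (m N.+ n)))
  γ-perp m n m< n< = TauΓ.perp m n m< n<
   (fricke-ok (below-sound2 7 (\m n -> trace? (+ 1) ((+ 13) Z.^ (m N.+ n)) (fullp 0 0 0 1 (ae (suc (m N.+ n))) (be (suc (m N.+ n))) (ce (suc (m N.+ n))) (\D -> pl m D ⊗ pl n D))) _ m n m< n<)) 0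

-- Vectors of residue class components and their pairings.

module Vectors where
 open import Data.Nat.Base as N using (ℕ; zero; suc; _≡ᵇ_)
 open import Data.Integer.DivMod using (_%ℕ_; _/ℕ_; n%ℕd<d; a≡a%ℕn+[a/ℕn]*n)
 open import Data.Bool.Base using (true; false; T; if_then_else_)
 open PS using (+ˡ; *ˡ)
 open Series using (at)
 open Classes using (co-class)
 open LInt
 open Base
 open Poly
 open Forms
 open Param hiding (pl)
 open Delta
 open Side
 open Curves
 open Trace
 open TraceLemma
 open LevelOne
 open Tau
 open BaseL
 open Eval
 open FormsL
 open ParamL hiding (a; c; d)
 open DeltaL
 open SideL
 open TraceL

 mod-unique : ∀ {z} r w -> r N.< 13 -> z ≡ + r Z.+ w Z.* + 13 -> z %ℕ 13 ≡ r
 mod-unique {z} r w r< e = go (z /ℕ 13 Z.- w) (tr (lem1 (+ r) w (z /ℕ 13)) (tr (cong (\v -> v Z.+ (Z.- w Z.* + 13)) (sy e)) (tr (cong (\v -> v Z.+ (Z.- w Z.* + 13)) (a≡a%ℕn+[a/ℕn]*n z 13)) (lem2 (+ (z %ℕ 13)) (z /ℕ 13) w))))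
  where
  lem1 : ∀ r w k -> r ≡ r Z.+ w Z.* + 13 Z.+ (Z.- w Z.* + 13)
  lem1 = arith
  lem2 : ∀ s k w -> s Z.+ k Z.* + 13 Z.+ (Z.- w Z.* + 13) ≡ s Z.+ (k Z.- w) Z.* + 13
  lem2 = arith
  lem3 : ∀ s d -> s Z.+ Z.- d Z.* + 13 Z.+ d Z.* + 13 ≡ s
  lem3 = arith
  absurd : ∀ {m n} d -> m N.< 13 -> + m ≡ + n Z.+ + suc d Z.* + 13 -> z %ℕ 13 ≡ r
  absurd {m} {n} d m< e = ⊥-elim (N.<-irrefl (Z.+-injective (tr e (cong (\s -> + n Z.+ s) (sy (Z.pos-* (suc d) 13))))) (N.<-≤-trans m< (N.≤-trans (N.m≤m+n 13 (d N.* 13)) (N.m≤n+m _ n))))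
  go : ∀ d -> + r ≡ + (z %ℕ 13) Z.+ d Z.* + 13 -> z %ℕ 13 ≡ r
  go (+ zero)  e = sy (Z.+-injective (tr e (Z.+-identityʳ _)))
  go (+ suc d) e = absurd d r< e
  go -[1+ d ]  e = absurd d (n%ℕd<d z 13) (tr (sy (lem3 (+ (z %ℕ 13)) (+ suc d))) (cong (\v -> v Z.+ + suc d Z.* + 13) (sy e)))

 ≡ᵇ-refl : ∀ r -> (r ≡ᵇ r) ≡ true
 ≡ᵇ-refl zero    = ≡refl
 ≡ᵇ-refl (suc r) = ≡ᵇ-refl r

 ≡ᵇ-false : ∀ {m n} -> m ≢ n -> (m ≡ᵇ n) ≡ false
 ≡ᵇ-false {m} {n} ne with m ≡ᵇ n in e
 ... | true  = ⊥-elim (ne (N.≡ᵇ⇒≡ m n (subst T (sy e) _)))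
 ... | false = ≡refl

 co-Π-in : ∀ {r} X z -> z %ℕ 13 ≡ r -> co (Π r X) z ≡ co X z
 co-Π-in {r} X z ≡refl = tr (co-Π r X z) (cong (\b -> if b then co X z else + 0) (≡ᵇ-refl r))

 co-Π-out : ∀ {r} X z -> z %ℕ 13 ≢ r -> co (Π r X) z ≡ + 0
 co-Π-out {r} X z ne = tr (co-Π r X z) (cong (\b -> if b then co X z else + 0) (≡ᵇ-false ne))

 co-q-off : ∀ k z -> z ≢ k -> co (q k) z ≡ + 0
 co-q-off k z ne = tr (q-co k z) (zero-at (z Z.- k) (\e -> ne (Z.i-j≡0⇒i≡j z k e)))
  where
  zero-at : ∀ w -> w ≢ + 0 -> at (PS.con (+ 1)) w ≡ + 0
  zero-at (+ zero)  ne = ⊥-elim (ne ≡refl)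
  zero-at (+ suc n) ne = ≡refl
  zero-at -[1+ n ]  ne = ≡refl

 Pure : ℕ -> Carrier -> Set
 Pure r Y = ∀ ρ -> Π ρ Y ≈ (if r ≡ᵇ ρ then Y else ι (+ 0))

 pure-q : ∀ k -> Pure (k %ℕ 13) (q k)
 pure-q k ρ = co-ext go
  where
  if-co : ∀ b z -> co (if b then q k else ι (+ 0)) z ≡ (if b then co (q k) z else + 0)
  if-co true  z = ≡refl
  if-co false z = tr (co-ιz (+ 0) z) (zeros z)
   where
   zeros : ∀ z -> at (PS.con (+ 0)) z ≡ + 0
   zeros (+ zero)  = ≡refl
   zeros (+ suc n) = ≡refl
   zeros -[1+ n ]  = ≡refl
  if-0 : ∀ b {a} -> a ≡ + 0 -> (if b then a else + 0) ≡ + 0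
  if-0 true  e = e
  if-0 false e = ≡refl
  go : ∀ z -> co (Π ρ (q k)) z ≡ co (if k %ℕ 13 ≡ᵇ ρ then q k else ι (+ 0)) z
  go z with z Z.≟ k
  ... | yes ≡refl = tr (co-Π ρ (q k) z) (sy (if-co (k %ℕ 13 ≡ᵇ ρ) z))
  ... | no ne = tr (co-Π ρ (q k) z) (tr (if-0 (z %ℕ 13 ≡ᵇ ρ) (co-q-off k z ne)) (sy (tr (if-co (k %ℕ 13 ≡ᵇ ρ) z) (if-0 (k %ℕ 13 ≡ᵇ ρ) (co-q-off k z ne)))))

 pure-V : ∀ {r X} -> Pure r X -> ∀ Y -> Pure r (X * V Y)
 pure-V {r} {X} h Y ρ = trans (ΠV ρ X Y) (trans (*-congʳ (h ρ)) (lem (r ≡ᵇ ρ)))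
  where
  lem : ∀ b -> (if b then X else ι (+ 0)) * V Y ≈ (if b then X * V Y else ι (+ 0))
  lem true  = refl
  lem false = solve 1 (\y -> :0 :* y := :0) refl (V Y)

 sum-cong : ∀ n {F G} -> (∀ k -> k N.< n -> F k ≈ G k) -> sumr n F ≈ sumr n G
 sum-cong zero    h = refl
 sum-cong (suc n) h = +-cong (sum-cong n (\k k< -> h k (N.<-trans k< (N.n<1+n n)))) (h n (N.n<1+n n))

 sum-+ : ∀ n F G -> sumr n (\k -> F k + G k) ≈ sumr n F + sumr n G
 sum-+ zero    F G = sym (+-identityˡ 0#)
 sum-+ (suc n) F G = trans (+-congʳ (sum-+ n F G)) (solve 4 (\a b c d -> (a :+ b) :+ (c :+ d) := (a :+ c) :+ (b :+ d)) refl (sumr n F) (sumr n G) (F n) (G n))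

 sum-* : ∀ n X F -> X * sumr n F ≈ sumr n (\k -> X * F k)
 sum-* zero    X F = zeroʳ X
 sum-* (suc n) X F = trans (distribˡ X (sumr n F) (F n)) (+-congʳ (sum-* n X F))

 sum-zero : ∀ n {G} -> (∀ k -> k N.< n -> G k ≈ ι (+ 0)) -> sumr n G ≈ ι (+ 0)
 sum-zero zero    h = sym ι-0
 sum-zero (suc n) h = trans (+-cong (sum-zero n (\k k< -> h k (N.<-trans k< (N.n<1+n n)))) (h n (N.n<1+n n))) (solve 0 (:0 :+ :0 := :0) refl)

 sum-single : ∀ n r -> r N.< n -> ∀ {G} -> (∀ k -> k N.< n -> k ≢ r -> G k ≈ ι (+ 0)) -> sumr n G ≈ G r
 sum-single (suc n) r r< {G} h with r N.≟ n
 ... | yes ≡refl = trans (+-congʳ (sum-zero n \k k< -> h k (N.<-trans k< (N.n<1+n n)) (N.<⇒≢ k<))) (solve 1 (\x -> :0 :+ x := x) refl (G n))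
 ... | no ne = trans (+-cong (sum-single n r (N.≤∧≢⇒< (N.≤-pred r<) ne) (\k k< -> h k (N.<-trans k< (N.n<1+n n)))) (h n (N.n<1+n n) (\e -> ne (sy e)))) (solve 1 (\x -> x :+ :0 := x) refl (G r))

 Π-pure : ∀ s -> s N.< 13 -> ∀ r -> r N.< 13 -> ∀ X {Y} -> Pure r Y -> Π s (X * Y) ≈ Π (co-class s r) X * Y
 Π-pure s s< r r< X {Y} h = trans (Π-* s s< X Y) (trans (sum-single 13 r r< \k k< ne -> trans (*-congˡ (trans (h k) (reflexive (cong (\b -> if b then Y else ι (+ 0)) (≡ᵇ-false (\e -> ne (sy e))))))) (solve 1 (\x -> x :* :0 := :0) refl (Π (co-class s k) X)))
  (*-congˡ (trans (h r) (reflexive (cong (\b -> if b then Y else ι (+ 0)) (≡ᵇ-refl r))))))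

 N : ℕ -> Carrier
 N n = E * C1.p n

 R : ℕ -> ℕ -> Carrier
 R ρ n = Π ρ (N n)

 -- 24 times the Serre derivative in weight 2n + 1/2. The summand `N n` stems from the factor
 -- q^(1/24) by which (q;q)_∞ differs from η.
 N-suc : ∀ n -> N (suc n) ≈ ι (+ 24) * θ (N n) + N n - ι (+ (1 N.+ 4 N.* n)) * (M * N n)
 N-suc n = begin
  E * ((ι (+ 24) * θ p - ι (+ (4 N.* n)) * M * p) - ι (+ 12) * (ε * p))
   ≈⟨ solve 6 (\e p pʹ k m s -> e :* ((con (+ 24) :* pʹ :- k :* m :* p) :- con (+ 12) :* (s :* p)) := con (+ 24) :* (e :* pʹ) :- (k :* m :+ con (+ 12) :* s) :* (e :* p)) refl E p (θ p) (ι (+ (4 N.* n))) M ε ⟩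
  ι (+ 24) * (E * θ p) - (ι (+ (4 N.* n)) * M + ι (+ 12) * ε) * (E * p)
   ≈⟨ solve 7 (\e p pʹ k m s r -> con (+ 24) :* (e :* pʹ) :- (k :* m :+ con (+ 12) :* s) :* (e :* p) :=
     con (+ 24) :* (:- (r :* e) :* p :+ e :* pʹ) :+ e :* p :- (:1 :+ k) :* (m :* (e :* p)) :+ (m :- ((:1 :+ con -[1+ 23 ] :* r) :+ con (+ 12) :* s)) :* (e :* p)) refl E p (θ p) (ι (+ (4 N.* n))) M ε S1 ⟩
  ι (+ 24) * (- (S1 * E) * p + E * θ p) + E * p - (ι (+ 1) + ι (+ (4 N.* n))) * (M * (E * p)) + (M - ((ι (+ 1) + ι -[1+ 23 ] * S1) + ι (+ 12) * ε)) * (E * p)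
   ≈⟨ +-cong (+-cong (+-congʳ (*-congˡ (sym (trans (θ-* E p) (+-congʳ (*-congʳ θE)))))) (-‿cong (*-congʳ (sym (ι-+ (+ 1) (+ (4 N.* n))))))) (*-congʳ (0-sub (trans M-ε (+-congʳ E2-S1)))) ⟩
  ι (+ 24) * θ (E * p) + E * p - ι (+ (1 N.+ 4 N.* n)) * (M * (E * p)) + ι (+ 0) * (E * p)
   ≈⟨ solve 2 (\z y -> z :+ :0 :* y := z) refl (ι (+ 24) * θ (E * p) + E * p - ι (+ (1 N.+ 4 N.* n)) * (M * (E * p))) (E * p) ⟩
  ι (+ 24) * θ (E * p) + E * p - ι (+ (1 N.+ 4 N.* n)) * (M * (E * p)) ∎
  where p = C1.p n

 -- M is a multiple of a V-image, so multiplication by it commutes with `Π ρ`, as θ does; each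
 -- component obeys the recursion of the whole series.
 R-suc : ∀ ρ n -> R ρ (suc n) ≈ ι (+ 24) * θ (R ρ n) + R ρ n - ι (+ (1 N.+ 4 N.* n)) * (M * R ρ n)
 R-suc ρ n = trans (Π-cong ρ (trans (N-suc n) (+-congˡ (solve 2 (\k y -> :- (k :* y) := con mone :* (k :* y)) refl (ι (+ (1 N.+ 4 N.* n))) (M * N n)))))
  (trans (trans (Π-+ ρ _ _) (+-cong (trans (Π-+ ρ _ _) (+-congʳ (trans (Π-ι ρ (+ 24) _) (*-congˡ (Π-θ ρ (N n)))))) (trans (Π-ι ρ mone _) (*-congˡ (trans (Π-ι ρ (+ (1 N.+ 4 N.* n)) _) (*-congˡ ΠM))))))
   (+-congˡ (solve 2 (\k y -> con mone :* (k :* y) := :- (k :* y)) refl (ι (+ (1 N.+ 4 N.* n))) (M * R ρ n))))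
  where
  ΠM : Π ρ (M * N n) ≈ M * R ρ n
  ΠM = trans (Π-cong ρ (solve 3 (\k v y -> k :* v :* y := k :* (y :* v)) refl (ι (+ 13)) E2ʹ (N n))) (trans (Π-ι ρ (+ 13) _) (trans (*-congˡ (ΠV ρ (N n) E2)) (solve 3 (\k v y -> k :* (y :* v) := k :* v :* y) refl (ι (+ 13)) E2ʹ (R ρ n))))

 R-0 : ∀ ρ -> R ρ 0 ≈ Π ρ E
 R-0 ρ = Π-cong ρ (solve 1 (\e -> e :* :1 := e) refl E)

 R-off : ∀ ρ -> Pent.pentagonal ρ ≡ false -> ∀ n -> R ρ n ≈ ι (+ 0)
 R-off ρ off zero = trans (R-0 ρ) (co-ext \z -> tr (go z) (sy (tr (co-cong ι-0 z) (co-0 z))))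
  where
  go : ∀ z -> co (Π ρ E) z ≡ + 0
  go z with z %ℕ 13 N.≟ ρ
  go (+ n)    | yes e = tr (co-Π-in E (+ n) e) (tr (co-emb Euler.E (+ n)) (Pent.E-support n (tr (cong Pent.pentagonal e) off)))
  go -[1+ n ] | yes e = tr (co-Π-in E -[1+ n ] e) (co-emb Euler.E -[1+ n ])
  go z        | no ne = co-Π-out E z ne
 R-off ρ off (suc n) = trans (R-suc ρ n) (trans (+-cong (+-cong (*-congˡ (trans (θ-cong (R-off ρ off n)) (θ-ι (+ 0)))) (R-off ρ off n)) (-‿cong (*-congˡ (*-congˡ (R-off ρ off n)))))
  (solve 2 (\k m -> con (+ 24) :* :0 :+ :0 :- k :* (m :* :0) := :0) refl (ι (+ (1 N.+ 4 N.* n))) M))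

 Π7E : Π 7 E ≈ q (+ 7) * V (V E)
 Π7E = co-ext go
  where
  l : ∀ z -> z ≡ + 7 Z.+ (z Z.- + 7)
  l = arith
  go : ∀ z -> co (Π 7 E) z ≡ co (q (+ 7) * V (V E)) z
  go z with multiple? (z Z.- + 7)
  ... | inj₂ no-multiple = tr (co-Π-out E z \e -> no-multiple (z /ℕ 13) (tr (cong (Z._- + 7) (tr (a≡a%ℕn+[a/ℕn]*n z 13) (cong (\r -> + r Z.+ z /ℕ 13 Z.* + 13) e))) (cancel7 (z /ℕ 13 Z.* + 13))))
   (sy (tr (co-q (+ 7) (V (V E)) z) (co-V0 (V E) (z Z.- + 7) no-multiple)))
   where
   cancel7 : ∀ y -> + 7 Z.+ y Z.- + 7 ≡ y
   cancel7 = arith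
  ... | inj₁ (w , e) = tr (co-Π-in E z (mod-unique {z} 7 w (N.≤ᵇ⇒≤ 8 13 _) z≡)) (tr (cong (co E) z≡) (tr (values w) (sy (tr (co-q (+ 7) (V (V E)) z) (tr (cong (co (V (V E))) e) (co-V (V E) w))))))
   where
   z≡ : z ≡ + 7 Z.+ w Z.* + 13
   z≡ = tr (l z) (cong (\s -> + 7 Z.+ s) e)
   VE : ∀ w -> co (V E) w ≡ at (Series.Vp Euler.E) w
   VE w = tr (co-cong (sym (emb-V Euler.E)) w) (co-emb _ w)
   values : ∀ w -> co E (+ 7 Z.+ w Z.* + 13) ≡ co (V E) w
   values (+ m)    = tr (tr (cong (\k -> co E (+ 7 Z.+ k)) (sy (Z.pos-* m 13))) (co-emb Euler.E (+ (7 N.+ m N.* 13)))) (tr (Pent.E-class7 m) (sy (VE (+ m))))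
   values -[1+ m ] = tr (co-emb Euler.E (+ 7 Z.+ -[1+ m ] Z.* + 13)) (sy (VE -[1+ m ]))

 -- On q⁷ V(Y) every term of the recursion carries a factor 13: the derivative of V(Y) by `θV`, M by
 -- definition, and the remaining term because 24 · 7 + 1 = 13². What is left under V is the
 -- recursion of the second curve.
 R7 : ∀ n -> R 7 n ≈ ι ((+ 13) Z.^ n) * (q (+ 7) * V (V E * C2.p n))
 R7 zero = trans (R-0 7) (trans Π7E (trans (*-congˡ (V-cong (solve 1 (\e -> e := e :* :1) refl (V E)))) (solve 1 (\y -> y := :1 :* y) refl _)))
 R7 (suc n) = begin
  R 7 (suc n) ≈⟨ R-suc 7 n ⟩
  ι (+ 24) * θ (R 7 n) + R 7 n - k * (M * R 7 n) ≈⟨ +-cong (+-cong (*-congˡ (trans (θ-cong (R7 n)) (trans (θ-ι* K _) (*-congˡ θqV)))) (R7 n)) (-‿cong (*-congˡ (*-congˡ (R7 n)))) ⟩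
  ι (+ 24) * (κ * (ι (+ 7) * q (+ 7) * V Y + q (+ 7) * (ι (+ 13) * V (θ Y)))) + κ * (q (+ 7) * V Y) - k * (ι (+ 13) * V E2 * (κ * (q (+ 7) * V Y)))
   ≈⟨ solve 6 (\κ r y yʹ k e -> con (+ 24) :* (κ :* (con (+ 7) :* r :* y :+ r :* (con (+ 13) :* yʹ))) :+ κ :* (r :* y) :- k :* (con (+ 13) :* e :* (κ :* (r :* y))) :=
     con (+ 13) :* κ :* (r :* ((con (+ 24) :* yʹ :+ con (+ 13) :* y) :- k :* e :* y))) refl κ (q (+ 7)) (V Y) (V (θ Y)) k (V E2) ⟩
  ι (+ 13) * κ * (q (+ 7) * ((ι (+ 24) * V (θ Y) + ι (+ 13) * V Y) - k * V E2 * V Y)) ≈⟨ *-cong (sym (ι-* (+ 13) K)) (*-congˡ (sym V-inner)) ⟩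
  ι ((+ 13) Z.^ suc n) * (q (+ 7) * V ((ι (+ 24) * θ Y + ι (+ 13) * Y) - k * (E2 * Y))) ≈⟨ *-congˡ (*-congˡ (V-cong inner)) ⟩
  ι ((+ 13) Z.^ suc n) * (q (+ 7) * V (V E * C2.p (suc n))) ∎
  where
  K = (+ 13) Z.^ n
  κ = ι K
  p̃ = C2.p n
  Y = V E * p̃
  k = ι (+ (1 N.+ 4 N.* n))
  θqV : θ (q (+ 7) * V Y) ≈ ι (+ 7) * q (+ 7) * V Y + q (+ 7) * (ι (+ 13) * V (θ Y))
  θqV = trans (θ-* _ _) (+-cong (*-congʳ (θ-q (+ 7))) (*-congˡ (θV Y)))
  V-inner : V ((ι (+ 24) * θ Y + ι (+ 13) * Y) - k * (E2 * Y)) ≈ (ι (+ 24) * V (θ Y) + ι (+ 13) * V Y) - k * V E2 * V Y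
  V-inner = trans (V-sub _ _) (+-cong (trans (V-+ _ _) (+-cong (V-ι* (+ 24) _) (V-ι* (+ 13) _))) (-‿cong (trans (V-ι* _ _) (trans (*-congˡ (V-* E2 Y)) (sym (*-assoc _ _ _))))))
  inner : (ι (+ 24) * θ Y + ι (+ 13) * Y) - k * (E2 * Y) ≈ V E * C2.p (suc n)
  inner = begin
   (ι (+ 24) * θ (V E * p̃) + ι (+ 13) * (V E * p̃)) - k * (E2 * (V E * p̃)) ≈⟨ +-cong (+-congʳ (*-congˡ (trans (θ-* _ _) (+-congʳ (*-congʳ θVE))))) (-‿cong (*-congʳ (ι-+ (+ 1) (+ (4 N.* n))))) ⟩
   (ι (+ 24) * (- (ι (+ 13) * V S1 * V E) * p̃ + V E * θ p̃) + ι (+ 13) * (V E * p̃)) - (ι (+ 1) + ι (+ (4 N.* n))) * (E2 * (V E * p̃))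
    ≈⟨ solve 7 (\e p pʹ s k m w -> (con (+ 24) :* (:- (con (+ 13) :* s :* e) :* p :+ e :* pʹ) :+ con (+ 13) :* (e :* p)) :- (:1 :+ k) :* (m :* (e :* p)) :=
      e :* ((con (+ 24) :* pʹ :- k :* m :* p) :- con (+ 12) :* ((:- w) :* p)) :+ (con (+ 13) :* (:1 :+ con -[1+ 23 ] :* s) :- (m :+ con (+ 12) :* w)) :* (e :* p)) refl
      (V E) p̃ (θ p̃) (V S1) (ι (+ (4 N.* n))) E2 ε ⟩
   V E * C2.p (suc n) + (ι (+ 13) * (ι (+ 1) + ι -[1+ 23 ] * V S1) - (E2 + ι (+ 12) * ε)) * (V E * p̃)
    ≈⟨ +-congˡ (*-congʳ (0-sub (trans (*-congˡ (sym (trans (V-cong E2-S1) (trans (V-+ _ _) (+-cong (V-ι (+ 1)) (V-ι* -[1+ 23 ] S1)))))) M-ε))) ⟩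
   V E * C2.p (suc n) + ι (+ 0) * (V E * p̃) ≈⟨ solve 2 (\y z -> y :+ :0 :* z := y) refl _ (V E * p̃) ⟩
   V E * C2.p (suc n) ∎

 -- The convolution over residue classes gives class s of X N_n. The vector is altered at ρ = 7
 -- only, where `R7` makes the extra product computable.
 pairing : ∀ s -> s N.< 13 -> ∀ X C n -> sumr 13 (\ρ -> (Π (co-class s ρ) X + (if 7 ≡ᵇ ρ then C else ι (+ 0))) * R ρ n) ≈ Π s (X * N n) + C * R 7 n
 pairing s s< X C n = begin
  sumr 13 (\ρ -> (Π (co-class s ρ) X + (if 7 ≡ᵇ ρ then C else ι (+ 0))) * R ρ n) ≈⟨ sum-cong 13 {\ρ -> (A ρ + D ρ) * R ρ n} {\ρ -> A ρ * R ρ n + D ρ * R ρ n} (\ρ _ -> distribʳ (R ρ n) (A ρ) (D ρ)) ⟩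
  sumr 13 (\ρ -> Π (co-class s ρ) X * R ρ n + (if 7 ≡ᵇ ρ then C else ι (+ 0)) * R ρ n) ≈⟨ sum-+ 13 (\ρ -> A ρ * R ρ n) (\ρ -> D ρ * R ρ n) ⟩
  sumr 13 (\ρ -> Π (co-class s ρ) X * R ρ n) + sumr 13 (\ρ -> (if 7 ≡ᵇ ρ then C else ι (+ 0)) * R ρ n)
   ≈⟨ +-cong (sym (Π-* s s< X (N n))) (sum-single 13 7 (N.≤ᵇ⇒≤ 8 13 _) {\ρ -> D ρ * R ρ n} \ρ _ ne -> trans (*-congʳ (reflexive (cong (\b -> if b then C else ι (+ 0)) (≡ᵇ-false (\e -> ne (sy e)))))) (solve 1 (\y -> :0 :* y := :0) refl (R ρ n))) ⟩
  Π s (X * N n) + C * R 7 n ∎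
  where
  A D : ℕ -> Carrier
  A ρ = Π (co-class s ρ) X
  D ρ = if 7 ≡ᵇ ρ then C else ι (+ 0)

 private
  0<13 : 0 N.< 13
  0<13 = N.≤ᵇ⇒≤ 1 13 _
  1<13 : 1 N.< 13
  1<13 = N.≤ᵇ⇒≤ 2 13 _

  Π1q : ∀ X -> Π 1 (q (+ 1) * V (E * E) * X) ≈ q (+ 1) * V (E * E) * V (U X)
  Π1q X = trans (Π-cong 1 (*-comm _ _)) (trans (Π-pure 1 1<13 1 1<13 X (pure-V {1} {q (+ 1)} (pure-q (+ 1)) (E * E))) (trans (*-congʳ (Π0 X)) (*-comm _ _)))

  EE : E * E ≈ q (+ 1) * V (E * E) * t
  EE = sym (begin
   q (+ 1) * V (E * E) * (q mone * (E * E * (V P * V P))) ≈⟨ *-congʳ (*-congˡ (V-* E E)) ⟩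
   q (+ 1) * (V E * V E) * (q mone * (E * E * (V P * V P))) ≈⟨ solve 5 (\a b e v w -> a :* (v :* v) :* (b :* (e :* e :* (w :* w))) := (a :* b) :* (v :* w) :* (v :* w) :* (e :* e)) refl (q (+ 1)) (q mone) E (V E) (V P) ⟩
   q (+ 1) * q mone * (V E * V P) * (V E * V P) * (E * E) ≈⟨ *-congʳ (*-cong (*-cong (q-inv (+ 1)) VEP) VEP) ⟩
   ι (+ 1) * ι (+ 1) * ι (+ 1) * (E * E) ≈⟨ solve 1 (\y -> :1 :* :1 :* :1 :* y := y) refl (E * E) ⟩
   E * E ∎)

  xEE : x * (E * E) ≈ q (+ 1) * (V E * V E)
  xEE = trans (solve 4 (\a v p e -> a :* (v :* v :* (p :* p)) :* (e :* e) := a :* (v :* v) :* ((e :* p) :* (e :* p))) refl (q (+ 1)) (V E) P E)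
   (trans (*-congˡ (*-cong EP EP)) (solve 2 (\a v -> a :* v :* (:1 :* :1) := a :* v) refl (q (+ 1)) (V E * V E)))

  V-j^ : ∀ l -> V (j ^ l) ≈ jʹ ^ l
  V-j^ l = V-^ j l

  -- Because 7 + 7 = 1 + 13 and x E² = q V(E)², two factors of class 7 have the same prefactor q
  -- V(E²) as class 1 of a product containing E².
  q14 : ∀ Y -> (q (+ 7) * V (V E)) * (q (+ 7) * V (V E * Y)) ≈ q (+ 1) * V (E * E) * V (x * Y)
  q14 Y = sym (begin
   q (+ 1) * V (E * E) * V (x * Y) ≈⟨ *-assoc _ _ _ ⟩
   q (+ 1) * (V (E * E) * V (x * Y)) ≈⟨ *-congˡ (trans (sym (V-* (E * E) (x * Y))) (V-cong (trans (solve 3 (\e x y -> e :* (x :* y) := (x :* e) :* y) refl (E * E) x Y) (trans (*-congʳ xEE) (solve 3 (\a v y -> a :* (v :* v) :* y := a :* (v :* (v :* y))) refl (q (+ 1)) (V E) Y))))) ⟩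
   q (+ 1) * V (q (+ 1) * (V E * (V E * Y))) ≈⟨ *-congˡ (trans (V-* _ _) (*-cong (V-q (+ 1)) (V-* _ _))) ⟩
   q (+ 1) * (q (+ 13) * (V (V E) * V (V E * Y))) ≈⟨ sym (*-assoc _ _ _) ⟩
   q (+ 1) * q (+ 13) * (V (V E) * V (V E * Y)) ≈⟨ *-congʳ (trans (sym (q-+ (+ 1) (+ 13))) (q-+ (+ 7) (+ 7))) ⟩
   q (+ 7) * q (+ 7) * (V (V E) * V (V E * Y)) ≈⟨ solve 3 (\a u v -> a :* a :* (u :* v) := (a :* u) :* (a :* v)) refl (q (+ 7)) (V (V E)) (V (V E * Y)) ⟩
   (q (+ 7) * V (V E)) * (q (+ 7) * V (V E * Y)) ∎)

 -- Paired with the components of `N n`, the classes of g yield the term with U of `TauG`, and the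
 -- addition at ρ = 7 yields its Fricke term. `vH` and `vM` are built on the same pattern for class
 -- 1.
 vG : Carrier -> ℕ -> Carrier
 vG g ρ = Π (co-class 0 ρ) g + (if 7 ≡ᵇ ρ then ι (+ 2197) * (q -[1+ 6 ] * V (V g)) else ι (+ 0))

 vH : Carrier -> ℕ -> Carrier
 vH h ρ = Π (co-class 1 ρ) (ι (+ 169) * h) + (if 7 ≡ᵇ ρ then q (+ 7) * V (V h) else ι (+ 0))

 vM : ℕ -> ℕ -> Carrier
 vM m ρ = Π (co-class 1 ρ) (N m) + (if 7 ≡ᵇ ρ then R 7 m else ι (+ 0))

 g : ℕ -> Carrier
 g l = E4 * j ^ l * P

 h : ℕ -> Carrier
 h l = E * (E4 * E6 * Δ⁻ * j ^ l)

 T-G : ∀ n n< l -> sumr 13 (\ρ -> vG (g l) ρ * R ρ n) ≈ V (TauG.τ n n< l)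
 T-G n n< l = begin
  sumr 13 (\ρ -> vG (g l) ρ * R ρ n) ≈⟨ pairing 0 0<13 (g l) _ n ⟩
  Π 0 (g l * N n) + ι (+ 2197) * (q -[1+ 6 ] * V (V (g l))) * R 7 n ≈⟨ +-cong (trans (Π0 _) (V-cong (trans (U-cong first) (solve 1 (\y -> y := :1 :* y) refl _)))) second ⟩
  V (ι (+ 1) * U (TauG.base1 n n< * C1.p n * j ^ l)) + V (ι ((+ 13) Z.^ (3 N.+ n)) * (TauG.base2 n n< * C2.p n * jʹ ^ l)) ≈⟨ sym (V-+ _ _) ⟩
  V (TauG.τ n n< l) ∎
  where
  first : g l * N n ≈ TauG.base1 n n< * C1.p n * j ^ l
  first = trans (solve 5 (\a j p e r -> a :* j :* p :* (e :* r) := a :* j :* r :* (e :* p)) refl E4 (j ^ l) P E (C1.p n)) (trans (*-congˡ EP)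
   (solve 3 (\a j r -> a :* j :* r :* :1 := a :* :1 :* :1 :* :1 :* :1 :* r :* j) refl E4 (j ^ l) (C1.p n)))
  K = (+ 13) Z.^ n
  second : ι (+ 2197) * (q -[1+ 6 ] * V (V (g l))) * R 7 n ≈ V (ι ((+ 13) Z.^ (3 N.+ n)) * (TauG.base2 n n< * C2.p n * jʹ ^ l))
  second = begin
   ι (+ 2197) * (q -[1+ 6 ] * V (V (g l))) * R 7 n ≈⟨ *-congˡ (R7 n) ⟩
   ι (+ 2197) * (q -[1+ 6 ] * V (V (g l))) * (ι K * (q (+ 7) * V (V E * C2.p n)))
    ≈⟨ solve 6 (\a b v k c w -> a :* (b :* v) :* (k :* (c :* w)) := a :* k :* ((c :* b) :* (v :* w))) refl (ι (+ 2197)) (q -[1+ 6 ]) (V (V (g l))) (ι K) (q (+ 7)) (V (V E * C2.p n)) ⟩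
   ι (+ 2197) * ι K * ((q (+ 7) * q -[1+ 6 ]) * (V (V (g l)) * V (V E * C2.p n)))
    ≈⟨ *-cong (trans (sym (ι-* (+ 2197) K)) (ι-≡ (assoc13 K))) (trans (*-cong (q-inv (+ 7)) (sym (V-* _ _))) (solve 1 (\y -> :1 :* y := y) refl _)) ⟩
   ι ((+ 13) Z.^ (3 N.+ n)) * V (V (g l) * (V E * C2.p n)) ≈⟨ sym (V-ι* _ _) ⟩
   V (ι ((+ 13) Z.^ (3 N.+ n)) * (V (g l) * (V E * C2.p n))) ≈⟨ V-cong (*-congˡ (begin
    V (E4 * j ^ l * P) * (V E * C2.p n) ≈⟨ *-congʳ (trans (V-* _ _) (*-congʳ (trans (V-* _ _) (*-congˡ (V-j^ l))))) ⟩
    E4ʹ * jʹ ^ l * V P * (V E * C2.p n) ≈⟨ solve 5 (\a j p e r -> a :* j :* p :* (e :* r) := a :* j :* r :* (e :* p)) refl E4ʹ (jʹ ^ l) (V P) (V E) (C2.p n) ⟩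
    E4ʹ * jʹ ^ l * C2.p n * (V E * V P) ≈⟨ *-congˡ VEP ⟩
    E4ʹ * jʹ ^ l * C2.p n * ι (+ 1) ≈⟨ solve 3 (\a j r -> a :* j :* r :* :1 := a :* :1 :* :1 :* :1 :* :1 :* r :* j) refl E4ʹ (jʹ ^ l) (C2.p n) ⟩
    TauG.base2 n n< * C2.p n * jʹ ^ l ∎)) ⟩
   V (ι ((+ 13) Z.^ (3 N.+ n)) * (TauG.base2 n n< * C2.p n * jʹ ^ l)) ∎
   where
   assoc13 : ∀ k -> + 2197 Z.* k ≡ + 13 Z.* (+ 13 Z.* (+ 13 Z.* k))
   assoc13 = arith

 T-H : ∀ n n< l -> sumr 13 (\ρ -> vH (h l) ρ * R ρ n) ≈ q (+ 1) * V (E * E) * V (TauH.τ n n< l)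
 T-H n n< l = begin
  sumr 13 (\ρ -> vH (h l) ρ * R ρ n) ≈⟨ pairing 1 1<13 (ι (+ 169) * h l) _ n ⟩
  Π 1 (ι (+ 169) * h l * N n) + q (+ 7) * V (V (h l)) * R 7 n ≈⟨ +-cong (trans (Π-cong 1 first) (trans (Π-ι 1 (+ 169) _) (trans (*-congˡ (Π1q _)) (trans (solve 3 (\k w v -> k :* (w :* v) := w :* (k :* v)) refl (ι (+ 169)) W (V (U Z1))) (*-congˡ (sym (V-ι* _ _))))))) second ⟩
  W * V (ι (+ 169) * U Z1) + W * V (ι K * Z2) ≈⟨ sym (trans (*-congˡ (V-+ _ _)) (distribˡ W _ _)) ⟩
  W * V (TauH.τ n n< l) ∎
  where
  W = q (+ 1) * V (E * E)
  K = (+ 13) Z.^ n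
  B = E4 * E6 * Δ⁻ * j ^ l
  Z1 = TauH.base1 n n< * C1.p n * j ^ l
  Z2 = TauH.base2 n n< * C2.p n * jʹ ^ l
  first : ι (+ 169) * h l * N n ≈ ι (+ 169) * (W * Z1)
  first = begin
   ι (+ 169) * (E * B) * (E * C1.p n) ≈⟨ solve 4 (\k e b p -> k :* (e :* b) :* (e :* p) := k :* ((e :* e) :* (b :* p))) refl (ι (+ 169)) E B (C1.p n) ⟩
   ι (+ 169) * ((E * E) * (B * C1.p n)) ≈⟨ *-congˡ (*-congʳ EE) ⟩
   ι (+ 169) * (W * t * (B * C1.p n)) ≈⟨ *-congˡ (solve 7 (\w t a b d y p -> w :* t :* (a :* b :* d :* y :* p) :=
     w :* (a :* :1 :* (b :* :1) :* (d :* :1) :* (t :* :1) :* p :* y)) refl W t E4 E6 Δ⁻ (j ^ l) (C1.p n)) ⟩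
   ι (+ 169) * (W * Z1) ∎
  second : q (+ 7) * V (V (h l)) * R 7 n ≈ W * V (ι K * Z2)
  second = begin
   q (+ 7) * V (V (E * B)) * R 7 n ≈⟨ *-cong (*-congˡ (trans (V-cong (V-* E B)) (V-* _ _))) (R7 n) ⟩
   q (+ 7) * (V (V E) * V (V B)) * (ι K * (q (+ 7) * V (V E * C2.p n))) ≈⟨ solve 5 (\c u v k w -> c :* (u :* v) :* (k :* (c :* w)) := k :* ((c :* u) :* (c :* (w :* v)))) refl (q (+ 7)) (V (V E)) (V (V B)) (ι K) (V (V E * C2.p n)) ⟩
   ι K * ((q (+ 7) * V (V E)) * (q (+ 7) * (V (V E * C2.p n) * V (V B)))) ≈⟨ *-congˡ (trans (*-congˡ (*-congˡ (trans (sym (V-* _ _)) (V-cong (*-assoc _ _ _))))) (q14 (C2.p n * V B))) ⟩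
   ι K * (W * V (x * (C2.p n * V B))) ≈⟨ trans (solve 3 (\k w v -> k :* (w :* v) := w :* (k :* v)) refl (ι K) W (V (x * (C2.p n * V B)))) (*-congˡ (sym (V-ι* _ _))) ⟩
   W * V (ι K * (x * (C2.p n * V B))) ≈⟨ *-congˡ (V-cong (*-congˡ (trans (*-congˡ (*-congˡ (trans (V-* _ _) (*-cong (trans (V-* _ _) (*-congʳ (V-* _ _))) (V-j^ l)))))
     (solve 6 (\x p a b d y -> x :* (p :* (a :* b :* d :* y)) := a :* :1 :* (b :* :1) :* (d :* :1) :* (x :* :1) :* p :* y) refl x (C2.p n) E4ʹ E6ʹ Δʹ⁻ (jʹ ^ l))))) ⟩
   W * V (ι K * Z2) ∎

 -- The Gram matrix before the prefactor is removed. Class 1 is the relevant one, since E² = q V(E²)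
 -- t.
 Γ : ℕ -> ℕ -> Carrier
 Γ m n = Π 1 (N m * N n) + R 7 m * R 7 n

 T-Γ : ∀ m n -> sumr 13 (\ρ -> vM m ρ * R ρ n) ≈ Γ m n
 T-Γ m n = pairing 1 1<13 (N m) (R 7 m) n

 Γ-γ : ∀ m n m< n< -> Γ m n ≈ q (+ 1) * V (E * E) * V (TauΓ.τ m n m< n< 0)
 Γ-γ m n m< n< = begin
  Π 1 (N m * N n) + R 7 m * R 7 n ≈⟨ +-cong (trans (Π-cong 1 first) (trans (Π1q Z1) (*-congˡ (V-cong (solve 1 (\y -> y := :1 :* y) refl (U Z1)))))) second ⟩
  W * V (ι (+ 1) * U Z1) + W * V (ι ((+ 13) Z.^ (m N.+ n)) * Z2) ≈⟨ sym (trans (*-congˡ (V-+ _ _)) (distribˡ W _ _)) ⟩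
  W * V (TauΓ.τ m n m< n< 0) ∎
  where
  W = q (+ 1) * V (E * E)
  Z1 = TauΓ.base1 m n m< n< * (C1.p m * C1.p n) * ι (+ 1)
  Z2 = TauΓ.base2 m n m< n< * (C2.p m * C2.p n) * ι (+ 1)
  first : N m * N n ≈ W * Z1
  first = trans (solve 3 (\e p r -> e :* p :* (e :* r) := e :* e :* (p :* r)) refl E (C1.p m) (C1.p n)) (trans (*-congʳ EE)
   (solve 3 (\w t p -> w :* t :* p := w :* (:1 :* :1 :* :1 :* (t :* :1) :* p :* :1)) refl W t (C1.p m * C1.p n)))
  second : R 7 m * R 7 n ≈ W * V (ι ((+ 13) Z.^ (m N.+ n)) * Z2)
  second = begin
   R 7 m * R 7 n ≈⟨ *-cong (trans (R7 m) (*-congˡ (*-congˡ (V-* _ _)))) (R7 n) ⟩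
   ι ((+ 13) Z.^ m) * (q (+ 7) * (V (V E) * V (C2.p m))) * (ι ((+ 13) Z.^ n) * (q (+ 7) * V (V E * C2.p n)))
    ≈⟨ solve 6 (\k l c u v w -> k :* (c :* (u :* v)) :* (l :* (c :* w)) := k :* l :* ((c :* u) :* (c :* (w :* v)))) refl (ι ((+ 13) Z.^ m)) (ι ((+ 13) Z.^ n)) (q (+ 7)) (V (V E)) (V (C2.p m)) (V (V E * C2.p n)) ⟩
   ι ((+ 13) Z.^ m) * ι ((+ 13) Z.^ n) * ((q (+ 7) * V (V E)) * (q (+ 7) * (V (V E * C2.p n) * V (C2.p m))))
    ≈⟨ *-cong (trans (sym (ι-* _ _)) (ι-≡ (sy (Z.^-distribˡ-+-* (+ 13) m n)))) (trans (*-congˡ (*-congˡ (trans (sym (V-* _ _)) (V-cong (*-assoc _ _ _))))) (q14 (C2.p n * C2.p m))) ⟩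
   ι ((+ 13) Z.^ (m N.+ n)) * (W * V (x * (C2.p n * C2.p m))) ≈⟨ trans (solve 3 (\k w v -> k :* (w :* v) := w :* (k :* v)) refl (ι ((+ 13) Z.^ (m N.+ n))) W _) (*-congˡ (sym (V-ι* _ _))) ⟩
   W * V (ι ((+ 13) Z.^ (m N.+ n)) * (x * (C2.p n * C2.p m))) ≈⟨ *-congˡ (V-cong (*-congˡ (solve 3 (\x p r -> x :* (r :* p) := :1 :* :1 :* :1 :* (x :* :1) :* (p :* r) :* :1) refl x (C2.p m) (C2.p n)))) ⟩
   W * V (ι ((+ 13) Z.^ (m N.+ n)) * Z2) ∎

-- The Gram matrix, its explicit entries and its inverse.

module Gram where
 open import Data.Nat.Base as N using (ℕ; zero; suc; _∸_; _≡ᵇ_; _≤ᵇ_)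
 open import Data.Nat.DivMod using (_%_; _/_)
 open import Data.Integer.DivMod using (_%ℕ_)
 open import Data.List.Base using (List; []; _∷_; take)
 open import Data.Bool.Base using (Bool; true; false; T; _∧_; _∨_; if_then_else_)
 open PS using (PS; +ˡ; *ˡ)
 open Series using (at)
 open Classes using (pick)
 open LInt
 open LL
 open Base
 open Poly
 open Num
 open Forms
 open Param hiding (pl)
 open Delta
 open Side
 open Curves
 open Trace
 open TraceLemma
 open LevelOne
 open Tau
 open Vectors
 open BaseL
 open Eval
 open Numeric
 open FormsL
 open ParamL hiding (a; c; d)
 open DeltaL
 open SideL
 open TraceL

 -- The form E₄^a E₆^b Δ^N p(j), where N is the field `expΔ`; with a ≤ 2 and b ≤ 1 the weight fixes
 -- the exponents.
 record NF : Set where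
  constructor nf
  field
   a b expΔ : ℕ
   p     : Poly

 ⟦_⟧ : NF -> Carrier
 ⟦ nf a b N p ⟧ = E4 ^ a * E6 ^ b * (Δ ^ N * ev p j)

 -- Row m lists the entries with n ≥ m, of weight 2(m + n); `Identify` proves that they are correct.
 γ-table : List (List NF)
 γ-table =
   (nf 0 0 0 (-[1+ 1 ] ∷ []) ∷ nf 0 0 0 [] ∷ nf 1 0 0 (-[1+ 287 ] ∷ []) ∷ nf 0 1 0 (+ 44928 ∷ []) ∷ nf 2 0 0 (-[1+ 8607743 ] ∷ []) ∷ nf 1 1 0 (+ 2046320640 ∷ []) ∷ nf 0 0 1 (+ 400737207582720 ∷ -[1+ 586512138239 ] ∷ []) ∷ [])
  ∷ (nf 1 0 0 (+ 288 ∷ []) ∷ nf 0 1 0 (-[1+ 14975 ] ∷ []) ∷ nf 2 0 0 (+ 1598976 ∷ []) ∷ nf 1 1 0 (-[1+ 255909887 ] ∷ []) ∷ nf 0 0 1 (-[1+ 32988832727039 ] ∷ + 54468771840 ∷ []) ∷ nf 2 1 0 (-[1+ 14456550850559 ] ∷ []) ∷ [])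
  ∷ (nf 2 0 0 (+ 737280 ∷ []) ∷ nf 1 1 0 (-[1+ 76677119 ] ∷ []) ∷ nf 0 0 1 (-[1+ 13001245065215 ] ∷ + 12067799040 ∷ []) ∷ nf 2 1 0 (-[1+ 2537705963519 ] ∷ []) ∷ nf 1 0 1 (-[1+ 758061975082106879 ] ∷ + 667282896322560 ∷ []) ∷ [])
  ∷ (nf 0 0 1 (-[1+ 778553524223 ] ∷ + 7868252160 ∷ []) ∷ nf 2 1 0 (-[1+ 1227447336959 ] ∷ []) ∷ nf 1 0 1 (-[1+ 154050453150105599 ] ∷ + 256442074398720 ∷ []) ∷ nf 0 1 1 (+ 1090821046161899520 ∷ -[1+ 67087361648885759 ] ∷ []) ∷ [])
  ∷ (nf 1 0 1 (-[1+ 287123578489405439 ] ∷ + 190348756254720 ∷ []) ∷ nf 0 1 1 (+ 14930426081449082880 ∷ -[1+ 39592541300981759 ] ∷ []) ∷ nf 2 0 1 (-[1+ 16082638423481112330239 ] ∷ + 10321470959155937280 ∷ []) ∷ [])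
  ∷ (nf 2 0 1 (-[1+ 7592272392071046758399 ] ∷ + 8207838369703526400 ∷ []) ∷ nf 1 1 1 (+ 789596328775388862873600 ∷ -[1+ 2134037976122916863999 ] ∷ []) ∷ [])
  ∷ (nf 0 0 2 (-[1+ 16657405889294344269909196799 ] ∷ -[1+ 865443321564611435141529599 ] ∷ + 553667945066721076838400 ∷ []) ∷ [])
  ∷ []

 -- `discr` Δ² times the inverse of the symmetric Gram matrix, in the same triangular format. A
 -- nonzero entry (n, l) has weight 24 - 2(n + l).
 κ-table : List (List NF)
 κ-table =
   (nf 0 0 2 (+ 2978089164883274058166173696 ∷ -[1+ 3592464403131161880035327 ] ∷ + 2776328195575904206848 ∷ []) ∷ nf 1 1 1 (+ 311103207552496907059200 ∷ + 108408771598620819456 ∷ []) ∷ nf 2 0 1 (+ 2555231138902091759616 ∷ + 3638206069028683776 ∷ []) ∷ nf 0 1 1 (+ 234982884188495020032 ∷ -[1+ 93302362868023295 ] ∷ []) ∷ nf 1 0 1 (+ 320995797208399872 ∷ + 1283031125655552 ∷ []) ∷ nf 2 1 0 (-[1+ 9288787083263 ] ∷ []) ∷ nf 0 0 1 (+ 45055202033664 ∷ -[1+ 69639118847 ] ∷ []) ∷ [])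
  ∷ (nf 2 0 1 (+ 46119892423656515567616 ∷ + 3553156997743378432 ∷ []) ∷ nf 0 1 1 (+ 2157446568769392476160 ∷ + 66195798695084032 ∷ []) ∷ nf 1 0 1 (-[1+ 27278706113941340159 ] ∷ -[1+ 2058514808635391 ] ∷ []) ∷ nf 2 1 0 (+ 56609251672064 ∷ []) ∷ nf 0 0 1 (+ 1878679911923712 ∷ -[1+ 585026408447 ] ∷ []) ∷ nf 1 1 0 (-[1+ 3431806975 ] ∷ []) ∷ [])
  ∷ (nf 1 0 1 (+ 41489357091719086080 ∷ -[1+ 3697579001839615 ] ∷ []) ∷ nf 2 1 0 (+ 54554471841792 ∷ []) ∷ nf 0 0 1 (+ 4766886329057280 ∷ + 2407720890368 ∷ []) ∷ nf 1 1 0 (-[1+ 36978978815 ] ∷ []) ∷ nf 2 0 0 (-[1+ 170766079 ] ∷ []) ∷ [])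
  ∷ (nf 0 0 1 (-[1+ 25227454238687231 ] ∷ -[1+ 557887979519 ] ∷ []) ∷ nf 1 1 0 (-[1+ 58290825215 ] ∷ []) ∷ nf 2 0 0 (+ 830322432 ∷ []) ∷ nf 0 1 0 (+ 4001088 ∷ []) ∷ [])
  ∷ (nf 2 0 0 (+ 530599936 ∷ []) ∷ nf 0 1 0 (-[1+ 2164031 ] ∷ []) ∷ nf 1 0 0 (-[1+ 25359 ] ∷ []) ∷ [])
  ∷ (nf 1 0 0 (-[1+ 41615 ] ∷ []) ∷ nf 0 0 0 [] ∷ [])
  ∷ (nf 0 0 0 (+ 1 ∷ []) ∷ [])
  ∷ []

 discr : ℤ
 discr = -[1+ 6143915923698926412103679999 ]

 lookupn : List (List NF) -> ℕ -> ℕ -> NF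
 lookupn t m n = column (row t (m N.⊓ n)) (m N.⊔ n ∸ m N.⊓ n)
  where
  row : List (List NF) -> ℕ -> List NF
  row []      k       = []
  row (r ∷ t) zero    = r
  row (r ∷ t) (suc k) = row t k
  column : List NF -> ℕ -> NF
  column []      k       = nf 0 0 0 []
  column (x ∷ r) zero    = x
  column (x ∷ r) (suc k) = column r k

 γn κn : ℕ -> ℕ -> NF
 γn = lookupn γ-table
 κn = lookupn κ-table

 wt : NF -> ℕ
 wt (nf a b N p) = a N.* 4 N.+ b N.* 6 N.+ N N.* 12

 mod-nf : ∀ n -> Mod (+ wt n) ⟦ n ⟧
 mod-nf (nf a b N p) = mod-weight weight≡ (mod-* (mod-* (mod-^ a mod-E4) (mod-^ b mod-E6)) (mod-* (mod-^ N mod-Δ) (mod-ev p)))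
  where
  weight≡ : + a Z.* + 4 Z.+ + b Z.* + 6 Z.+ (+ N Z.* + 12 Z.+ + 0) ≡ + (a N.* 4 N.+ b N.* 6 N.+ N N.* 12)
  weight≡ = cong₂ Z._+_ (cong₂ Z._+_ (sy (Z.pos-* a 4)) (sy (Z.pos-* b 6))) (tr (Z.+-identityʳ _) (sy (Z.pos-* N 12)))

 null-nf : ∀ n -> T (null (NF.p n)) -> ⟦ n ⟧ ≈ ι (+ 0)
 null-nf (nf a b N p) h = trans (*-congˡ (*-congˡ (ev-null p j h))) (solve 3 (\u v w -> u :* v :* (w :* :0) := :0) refl (E4 ^ a) (E6 ^ b) (Δ ^ N))

 Δj : Δ * j ≈ E4 ^ 3
 Δj = trans (solve 3 (\d d⁻ e -> d :* (e :* d⁻) := (d :* d⁻) :* e) refl Δ Δ⁻ (E4 ^ 3)) (trans (*-congʳ ΔΔ⁻) (solve 1 (\e -> :1 :* e := e) refl (E4 ^ 3)))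

 redB : ℕ -> ℕ -> ℕ -> Poly -> NF
 redB a (suc (suc b)) N p = redB a b (suc N) ((+ 0 ∷ p) ⊟ (+ 1728 · p))
 redB a (suc zero)    N p = nf a 1 N p
 redB a zero          N p = nf a 0 N p

 redA : ℕ -> ℕ -> ℕ -> Poly -> NF
 redA (suc (suc (suc a))) b N p = redA a b (suc N) (+ 0 ∷ p)
 redA (suc (suc zero))    b N p = redB 2 b N p
 redA (suc zero)          b N p = redB 1 b N p
 redA zero                b N p = redB 0 b N p

 redB-sound : ∀ a b N p -> ⟦ redB a b N p ⟧ ≈ ⟦ nf a b N p ⟧
 redB-sound a (suc (suc b)) N p = trans (redB-sound a b (suc N) ((+ 0 ∷ p) ⊟ (+ 1728 · p))) (begin
  E4 ^ a * E6 ^ b * (Δ * Δ ^ N * ev ((+ 0 ∷ p) ⊟ (+ 1728 · p)) j) ≈⟨ *-congˡ (*-congˡ (trans (ev-⊟ (+ 0 ∷ p) (+ 1728 · p) j) (+-congˡ (-‿cong (ev-· (+ 1728) p j))))) ⟩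
  E4 ^ a * E6 ^ b * (Δ * Δ ^ N * (ι (+ 0) + j * ev p j - ι (+ 1728) * ev p j))
   ≈⟨ solve 6 (\u v d w j p -> u :* v :* (d :* w :* (:0 :+ j :* p :- con (+ 1728) :* p)) := u :* v :* ((d :* j :- con (+ 1728) :* d) :* (w :* p))) refl (E4 ^ a) (E6 ^ b) Δ (Δ ^ N) j (ev p j) ⟩
  E4 ^ a * E6 ^ b * ((Δ * j - ι (+ 1728) * Δ) * (Δ ^ N * ev p j)) ≈⟨ *-congˡ (*-congʳ (trans (+-cong Δj (-‿cong (sym discriminant))) (solve 2 (\e f -> e :- (e :- f) := f) refl (E4 ^ 3) (E6 ^ 2)))) ⟩
  E4 ^ a * E6 ^ b * (E6 ^ 2 * (Δ ^ N * ev p j)) ≈⟨ solve 4 (\u v f y -> u :* v :* (f :* (f :* :1) :* y) := u :* (f :* (f :* v)) :* y) refl (E4 ^ a) (E6 ^ b) E6 (Δ ^ N * ev p j) ⟩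
  E4 ^ a * E6 ^ (suc (suc b)) * (Δ ^ N * ev p j) ∎)
 redB-sound a (suc zero)    N p = refl
 redB-sound a zero          N p = refl

 redA-sound : ∀ a b N p -> ⟦ redA a b N p ⟧ ≈ ⟦ nf a b N p ⟧
 redA-sound (suc (suc (suc a))) b N p = trans (redA-sound a b (suc N) (+ 0 ∷ p)) (begin
  E4 ^ a * E6 ^ b * (Δ * Δ ^ N * (ι (+ 0) + j * ev p j)) ≈⟨ solve 6 (\u v d w j p -> u :* v :* (d :* w :* (:0 :+ j :* p)) := u :* v :* (d :* j :* (w :* p))) refl (E4 ^ a) (E6 ^ b) Δ (Δ ^ N) j (ev p j) ⟩
  E4 ^ a * E6 ^ b * (Δ * j * (Δ ^ N * ev p j)) ≈⟨ *-congˡ (*-congʳ Δj) ⟩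
  E4 ^ a * E6 ^ b * (E4 ^ 3 * (Δ ^ N * ev p j)) ≈⟨ solve 4 (\u v e y -> u :* v :* (e :* (e :* (e :* :1)) :* y) := e :* (e :* (e :* u)) :* v :* y) refl (E4 ^ a) (E6 ^ b) E4 (Δ ^ N * ev p j) ⟩
  E4 ^ (suc (suc (suc a))) * E6 ^ b * (Δ ^ N * ev p j) ∎)
 redA-sound (suc (suc zero))    b N p = redB-sound 2 b N p
 redA-sound (suc zero)          b N p = redB-sound 1 b N p
 redA-sound zero                b N p = redB-sound 0 b N p

 _·n_ : NF -> NF -> NF
 nf a b N p ·n nf aʹ bʹ Nʹ pʹ = redA (a N.+ aʹ) (b N.+ bʹ) (N N.+ Nʹ) (p ⊠ pʹ)

 ·n-sound : ∀ m n -> ⟦ m ·n n ⟧ ≈ ⟦ m ⟧ * ⟦ n ⟧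
 ·n-sound (nf a b N p) (nf aʹ bʹ Nʹ pʹ) = trans (redA-sound (a N.+ aʹ) (b N.+ bʹ) (N N.+ Nʹ) (p ⊠ pʹ))
  (trans (*-cong (*-cong (^-+ E4 a aʹ) (^-+ E6 b bʹ)) (*-cong (^-+ Δ N Nʹ) (ev-⊠ p pʹ j)))
   (solve 8 (\u uʹ v vʹ w wʹ p pʹ -> (u :* uʹ) :* (v :* vʹ) :* (w :* wʹ :* (p :* pʹ)) := (u :* v :* (w :* p)) :* (uʹ :* vʹ :* (wʹ :* pʹ))) refl
    (E4 ^ a) (E4 ^ aʹ) (E6 ^ b) (E6 ^ bʹ) (Δ ^ N) (Δ ^ Nʹ) (ev p j) (ev pʹ j)))

 same? : ℕ -> ℕ -> ℕ -> NF -> Bool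
 same? a b N (nf aʹ bʹ Nʹ p) = null p ∨ ((aʹ ≡ᵇ a) ∧ ((bʹ ≡ᵇ b) ∧ (Nʹ ≡ᵇ N)))

 ∨-T : ∀ {a b} {A : Set} -> T (a ∨ b) -> (T a -> A) -> (T b -> A) -> A
 ∨-T {true}  t f g = f t
 ∨-T {false} t f g = g t

 same-sound : ∀ a b N n -> T (same? a b N n) -> ⟦ n ⟧ ≈ E4 ^ a * E6 ^ b * (Δ ^ N * ev (NF.p n) j)
 same-sound a b N (nf aʹ bʹ Nʹ p) h = ∨-T {null p} {(aʹ ≡ᵇ a) ∧ ((bʹ ≡ᵇ b) ∧ (Nʹ ≡ᵇ N))} h
  (\t -> trans (null-nf (nf aʹ bʹ Nʹ p) t) (sym (null-nf (nf a b N p) t)))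
  \t -> reflexive (tr (cong (\a -> ⟦ nf a bʹ Nʹ p ⟧) (N.≡ᵇ⇒≡ aʹ a (∧-fst {aʹ ≡ᵇ a} {(bʹ ≡ᵇ b) ∧ (Nʹ ≡ᵇ N)} t)))
    (tr (cong (\b -> ⟦ nf a b Nʹ p ⟧) (N.≡ᵇ⇒≡ bʹ b (∧-fst {bʹ ≡ᵇ b} {Nʹ ≡ᵇ N} (∧-snd {aʹ ≡ᵇ a} {(bʹ ≡ᵇ b) ∧ (Nʹ ≡ᵇ N)} t))))
     (cong (\N -> ⟦ nf a b N p ⟧) (N.≡ᵇ⇒≡ Nʹ N (∧-snd {bʹ ≡ᵇ b} {Nʹ ≡ᵇ N} (∧-snd {aʹ ≡ᵇ a} {(bʹ ≡ᵇ b) ∧ (Nʹ ≡ᵇ N)} t))))))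

 -- The solution of 2a + 3b + 6N = s with a ≤ 2 and b ≤ 1, the normal form exponents in weight 2s.
 -- All nonzero products in one entry of γκ have weight 2(12 + m - l).
 aₛ bs Ns : ℕ -> ℕ
 aₛ s = (s N.* 2) % 3
 bs s = s % 2
 Ns s = (s ∸ (aₛ s N.* 2 N.+ bs s N.* 3)) / 6

 rowp : ℕ -> ℕ -> ℕ -> Poly
 rowp m l zero    = []
 rowp m l (suc k) = rowp m l k ⊞ NF.p (γn m k ·n κn k l)

 row? : ℕ -> ℕ -> Bool
 row? m l = below? 7 (\n -> same? (aₛ s) (bs s) (Ns s) (γn m n ·n κn n l)) ∧ (rowp m l 7 == (if m ≡ᵇ l then discr ∷ [] else []))
  where s = 12 N.+ m ∸ l

 record Row-ok (m l : ℕ) : Set where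
  constructor row-ok
  field
   holds : T (row? m l)

 private
  row-sound : ∀ m l -> Row-ok m l -> sumr 7 (\n -> ⟦ γn m n ⟧ * ⟦ κn n l ⟧) ≈ ⟦ nf (aₛ (12 N.+ m ∸ l)) (bs (12 N.+ m ∸ l)) (Ns (12 N.+ m ∸ l)) (if m ≡ᵇ l then discr ∷ [] else []) ⟧
  row-sound m l (row-ok h) = trans (partial 7 N.≤-refl) (*-congˡ (*-congˡ (ev-== (rowp m l 7) target j (∧-snd {below? 7 f} {rowp m l 7 == target} h))))
   where
   s = 12 N.+ m ∸ l
   target = if m ≡ᵇ l then discr ∷ [] else []
   f = \n -> same? (aₛ s) (bs s) (Ns s) (γn m n ·n κn n l)
   partial : ∀ k -> k N.≤ 7 -> sumr k (\n -> ⟦ γn m n ⟧ * ⟦ κn n l ⟧) ≈ ⟦ nf (aₛ s) (bs s) (Ns s) (rowp m l k) ⟧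
   partial zero    _ = trans (sum-zero 0 {\n -> ⟦ γn m n ⟧ * ⟦ κn n l ⟧} (\k ())) (sym (null-nf (nf (aₛ s) (bs s) (Ns s) []) _))
   partial (suc k) k< = trans (+-cong (partial k (N.≤-trans (N.n≤1+n k) k<)) (trans (sym (·n-sound (γn m k) (κn k l))) (same-sound (aₛ s) (bs s) (Ns s) (γn m k ·n κn k l) (below-sound 7 f (∧-fst {below? 7 f} {rowp m l 7 == target} h) k k<))))
    (trans (solve 4 (\u w p r -> u :* (w :* p) :+ u :* (w :* r) := u :* (w :* (p :+ r))) refl (E4 ^ aₛ s * E6 ^ bs s) (Δ ^ Ns s) (ev (rowp m l k) j) (ev (NF.p (γn m k ·n κn k l)) j))
     (*-congˡ (*-congˡ (sym (ev-⊞ (rowp m l k) (NF.p (γn m k ·n κn k l)) j)))))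

 abstract
  γκ-diagonal : ∀ m -> m N.< 7 -> sumr 7 (\n -> ⟦ γn m n ⟧ * ⟦ κn n m ⟧) ≈ ι discr * Δ ^ 2
  γκ-diagonal m m< = trans (row-sound m m (row-ok (below-sound 7 (\m -> row? m m) _ m m<)))
   (trans (reflexive (cong₂ (\s b -> ⟦ nf (aₛ s) (bs s) (Ns s) (if b then discr ∷ [] else []) ⟧) (N.m+n∸n≡m 12 m) (≡ᵇ-refl m)))
    (solve 3 (\c d j -> :1 :* :1 :* (d :* (d :* :1) :* (c :+ j :* :0)) := c :* (d :* (d :* :1))) refl (ι discr) Δ j))

  γκ-off : ∀ m l -> m N.< 7 -> l N.< 7 -> m ≢ l -> sumr 7 (\n -> ⟦ γn m n ⟧ * ⟦ κn n l ⟧) ≈ ι (+ 0)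
  γκ-off m l m< l< ne = trans (row-sound m l (row-ok (below-sound2 7 row? _ m l m< l<)))
   (trans (reflexive (cong (\b -> ⟦ nf (aₛ (12 N.+ m ∸ l)) (bs (12 N.+ m ∸ l)) (Ns (12 N.+ m ∸ l)) (if b then discr ∷ [] else []) ⟧) (≡ᵇ-false ne)))
    (null-nf (nf (aₛ (12 N.+ m ∸ l)) (bs (12 N.+ m ∸ l)) (Ns (12 N.+ m ∸ l)) []) _))

 Ml : Poly
 Ml = + 13 · take 28 (spreadl ((+ 1 ∷ []) ⊞ (-[1+ 23 ] · s1l)))

 -- separate functions of their arguments, so that evaluation shares them
 N-stepl : ℕ -> Poly -> Poly
 N-stepl n l = (+ 24 · xd 0 l ⊞ l) ⊞ (mone · (+ (1 N.+ 4 N.* n) · take 28 (Ml ⊠ l)))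

 Nl : ℕ -> Poly
 Nl zero    = El
 Nl (suc n) = N-stepl n (Nl n)

 num-N : ∀ n -> Num 28 (N n) (Nl n)
 num-N zero    = num-≈ (solve 1 (\e -> e := e :* :1) refl E) num-E
 num-N (suc n) = num-≈ (trans (+-congˡ (solve 1 (\y -> con mone :* y := :- y) refl _)) (sym (N-suc n)))
  (num-+ (num-+ (num-ι* (+ 24) (num-θ (num-N n))) (num-N n)) (num-ι* mone (num-ι* (+ (1 N.+ 4 N.* n)) (num-* num-M (num-N n)))))

 sell : ℕ -> ℕ -> Poly -> Poly
 sell r k []      = []
 sell r k (u ∷ l) = (if k % 13 ≡ᵇ r then u else + 0) ∷ sell r (suc k) l

 nth-sel : ∀ r k l n -> nth (sell r k l) n ≡ (if (k N.+ n) % 13 ≡ᵇ r then nth l n else + 0)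
 nth-sel r k []      n       = sy (collapse ((k N.+ n) % 13 ≡ᵇ r))
  where
  collapse : ∀ b -> (if b then + 0 else + 0) ≡ + 0
  collapse true  = ≡refl
  collapse false = ≡refl
 nth-sel r k (u ∷ l) zero    = cong (\m -> if m % 13 ≡ᵇ r then u else + 0) (sy (N.+-identityʳ k))
 nth-sel r k (u ∷ l) (suc n) = tr (nth-sel r (suc k) l n) (cong (\m -> if m % 13 ≡ᵇ r then nth l n else + 0) (sy (N.+-suc k n)))

 num-Π : ∀ {K X l} r -> Num K X l -> Num K (Π r X) (sell r 0 l)
 num-Π {K} {X} {l} r (numeric f e h) = numeric (pick r f) (trans (co-ext go) (Π-cong r e))
  \k k< -> tr (cong (\v -> if k % 13 ≡ᵇ r then v else + 0) (h k k<)) (sy (nth-sel r 0 l k))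
  where
  collapse : ∀ b {v} -> v ≡ + 0 -> + 0 ≡ (if b then v else + 0)
  collapse true  e = sy e
  collapse false e = ≡refl
  go : ∀ z -> co (emb (pick r f)) z ≡ co (Π r (emb f)) z
  go (+ n)    = tr (co-emb (pick r f) (+ n)) (sy (tr (co-Π r (emb f) (+ n)) (cong (\v -> if n % 13 ≡ᵇ r then v else + 0) (co-emb f (+ n)))))
  go -[1+ n ] = tr (co-emb (pick r f) -[1+ n ]) (tr (collapse (-[1+ n ] %ℕ 13 ≡ᵇ r) (co-emb f -[1+ n ])) (sy (co-Π r (emb f) -[1+ n ])))

 graml : Poly -> Poly -> Poly
 graml l lʹ = sell 1 0 (take 28 (l ⊠ lʹ)) ⊞ take 28 (sell 7 0 l ⊠ sell 7 0 lʹ)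

 Γl : ℕ -> ℕ -> Poly
 Γl m n = graml (Nl m) (Nl n)

 num-Γ : ∀ m n -> Num 28 (Γ m n) (Γl m n)
 num-Γ m n = num-+ (num-Π 1 (num-* (num-N m) (num-N n))) (num-* (num-Π 7 (num-N m)) (num-Π 7 (num-N n)))

 e4³ e6³ δ³ e³ : Poly
 e4³ = + 1 ∷ + 240 ∷ + 2160 ∷ []
 e6³ = + 1 ∷ -[1+ 503 ] ∷ -[1+ 16631 ] ∷ []
 δ³  = + 0 ∷ + 1 ∷ -[1+ 23 ] ∷ []
 e³  = + 1 ∷ mone ∷ mone ∷ []

 num-E4³ : Num 3 E4 e4³
 num-E4³ = num-check 3 EisPS.e₄ EisPS.e₄ e4³ (\_ -> ≡refl) _

 num-E6³ : Num 3 E6 e6³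
 num-E6³ = num-check 3 EisPS.e6 EisPS.e6 e6³ (\_ -> ≡refl) _

 num-Δ³ : Num 3 Δ δ³
 num-Δ³ = num-q 1 num-E²⁴

 num-E³ : Num 3 E e³
 num-E³ = num-restrictʹ num-E
  where
  num-restrictʹ : Num 28 E El -> Num 3 E e³
  num-restrictʹ (numeric f e h) = numeric f e \ { 0 _ -> h 0 (N.≤ᵇ⇒≤ 1 28 _) ; 1 _ -> h 1 (N.≤ᵇ⇒≤ 2 28 _) ; 2 _ -> h 2 (N.≤ᵇ⇒≤ 3 28 _) ; (suc (suc (suc k))) (N.s≤s (N.s≤s (N.s≤s ()))) }

 fits : ℕ -> Poly -> Bool
 fits N       []      = true
 fits zero    (u ∷ p) = null p
 fits (suc N) (u ∷ p) = fits N p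

 -- The pole of j is absorbed by Δ j = E₄³, one factor Δ for each power of j; `fits` says that the
 -- degree of p does not exceed N.
 Δ-evl : ℕ -> Poly -> Poly
 Δ-evl N       []      = + 0 ∷ []
 Δ-evl zero    (u ∷ p) = u ∷ []
 Δ-evl (suc N) (u ∷ p) = (u · pwl 3 δ³ (suc N)) ⊞ take 3 (pwl 3 e4³ 3 ⊠ Δ-evl N p)

 num-Δ-ev : ∀ N p -> T (fits N p) -> Num 3 (Δ ^ N * ev p j) (Δ-evl N p)
 num-Δ-ev zero    []      h = num-≈ (solve 0 (:0 := :1 :* :0) refl) (num-ι (+ 0))
 num-Δ-ev (suc N) []      h = num-≈ (solve 1 (\d -> :0 := d :* :0) refl (Δ ^ suc N)) (num-ι (+ 0))
 num-Δ-ev zero    (u ∷ p) h = num-≈ (trans (solve 2 (\u j -> u := :1 :* (u :+ j :* :0)) refl (ι u) j) (*-congˡ (+-congˡ (*-congˡ (sym (ev-null p j h)))))) (num-ι u)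
 num-Δ-ev (suc N) (u ∷ p) h = num-≈ (begin
  ι u * Δ ^ suc N + E4 ^ 3 * (Δ ^ N * ev p j) ≈⟨ +-congˡ (*-congʳ (sym Δj)) ⟩
  ι u * Δ ^ suc N + Δ * j * (Δ ^ N * ev p j) ≈⟨ solve 5 (\u d w j p -> u :* (d :* w) :+ d :* j :* (w :* p) := d :* w :* (u :+ j :* p)) refl (ι u) Δ (Δ ^ N) j (ev p j) ⟩
  Δ ^ suc N * ev (u ∷ p) j ∎) (num-+ (num-ι* u (num-pw num-Δ³ (suc N))) (num-* (num-pw num-E4³ 3) (num-Δ-ev N p h)))

 E²l : NF -> Poly
 E²l (nf a b N p) = take 3 (take 3 (e³ ⊠ e³) ⊠ take 3 (take 3 (pwl 3 e4³ a ⊠ pwl 3 e6³ b) ⊠ Δ-evl N p))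

 num-E² : ∀ n -> T (fits (NF.expΔ n) (NF.p n)) -> Num 3 (E * E * ⟦ n ⟧) (E²l n)
 num-E² (nf a b N p) h = num-* (num-* num-E³ num-E³) (num-* (num-* (num-pw num-E4³ a) (num-pw num-E6³ b)) (num-Δ-ev N p h))

 agree? : Poly -> Poly -> Bool
 agree? l r = below? 3 (\k -> isZero (nth l (k N.* 13 N.+ 1) Z.- nth r k))

 identify? : ℕ -> ℕ -> Bool
 identify? m n = (fits (NF.expΔ y) (NF.p y) ∧ agree? (Γl m n) (E²l y)) ∧ ((ce i ≤ᵇ 3) ∧ (null (NF.p y) ∨ (wt y N.+ (ae i N.* 4 N.+ be i N.* 6) ≡ᵇ 2 N.+ ce i N.* 12)))
  where
  y = γn m n
  i = suc (m N.+ n)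

 record Identify-ok (m n : ℕ) : Set where
  constructor identify-ok
  field
   holds : T (identify? m n)

 -- X and the table entry Y are compared through E² X, whose coefficient k is the coefficient 13k +
 -- 1 of Γ. Agreement for k = 0, 1, 2, within reach of 28 coefficients, outweighs the pole of order
 -- at most 3 of `F i`; then (X - Y) `F i` has no negative exponents and is orthogonal to all powers
 -- of j, hence 0.
 module Identify (m n : ℕ) (m< : m N.< 7) (n< : n N.< 7) (ok : Identify-ok m n) where
  private
   X = TauΓ.τ m n m< n< 0
   y = γn m n
   Y = ⟦ y ⟧
   i = suc (m N.+ n)
   b1 = fits (NF.expΔ y) (NF.p y)
   b2 = agree? (Γl m n) (E²l y)
   b3 = ce i ≤ᵇ 3
   b4 = null (NF.p y)
   b5 = wt y N.+ (ae i N.* 4 N.+ be i N.* 6) ≡ᵇ 2 N.+ ce i N.* 12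
   all-ok : T ((b1 ∧ b2) ∧ (b3 ∧ (b4 ∨ b5)))
   all-ok = Identify-ok.holds ok
   h1 : T b1
   h1 = ∧-fst {b1} {b2} (∧-fst {b1 ∧ b2} {b3 ∧ (b4 ∨ b5)} all-ok)
   h2 : T b2
   h2 = ∧-snd {b1} {b2} (∧-fst {b1 ∧ b2} {b3 ∧ (b4 ∨ b5)} all-ok)
   h3 : T b3
   h3 = ∧-fst {b3} {b4 ∨ b5} (∧-snd {b1 ∧ b2} {b3 ∧ (b4 ∨ b5)} all-ok)
   h4 : T (b4 ∨ b5)
   h4 = ∧-snd {b3} {b4 ∨ b5} (∧-snd {b1 ∧ b2} {b3 ∧ (b4 ∨ b5)} all-ok)

   co-X : ∀ z -> co (E * E * X) z ≡ co (Γ m n) (z Z.* + 13 Z.+ + 1)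
   co-X z = sy (tr (co-cong (trans (Γ-γ m n m< n<) (trans (*-assoc _ _ _) (*-congˡ (sym (V-* _ _))))) _)
    (tr (co-q (+ 1) (V (E * E * X)) _) (tr (cong (co (V (E * E * X))) (lem (z Z.* + 13))) (co-V (E * E * X) z))))
    where
    lem : ∀ y -> y Z.+ + 1 Z.- + 1 ≡ y
    lem = arith

   low-X : Low (E * E * X) (+ 0)
   low-X (+ n)    (Z.+<+ ())
   low-X -[1+ k ] _ = tr (co-X -[1+ k ]) (num-low (num-Γ m n) _ (Z.-<+))

   at-k : ∀ k -> k N.< 3 -> co (E * E * (X - Y)) (+ k) ≡ + 0
   at-k k k< = tr (co-cong (solve 3 (\e x y -> e :* (x :- y) := e :* x :- e :* y) refl (E * E) X Y) (+ k)) (tr (co-sub _ _ (+ k))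
    (Z.i≡j⇒i-j≡0 (tr (co-X (+ k)) (tr (tr (cong (\s -> co (Γ m n) (s Z.+ + 1)) (sy (Z.pos-* k 13))) (num-co (num-Γ m n) (k N.* 13 N.+ 1) (bound k k<)))
     (tr (Z.i-j≡0⇒i≡j _ _ (isZero-sound _ (below-sound 3 (\k -> isZero (nth (Γl m n) (k N.* 13 N.+ 1) Z.- nth (E²l y) k)) h2 k k<))) (sy (num-co (num-E² y h1) k k<)))))))
    where
    bound : ∀ k -> k N.< 3 -> k N.* 13 N.+ 1 N.< 28
    bound k k< = N.+-monoˡ-≤ 1 {suc (k N.* 13)} {27} (N.≤-trans (N.s≤s (N.*-monoˡ-≤ 13 (N.≤-pred k<))) (N.≤ᵇ⇒≤ 27 27 _))

   low0 : Low (E * E * (X - Y)) (+ 0)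
   low0 = Low-cong (solve 3 (\e x y -> e :* x :- e :* y := e :* (x :- y)) refl (E * E) X Y) (Low-+ low-X (Low-neg (num-low (num-E² y h1))))

   low3 : Low (E * E * (X - Y)) (+ 3)
   low3 = Low-step (Low-step (Low-step low0 (at-k 0 (N.≤ᵇ⇒≤ 1 3 _))) (at-k 1 (N.≤ᵇ⇒≤ 2 3 _))) (at-k 2 (N.≤ᵇ⇒≤ 3 3 _))

   low-PP : Low (P * P) (+ 0)
   low-PP = co-low (proj₁ val-P) (proj₁ val-P)

   low-D : Low ((X - Y) * F i) (+ 0)
   low-D = Low-cong (begin
     P * P * (E * E * (X - Y)) * F i ≈⟨ *-congʳ (solve 3 (\p e z -> p :* p :* (e :* e :* z) := (e :* p) :* (e :* p) :* z) refl P E (X - Y)) ⟩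
     (E * P) * (E * P) * (X - Y) * F i ≈⟨ *-congʳ (*-congʳ (*-cong EP EP)) ⟩
     ι (+ 1) * ι (+ 1) * (X - Y) * F i ≈⟨ *-congʳ (solve 1 (\z -> :1 :* :1 :* z := z) refl (X - Y)) ⟩
     (X - Y) * F i ∎)
    (Low-weaken (Z.≤-trans (Z.+≤+ N.z≤n) (Z.≤-reflexive (sy (tr (Z.⊖-≥ (N.≤ᵇ⇒≤ (ce i) 3 h3)) ≡refl) ⟪⟫ ))) (co-low (co-low low-PP low3) (proj₁ (lead-F i))))
    where
    _⟪⟫ : + (3 ∸ ce i) ≡ 3 Z.⊖ ce i -> + (3 ∸ ce i) ≡ + 0 Z.+ + 3 Z.+ Z.- (+ ce i)
    e ⟪⟫ = tr e (sy (Z.m-n≡m⊖n 3 (ce i)))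

   perp-Y : Perp (ι (+ 1)) (Y * F i)
   perp-Y = ∨-T {b4} {b5} h4
    (\t -> mod-perp (mod-0 (trans (*-congʳ (null-nf y t)) (solve 1 (\f -> :0 :* f := :0) refl (F i)))))
    (\t -> mod-perp (mod-weight (weight t) (mod-* (mod-nf y) (mod-F i))))
    where
    weight : T b5 -> + wt y Z.+ (+ ae i Z.* + 4 Z.+ + be i Z.* + 6 Z.+ + ce i Z.* -[1+ 11 ]) ≡ + 2
    weight t = tr (cong₂ (\u v -> + wt y Z.+ (u Z.+ v Z.+ + ce i Z.* -[1+ 11 ])) (sy (Z.pos-* (ae i) 4)) (sy (Z.pos-* (be i) 6)))
     (tr (l1 (+ wt y) (+ (ae i N.* 4)) (+ (be i N.* 6)) (+ ce i)) (tr (cong (\n -> n Z.- + ce i Z.* + 12) (cong +_ (N.≡ᵇ⇒≡ _ _ t))) (tr (cong (\n -> + 2 Z.+ n Z.- + ce i Z.* + 12) (Z.pos-* (ce i) 12)) (l2 (+ ce i)))))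
     where
     l1 : ∀ w a b c -> w Z.+ (a Z.+ b Z.+ c Z.* -[1+ 11 ]) ≡ w Z.+ (a Z.+ b) Z.- c Z.* + 12
     l1 = arith
     l2 : ∀ c -> + 2 Z.+ c Z.* + 12 Z.- c Z.* + 12 ≡ + 2
     l2 = arith

  γ-explicit : X ≈ Y
  γ-explicit = sub-0 (cancel0 (unit-F i) (trans (*-comm _ _) (perp-zero (lead-val (val-ι (+ 1)))
   (perp-cong (solve 3 (\x y f -> x :* f :- :1 :* (y :* f) := (x :- y) :* f) refl X Y (F i)) (perp-combine (+ 1) (γ-perp m n m< n<) perp-Y)) low-D)))

 abstract
  γ-explicit : ∀ m n m< n< -> TauΓ.τ m n m< n< 0 ≈ ⟦ γn m n ⟧
  γ-explicit m n m< n< = Identify.γ-explicit m n m< n< (identify-ok (below-sound2 7 identify? _ m n m< n<))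

  κ-modular : ∀ n l -> n N.< 7 -> l N.< 7 -> Mod (+ 24 Z.- + (n N.* 2 N.+ l N.* 2)) ⟦ κn n l ⟧
  κ-modular n l n< l< = ∨-T {null (NF.p (κn n l))} {wt (κn n l) N.+ (n N.* 2 N.+ l N.* 2) ≡ᵇ 24} (below-sound2 7 (\n l -> null (NF.p (κn n l)) ∨ (wt (κn n l) N.+ (n N.* 2 N.+ l N.* 2) ≡ᵇ 24)) _ n l n< l<)
   (\t -> mod-0 (null-nf (κn n l) t))
   (\t -> mod-weight (tr (lem (+ wt (κn n l)) (+ (n N.* 2 N.+ l N.* 2))) (cong (\s -> + s Z.- + (n N.* 2 N.+ l N.* 2)) (N.≡ᵇ⇒≡ (wt (κn n l) N.+ (n N.* 2 N.+ l N.* 2)) 24 t))) (mod-nf (κn n l)))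
   where
   lem : ∀ w s -> w ≡ w Z.+ s Z.- s
   lem = arith

-- Independence of the component vectors.

module Inject where
 open import Data.Nat.Base as N using (ℕ; zero; suc; _≡ᵇ_)
 open import Data.Bool.Base using (true; false; T; if_then_else_; not)
 open PS using (+ˡ; *ˡ)
 open LInt
 open LL
 open Base
 open Poly
 open Num
 open Forms
 open Param hiding (pl)
 open Delta
 open LevelOne
 open Tau
 open Vectors
 open Gram
 open BaseL
 open Numeric
 open FormsL
 open ParamL hiding (a; c; d)
 open DeltaL

 -- the pentagonal residues modulo 13, with the exponent of the leading term of each component of E
 residue : ℕ -> ℕ
 residue 0 = 0
 residue 1 = 1
 residue 2 = 2
 residue 3 = 5
 residue 4 = 7
 residue 5 = 12
 residue _ = 9

 leading : ℕ -> ℕ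
 -- 9 is not a generalised pentagonal number; the first one in its class is 22.
 leading 6 = 22
 leading k = residue k

 -- With yᵢ = 24 `leading i` + 1, row k is the product of Y - yᵢ over i ≠ k, expanded in the Newton
 -- basis with nodes 13, 65, 117, ..., so that it vanishes at every yᵢ except y_k.
 newton : List (List ℤ)
 newton =
   (+ 1036551499776 ∷ -[1+ 12483550207 ] ∷ + 65449216 ∷ -[1+ 178943 ] ∷ + 21152 ∷ -[1+ 323 ] ∷ + 1 ∷ [])
  ∷ (-[1+ 1036551499775 ] ∷ + 31853894656 ∷ -[1+ 399405823 ] ∷ + 3019392 ∷ + 7424 ∷ -[1+ 299 ] ∷ + 1 ∷ [])
  ∷ (-[1+ 345517166591 ] ∷ + 36445090816 ∷ -[1+ 607890175 ] ∷ + 5360640 ∷ -[1+ 5151 ] ∷ -[1+ 275 ] ∷ + 1 ∷ [])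
  ∷ (-[1+ 115172388863 ] ∷ -[1+ 6299583487 ] ∷ -[1+ 352035583 ] ∷ + 8071296 ∷ -[1+ 35967 ] ∷ -[1+ 203 ] ∷ + 1 ∷ [])
  ∷ (-[1+ 79734730751 ] ∷ -[1+ 3051336703 ] ∷ + 35386624 ∷ + 7113600 ∷ -[1+ 50751 ] ∷ -[1+ 155 ] ∷ + 1 ∷ [])
  ∷ (-[1+ 45067456511 ] ∷ -[1+ 1261927423 ] ∷ + 21101824 ∷ -[1+ 119039 ] ∷ -[1+ 67551 ] ∷ -[1+ 35 ] ∷ + 1 ∷ [])
  ∷ (-[1+ 24105848831 ] ∷ -[1+ 564030463 ] ∷ + 10503424 ∷ -[1+ 69119 ] ∷ -[1+ 14751 ] ∷ + 204 ∷ + 1 ∷ [])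
  ∷ []

 sumℤ : ℕ -> (ℕ -> ℤ) -> ℤ
 sumℤ zero    f = + 0
 sumℤ (suc n) f = sumℤ n f Z.+ f n

 sumℤ-cong : ∀ n {f g} -> (∀ k -> k N.< n -> f k ≡ g k) -> sumℤ n f ≡ sumℤ n g
 sumℤ-cong zero    h = ≡refl
 sumℤ-cong (suc n) h = cong₂ Z._+_ (sumℤ-cong n (\k k< -> h k (N.<-trans k< (N.n<1+n n)))) (h n (N.n<1+n n))

 sumℤ-zero : ∀ n {f} -> (∀ k -> k N.< n -> f k ≡ + 0) -> sumℤ n f ≡ + 0
 sumℤ-zero zero    h = ≡refl
 sumℤ-zero (suc n) h = cong₂ Z._+_ (sumℤ-zero n (\k k< -> h k (N.<-trans k< (N.n<1+n n)))) (h n (N.n<1+n n))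

 sumℤ-single : ∀ n r -> r N.< n -> ∀ {f} -> (∀ k -> k N.< n -> k ≢ r -> f k ≡ + 0) -> sumℤ n f ≡ f r
 sumℤ-single (suc n) r r< {f} h with r N.≟ n
 ... | yes ≡refl = tr (cong (Z._+ f n) (sumℤ-zero n \k k< -> h k (N.<-trans k< (N.n<1+n n)) (N.<⇒≢ k<))) (Z.+-identityˡ _)
 ... | no ne = tr (cong₂ Z._+_ (sumℤ-single n r (N.≤∧≢⇒< (N.≤-pred r<) ne) {f} (\k k< -> h k (N.<-trans k< (N.n<1+n n)))) (h n (N.n<1+n n) (\e -> ne (sy e)))) (Z.+-identityʳ _)

 sumℤ-+ : ∀ n f g -> sumℤ n (\k -> f k Z.+ g k) ≡ sumℤ n f Z.+ sumℤ n g
 sumℤ-+ zero    f g = ≡refl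
 sumℤ-+ (suc n) f g = tr (cong (Z._+ (f n Z.+ g n)) (sumℤ-+ n f g)) (lem (sumℤ n f) (sumℤ n g) (f n) (g n))
  where
  lem : ∀ a b c d -> a Z.+ b Z.+ (c Z.+ d) ≡ a Z.+ c Z.+ (b Z.+ d)
  lem = arith

 sumℤ-* : ∀ n a f -> a Z.* sumℤ n f ≡ sumℤ n (\k -> a Z.* f k)
 sumℤ-* zero    a f = Z.*-zeroʳ a
 sumℤ-* (suc n) a f = tr (Z.*-distribˡ-+ a (sumℤ n f) (f n)) (cong (Z._+ a Z.* f n) (sumℤ-* n a f))

 sumℤ-swap : ∀ m n (f : ℕ -> ℕ -> ℤ) -> sumℤ m (\a -> sumℤ n (f a)) ≡ sumℤ n (\b -> sumℤ m (\a -> f a b))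
 sumℤ-swap zero    n f = sy (sumℤ-zero n (\_ _ -> ≡refl))
 sumℤ-swap (suc m) n f = tr (cong (Z._+ sumℤ n (f m)) (sumℤ-swap m n f)) (sy (sumℤ-+ n (\b -> sumℤ m (\a -> f a b)) (f m)))

 co-sum : ∀ n G z -> co (sumr n G) z ≡ sumℤ n (\k -> co (G k) z)
 co-sum zero    G z = co-0 z
 co-sum (suc n) G z = tr (co-+ (sumr n G) (G n) z) (cong (Z._+ co (G n) z) (co-sum n G z))

 row : List Poly -> ℕ -> Poly
 row []      k       = []
 row (r ∷ t) zero    = r
 row (r ∷ t) (suc k) = row t k

 -- `R-suc` at the leading exponent e multiplies by (24e + 1) - 13(4n + 1), where 13 is the constant
 -- term of M.
 lead-step : ℕ -> ℕ -> ℤ -> ℤ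
 lead-step k n v = (+ 24 Z.* (+ leading k Z.* v) Z.+ v) Z.- + (1 N.+ 4 N.* n) Z.* (+ 13 Z.* v)

 abstract
  entry lead-coeff : ℕ -> ℕ -> ℤ
  entry k n = nth (row newton k) n
  lead-coeff k zero    = nth (sell (residue k) 0 El) (leading k)
  lead-coeff k (suc n) = lead-step k n (lead-coeff k n)

  lead-coeff-zero : ∀ k -> lead-coeff k 0 ≡ nth (sell (residue k) 0 El) (leading k)
  lead-coeff-zero k = ≡refl

  lead-coeff-suc : ∀ k n -> lead-coeff k (suc n) ≡ lead-step k n (lead-coeff k n)
  lead-coeff-suc k n = ≡refl

 combination : ℕ -> ℕ -> ℤ
 combination k i = sumℤ 7 (\n -> entry k n Z.* lead-coeff i n)

 abstract
  combination-off : ∀ k i -> k N.< 7 -> i N.< 7 -> k ≢ i -> combination k i ≡ + 0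
  combination-off k i k< i< ne = isZero-sound _ (subst (\b -> T (if b then not (isZero (combination k i)) else isZero (combination k i))) (≡ᵇ-false ne) (below-sound2 7 (\k i -> if k ≡ᵇ i then not (isZero (combination k i)) else isZero (combination k i)) _ k i k< i<))

  combination-on : ∀ k -> k N.< 7 -> combination k k ≢ + 0
  combination-on k k< e = subst (\v -> T (not (isZero v))) e (below-sound 7 (\k -> not (isZero (combination k k))) _ k k<)

 low-num : ∀ {K X l} e -> e N.≤ K -> Num K X l -> T (below? e (\k -> isZero (nth l k))) -> Low X (+ e)
 low-num zero    e≤ n t = num-low n
 low-num {l = l} (suc e) e≤ n t = Low-step (low-num e (N.≤-trans (N.n≤1+n e) e≤) n (∧-fst {below? e (\k -> isZero (nth l k))} {isZero (nth l e)} t))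
  (tr (num-co n e e≤) (isZero-sound _ (∧-snd {below? e (\k -> isZero (nth l k))} {isZero (nth l e)} t)))

 lead-R : ∀ k -> k N.< 7 -> ∀ n -> Lead (R (residue k) n) (+ leading k) (lead-coeff k n)
 lead-R k k< zero = lead-cong (sym (R-0 (residue k)))
  ( low-num (leading k) (N.<⇒≤ bound) numbers (below-sound 7 (\k -> below? (leading k) (\i -> isZero (nth (sell (residue k) 0 El) i))) _ k k<)
  , tr (num-co numbers (leading k) bound) (sy (lead-coeff-zero k)))
  where
  bound : leading k N.< 28
  bound = N.<ᵇ⇒< (leading k) 28 (below-sound 7 (\k -> leading k N.<ᵇ 28) _ k k<)
  numbers : Num 28 (Π (residue k) E) (sell (residue k) 0 El)
  numbers = num-Π (residue k) num-E
 lead-R k k< (suc n) = lead-cong (sym (R-suc (residue k) n))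
  ( Low-+ (Low-+ (Low-ι (+ 24) (Low-θ low)) low) (Low-neg (Low-ι _ (proj₁ MR)))
  , (tr (co-sub _ _ e) (cong₂ Z._-_ (tr (co-+ _ _ e) (cong₂ Z._+_ (tr (co-ι (+ 24) _ e) (*ˡ (+ 24) (tr (co-θ _ e) (*ˡ e val)))) val)) (tr (co-ι (+ (1 N.+ 4 N.* n)) _ e) (*ˡ (+ (1 N.+ 4 N.* n)) (proj₂ MR)))) ) ⟫ sy (lead-coeff-suc k n))
  where
  infixl 5 _⟫_
  _⟫_ : ∀ {a b c : ℤ} -> a ≡ b -> b ≡ c -> a ≡ c
  _⟫_ = tr
  e = + leading k
  low = proj₁ (lead-R k k< n)
  val = proj₂ (lead-R k k< n)
  MR : Lead (M * R (residue k) n) e (+ 13 Z.* lead-coeff k n)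
  MR = lead-* (lead-val val-M) (lead-R k k< n)

 -- Taking the combination c of all the equations isolates the single unknown `w k`, as in Lagrange
 -- interpolation.
 eliminate : ∀ K k -> k N.< K -> ∀ (w c : ℕ -> ℤ) (v : ℕ -> ℕ -> ℤ) -> (∀ n -> n N.< K -> sumℤ K (\i -> w i Z.* v i n) ≡ + 0) ->
  (∀ i -> i N.< K -> i ≢ k -> sumℤ K (\n -> c n Z.* v i n) ≡ + 0) -> w k Z.* sumℤ K (\n -> c n Z.* v k n) ≡ + 0
 eliminate K k k< w c v column off =
  w k Z.* u k ≡⟪ sy (sumℤ-single K k k< {\i -> w i Z.* u i} (\i i< ne -> tr (*ˡ (w i) (off i i< ne)) (Z.*-zeroʳ (w i)))) ⟫
  sumℤ K (\i -> w i Z.* u i) ≡⟪ sumℤ-cong K (\i _ -> sumℤ-* K (w i) (\n -> c n Z.* v i n)) ⟫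
  sumℤ K (\i -> sumℤ K (\n -> w i Z.* (c n Z.* v i n))) ≡⟪ sumℤ-swap K K (\i n -> w i Z.* (c n Z.* v i n)) ⟫
  sumℤ K (\n -> sumℤ K (\i -> w i Z.* (c n Z.* v i n))) ≡⟪ sumℤ-cong K (\n _ -> sumℤ-cong K (\i _ -> shuffle (w i) (c n) (v i n))) ⟫
  sumℤ K (\n -> sumℤ K (\i -> c n Z.* (w i Z.* v i n))) ≡⟪ sumℤ-zero K (\n n< -> tr (sy (sumℤ-* K (c n) (\i -> w i Z.* v i n))) (tr (*ˡ (c n) (column n n<)) (Z.*-zeroʳ (c n)))) ⟫
  + 0 ■
  where
  u : ℕ -> ℤ
  u i = sumℤ K (\n -> c n Z.* v i n)
  shuffle : ∀ a b c -> a Z.* (b Z.* c) ≡ b Z.* (a Z.* c)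
  shuffle = arith

 -- Columns with prescribed leading exponents are independent as soon as their leading coefficients are.
 module Independence (K : ℕ) (C : ℕ -> ℕ -> Carrier) (e : ℕ -> ℕ) (v c : ℕ -> ℕ -> ℤ)
  (leads : ∀ k -> k N.< K -> ∀ n -> Lead (C k n) (+ e k) (v k n))
  (off : ∀ k i -> k N.< K -> i N.< K -> k ≢ i -> sumℤ K (\n -> c k n Z.* v i n) ≡ + 0)
  (on : ∀ k -> k N.< K -> sumℤ K (\n -> c k n Z.* v k n) ≢ + 0)
  (δ : ℕ -> Carrier) (h : ∀ n -> n N.< K -> sumr K (\k -> δ k * C k n) ≈ ι (+ 0)) where

  private
   d : ℕ -> ℕ
   d k = proj₁ (below (δ k))
   D : ℕ -> ℕ
   D zero    = 0
   D (suc n) = D n N.+ d n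
   d≤D : ∀ m k -> k N.< m -> d k N.≤ D m
   d≤D (suc m) k k< with N.m≤n⇒m<n∨m≡n (N.≤-pred k<)
   ... | inj₁ k<m   = N.≤-trans (d≤D m k k<m) (N.m≤m+n (D m) (d m))
   ... | inj₂ ≡refl = N.m≤n+m (d m) (D m)

   -- The bounds are offset by `e k`, so that all products δ k · C k n can start at one common
   -- exponent and their leading terms interact.
   point : ℕ -> ℕ -> ℤ
   point m k = Z.- (+ D K) Z.+ + m Z.- + e k

   reach : ∀ n k -> + n Z.≤ point (n N.+ e k N.+ D K) k
   reach n k = Z.≤-reflexive (lem (+ n) (+ e k) (+ D K))
    where
    lem : ∀ n e D -> n ≡ Z.- D Z.+ (n Z.+ e Z.+ D) Z.- e
    lem = arith

   step : ∀ m -> (∀ k -> k N.< K -> Low (δ k) (point m k)) -> ∀ k -> k N.< K -> co (δ k) (point m k) ≡ + 0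
   step m lows k k< with Z.i*j≡0⇒i≡0∨j≡0 (co (δ k) (point m k)) (eliminate K k k< (\i -> co (δ i) (point m i)) (c k) v column (\i i< ne -> off k i k< i< (\e -> ne (sy e))))
    where
    a = Z.- (+ D K) Z.+ + m
    l : ∀ a e -> a ≡ a Z.- e Z.+ e
    l = arith
    column : ∀ n -> n N.< K -> sumℤ K (\i -> co (δ i) (point m i) Z.* v i n) ≡ + 0
    column n n< = tr (sumℤ-cong K {\i -> co (δ i) (point m i) Z.* v i n} {\i -> co (δ i * C i n) a}
      (\i i< -> sy (tr (cong (co (δ i * C i n)) (l a (+ e i))) (tr (co-lead (lows i i<) (proj₁ (leads i i< n))) (*ˡ (co (δ i) (point m i)) (proj₂ (leads i i< n)))))))
     (tr (sy (co-sum K (\i -> δ i * C i n) a)) (tr (co-cong (h n n<) a) (tr (co-cong ι-0 a) (co-0 a))))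
   ... | inj₁ z = z
   ... | inj₂ z = ⊥-elim (on k k< z)

   lows : ∀ m k -> k N.< K -> Low (δ k) (point m k)
   lows zero k k< = Low-weaken (Z.≤-trans (Z.≤-trans (Z.i≤j⇒i-k≤j {Z.- (+ D K) Z.+ + 0} (+ e k) Z.≤-refl) (Z.≤-reflexive (Z.+-identityʳ (Z.- (+ D K))))) (Z.neg-mono-≤ (Z.+≤+ (d≤D K k k<)))) (proj₂ (below (δ k)))
   lows (suc m) k k< = subst (Low (δ k)) (lem (Z.- (+ D K)) (+ m) (+ e k)) (Low-step (lows m k k<) (step m (lows m) k k<))
    where
    lem : ∀ D m e -> + 1 Z.+ (D Z.+ m Z.- e) ≡ D Z.+ (+ 1 Z.+ m) Z.- e
    lem = arith

  all-zero : ∀ k -> k N.< K -> δ k ≈ ι (+ 0)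
  all-zero k k< = Low-all (δ k) \n -> Low-weaken (reach n k) (lows (n N.+ e k N.+ D K) k k<)

 -- The leading coefficients of the columns are Newton polynomials in the distinct numbers 24 e + 1.
 injective : ∀ (δ : ℕ -> Carrier) -> (∀ n -> n N.< 7 -> sumr 7 (\k -> δ k * R (residue k) n) ≈ ι (+ 0)) -> ∀ k -> k N.< 7 -> δ k ≈ ι (+ 0)
 injective = Independence.all-zero 7 (\k -> R (residue k)) leading lead-coeff entry lead-R combination-off combination-on

 sum-residues : ∀ (A : ℕ -> Carrier) n -> sumr 13 (\ρ -> A ρ * R ρ n) ≈ sumr 7 (\k -> A (residue k) * R (residue k) n)
 sum-residues A n = trans (sum-cong 13 {G} {\ρ -> if Pent.pentagonal ρ then G ρ else ι (+ 0)} (\ρ _ -> restrict ρ (Pent.pentagonal ρ) ≡refl))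
  (solve 8 (\z a b c d e f g -> z :+ a :+ b :+ c :+ :0 :+ :0 :+ d :+ :0 :+ e :+ :0 :+ f :+ :0 :+ :0 :+ g := z :+ a :+ b :+ c :+ d :+ e :+ g :+ f) refl 0# (G 0) (G 1) (G 2) (G 5) (G 7) (G 9) (G 12))
  where
  G : ℕ -> Carrier
  G ρ = A ρ * R ρ n
  restrict : ∀ ρ b -> Pent.pentagonal ρ ≡ b -> G ρ ≈ (if b then G ρ else ι (+ 0))
  restrict ρ true  _ = refl
  restrict ρ false e = trans (*-congˡ (R-off ρ e n)) (solve 1 (\a -> a :* :0 := :0) refl (A ρ))

-- The pairing of the vectors of g and h.

module Pairing where
 open import Data.Nat.Base as N using (ℕ; zero; suc)
 open PS using (+ˡ; *ˡ)
 open LInt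
 open LL
 open Base
 open Forms
 open Param hiding (pl)
 open Delta
 open Side
 open Trace
 open TraceLemma
 open LevelOne
 open Tau
 open Vectors
 open Gram
 open Inject
 open BaseL
 open FormsL
 open ParamL hiding (a; c; d)
 open DeltaL
 open SideL
 open TraceL

 sum-*ʳ : ∀ n F Y -> sumr n F * Y ≈ sumr n (\k -> F k * Y)
 sum-*ʳ zero    F Y = zeroˡ Y
 sum-*ʳ (suc n) F Y = trans (distribʳ Y (sumr n F) (F n)) (+-congʳ (sum-*ʳ n F Y))

 sum-zeros : ∀ n -> sumr n (\_ -> 0#) ≈ 0#
 sum-zeros n = trans (sum-zero n {\_ -> 0#} (\_ _ -> sym ι-0)) ι-0

 sum-swap : ∀ m n (F : ℕ -> ℕ -> Carrier) -> sumr m (\a -> sumr n (F a)) ≈ sumr n (\b -> sumr m (\a -> F a b))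
 sum-swap zero    n F = sym (sum-zeros n)
 sum-swap (suc m) n F = trans (+-congʳ (sum-swap m n F)) (sym (sum-+ n (\b -> sumr m (\a -> F a b)) (F m)))

 V-sum : ∀ n F -> V (sumr n F) ≈ sumr n (\k -> V (F k))
 V-sum zero    F = trans (V-cong (sym ι-0)) (trans (V-ι (+ 0)) ι-0)
 V-sum (suc n) F = trans (V-+ (sumr n F) (F n)) (+-congʳ (V-sum n F))

 mod-sum : ∀ {w} n {F} -> (∀ k -> k N.< n -> Mod w (F k)) -> Mod w (sumr n F)
 mod-sum zero    h = mod-0 (sym ι-0)
 mod-sum (suc n) h = mod-+ (mod-sum n (\k k< -> h k (N.<-trans k< (N.n<1+n n)))) (h n (N.n<1+n n))

 sum-exchange : ∀ K A B (c v : ℕ -> ℕ -> Carrier) (r : ℕ -> Carrier) ->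
  sumr K (\k -> sumr A (\a -> sumr B (\b -> c a b * v b k)) * r k) ≈ sumr A (\a -> sumr B (\b -> c a b * sumr K (\k -> v b k * r k)))
 sum-exchange K A B c v r = begin
  sumr K (\k -> sumr A (\a -> sumr B (\b -> c a b * v b k)) * r k)
   ≈⟨ sum-cong K (\k _ -> trans (sum-*ʳ A (\a -> sumr B (\b -> c a b * v b k)) (r k)) (sum-cong A (\a _ -> trans (sum-*ʳ B (\b -> c a b * v b k) (r k)) (sum-cong B (\b _ -> *-assoc (c a b) (v b k) (r k)))))) ⟩
  sumr K (\k -> sumr A (\a -> sumr B (\b -> c a b * (v b k * r k)))) ≈⟨ sum-swap K A (\k a -> sumr B (\b -> c a b * (v b k * r k))) ⟩
  sumr A (\a -> sumr K (\k -> sumr B (\b -> c a b * (v b k * r k)))) ≈⟨ sum-cong A (\a _ -> sum-swap K B (\k b -> c a b * (v b k * r k))) ⟩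
  sumr A (\a -> sumr B (\b -> sumr K (\k -> c a b * (v b k * r k)))) ≈⟨ sum-cong A (\a _ -> sum-cong B (\b _ -> sym (sum-* K (c a b) (\k -> v b k * r k)))) ⟩
  sumr A (\a -> sumr B (\b -> c a b * sumr K (\k -> v b k * r k))) ∎

 -- A vector is recovered from its pairings with the columns through the inverse of the Gram matrix.
 module Recover (K : ℕ) (C : ℕ -> ℕ -> Carrier) (D W : Carrier) (v τ : ℕ -> Carrier) (m : ℕ -> ℕ -> Carrier) (γ κ : ℕ -> ℕ -> Carrier)
  (inj : ∀ (δ : ℕ -> Carrier) -> (∀ n -> n N.< K -> sumr K (\k -> δ k * C k n) ≈ ι (+ 0)) -> ∀ k -> k N.< K -> δ k ≈ ι (+ 0))
  (pair-v : ∀ n -> n N.< K -> sumr K (\k -> v k * C k n) ≈ W * V (τ n))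
  (pair-m : ∀ b n -> b N.< K -> n N.< K -> sumr K (\k -> m b k * C k n) ≈ W * V (γ n b))
  (diagonal : ∀ n -> n N.< K -> sumr K (\b -> γ n b * κ b n) ≈ D)
  (off : ∀ n a -> n N.< K -> a N.< K -> n ≢ a -> sumr K (\b -> γ n b * κ b a) ≈ ι (+ 0)) where

  combo : ℕ -> Carrier
  combo k = sumr K (\a -> sumr K (\b -> V (τ a) * V (κ b a) * m b k))

  private
   inner : ∀ a n -> n N.< K -> sumr K (\b -> V (τ a) * V (κ b a) * sumr K (\k -> m b k * C k n)) ≈ W * V (τ a) * V (sumr K (\b -> γ n b * κ b a))
   inner a n n< = begin
    sumr K (\b -> V (τ a) * V (κ b a) * sumr K (\k -> m b k * C k n)) ≈⟨ sum-cong K (\b b< -> trans (*-congˡ (pair-m b n b< n<))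
      (trans (solve 4 (\t k w g -> t :* k :* (w :* g) := w :* t :* (g :* k)) refl (V (τ a)) (V (κ b a)) W (V (γ n b))) (*-congˡ (sym (V-* (γ n b) (κ b a)))))) ⟩
    sumr K (\b -> W * V (τ a) * V (γ n b * κ b a)) ≈⟨ sym (sum-* K (W * V (τ a)) (\b -> V (γ n b * κ b a))) ⟩
    W * V (τ a) * sumr K (\b -> V (γ n b * κ b a)) ≈⟨ *-congˡ (sym (V-sum K (\b -> γ n b * κ b a))) ⟩
    W * V (τ a) * V (sumr K (\b -> γ n b * κ b a)) ∎

   pair-combo : ∀ n -> n N.< K -> sumr K (\k -> combo k * C k n) ≈ W * V (τ n) * V D
   pair-combo n n< = begin
    sumr K (\k -> combo k * C k n) ≈⟨ sum-exchange K K K (\a b -> V (τ a) * V (κ b a)) m (\k -> C k n) ⟩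
    sumr K (\a -> sumr K (\b -> V (τ a) * V (κ b a) * sumr K (\k -> m b k * C k n))) ≈⟨ sum-cong K (\a _ -> inner a n n<) ⟩
    sumr K (\a -> W * V (τ a) * V (sumr K (\b -> γ n b * κ b a)))
     ≈⟨ sum-single K n n< {\a -> W * V (τ a) * V (sumr K (\b -> γ n b * κ b a))} (\a a< ne -> trans (*-congˡ (trans (V-cong (off n a n< a< (\e -> ne (sy e)))) (V-ι (+ 0)))) (solve 1 (\y -> y :* :0 := :0) refl (W * V (τ a)))) ⟩
    W * V (τ n) * V (sumr K (\b -> γ n b * κ b n)) ≈⟨ *-congˡ (V-cong (diagonal n n<)) ⟩
    W * V (τ n) * V D ∎

   neg-sum : ∀ n F -> sumr n (\k -> - F k) ≈ - sumr n F
   neg-sum n F = trans (sum-cong n {\k -> - F k} {\k -> ι mone * F k} (\k _ -> solve 1 (\f -> :- f := con mone :* f) refl (F k))) (trans (sym (sum-* n (ι mone) F)) (solve 1 (\f -> con mone :* f := :- f) refl (sumr n F)))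

   orthogonal : ∀ n -> n N.< K -> sumr K (\k -> (V D * v k - combo k) * C k n) ≈ ι (+ 0)
   orthogonal n n< = begin
    sumr K (\k -> (V D * v k - combo k) * C k n) ≈⟨ sum-cong K (\k _ -> solve 4 (\d v c r -> (d :* v :- c) :* r := d :* (v :* r) :+ (:- (c :* r))) refl (V D) (v k) (combo k) (C k n)) ⟩
    sumr K (\k -> V D * (v k * C k n) + - (combo k * C k n)) ≈⟨ sum-+ K (\k -> V D * (v k * C k n)) (\k -> - (combo k * C k n)) ⟩
    sumr K (\k -> V D * (v k * C k n)) + sumr K (\k -> - (combo k * C k n))
     ≈⟨ +-cong (trans (sym (sum-* K (V D) (\k -> v k * C k n))) (*-congˡ (pair-v n n<))) (trans (neg-sum K (\k -> combo k * C k n)) (-‿cong (pair-combo n n<))) ⟩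
    V D * (W * V (τ n)) - W * V (τ n) * V D ≈⟨ solve 2 (\d w -> d :* w :- w :* d := :0) refl (V D) (W * V (τ n)) ⟩
    ι (+ 0) ∎

  recovered : ∀ k -> k N.< K -> V D * v k ≈ combo k
  recovered k k< = sub-0 (inj (\k -> V D * v k - combo k) orthogonal k k<)

 -- The index of the class 1 - r modulo 13, the pairing of classes that is built into `vM` and `vH`:
 -- 0 with 1, 2 with 12, 5 with 9, and 7 with itself.
 mirror : ℕ -> ℕ
 mirror 0 = 1
 mirror 1 = 0
 mirror 2 = 5
 mirror 3 = 6
 mirror 4 = 4
 mirror 5 = 2
 mirror _ = 3

 mirror<7 : ∀ k -> mirror k N.< 7
 mirror<7 0 = N.≤ᵇ⇒≤ 2 7 _
 mirror<7 1 = N.≤ᵇ⇒≤ 1 7 _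
 mirror<7 2 = N.≤ᵇ⇒≤ 6 7 _
 mirror<7 3 = N.≤ᵇ⇒≤ 7 7 _
 mirror<7 4 = N.≤ᵇ⇒≤ 5 7 _
 mirror<7 5 = N.≤ᵇ⇒≤ 3 7 _
 mirror<7 (suc (suc (suc (suc (suc (suc k)))))) = N.≤ᵇ⇒≤ 4 7 _

 -- In the self-paired class 7 the entry of `vM` is already doubled; weight 1 there and 2 elsewhere
 -- makes `vM-mirror` uniform.
 ω : ℕ -> ℤ
 ω 4 = + 1
 ω _ = + 2

 vM-mirror : ∀ k b -> k N.< 7 -> ι (ω k) * vM b (residue (mirror k)) ≈ ι (+ 2) * R (residue k) b
 vM-mirror 0 b _ = solve 1 (\r -> con (+ 2) :* (r :+ :0) := con (+ 2) :* r) refl (R 0 b)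
 vM-mirror 1 b _ = solve 1 (\r -> con (+ 2) :* (r :+ :0) := con (+ 2) :* r) refl (R 1 b)
 vM-mirror 2 b _ = solve 1 (\r -> con (+ 2) :* (r :+ :0) := con (+ 2) :* r) refl (R 2 b)
 vM-mirror 3 b _ = solve 1 (\r -> con (+ 2) :* (r :+ :0) := con (+ 2) :* r) refl (R 5 b)
 vM-mirror 4 b _ = solve 1 (\r -> :1 :* (r :+ r) := con (+ 2) :* r) refl (R 7 b)
 vM-mirror 5 b _ = solve 1 (\r -> con (+ 2) :* (r :+ :0) := con (+ 2) :* r) refl (R 12 b)
 vM-mirror 6 b _ = solve 1 (\r -> con (+ 2) :* (r :+ :0) := con (+ 2) :* r) refl (R 9 b)
 vM-mirror (suc (suc (suc (suc (suc (suc (suc k))))))) b (N.s≤s (N.s≤s (N.s≤s (N.s≤s (N.s≤s (N.s≤s (N.s≤s ())))))))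

 τg τh : ℕ -> ℕ -> Carrier
 τg l n = ι (+ 1) * U (E4 ^ 1 * E6 ^ 0 * Δ⁻ ^ 0 * t ^ 0 * C1.p n * j ^ l) + ι ((+ 13) Z.^ (3 N.+ n)) * (E4ʹ ^ 1 * E6ʹ ^ 0 * Δʹ⁻ ^ 0 * x ^ 0 * C2.p n * jʹ ^ l)
 τh l n = ι (+ 169) * U (E4 ^ 1 * E6 ^ 1 * Δ⁻ ^ 1 * t ^ 1 * C1.p n * j ^ l) + ι ((+ 13) Z.^ n) * (E4ʹ ^ 1 * E6ʹ ^ 1 * Δʹ⁻ ^ 1 * x ^ 1 * C2.p n * jʹ ^ l)

 Γ-sym : ∀ m n -> Γ m n ≈ Γ n m
 Γ-sym m n = +-cong (Π-cong 1 (*-comm (N m) (N n))) (*-comm (R 7 m) (R 7 n))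

 module _ (l i : ℕ) where
  private
   module Rec = Recover 7 (\k -> R (residue k)) (ι discr * Δ ^ 2) (q (+ 1) * V (E * E)) (\k -> vH (h i) (residue k)) (τh i) (\b k -> vM b (residue k)) (\m n -> ⟦ γn m n ⟧) (\m n -> ⟦ κn m n ⟧)
    injective
    (\n n< -> trans (sym (sum-residues (vH (h i)) n)) (T-H n n< i))
    (\b n b< n< -> trans (sym (sum-residues (vM b) n)) (trans (T-Γ b n) (trans (Γ-sym b n) (trans (Γ-γ n b n< b<) (*-congˡ (V-cong (γ-explicit n b n< b<)))))))
    γκ-diagonal γκ-off

   module Combine (K : ℕ) (D : Carrier) (mir : ℕ -> ℕ) (om : ℕ -> ℤ) (vg vh : ℕ -> Carrier) (m c : ℕ -> ℕ -> Carrier) (r : ℕ -> ℕ -> Carrier) (τ1 τ2 : ℕ -> Carrier) (κ : ℕ -> ℕ -> Carrier)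
    (rec : ∀ k -> k N.< K -> V D * vh (mir k) ≈ sumr K (\a -> sumr K (\b -> V (τ2 a) * V (κ b a) * m b (mir k))))
    (mirrored : ∀ k b -> k N.< K -> ι (om k) * m b (mir k) ≈ ι (+ 2) * r k b)
    (pair-g : ∀ b -> b N.< K -> sumr K (\k -> vg k * r k b) ≈ V (τ1 b)) where

    -- After the vector of h is recovered from the Gram matrix, it consists of mirrored components
    -- of the N_b; `mirrored` turns their products with the vector of g into pairings that are known
    -- by `pair-g`.
    combined : V D * sumr K (\k -> ι (om k) * (vg k * vh (mir k))) ≈ ι (+ 2) * V (sumr K (\a -> sumr K (\b -> τ2 a * κ b a * τ1 b)))
    combined = begin
     V D * sumr K (\k -> ι (om k) * (vg k * vh (mir k))) ≈⟨ sum-* K (V D) (\k -> ι (om k) * (vg k * vh (mir k))) ⟩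
     sumr K (\k -> V D * (ι (om k) * (vg k * vh (mir k))))
      ≈⟨ sum-cong K (\k k< -> trans (solve 4 (\d o g h -> d :* (o :* (g :* h)) := (d :* h) :* (o :* g)) refl (V D) (ι (om k)) (vg k) (vh (mir k))) (*-congʳ (rec k k<))) ⟩
     sumr K (\k -> sumr K (\a -> sumr K (\b -> V (τ2 a) * V (κ b a) * m b (mir k))) * (ι (om k) * vg k)) ≈⟨ sum-exchange K K K (\a b -> V (τ2 a) * V (κ b a)) (\b k -> m b (mir k)) (\k -> ι (om k) * vg k) ⟩
     sumr K (\a -> sumr K (\b -> V (τ2 a) * V (κ b a) * sumr K (\k -> m b (mir k) * (ι (om k) * vg k)))) ≈⟨ sum-cong K (\a _ -> sum-cong K (\b b< -> term a b b<)) ⟩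
     sumr K (\a -> sumr K (\b -> ι (+ 2) * V (τ2 a * κ b a * τ1 b))) ≈⟨ sum-cong K (\a _ -> trans (sym (sum-* K (ι (+ 2)) (\b -> V (τ2 a * κ b a * τ1 b)))) (*-congˡ (sym (V-sum K (\b -> τ2 a * κ b a * τ1 b))))) ⟩
     sumr K (\a -> ι (+ 2) * V (sumr K (\b -> τ2 a * κ b a * τ1 b))) ≈⟨ trans (sym (sum-* K (ι (+ 2)) (\a -> V (sumr K (\b -> τ2 a * κ b a * τ1 b))))) (*-congˡ (sym (V-sum K (\a -> sumr K (\b -> τ2 a * κ b a * τ1 b))))) ⟩
     ι (+ 2) * V (sumr K (\a -> sumr K (\b -> τ2 a * κ b a * τ1 b))) ∎
     where
     term : ∀ a b -> b N.< K -> V (τ2 a) * V (κ b a) * sumr K (\k -> m b (mir k) * (ι (om k) * vg k)) ≈ ι (+ 2) * V (τ2 a * κ b a * τ1 b)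
     term a b b< = begin
      V (τ2 a) * V (κ b a) * sumr K (\k -> m b (mir k) * (ι (om k) * vg k))
       ≈⟨ *-congˡ (sum-cong K (\k k< -> trans (solve 3 (\m o g -> m :* (o :* g) := (o :* m) :* g) refl (m b (mir k)) (ι (om k)) (vg k)) (trans (*-congʳ (mirrored k b k<)) (solve 3 (\c r g -> c :* r :* g := c :* (g :* r)) refl (ι (+ 2)) (r k b) (vg k))))) ⟩
      V (τ2 a) * V (κ b a) * sumr K (\k -> ι (+ 2) * (vg k * r k b)) ≈⟨ *-congˡ (trans (sym (sum-* K (ι (+ 2)) (\k -> vg k * r k b))) (*-congˡ (pair-g b b<))) ⟩
      V (τ2 a) * V (κ b a) * (ι (+ 2) * V (τ1 b)) ≈⟨ solve 4 (\t k c g -> t :* k :* (c :* g) := c :* (t :* k :* g)) refl (V (τ2 a)) (V (κ b a)) (ι (+ 2)) (V (τ1 b)) ⟩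
      ι (+ 2) * (V (τ2 a) * V (κ b a) * V (τ1 b)) ≈⟨ *-congˡ (sym (trans (V-* _ _) (*-congʳ (V-* _ _)))) ⟩
      ι (+ 2) * V (τ2 a * κ b a * τ1 b) ∎

   Z : Carrier
   Z = sumr 7 (\a -> sumr 7 (\b -> τh i a * ⟦ κn b a ⟧ * τg l b))

   -- (2a - 2) + (24 - 2a - 2b) + (2b + 4) = 26, so that division by Δ² gives weight 2 and `mod-ct`
   -- applies.
   mod-Z : Mod (+ 26) Z
   mod-Z = mod-sum 7 {\a -> sumr 7 (\b -> τh i a * ⟦ κn b a ⟧ * τg l b)} (\a a< -> mod-sum 7 {\b -> τh i a * ⟦ κn b a ⟧ * τg l b} (\b b< ->
    mod-weight (weight a b) (mod-* (mod-* (τH-modular a a< i) (κ-modular b a b< a<)) (τG-modular b b< l))))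
    where
    weight : ∀ a b -> + (2 N.* a) Z.- + 2 Z.+ (+ 24 Z.- + (b N.* 2 N.+ a N.* 2)) Z.+ (+ (2 N.* (3 N.+ b)) Z.- + 2) ≡ + 26
    weight a b = tr (cong₂ (\u v -> u Z.- + 2 Z.+ (+ 24 Z.- + (b N.* 2 N.+ a N.* 2)) Z.+ (v Z.- + 2)) (Z.pos-* 2 a) (Z.pos-* 2 (3 N.+ b)))
     (tr (cong₂ (\u v -> + 2 Z.* + a Z.- + 2 Z.+ (+ 24 Z.- (u Z.+ v)) Z.+ (+ 2 Z.* (+ 3 Z.+ + b) Z.- + 2)) (Z.pos-* b 2) (Z.pos-* a 2)) (lem (+ a) (+ b)))
     where
     lem : ∀ a b -> + 2 Z.* a Z.- + 2 Z.+ (+ 24 Z.- (b Z.* + 2 Z.+ a Z.* + 2)) Z.+ (+ 2 Z.* (+ 3 Z.+ b) Z.- + 2) ≡ + 26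
     lem = arith

  pairing-sum : Carrier
  pairing-sum = sumr 7 (\k -> ι (ω k) * (vG (g l) (residue k) * vH (h i) (residue (mirror k))))

  abstract
   V-pairing-sum : V (ι discr * Δ ^ 2) * pairing-sum ≈ ι (+ 2) * V Z
   V-pairing-sum = Combine.combined 7 (ι discr * Δ ^ 2) mirror ω (\k -> vG (g l) (residue k)) (\k -> vH (h i) (residue k)) (\b k -> vM b (residue k)) (\_ _ -> 0#) (\k -> R (residue k)) (τg l) (τh i) (\m n -> ⟦ κn m n ⟧)
    (\k k< -> Rec.recovered (mirror k) (mirror<7 k)) (\k b k< -> vM-mirror k b k<) (\b b< -> trans (sym (sum-residues (vG (g l)) b)) (T-G b b< l))

   ct-pairing-sum : ct pairing-sum ≡ + 0
   ct-pairing-sum = Z.*-cancelˡ-≡ discr (ct pairing-sum) (+ 0) (tr (sy (co-ι discr pairing-sum (+ 0))) (tr (co-cong scaled (+ 0))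
    (tr (co-ι (+ 2) (V (Z * Δ⁻ ^ 2)) (+ 0)) (tr (*ˡ (+ 2) (tr (ct-V (Z * Δ⁻ ^ 2)) (mod-ct (mod-* mod-Z (mod-^ 2 mod-Δ⁻))))) (sy (Z.*-zeroʳ discr))))))
    where
    scaled : ι discr * pairing-sum ≈ ι (+ 2) * V (Z * Δ⁻ ^ 2)
    scaled = begin
     ι discr * pairing-sum ≈⟨ solve 2 (\c s -> c :* s := :1 :* :1 :* (c :* s)) refl (ι discr) pairing-sum ⟩
     ι (+ 1) * ι (+ 1) * (ι discr * pairing-sum) ≈⟨ *-congʳ (*-cong (sym ΔʹΔʹ⁻) (sym ΔʹΔʹ⁻)) ⟩
     Δʹ * Δʹ⁻ * (Δʹ * Δʹ⁻) * (ι discr * pairing-sum) ≈⟨ solve 4 (\d e c s -> d :* e :* (d :* e) :* (c :* s) := c :* (d :* (d :* :1)) :* s :* (e :* (e :* :1))) refl Δʹ Δʹ⁻ (ι discr) pairing-sum ⟩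
     ι discr * Δʹ ^ 2 * pairing-sum * Δʹ⁻ ^ 2 ≈⟨ *-cong (trans (*-congʳ (sym (trans (V-ι* discr (Δ ^ 2)) (*-congˡ (V-^ Δ 2))))) V-pairing-sum) (sym (V-^ Δ⁻ 2)) ⟩
     ι (+ 2) * V Z * V (Δ⁻ ^ 2) ≈⟨ trans (*-assoc _ _ _) (*-congˡ (sym (V-* Z (Δ⁻ ^ 2)))) ⟩
     ι (+ 2) * V (Z * Δ⁻ ^ 2) ∎

-- Stability of the span under the Hecke operator.

module TStable where
 open import Data.Nat.Base as N using (ℕ; zero; suc)
 open import Data.Integer.DivMod using (_%ℕ_)
 open import Data.Bool.Base using (if_then_else_)
 open PS using (+ˡ; *ˡ)
 open Classes using (co-class)
 open LInt
 open LL
 open Base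
 open Poly
 open Forms
 open Param hiding (pl)
 open Delta
 open TraceLemma
 open LevelOne
 open Tau
 open Vectors
 open Inject
 open Pairing
 open BaseL
 open Eval
 open FormsL
 open ParamL hiding (a; c; d)
 open DeltaL

 -- quadratic character of 1 − 24 r, up to normalisation
 χ : ℕ -> ℤ
 χ 0  = + 1
 χ 1  = + 1
 χ 4  = + 1
 χ 6  = + 0
 χ 8  = + 1
 χ 11 = + 1
 χ 12 = + 1
 χ _  = mone

 -- the Hecke operator of index 13² on forms of half-integral weight 7/2
 middle hecke : Carrier -> Carrier
 middle X = sumr 13 (\r -> ι (χ r) * Π r X)
 hecke X = U (U (q (+ 7) * X)) + ι (+ 169) * middle X + ι (+ 371293) * (q -[1+ 6 ] * V (V X))

 sum-congʹ : ∀ n {F G} -> (∀ k -> F k ≈ G k) -> sumr n F ≈ sumr n G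
 sum-congʹ n h = sum-cong n (\k _ -> h k)

 middle-cong : ∀ {X Y} -> X ≈ Y -> middle X ≈ middle Y
 middle-cong {X} {Y} e = sum-congʹ 13 {\r -> ι (χ r) * Π r X} {\r -> ι (χ r) * Π r Y} (\r -> *-congˡ (Π-cong r e))

 middle-+ : ∀ X Y -> middle (X + Y) ≈ middle X + middle Y
 middle-+ X Y = trans (sum-congʹ 13 {\r -> ι (χ r) * Π r (X + Y)} {\r -> ι (χ r) * Π r X + ι (χ r) * Π r Y} (\r -> trans (*-congˡ (Π-+ r X Y)) (distribˡ _ _ _)))
  (sum-+ 13 (\r -> ι (χ r) * Π r X) (\r -> ι (χ r) * Π r Y))

 middle-ι : ∀ c X -> middle (ι c * X) ≈ ι c * middle X
 middle-ι c X = trans (sum-congʹ 13 {\r -> ι (χ r) * Π r (ι c * X)} {\r -> ι c * (ι (χ r) * Π r X)} (\r -> trans (*-congˡ (Π-ι r c X)) (solve 3 (\a c x -> a :* (c :* x) := c :* (a :* x)) refl (ι (χ r)) (ι c) (Π r X))))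
  (sym (sum-* 13 (ι c) (\r -> ι (χ r) * Π r X)))

 hecke-cong : ∀ {X Y} -> X ≈ Y -> hecke X ≈ hecke Y
 hecke-cong e = +-cong (+-cong (U-cong (U-cong (*-congˡ e))) (*-congˡ (middle-cong e))) (*-congˡ (*-congˡ (V-cong (V-cong e))))

 hecke-+ : ∀ X Y -> hecke (X + Y) ≈ hecke X + hecke Y
 hecke-+ X Y = trans (+-cong (+-cong (trans (U-cong (trans (U-cong (distribˡ _ X Y)) (U-+ _ _))) (U-+ _ _)) (*-congˡ (middle-+ X Y))) (*-congˡ (*-congˡ (trans (V-cong (V-+ X Y)) (V-+ _ _)))))
  (solve 8 (\u uʹ m mʹ v vʹ k r -> (u :+ uʹ) :+ con (+ 169) :* (m :+ mʹ) :+ k :* (r :* (v :+ vʹ)) := (u :+ con (+ 169) :* m :+ k :* (r :* v)) :+ (uʹ :+ con (+ 169) :* mʹ :+ k :* (r :* vʹ))) refl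
   (U (U (q (+ 7) * X))) (U (U (q (+ 7) * Y))) (middle X) (middle Y) (V (V X)) (V (V Y)) (ι (+ 371293)) (q -[1+ 6 ]))

 hecke-ι : ∀ c X -> hecke (ι c * X) ≈ ι c * hecke X
 hecke-ι c X = trans (+-cong (+-cong (trans (U-cong (trans (U-cong (solve 3 (\r c x -> r :* (c :* x) := c :* (r :* x)) refl (q (+ 7)) (ι c) X)) (U-ι c _))) (U-ι c _)) (*-congˡ (middle-ι c X))) (*-congˡ (*-congˡ (trans (V-cong (V-ι* c X)) (V-ι* c _)))))
  (solve 6 (\c u m v k r -> c :* u :+ con (+ 169) :* (c :* m) :+ k :* (r :* (c :* v)) := c :* (u :+ con (+ 169) :* m :+ k :* (r :* v))) refl (ι c) (U (U (q (+ 7) * X))) (middle X) (V (V X)) (ι (+ 371293)) (q -[1+ 6 ]))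

 ct-Π0 : ∀ X -> ct (Π 0 X) ≡ ct X
 ct-Π0 X = co-Π-in X (+ 0) ≡refl

 pure-Π : ∀ r X -> Pure r (Π r X)
 pure-Π r X ρ with r N.≟ ρ
 ... | yes ≡refl = trans (co-ext same) (reflexive (cong (\b -> if b then Π r X else ι (+ 0)) (sy (≡ᵇ-refl r))))
  where
  same : ∀ z -> co (Π r (Π r X)) z ≡ co (Π r X) z
  same z with z %ℕ 13 N.≟ r
  ... | yes e = co-Π-in (Π r X) z e
  ... | no ne = tr (co-Π-out (Π r X) z ne) (sy (co-Π-out X z ne))
 ... | no r≢ρ = trans (co-ext (\z -> tr (zero-at z) (sy (tr (co-cong ι-0 z) (co-0 z))))) (reflexive (cong (\b -> if b then Π r X else ι (+ 0)) (sy (≡ᵇ-false r≢ρ))))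
  where
  zero-at : ∀ z -> co (Π ρ (Π r X)) z ≡ + 0
  zero-at z with z %ℕ 13 N.≟ ρ
  ... | yes e = tr (co-Π-in (Π r X) z e) (co-Π-out X z (\eʹ -> r≢ρ (tr (sy eʹ) e)))
  ... | no ne = co-Π-out (Π r X) z ne

 private
  0<13 : 0 N.< 13
  0<13 = N.≤ᵇ⇒≤ 1 13 _

 ct-pure : ∀ r -> r N.< 13 -> ∀ X {Y} -> Pure r Y -> ct (X * Y) ≡ ct (Π (co-class 0 r) X * Y)
 ct-pure r r< X h = tr (sy (ct-Π0 _)) (co-cong (Π-pure 0 0<13 r r< X h) (+ 0))

 -- `c r` is the share of class r of G in the constant term of GH. `A` and `B` belong to the outer
 -- terms of the operator, which see only class 6 of G and class 7 of H.
 module Adjoint (G H : Carrier) where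
  c : ℕ -> ℤ
  c r = ct (Π (co-class 0 r) H * Π r G)

  A B : ℤ
  A = ct (Π 6 G * (q (+ 7) * V (V H)))
  B = ct (Π 7 H * (q -[1+ 6 ] * V (V G)))

  total : sumℤ 13 c ≡ ct (G * H)
  total = sy (tr (co-cong (*-comm G H) (+ 0)) (tr (sy (ct-Π0 _)) (tr (co-cong (Π-* 0 0<13 H G) (+ 0)) (co-sum 13 (\r -> Π (co-class 0 r) H * Π r G) (+ 0)))))

  ct-middle : ct (middle G * H) ≡ sumℤ 13 (\r -> χ r Z.* c r)
  ct-middle = tr (co-cong (sum-*ʳ 13 (\r -> ι (χ r) * Π r G) H) (+ 0)) (tr (co-sum 13 (\r -> ι (χ r) * Π r G * H) (+ 0))
   (sumℤ-cong 13 {\r -> ct (ι (χ r) * Π r G * H)} {\r -> χ r Z.* c r} (\r r< -> tr (co-cong (solve 3 (\k x h -> k :* x :* h := k :* (h :* x)) refl (ι (χ r)) (Π r G) H) (+ 0)) (tr (co-ι (χ r) _ (+ 0)) (*ˡ (χ r) (ct-pure r r< H (pure-Π r G)))))))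

  ct-hecke : ct (hecke G * H) ≡ A Z.+ + 169 Z.* sumℤ 13 (\r -> χ r Z.* c r) Z.+ + 371293 Z.* B
  ct-hecke = tr (co-cong (solve 5 (\u m k v h -> (u :+ con (+ 169) :* m :+ k :* v) :* h := u :* h :+ con (+ 169) :* (m :* h) :+ k :* (h :* v)) refl (U (U (q (+ 7) * G))) (middle G) (ι (+ 371293)) (q -[1+ 6 ] * V (V G)) H) (+ 0))
   (tr (co-+ _ _ (+ 0)) (cong₂ Z._+_ (tr (co-+ _ _ (+ 0)) (cong₂ Z._+_ first (tr (co-ι (+ 169) _ (+ 0)) (*ˡ (+ 169) ct-middle)))) (tr (co-ι (+ 371293) _ (+ 0)) (*ˡ (+ 371293) (ct-pure 6 (N.≤ᵇ⇒≤ 7 13 _) H (pure-V { 6} {q -[1+ 6 ]} (pure-q -[1+ 6 ]) (V G)))))))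
   where
   first : ct (U (U (q (+ 7) * G)) * H) ≡ A
   first = tr (co-cong (sym (UV (U (q (+ 7) * G)) H)) (+ 0)) (tr (ct-U _) (tr (co-cong (sym (UV (q (+ 7) * G) (V H))) (+ 0)) (tr (ct-U _)
    (tr (co-cong (solve 3 (\r g h -> r :* g :* h := g :* (r :* h)) refl (q (+ 7)) G (V (V H))) (+ 0)) (ct-pure 7 (N.≤ᵇ⇒≤ 8 13 _) G (pure-V {7} {q (+ 7)} (pure-q (+ 7)) (V H)))))))

  private
   ordinary : ∀ r ρ -> co-class 0 r ≡ ρ -> ct (ι (+ 2) * ((Π r G + ι (+ 0)) * (Π ρ (ι (+ 169) * H) + ι (+ 0)))) ≡ + 338 Z.* c r
   ordinary r ρ ≡refl = tr (co-cong (trans (*-congˡ (*-congˡ (+-congʳ (Π-ι ρ (+ 169) H)))) (solve 2 (\g h -> con (+ 2) :* ((g :+ :0) :* (con (+ 169) :* h :+ :0)) := con (+ 338) :* (h :* g)) refl (Π r G) (Π ρ H))) (+ 0)) (co-ι (+ 338) _ (+ 0))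

   special : ct (G * H) ≡ + 0 -> ct (ι (+ 1) * ((Π 6 G + ι (+ 2197) * (q -[1+ 6 ] * V (V G))) * (Π 7 (ι (+ 169) * H) + q (+ 7) * V (V H)))) ≡ + 169 Z.* c 6 Z.+ A Z.+ + 371293 Z.* B
   special e = tr (co-cong (begin
     ι (+ 1) * ((Π 6 G + ι (+ 2197) * (q -[1+ 6 ] * V (V G))) * (Π 7 (ι (+ 169) * H) + q (+ 7) * V (V H))) ≈⟨ *-congˡ (*-congˡ (+-congʳ (Π-ι 7 (+ 169) H))) ⟩
     ι (+ 1) * ((Π 6 G + ι (+ 2197) * (q -[1+ 6 ] * V (V G))) * (ι (+ 169) * Π 7 H + q (+ 7) * V (V H)))
      ≈⟨ solve 7 (\g h r s v w k -> :1 :* ((g :+ con (+ 2197) :* (s :* v)) :* (con (+ 169) :* h :+ r :* w)) :=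
        con (+ 169) :* (h :* g) :+ g :* (r :* w) :+ con (+ 371293) :* (h :* (s :* v)) :+ con (+ 2197) :* ((r :* s) :* (v :* w))) refl (Π 6 G) (Π 7 H) (q (+ 7)) (q -[1+ 6 ]) (V (V G)) (V (V H)) (ι (+ 0)) ⟩
     ι (+ 169) * (Π 7 H * Π 6 G) + Π 6 G * (q (+ 7) * V (V H)) + ι (+ 371293) * (Π 7 H * (q -[1+ 6 ] * V (V G))) + ι (+ 2197) * ((q (+ 7) * q -[1+ 6 ]) * (V (V G) * V (V H)))
      ≈⟨ +-congˡ (*-congˡ (trans (*-cong (q-inv (+ 7)) (trans (sym (V-* _ _)) (V-cong (sym (V-* G H))))) (solve 1 (\y -> :1 :* y := y) refl _))) ⟩
     ι (+ 169) * (Π 7 H * Π 6 G) + Π 6 G * (q (+ 7) * V (V H)) + ι (+ 371293) * (Π 7 H * (q -[1+ 6 ] * V (V G))) + ι (+ 2197) * V (V (G * H)) ∎) (+ 0))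
    (tr (co-+ _ _ (+ 0)) (tr (cong₂ Z._+_ (tr (co-+ _ _ (+ 0)) (cong₂ Z._+_ (tr (co-+ _ _ (+ 0)) (cong (Z._+ A) (co-ι (+ 169) _ (+ 0)))) (co-ι (+ 371293) _ (+ 0))))
      (tr (co-ι (+ 2197) _ (+ 0)) (*ˡ (+ 2197) (tr (ct-V _) (tr (ct-V _) e)))))
     (Z.+-identityʳ _)))

  ct-pairing : ct (G * H) ≡ + 0 -> ct (sumr 7 (\k -> ι (ω k) * (vG G (residue k) * vH H (residue (mirror k))))) ≡
   + 338 Z.* c 0 Z.+ + 338 Z.* c 12 Z.+ + 338 Z.* c 11 Z.+ + 338 Z.* c 8 Z.+ (+ 169 Z.* c 6 Z.+ A Z.+ + 371293 Z.* B) Z.+ + 338 Z.* c 1 Z.+ + 338 Z.* c 4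
  ct-pairing e = tr (co-sum 7 (\k -> ι (ω k) * (vG G (residue k) * vH H (residue (mirror k)))) (+ 0))
   (tr (cong₂ Z._+_ (cong₂ Z._+_ (cong₂ Z._+_ (cong₂ Z._+_ (cong₂ Z._+_ (cong₂ Z._+_ (cong₂ Z._+_ (I.refl {x = + 0})
    (ordinary 0 0 ≡refl)) (ordinary 12 1 ≡refl)) (ordinary 11 2 ≡refl)) (ordinary 8 5 ≡refl)) (special e)) (ordinary 1 12 ≡refl)) (ordinary 4 9 ≡refl))
    (cong (\w -> w Z.+ + 338 Z.* c 12 Z.+ + 338 Z.* c 11 Z.+ + 338 Z.* c 8 Z.+ (+ 169 Z.* c 6 Z.+ A Z.+ + 371293 Z.* B) Z.+ + 338 Z.* c 1 Z.+ + 338 Z.* c 4) (Z.+-identityˡ (+ 338 Z.* c 0))))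

  -- χ(r) is 2 or 0 according as χ(r) = 1 or not, plus 1 for r = 6, minus 1. The first two parts
  -- reproduce the pairing of the vectors; the last one sums to a multiple of the constant term of
  -- GH.
  adjoint : ct (G * H) ≡ + 0 -> ct (sumr 7 (\k -> ι (ω k) * (vG G (residue k) * vH H (residue (mirror k))))) ≡ + 0 -> ct (hecke G * H) ≡ + 0
  adjoint e p = tr ct-hecke (tr (rearrange A B (c 0) (c 1) (c 2) (c 3) (c 4) (c 5) (c 6) (c 7) (c 8) (c 9) (c 10) (c 11) (c 12))
   (cong₂ (\u v -> u Z.- + 169 Z.* v) (tr (sy (ct-pairing e)) p) (tr total e)))
   where
   rearrange : ∀ A B c0 c1 c2 c3 c4 c5 c6 c7 c8 c9 c10 c11 c12 ->
    A Z.+ + 169 Z.* (+ 0 Z.+ + 1 Z.* c0 Z.+ + 1 Z.* c1 Z.+ mone Z.* c2 Z.+ mone Z.* c3 Z.+ + 1 Z.* c4 Z.+ mone Z.* c5 Z.+ + 0 Z.* c6 Z.+ mone Z.* c7 Z.+ + 1 Z.* c8 Z.+ mone Z.* c9 Z.+ mone Z.* c10 Z.+ + 1 Z.* c11 Z.+ + 1 Z.* c12) Z.+ + 371293 Z.* B ≡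
    (+ 338 Z.* c0 Z.+ + 338 Z.* c12 Z.+ + 338 Z.* c11 Z.+ + 338 Z.* c8 Z.+ (+ 169 Z.* c6 Z.+ A Z.+ + 371293 Z.* B) Z.+ + 338 Z.* c1 Z.+ + 338 Z.* c4) Z.-
    + 169 Z.* (+ 0 Z.+ c0 Z.+ c1 Z.+ c2 Z.+ c3 Z.+ c4 Z.+ c5 Z.+ c6 Z.+ c7 Z.+ c8 Z.+ c9 Z.+ c10 Z.+ c11 Z.+ c12)
   rearrange = arith

 -- The leading exponents are 0 and -1, with sum -1 as `dual` requires.
 A0 B0 : Carrier
 A0 = E4 * P
 B0 = E * (E4 * E6 * Δ⁻)

 lead-A0 : Lead A0 (+ 0) (+ 1)
 lead-A0 = lead-val (val-* val-E4 val-P)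

 lead-B0 : Lead B0 mone (+ 1)
 lead-B0 = lead-* (lead-val val-E) (lead-* (lead-* (lead-val val-E4) (lead-val val-E6)) lead-Δ⁻)

 ct-gh : ∀ l i -> ct (A0 * j ^ l * (B0 * j ^ i)) ≡ + 0
 ct-gh l i = tr (co-cong (begin
  E4 * P * j ^ l * (E * (E4 * E6 * Δ⁻) * j ^ i) ≈⟨ solve 7 (\a p y e b d z -> a :* p :* y :* (e :* (a :* b :* d) :* z) := (e :* p) :* (a :* (a :* :1) :* b :* d :* (y :* z))) refl E4 P (j ^ l) E E6 Δ⁻ (j ^ i) ⟩
  E * P * (A2 * (j ^ l * j ^ i)) ≈⟨ *-cong EP (*-congˡ (sym (^-+ j l i))) ⟩
  ι (+ 1) * (A2 * j ^ (l N.+ i)) ≈⟨ solve 1 (\y -> :1 :* y := y) refl _ ⟩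
  A2 * j ^ (l N.+ i) ∎) (+ 0)) (ct-A2 (l N.+ i))

 hecke-basis : ∀ l -> Perp B0 (hecke (A0 * j ^ l))
 hecke-basis l i = tr (co-cong (*-cong (hecke-cong g≈) h≈) (+ 0))
  (Adjoint.adjoint (g l) (h i) (tr (co-cong (*-cong (sym g≈) (sym h≈)) (+ 0)) (ct-gh l i)) (ct-pairing-sum l i))
  where
  g≈ : A0 * j ^ l ≈ g l
  g≈ = solve 3 (\a p y -> a :* p :* y := a :* y :* p) refl E4 P (j ^ l)
  h≈ : B0 * j ^ i ≈ h i
  h≈ = *-assoc _ _ _

 perp-+ : ∀ {B X Y} -> Perp B X -> Perp B Y -> Perp B (X + Y)
 perp-+ {B} {X} {Y} p r k = tr (co-cong (distribʳ _ X Y) (+ 0)) (tr (co-+ _ _ (+ 0)) (cong₂ Z._+_ (p k) (r k)))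

 perp-ι : ∀ {B X} c -> Perp B X -> Perp B (ι c * X)
 perp-ι {B} {X} c p k = tr (co-cong (*-assoc _ _ _) (+ 0)) (tr (co-ι c _ (+ 0)) (tr (*ˡ c (p k)) (Z.*-zeroʳ c)))

 hecke-span : ∀ ρ n -> Perp B0 (hecke (A0 * (j ^ n * ev ρ j)))
 hecke-span []      n = perp-cong {B0} (sym (trans (hecke-cong (solve 2 (\a y -> a :* (y :* :0) := :0 :* a) refl A0 (j ^ n))) (hecke-ι (+ 0) A0))) (perp-ι {B0} {hecke A0} (+ 0) (perp-cong {B0} (hecke-cong (solve 1 (\a -> a :* :1 := a) refl A0)) (hecke-basis 0)))
 hecke-span (u ∷ ρ) n = perp-cong {B0} (sym (trans (hecke-cong (solve 5 (\a y u j p -> a :* (y :* (u :+ j :* p)) := u :* (a :* y) :+ a :* ((j :* y) :* p)) refl A0 (j ^ n) (ι u) j (ev ρ j))) (trans (hecke-+ _ _) (+-congʳ (hecke-ι u (A0 * j ^ n))))))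
  (perp-+ {B0} {ι u * hecke (A0 * j ^ n)} {hecke (A0 * (j ^ suc n * ev ρ j))} (perp-ι {B0} {hecke (A0 * j ^ n)} u (hecke-basis n)) (hecke-span ρ (suc n)))

 -- `dual` writes X as `A0` times a polynomial in j; by additivity the case of `A0` jˡ suffices.
 hecke-stable : ∀ {X} -> Perp B0 X -> Perp B0 (hecke X)
 hecke-stable {X} p = let ρ , e = dual lead-B0 lead-A0 ≡refl ct-gh {X} p in
  perp-cong {B0} (hecke-cong (sym (trans e (*-congˡ (solve 1 (\y -> y := :1 :* y) refl (ev ρ j)))))) (hecke-span ρ 0)

 -- the forms A₀ jˡ have leading coefficient 1, so divisibility spreads from the nonpositive exponents
 perp-divide : ∀ c X -> Perp B0 X -> (∀ z -> z Z.≤ + 0 -> ∃ \w -> co X z ≡ c Z.* w) -> ∃ \Y -> X ≈ ι c * Y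
 perp-divide c X p h = go d p h (Low-weaken le (proj₂ (below X)))
  where
  d = suc (proj₁ (below X))
  le : + 1 Z.+ Z.- (+ d) Z.≤ Z.- (+ proj₁ (below X))
  le = Z.≤-reflexive (lem (+ proj₁ (below X)))
   where
   lem : ∀ d -> + 1 Z.+ Z.- (+ 1 Z.+ d) ≡ Z.- d
   lem = arith
  go : ∀ d {X} -> Perp B0 X -> (∀ z -> z Z.≤ + 0 -> ∃ \w -> co X z ≡ c Z.* w) -> Low X (+ 1 Z.+ Z.- (+ d)) -> ∃ \Y -> X ≈ ι c * Y
  go zero    {X} p h l = ι (+ 0) , trans (perp-zero lead-B0 p l) (solve 1 (\c -> :0 := c :* :0) refl (ι c))
  go (suc d) {X} p h l = let Y , e = go d {X - ι u * G} (perp-combine {B0} u p (ct-gh d)) hʹ lowʹ in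
   Y + ι v * G , (begin
    X ≈⟨ solve 2 (\x y -> x := (x :- y) :+ y) refl X (ι u * G) ⟩
    (X - ι u * G) + ι u * G ≈⟨ +-cong e (*-congʳ (trans (ι-≡ (proj₂ (h m m≤0))) (ι-* c v))) ⟩
    ι c * Y + ι c * ι v * G ≈⟨ solve 4 (\c y v g -> c :* y :+ c :* v :* g := c :* (y :+ v :* g)) refl (ι c) Y (ι v) G ⟩
    ι c * (Y + ι v * G) ∎)
   where
   G = A0 * j ^ d
   m = Z.- (+ d)
   m≤0 : m Z.≤ + 0
   m≤0 = Z.neg-mono-≤ (Z.+≤+ N.z≤n)
   u = co X m
   v = proj₁ (h m m≤0)
   m≡ : + 0 Z.+ m ≡ m
   m≡ = Z.+-identityˡ m
   lead-G : Lead G m (+ 1)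
   lead-G = subst (\k -> Lead G k (+ 1)) m≡ (lead-* lead-A0 (lead-j^ d))
   hʹ : ∀ z -> z Z.≤ + 0 -> ∃ \w -> co (X - ι u * G) z ≡ c Z.* w
   hʹ z z≤ = proj₁ (h z z≤) Z.- v Z.* co G z , tr (co-sub X (ι u * G) z) (tr (cong₂ Z._-_ (proj₂ (h z z≤)) (tr (co-ι u G z) (cong (Z._* co G z) (proj₂ (h m m≤0))))) (lem c (proj₁ (h z z≤)) v (co G z)))
    where
    lem : ∀ c w v g -> c Z.* w Z.- c Z.* v Z.* g ≡ c Z.* (w Z.- v Z.* g)
    lem = arith
   low-X : Low X m
   low-X = subst (Low X) (lem (+ d)) l
    where
    lem : ∀ d -> + 1 Z.+ Z.- (+ 1 Z.+ d) ≡ Z.- d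
    lem = arith
   lowʹ : Low (X - ι u * G) (+ 1 Z.+ Z.- (+ d))
   lowʹ = Low-step (Low-+ low-X (Low-neg (Low-ι u (proj₁ lead-G)))) (tr (co-sub X (ι u * G) m) (tr (cong (Z._-_ u) (tr (co-ι u G m) (tr (*ˡ u (proj₂ lead-G)) (Z.*-identityʳ u)))) (Z.+-inverseʳ u)))

-- Good series, the recursion and the congruence.

module Final where
 open import Data.Nat.Divisibility as ℕ∣ using (divides)
 open import Data.Integer.DivMod using (_%ℕ_)
 open import Data.Nat.Tactic.RingSolver using () renaming (solve-∀ to arithℕ)
 open PS using (+ˡ; *ˡ)
 open LInt
 open LL
 open Base
 open Forms
 open Param hiding (pl)
 open Delta
 open LevelOne
 open Vectors
 open Inject
 open TStable
 open TraceLemma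
 open BaseL
 open FormsL
 open ParamL hiding (a; c; d)
 open DeltaL

 abstract
  -- The exponent at which the first term of the operator reads a coefficient. In the variable 1 -
  -- 24z it is multiplication by 169.
  σ169 : ℤ -> ℤ
  σ169 z = z Z.* + 13 Z.* + 13 Z.- + 7

  σ-def : ∀ z -> σ169 z ≡ z Z.* + 13 Z.* + 13 Z.- + 7
  σ-def z = ≡refl

  -- 24 z − 1 up to sign
  y : ℤ -> ℤ
  y z = + 1 Z.- + 24 Z.* z

  y-def : ∀ z -> y z ≡ + 1 Z.- + 24 Z.* z
  y-def z = ≡refl

  y-0 : y (+ 0) ≡ + 1
  y-0 = ≡refl

  y-σ : ∀ z -> y (σ169 z) ≡ + 169 Z.* y z
  y-σ = lem
   where
   lem : ∀ z -> + 1 Z.- + 24 Z.* (z Z.* + 13 Z.* + 13 Z.- + 7) ≡ + 169 Z.* (+ 1 Z.- + 24 Z.* z)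
   lem = arith

  σ≤0 : ∀ z -> z Z.≤ + 0 -> σ169 z Z.≤ + 0
  σ≤0 (+ zero)  _ = Z.-≤+
  σ≤0 (+ suc n) (Z.+≤+ ())
  σ≤0 -[1+ n ]  _ = Z.-≤+

  σ-pos : ∀ u -> σ169 u Z.≤ + 0 -> u Z.≤ + 0
  σ-pos (+ zero)  _ = Z.≤-refl
  σ-pos (+ suc n) h = ⊥-elim (positive (subst (Z._≤ + 0) (sy (lem (+ n))) h))
   where
   lem : ∀ n -> + 162 Z.+ n Z.* + 13 Z.* + 13 ≡ (+ 1 Z.+ n) Z.* + 13 Z.* + 13 Z.- + 7
   lem = arith
   positive : + 162 Z.+ + n Z.* + 13 Z.* + 13 Z.≤ + 0 -> ⊥
   positive h with subst (\v -> + 162 Z.+ v Z.≤ + 0) (sy (tr (Z.pos-* (n N.* 13) 13) (cong (Z._* + 13) (Z.pos-* n 13)))) h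
   ... | Z.+≤+ ()
  σ-pos -[1+ n ]  _ = Z.-≤+

 -- Coefficient z of the operator; at z = 169u − 7 the middle term vanishes and the last one is the coefficient u.
 module Coefficients (X : Carrier) where
  last : ℤ -> ℤ
  last z = co (q -[1+ 6 ] * V (V X)) z

  private
   multiple : ∀ n (k : ℕ -> ℤ) z -> ∃ \m -> sumℤ n (\r -> co (ι (k r) * Π r X) z) ≡ m Z.* co X z
   multiple zero    k z = + 0 , sy (Z.*-zeroˡ (co X z))
   multiple (suc n) k z with multiple n k z | z %ℕ 13 N.≟ n
   ... | m , e | yes in-class = m Z.+ k n , tr (cong₂ Z._+_ e (tr (co-ι (k n) _ z) (*ˡ (k n) (co-Π-in X z in-class)))) (sy (Z.*-distribʳ-+ (co X z) m (k n)))
   ... | m , e | no out       = m , tr (cong₂ Z._+_ e (tr (co-ι (k n) _ z) (tr (*ˡ (k n) (co-Π-out X z out)) (Z.*-zeroʳ (k n))))) (Z.+-identityʳ _)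

   vanishing : ∀ n (k : ℕ -> ℤ) z -> k (z %ℕ 13) ≡ + 0 -> sumℤ n (\r -> co (ι (k r) * Π r X) z) ≡ + 0
   vanishing n k z k0 = sumℤ-zero n (\r _ -> tr (co-ι (k r) _ z) (term r))
    where
    term : ∀ r -> k r Z.* co (Π r X) z ≡ + 0
    term r with z %ℕ 13 N.≟ r
    ... | yes ≡refl = tr (cong (Z._* co (Π r X) z) k0) (Z.*-zeroˡ (co (Π r X) z))
    ... | no out    = tr (*ˡ (k r) (co-Π-out X z out)) (Z.*-zeroʳ (k r))

  mid : ℤ -> ℤ
  mid z = co (middle X) z

  co-hecke : ∀ z -> co (hecke X) z ≡ co X (σ169 z) Z.+ + 169 Z.* mid z Z.+ + 371293 Z.* last z
  co-hecke z = tr (co-+ _ _ z) (cong₂ Z._+_ (tr (co-+ _ _ z) (cong₂ Z._+_ (tr (co-U _ z) (tr (co-U _ (z Z.* + 13)) (tr (co-q (+ 7) X _) (cong (co X) (sy (σ-def z)))))) (co-ι (+ 169) _ z))) (co-ι (+ 371293) _ z))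

  mid-multiple : ∀ z -> ∃ \m -> mid z ≡ m Z.* co X z
  mid-multiple z = let m , e = multiple 13 χ z in m , tr (co-sum 13 (\r -> ι (χ r) * Π r X) z) e

  mid-σ : ∀ u -> mid (σ169 u) ≡ + 0
  mid-σ u = tr (co-sum 13 (\r -> ι (χ r) * Π r X) (σ169 u)) (vanishing 13 χ (σ169 u) (cong χ (mod-unique 6 (u Z.* + 13 Z.- + 1) (N.≤ᵇ⇒≤ 7 13 _) (tr (σ-def u) (lem u)))))
   where
   lem : ∀ u -> u Z.* + 13 Z.* + 13 Z.- + 7 ≡ + 6 Z.+ (u Z.* + 13 Z.- + 1) Z.* + 13
   lem = arith

  last-σ : ∀ u -> last (σ169 u) ≡ co X u
  last-σ u = tr (co-q -[1+ 6 ] (V (V X)) (σ169 u)) (tr (cong (co (V (V X))) (tr (cong (Z._+ + 7) (σ-def u)) (lem u))) (tr (co-V (V X) (u Z.* + 13)) (co-V X u)))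
   where
   lem : ∀ u -> u Z.* + 13 Z.* + 13 Z.- + 7 Z.+ + 7 ≡ u Z.* + 13 Z.* + 13
   lem = arith

  last-cases : ∀ z -> last z ≡ + 0 ⊎ ∃ \u -> z ≡ σ169 u
  last-cases z with multiple? (z Z.+ + 7)
  ... | inj₂ ne = inj₁ (tr (co-q -[1+ 6 ] (V (V X)) z) (co-V0 (V X) _ ne))
  ... | inj₁ (w , e) with multiple? w
  ...   | inj₂ ne = inj₁ (tr (co-q -[1+ 6 ] (V (V X)) z) (tr (cong (co (V (V X))) e) (tr (co-V (V X) w) (co-V0 X w ne))))
  ...   | inj₁ (u , ≡refl) = inj₂ (u , tr (lem z) (tr (cong (Z._- + 7) e) (sy (σ-def u))))
   where
   lem : ∀ z -> z ≡ z Z.+ + 7 Z.- + 7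
   lem = arith

 Power : ℤ -> Set
 Power w = ∃ \m -> w ≡ (+ 169) Z.^ m

 power-up : ∀ {w} -> Power w -> Power (+ 169 Z.* w)
 power-up (m , e) = suc m , *ˡ (+ 169) e

 power-down : ∀ w -> Power (+ 169 Z.* w) -> Power w
 power-down w (suc m , e) = m , Z.*-cancelˡ-≡ (+ 169) w _ e
 power-down (+ zero)  (zero , ())
 power-down (+ suc n) (zero , e) = ⊥-elim (absurd (Z.+-injective (tr (Z.pos-* 169 (suc n)) e)))
  where
  absurd : 169 N.* suc n ≢ 1
  absurd eʹ with N.m*n≡1⇒m≡1 169 (suc n) eʹ
  ... | ()
 power-down -[1+ n ]  (zero , ())

 -- The factor c is 1 for a good series and 169 for its image under the operator.
 data Bounded (c z a : ℤ) : Set where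
  vanishes : a ≡ + 0 -> Bounded c z a
  bound    : Power (y z) -> ∀ w -> a ≡ c Z.* (y z Z.* w) -> Bounded c z a

 bounded-+ : ∀ {c z a b} -> Bounded c z a -> Bounded c z b -> Bounded c z (a Z.+ b)
 bounded-+ {c} {z} (vanishes ≡refl) h = subst (Bounded c z) (sy (Z.+-identityˡ _)) h
 bounded-+ {c} {z} h@(bound _ _ _) (vanishes ≡refl) = subst (Bounded c z) (sy (Z.+-identityʳ _)) h
 bounded-+ {c} {z} (bound p v e) (bound _ w f) = bound p (v Z.+ w) (tr (cong₂ Z._+_ e f) (lem c (y z) v w))
  where
  lem : ∀ c y v w -> c Z.* (y Z.* v) Z.+ c Z.* (y Z.* w) ≡ c Z.* (y Z.* (v Z.+ w))
  lem = arith

 record Good (X : Carrier) : Set where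
  field
   perp    : Perp B0 X
   bounded : ∀ z -> z Z.≤ + 0 -> Bounded (+ 1) z (co X z)

 module _ {X} (good : Good X) where
  open Good good
  open Coefficients X

  private
   first-term : ∀ z -> z Z.≤ + 0 -> Bounded (+ 169) z (co X (σ169 z))
   first-term z z≤ with bounded (σ169 z) (σ≤0 z z≤)
   ... | vanishes e  = vanishes e
   ... | bound p w e = bound (power-down (y z) (subst Power (y-σ z) p)) w (tr e (tr (cong (\v -> + 1 Z.* (v Z.* w)) (y-σ z)) (lem (y z) w)))
    where
    lem : ∀ y w -> + 1 Z.* (+ 169 Z.* y Z.* w) ≡ + 169 Z.* (y Z.* w)
    lem = arith

   mid-bounded : ∀ z -> z Z.≤ + 0 -> Bounded (+ 1) z (mid z)
   mid-bounded z z≤ with bounded z z≤ | mid-multiple z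
   ... | vanishes e  | k , f = vanishes (tr f (tr (*ˡ k e) (Z.*-zeroʳ k)))
   ... | bound p w e | k , f = bound p (k Z.* w) (tr f (tr (*ˡ k e) (lem k (y z) w)))
    where
    lem : ∀ k y w -> k Z.* (+ 1 Z.* (y Z.* w)) ≡ + 1 Z.* (y Z.* (k Z.* w))
    lem = arith

   scale : ∀ {z a} -> Bounded (+ 1) z a -> Bounded (+ 169) z (+ 169 Z.* a)
   scale     {a = a} (vanishes e)  = vanishes (tr (*ˡ (+ 169) {a} {+ 0} e) (Z.*-zeroʳ (+ 169)))
   scale {z} {a}     (bound p w e) = bound p w (tr (*ˡ (+ 169) {a} {+ 1 Z.* (y z Z.* w)} e) (cong (\v -> + 169 Z.* v) (Z.*-identityˡ (y z Z.* w))))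

   -- Of 13⁵ = 169 · 13 · 169 one factor 169 is kept for the division of the operator; the other
   -- one, used here, pays for the passage from `y u` to `y z` = 169 `y u`.
   last-bounded : ∀ z -> z Z.≤ + 0 -> Bounded (+ 1) z (+ 169 Z.* last z)
   last-bounded z z≤ = go (last-cases z)
    where
    lem : ∀ y w -> + 169 Z.* (+ 1 Z.* (y Z.* w)) ≡ + 1 Z.* (+ 169 Z.* y Z.* w)
    lem = arith
    at-σ : ∀ u -> z ≡ σ169 u -> Bounded (+ 1) u (co X u) -> Bounded (+ 1) z (+ 169 Z.* last z)
    at-σ u e (vanishes f)  = vanishes (tr (*ˡ (+ 169) {last z} {+ 0} (tr (cong last e) (tr (last-σ u) f))) (Z.*-zeroʳ (+ 169)))
    at-σ u e (bound p w f) = bound (subst Power (sy y≡) (power-up p)) w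
     (tr (*ˡ (+ 169) {last z} {+ 1 Z.* (y u Z.* w)} (tr (cong last e) (tr (last-σ u) f))) (tr (lem (y u) w) (cong (\v -> + 1 Z.* (v Z.* w)) (sy y≡))))
     where
     y≡ : y z ≡ + 169 Z.* y u
     y≡ = tr (cong y e) (y-σ u)
    go : last z ≡ + 0 ⊎ (∃ \u -> z ≡ σ169 u) -> Bounded (+ 1) z (+ 169 Z.* last z)
    go (inj₁ e)       = vanishes (tr (*ˡ (+ 169) {last z} {+ 0} e) (Z.*-zeroʳ (+ 169)))
    go (inj₂ (u , e)) = at-σ u e (bounded u (σ-pos u (subst (Z._≤ + 0) e z≤)))

   multiply : ∀ {c z a} k -> Bounded c z a -> Bounded c z (k Z.* a)
   multiply             k (vanishes e)  = vanishes (tr (*ˡ k e) (Z.*-zeroʳ k))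
   multiply {c} {z} {a} k (bound p w e) = bound p (k Z.* w) (tr (*ˡ k e) (lem c (y z) k w))
    where
    lem : ∀ c y k w -> k Z.* (c Z.* (y Z.* w)) ≡ c Z.* (y Z.* (k Z.* w))
    lem = arith

   split-constant : ∀ a -> + 371293 Z.* a ≡ + 169 Z.* (+ 13 Z.* (+ 169 Z.* a))
   split-constant = arith

   hecke-bounded : ∀ z -> z Z.≤ + 0 -> Bounded (+ 169) z (co (hecke X) z)
   hecke-bounded z z≤ = subst (Bounded (+ 169) z) (sy (co-hecke z)) (bounded-+ (bounded-+ (first-term z z≤) (scale (mid-bounded z z≤))) (subst (Bounded (+ 169) z) (sy (split-constant (last z))) (scale (multiply (+ 13) (last-bounded z z≤)))))

   multiple-of : ∀ {c z a} -> Bounded c z a -> ∃ \w -> a ≡ c Z.* w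
   multiple-of {c}     (vanishes e)  = + 0 , tr e (sy (Z.*-zeroʳ c))
   multiple-of {c} {z} (bound _ w e) = y z Z.* w , e

  -- The bounds give divisibility by 169 at exponents z ≤ 0 only; `perp-divide` extends it to all
  -- exponents because the image stays in the span.
  hecke-good : ∃ \Xʹ -> hecke X ≈ ι (+ 169) * Xʹ × Good Xʹ
  hecke-good = let Y , e = perp-divide (+ 169) (hecke X) (hecke-stable {X} perp) (\z z≤ -> multiple-of (hecke-bounded z z≤)) in Y , e , record
   { perp    = \k -> Z.*-cancelˡ-≡ (+ 169) _ (+ 0) (tr (sy (tr (co-cong (*-assoc _ _ _) (+ 0)) (co-ι (+ 169) _ (+ 0)))) (perp-cong {B0} e (hecke-stable {X} perp) k))
   ; bounded = \z z≤ -> descend (tr (co-cong e z) (co-ι (+ 169) Y z)) (hecke-bounded z z≤) }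
   where
   descend : ∀ {z a b} -> b ≡ + 169 Z.* a -> Bounded (+ 169) z b -> Bounded (+ 1) z a
   descend {z} {a} e (vanishes f) = vanishes (Z.*-cancelˡ-≡ (+ 169) a (+ 0) (tr (sy e) f))
   descend {z} {a} e (bound p w f) = bound p w (tr (Z.*-cancelˡ-≡ (+ 169) a _ (tr (sy e) f)) (sy (Z.*-identityˡ (y z Z.* w))))

 iterate : ℕ -> ℤ -> ℤ
 iterate zero    z = z
 iterate (suc k) z = σ169 (iterate k z)

 -- The constants are variables here: conversion checking unfolds products with large literals.
 first-step : ∀ c d -> d ≡ c Z.* (c Z.* + 13) -> ∀ h a m l y -> h ≡ a Z.+ c Z.* m Z.+ d Z.* l -> h ≡ c Z.* y -> ∃ \w -> a ≡ c Z.^ 1 Z.* w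
 first-step c d ≡refl h a m l y e f = y Z.- m Z.- c Z.* + 13 Z.* l , tr (isolate a c m l) (tr (cong (\h -> h Z.- c Z.* m Z.- c Z.* (c Z.* + 13) Z.* l) (tr (sy e) f)) (collect c y m l))
  where
  isolate : ∀ a c m l -> a ≡ a Z.+ c Z.* m Z.+ c Z.* (c Z.* + 13) Z.* l Z.- c Z.* m Z.- c Z.* (c Z.* + 13) Z.* l
  isolate = arith
  collect : ∀ c y m l -> c Z.* y Z.- c Z.* m Z.- c Z.* (c Z.* + 13) Z.* l ≡ c Z.* + 1 Z.* (y Z.- m Z.- c Z.* + 13 Z.* l)
  collect = arith

 -- Since d = 13 c², the last term carries c^(k+2) as soon as l carries c^k; with m = 0 only the
 -- image h under the operator is left.
 next-step : ∀ c d -> d ≡ c Z.* (c Z.* + 13) -> ∀ k h a m l w v -> h ≡ a Z.+ c Z.* m Z.+ d Z.* l -> h ≡ c Z.* (c Z.^ suc k Z.* w) -> m ≡ + 0 -> l ≡ c Z.^ k Z.* v -> ∃ \u -> a ≡ c Z.^ suc (suc k) Z.* u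
 next-step c d ≡refl k h a m l w v e f ≡refl ≡refl = w Z.- + 13 Z.* v ,
  tr (isolate a c (c Z.^ k Z.* v)) (tr (cong (\h -> h Z.- c Z.* + 0 Z.- c Z.* (c Z.* + 13) Z.* (c Z.^ k Z.* v)) (tr (sy e) f)) (collect c (c Z.^ k) w v))
  where
  isolate : ∀ a c l -> a ≡ a Z.+ c Z.* + 0 Z.+ c Z.* (c Z.* + 13) Z.* l Z.- c Z.* + 0 Z.- c Z.* (c Z.* + 13) Z.* l
  isolate = arith
  collect : ∀ c p w v -> c Z.* (c Z.* p Z.* w) Z.- c Z.* + 0 Z.- c Z.* (c Z.* + 13) Z.* (p Z.* v) ≡ c Z.* (c Z.* p) Z.* (w Z.- + 13 Z.* v)
  collect = arith

 -- Quantified over all good series, since the recursion for X calls on its quotient X′.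
 Divisible : ℕ -> Set
 Divisible k = ∀ X -> Good X -> ∀ z -> ∃ \w -> co X (iterate k z) ≡ (+ 169) Z.^ k Z.* w

 divisible-1 : Divisible 1
 divisible-1 X good z =
  first-step (+ 169) (+ 371293) ≡refl (co (hecke X) z) (co X (σ169 z)) (mid z) (last z) (co (proj₁ next) z) (co-hecke z) (tr (co-cong (proj₁ (proj₂ next)) z) (co-ι (+ 169) (proj₁ next) z))
  where
  open Coefficients X
  next = hecke-good good

 divisible-suc-suc : ∀ k -> Divisible (suc k) -> Divisible k -> Divisible (suc (suc k))
 divisible-suc-suc k d1 d0 X good z =
  next-step (+ 169) (+ 371293) ≡refl k (co (hecke X) u) (co X (σ169 u)) (mid u) (last u) (proj₁ ih1) (proj₁ ih0) (co-hecke u)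
   (tr (co-cong (proj₁ (proj₂ next)) u) (tr (co-ι (+ 169) (proj₁ next) u) (*ˡ (+ 169) {co (proj₁ next) u} {(+ 169) Z.^ suc k Z.* proj₁ ih1} (proj₂ ih1))))
   (mid-σ (iterate k z)) (tr (last-σ (iterate k z)) (proj₂ ih0))
  where
  open Coefficients X
  u = iterate (suc k) z
  next = hecke-good good
  ih1 = d1 (proj₁ next) (proj₂ (proj₂ next)) z
  ih0 = d0 X good z

 good-divisible : ∀ k -> Divisible k
 good-divisible zero          X good z = co X z , sy (Z.*-identityˡ (co X z))
 good-divisible (suc zero)    = divisible-1
 good-divisible (suc (suc k)) = divisible-suc-suc k (good-divisible (suc k)) (good-divisible k)

 e4-carrier : ∀ n -> co A0 (+ n) ≡ + Defs.e₄ n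
 e4-carrier n = tr (co-cong (sym (emb-** _ Euler.Pt)) (+ n)) (tr (co-emb _ (+ n)) (sy (Euler.e4-series n)))

 -- The constant term is the only coefficient at an exponent z ≤ 0 that can be nonzero, and there
 -- `y` is 1 = 169⁰.
 good-A0 : Good A0
 good-A0 = record
  { perp    = \k -> tr (co-cong (*-congʳ (solve 1 (\a -> a := a :* :1) refl A0)) (+ 0)) (ct-gh 0 k)
  ; bounded = \ { (+ zero) _ -> bound (0 , y-0) (co A0 (+ 0)) (tr (lem (co A0 (+ 0))) (cong (\v -> + 1 Z.* (v Z.* co A0 (+ 0))) (sy y-0))) ; (+ suc n) (Z.+≤+ ()) ; -[1+ n ] _ -> vanishes (proj₁ lead-A0 -[1+ n ] Z.-<+) } }
  where
  lem : ∀ a -> a ≡ + 1 Z.* (+ 1 Z.* a)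
  lem = arith

 iterate-y : ∀ k z -> y (iterate k z) ≡ (+ 169) Z.^ k Z.* y z
 iterate-y zero    z = sy (Z.*-identityˡ _)
 iterate-y (suc k) z = tr (y-σ (iterate k z)) (tr (*ˡ (+ 169) (iterate-y k z)) (sy (Z.*-assoc (+ 169) ((+ 169) Z.^ k) (y z))))

 y-injective : ∀ u v -> y u ≡ y v -> u ≡ v
 y-injective u v e = Z.*-cancelˡ-≡ (+ 24) u v (tr (lem (+ 24 Z.* u)) (tr (cong (\s -> + 1 Z.- s) (tr (sy (y-def u)) (tr e (y-def v)))) (sy (lem (+ 24 Z.* v)))))
  where
  lem : ∀ a -> a ≡ + 1 Z.- (+ 1 Z.- a)
  lem = arith

 power-13 : ∀ k -> + (13 N.^ (2 N.* k)) ≡ (+ 169) Z.^ k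
 power-13 k = tr (cong +_ (sy (N.^-*-assoc 13 2 k))) (pos-^ k)
  where
  pos-^ : ∀ k -> + (169 N.^ k) ≡ (+ 169) Z.^ k
  pos-^ zero    = ≡refl
  pos-^ (suc k) = tr (Z.pos-* 169 (169 N.^ k)) (*ˡ (+ 169) (pos-^ k))

 power-mod-24 : ∀ k -> ∃ \s -> 13 N.^ (2 N.* k) ≡ 1 N.+ 24 N.* s
 power-mod-24 k = let s , e = go k in s , tr (sy (N.^-*-assoc 13 2 k)) e
  where
  step : ∀ s -> 169 N.* (1 N.+ 24 N.* s) ≡ 1 N.+ 24 N.* (7 N.+ 169 N.* s)
  step = arithℕ
  go : ∀ k -> ∃ \s -> 169 N.^ k ≡ 1 N.+ 24 N.* s
  go zero    = 0 , ≡refl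
  go (suc k) = let s , e = go k in 7 N.+ 169 N.* s , tr (cong (169 N.*_) e) (step s)

 -- Q = 169^k is 1 modulo 24, so 24δ = 1 + rQ makes 24 divide r + 1, while δ < Q gives r < 24.
 residue-23 : ∀ k δ r -> 0 N.< δ -> δ N.< 13 N.^ (2 N.* k) -> 24 N.* δ N.∸ 1 ≡ r N.* 13 N.^ (2 N.* k) -> (24 N.* δ ≡ 1 N.+ r N.* 13 N.^ (2 N.* k)) × r ≡ 23
 residue-23 k δ r 0<δ δ< e = 24δ , N.suc-injective (N.≤-antisym r<24 (ℕ∣.∣⇒≤ divides-24))
  where
  Q = 13 N.^ (2 N.* k)
  s = proj₁ (power-mod-24 k)
  24δ : 24 N.* δ ≡ 1 N.+ r N.* Q
  24δ = tr (sy (N.m+[n∸m]≡n (N.≤-trans 0<δ (N.m≤n*m δ 24)))) (cong suc e)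
  divides-24 : 24 ℕ∣.∣ suc r
  divides-24 = ℕ∣.∣m+n∣m⇒∣n (divides δ (tr (regroup r s) (tr (cong (\Q -> 1 N.+ r N.* Q) (sy (proj₂ (power-mod-24 k)))) (tr (sy 24δ) (N.*-comm 24 δ))))) (ℕ∣.m∣m*n {24} (r N.* s))
   where
   regroup : ∀ r s -> 24 N.* (r N.* s) N.+ suc r ≡ 1 N.+ r N.* (1 N.+ 24 N.* s)
   regroup = arithℕ
  r<24 : r N.< 24
  r<24 = N.*-cancelʳ-< Q r 24 (N.<-≤-trans (N.≤-reflexive (sy 24δ)) (N.*-monoʳ-≤ 24 (N.<⇒≤ δ<)))

 congruence : (k n δ : ℕ) -> 0 N.< δ -> δ N.< 13 N.^ (2 N.* k) -> 13 N.^ (2 N.* k) ℕ∣.∣ 24 N.* δ N.∸ 1 ->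
  13 N.^ (2 N.* k) ℕ∣.∣ Defs.e₄ (13 N.^ (2 N.* k) N.* n N.+ δ)
 congruence k n δ 0<δ δ< (divides r e) = divides Z.∣ w ∣ (tr (cong Z.∣_∣ value) (tr (Z.abs-* (+ Q) w) (N.*-comm Q Z.∣ w ∣)))
  where
  Q = 13 N.^ (2 N.* k)
  m = Q N.* n N.+ δ
  z = + suc n
  r≡ : r ≡ 23
  r≡ = proj₂ (residue-23 k δ r 0<δ δ< e)
  24δ : 24 N.* δ ≡ 1 N.+ 23 N.* Q
  24δ = tr (proj₁ (residue-23 k δ r 0<δ δ< e)) (cong (\r -> 1 N.+ r N.* Q) r≡)
  w = proj₁ (good-divisible k A0 good-A0 z)
  -- 24δ = 1 + 23Q gives 1 - 24(Qn + δ) = Q(1 - 24(n + 1)), so the exponent is the k-th iterate of n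
  -- + 1.
  index : + m ≡ iterate k z
  index = y-injective (+ m) (iterate k z) (tr main (sy (tr (iterate-y k z) (cong (Z._* y z) (sy (power-13 k))))))
   where
   expand : ∀ Q n d -> + 1 Z.- + 24 Z.* (Q Z.* n Z.+ d) ≡ + 1 Z.- + 24 Z.* (Q Z.* n) Z.- + 24 Z.* d
   expand = arith
   collect : ∀ Q n -> + 1 Z.- + 24 Z.* (Q Z.* n) Z.- (+ 1 Z.+ + 23 Z.* Q) ≡ Q Z.* (+ 1 Z.- + 24 Z.* (+ 1 Z.+ n))
   collect = arith
   main : y (+ m) ≡ + Q Z.* y z
   main =
    y (+ m) ≡⟪ y-def (+ m) ⟫
    + 1 Z.- + 24 Z.* (+ (Q N.* n) Z.+ + δ) ≡⟪ cong (\v -> + 1 Z.- + 24 Z.* (v Z.+ + δ)) (Z.pos-* Q n) ⟫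
    + 1 Z.- + 24 Z.* (+ Q Z.* + n Z.+ + δ) ≡⟪ expand (+ Q) (+ n) (+ δ) ⟫
    + 1 Z.- + 24 Z.* (+ Q Z.* + n) Z.- + 24 Z.* + δ ≡⟪ cong (\v -> + 1 Z.- + 24 Z.* (+ Q Z.* + n) Z.- v) (tr (sy (Z.pos-* 24 δ)) (tr (cong +_ 24δ) (cong (\v -> + 1 Z.+ v) (Z.pos-* 23 Q)))) ⟫
    + 1 Z.- + 24 Z.* (+ Q Z.* + n) Z.- (+ 1 Z.+ + 23 Z.* + Q) ≡⟪ collect (+ Q) (+ n) ⟫
    + Q Z.* (+ 1 Z.- + 24 Z.* (+ 1 Z.+ + n)) ≡⟪ cong (\s -> + Q Z.* s) (sy (y-def z)) ⟫
    + Q Z.* y z ■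
  value : + Defs.e₄ m ≡ + Q Z.* w
  value = tr (sy (e4-carrier m)) (tr (cong (co A0) index) (tr (proj₂ (good-divisible k A0 good-A0 z)) (cong (Z._* w) (sy (power-13 k)))))

open import Defs
open import Data.Nat using (ℕ; _+_; _*_; _∸_; _^_; _≥_; _<_)
open import Data.Nat.Divisibility using (_∣_)

theorem6p5 : (k n δ : ℕ) → k ≥ 1 →
    0 < δ → δ < 13 ^ (2 * k) → 13 ^ (2 * k) ∣ 24 * δ ∸ 1 →
    13 ^ (2 * k) ∣ e₄ (13 ^ (2 * k) * n + δ)
theorem6p5 k n δ _ = Final.congruence k n δ
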